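{- There is an absolute constant $C>0$ such that for every modulus $q \geq 1$, all integers $L_1, L_2$ with $1 \leq L_1, L_2 \leq q$ and every integer $c$ with $(c,q)=1$, $$\sum_{a = 1}^{q} \sum_{b = 1}^{q} \Bigl( \mathop{\sum_{q_1 \in (a, a+L_1]} \mathop{{\sum\nolimits}'}_{q_2 \in (b, b+L_2]}}_{q_1 q_2 \equiv c \pmod q} 1 - \frac{1}{q} \sum_{q_1 \in (a, a+L_1]} \mathop{{\sum\nolimits}'}_{q_2 \in (b, b+L_2]} 1 \Bigr)^2 \leq C\, L_1 L_2\, q\, d(q)^3 .$$
   Context: The sums are over integers $q_1, q_2$ in the indicated half-open intervals. The notation $\sum'$ means that the summation is restricted to integers $q_2$ relatively prime to $q$. $d(q)$ denotes the number of positive divisors of $q$. -}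

module Defs where

open import Data.Nat as ℕ using (ℕ; zero; suc)
open import Data.Nat.Divisibility using (_∣?_)
open import Data.Nat.Coprimality using (Coprime; coprime?)
open import Data.Integer as ℤ using (ℤ; +_)
import Data.Integer.Divisibility as ℤDiv
open import Data.List using (List; foldr; map; upTo; filter; length)
open import Data.Nat.ListAction using (sum)
open import Data.Rational as ℚ using (ℚ)
open import Relation.Nullary using (Dec; yes; no; does)
open import Relation.Nullary.Decidable using (_×-dec_)

Ioc : ℕ → ℕ → List ℕ
Ioc a L = map (λ i → a ℕ.+ suc i) (upTo L)

Icc1 : ℕ → List ℕ
Icc1 n = Ioc 0 n

_≡_[mod_] : ℤ → ℤ → ℕ → Set
x ≡ c [mod q ] = (+ q) ℤDiv.∣ (x ℤ.- c)

-- ℤ divisibility is by definition ℕ-divisibility of absolute values.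
congr? : (x c : ℤ) (q : ℕ) → Dec (x ≡ c [mod q ])
congr? x c q = q ∣? ℤ.∣ x ℤ.- c ∣

countCong : (q : ℕ) (c : ℤ) (L₁ L₂ a b : ℕ) → ℕ
countCong q c L₁ L₂ a b =
  sum (map (λ q₁ → length
         (filter (λ q₂ → coprime? q₂ q ×-dec congr? (+ (q₁ ℕ.* q₂)) c q)
                 (Ioc b L₂)))
       (Ioc a L₁))

countAll : (q : ℕ) (L₁ L₂ a b : ℕ) → ℕ
countAll q L₁ L₂ a b =
  sum (map (λ q₁ → length (filter (λ q₂ → coprime? q₂ q) (Ioc b L₂))) (Ioc a L₁))

numDivisors : ℕ → ℕ
numDivisors q = length (filter (λ k → k ∣? q) (Icc1 q))

sumℚ : List ℚ → ℚ
sumℚ = foldr ℚ._+_ ℚ.0ℚ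

deviation : (q : ℕ) .{{_ : ℕ.NonZero q}} (c : ℤ) (L₁ L₂ a b : ℕ) → ℚ
deviation q c L₁ L₂ a b =
  ((+ (countCong q c L₁ L₂ a b)) ℚ./ 1) ℚ.- ((+ countAll q L₁ L₂ a b) ℚ./ q)

lhs : (q : ℕ) .{{_ : ℕ.NonZero q}} (c : ℤ) (L₁ L₂ : ℕ) → ℚ
lhs q c L₁ L₂ =
  sumℚ (map (λ a → sumℚ (map (λ b → let x = deviation q c L₁ L₂ a b in x ℚ.* x) (Icc1 q))) (Icc1 q))

{-# OPTIONS --safe #-}
module Submission where

-- Idea. Let X f (a , b) = ∑ f (a + y , b + c / y) over the units y modulo q. The deviation is X applied
-- to the product of (q · indicator - length) of the first interval and the indicator of the second, so
-- a bound for ‖X f‖² by ∑ e ‖f mod e‖² over divisors e of q, which is Weil's bound for Kloosterman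
-- sums freed of characters, suffices: it only remains to count an interval in residue classes.
--
-- For an odd prime p, X reduces by a Radon transform over the lines of the plane to the operator
-- v ↦ ∑ v (s + Tr (x + c / x)) on mean-zero functions on ℤ/p. Over the tower of quadratic extensions
-- F ⊂ E these operators satisfy X_F² + X_E = 2 |F|, so an eigenvalue exceeding 2 √p in absolute value
-- would grow along the tower faster than Stepanov's elementary point count permits.
--
-- For a prime power pⁿ with n ≥ 2, on functions with mean zero on the cosets of pⁿ⁻¹, the pieces of X
-- over distinct classes of y² modulo a suitable power of p are orthogonal, and the trivial bound for
-- each piece (split once more if n is odd) is enough; other functions come from pⁿ⁻¹. The modulus 2ⁿ
-- only costs a factor in the constant. Composite moduli follow by taking tensor products of operators and of quadratic forms.

-- No complex numbers occur. `X` and the operators derived from it are sums of translations with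
-- integer weights on a finite abelian group. They commute with their transposes, so what would be a
-- bound for every eigenvalue can be stated as ‖X f‖² ≤ B ‖f‖² for integer-valued f and proved with
-- Cauchy-Schwarz. Whatever would need a division is multiplied out.
--
-- The obstacle for composite moduli is the constant: a factor 4 for each odd prime would not be
-- absolute. But pⁿ with n ≥ 1 has n + 1 divisors and 4 ≤ (n + 1)², so the constants of all odd
-- primes together are at most the square of a divisor count; for p = 2 the constant is 32 ≤ 8 (n +
-- 1)². Hence ‖X f‖² ≤ 8 d(q)² ∑ e ‖f mod e‖². When f comes from two intervals, each of the at most
-- d(q) terms is at most 2 q³ L₁ L₂. This gives 16 q³ L₁ L₂ d(q)³, and q² is divided off since the
-- deviation was multiplied by q to make it an integer.

open import Data.Empty using (⊥-elim)
open import Data.Nat using (ℕ; zero; suc; z≤n; s≤s; NonZero)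
import Data.Nat as ℕ
import Data.Nat.Properties as ℕ
open import Data.Product using (_×_; _,_; proj₁; proj₂; ∃)
open import Data.Sum using (_⊎_; inj₁; inj₂)
open import Relation.Binary.PropositionalEquality hiding ([_]; J)
open import Relation.Nullary using (Dec; yes; no; ¬_; contradiction)

-- Integer arithmetic with sealed operations.

module Int where
  open import Data.Integer using (ℤ; +_; -[1+_]; _≤_; _<_; 0ℤ; 1ℤ; +≤+; +<+) public
  import Data.Integer as I
  import Data.Integer.Properties as P
  open import Data.Integer.Tactic.RingSolver using (solve-∀) public

  infixl 6 _+_ _-_
  infixl 7 _*_
  infix 8 -_

  -- Sealing the operations keeps the unifier from unfolding them.
  opaque
    _+_ _*_ : ℤ → ℤ → ℤ
    _+_ = I._+_
    _*_ = I._*_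
    -_ : ℤ → ℤ
    -_ = I.-_

  _-_ : ℤ → ℤ → ℤ
  x - y = x + - y

  opaque
    unfolding _+_ _*_ -_

    +-def : ∀ x y → x + y ≡ x I.+ y
    +-def x y = refl

    neg-def : ∀ x → - x ≡ I.- x
    neg-def x = refl

    +-comm : ∀ x y → x + y ≡ y + x
    +-comm = P.+-comm

    +-assoc : ∀ x y z → x + y + z ≡ x + (y + z)
    +-assoc = P.+-assoc

    +-identityˡ : ∀ x → 0ℤ + x ≡ x
    +-identityˡ = P.+-identityˡ

    +-identityʳ : ∀ x → x + 0ℤ ≡ x
    +-identityʳ = P.+-identityʳ

    +-inverseʳ : ∀ x → x - x ≡ 0ℤ
    +-inverseʳ = P.+-inverseʳ

    *-comm : ∀ x y → x * y ≡ y * x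
    *-comm = P.*-comm

    *-assoc : ∀ x y z → x * y * z ≡ x * (y * z)
    *-assoc = P.*-assoc

    *-identityˡ : ∀ x → 1ℤ * x ≡ x
    *-identityˡ = P.*-identityˡ

    *-identityʳ : ∀ x → x * 1ℤ ≡ x
    *-identityʳ = P.*-identityʳ

    *-zeroˡ : ∀ x → 0ℤ * x ≡ 0ℤ
    *-zeroˡ = P.*-zeroˡ

    *-zeroʳ : ∀ x → x * 0ℤ ≡ 0ℤ
    *-zeroʳ = P.*-zeroʳ

    *-distribˡ-+ : ∀ x y z → x * (y + z) ≡ x * y + x * z
    *-distribˡ-+ = P.*-distribˡ-+

    *-distribʳ-+ : ∀ x y z → (y + z) * x ≡ y * x + z * x
    *-distribʳ-+ = P.*-distribʳ-+

    -1*i≡-i : ∀ x → - 1ℤ * x ≡ - x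
    -1*i≡-i = P.-1*i≡-i

    pos-+ : ∀ m n → + (m ℕ.+ n) ≡ + m + + n
    pos-+ = P.pos-+

    pos-* : ∀ m n → + (m ℕ.* n) ≡ + m * + n
    pos-* = P.pos-*

    +-mono-≤ : ∀ {x y u v} → x ≤ y → u ≤ v → x + u ≤ y + v
    +-mono-≤ = P.+-mono-≤

    sq≥0 : ∀ x → 0ℤ ≤ x * x
    sq≥0 (+ n) = subst (0ℤ ≤_) (P.pos-* n n) (+≤+ z≤n)
    sq≥0 -[1+ n ] = +≤+ z≤n

    *-≥0 : ∀ {x y} → 0ℤ ≤ x → 0ℤ ≤ y → 0ℤ ≤ x * y
    *-≥0 {+ m} {+ n} _ _ = subst (0ℤ ≤_) (P.pos-* m n) (+≤+ z≤n)

    *-monoˡ : ∀ {k x y} → 0ℤ ≤ k → x ≤ y → k * x ≤ k * y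
    *-monoˡ {+ k} _ h = P.*-monoˡ-≤-nonNeg (+ k) h

    *-monoʳ : ∀ {k x y} → 0ℤ ≤ k → x ≤ y → x * k ≤ y * k
    *-monoʳ {+ k} _ h = P.*-monoʳ-≤-nonNeg (+ k) h

    *-cancel : ∀ {k x y} → 0ℤ < k → k * x ≤ k * y → x ≤ y
    *-cancel {+ suc k} {x} {y} _ h = P.*-cancelˡ-≤-pos x y (+ suc k) h
    *-cancel {+ zero} (+<+ ())

    *-cancel-≡0 : ∀ {k x} → 0ℤ < k → k * x ≡ 0ℤ → x ≡ 0ℤ
    *-cancel-≡0 {+ suc k} {x} _ h = P.*-cancelˡ-≡ (+ suc k) x 0ℤ (trans h (sym (P.*-zeroʳ (+ suc k))))
    *-cancel-≡0 {+ zero} (+<+ ())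

    -- The usual way to prove an inequality here: the difference is given as a manifestly
    -- nonnegative expression, and the ring solver checks the identity.
    ≤-via : ∀ {x y} d → 0ℤ ≤ d → y - x ≡ d → x ≤ y
    ≤-via d h e = P.0≤i-j⇒j≤i (subst (0ℤ ≤_) (sym e) h)

    ≤⇒0≤- : ∀ {x y} → x ≤ y → 0ℤ ≤ y - x
    ≤⇒0≤- h = P.i≤j⇒0≤j-i h

    <⇒1+≤ : ∀ {x y} → x < y → 1ℤ + x ≤ y
    <⇒1+≤ = P.i<j⇒suc[i]≤j

  open P public using (≤-refl; ≤-trans; ≤-reflexive; ≤-total; ≤-antisym; <⇒≤; ≮⇒≥; ≰⇒>; <⇒≱; _≤?_; _<?_; ≤-<-trans; <-≤-trans; +-injective; drop‿+≤+; module ≤-Reasoning)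

  +≥0 : ∀ n → 0ℤ ≤ + n
  +≥0 n = +≤+ z≤n

  +>0 : ∀ n → .{{_ : ℕ.NonZero n}} → 0ℤ < + n
  +>0 (suc n) = +<+ (s≤s z≤n)

-- Enumerated finite sets, sums over them, Cauchy-Schwarz and the pigeonhole principle.

module FiniteSums where
  open import Data.Bool using (if_then_else_)
  open Int using (ℤ; +_; _+_; _*_; -_; _-_; _≤_; _<_; 0ℤ; 1ℤ; +≤+; +<+; solve-∀; sq≥0; *-monoʳ; *-cancel; ≤-via)
  open import Data.List using (List; []; _∷_; _++_; map; cartesianProduct)
  open import Data.List.Membership.Propositional using (_∈_; lose)
  open import Data.List.Relation.Unary.Any using (here; there; any?; satisfied)
  open import Data.Product.Properties using (≡-dec)
  open import Data.Vec using (Vec; []; _∷_)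
  import Data.Vec.Properties as Vec
  open import Function using (_∘_)
  open import Relation.Nullary using (does)
  open import Relation.Nullary.Decidable using (map′; _×-dec_; ¬?; dec-true; dec-false)
  open ≡-Reasoning

  -- The Iverson bracket. It is taken of a decision and not of a proposition, so that a case
  -- distinction can be made by handing the decision to an auxiliary function.
  [_] : {P : Set} → Dec P → ℤ
  [ d ] = if does d then 1ℤ else 0ℤ

  []-yes : {P : Set} (d : Dec P) → P → [ d ] ≡ 1ℤ
  []-yes d p rewrite dec-true d p = refl

  []-no : {P : Set} (d : Dec P) → ¬ P → [ d ] ≡ 0ℤ
  []-no d ¬p rewrite dec-false d ¬p = refl

  []-cong : {P Q : Set} (d : Dec P) (e : Dec Q) → (P → Q) → (Q → P) → [ d ] ≡ [ e ]
  []-cong (yes p) e f g = sym ([]-yes e (f p))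
  []-cong (no ¬p) e f g = sym ([]-no e (λ q → ¬p (g q)))

  []-× : {P Q S : Set} (d : Dec P) (e : Dec Q) (s : Dec S) → (P × Q → S) → (S → P × Q) → [ d ] * [ e ] ≡ [ s ]
  []-× (yes p) (yes q) s f g = trans (Int.*-identityˡ _) (sym ([]-yes s (f (p , q))))
  []-× (yes p) (no ¬q) s f g = trans (Int.*-zeroʳ _) (sym ([]-no s (λ x → ¬q (proj₂ (g x)))))
  []-× (no ¬p) e s f g = trans (Int.*-zeroˡ _) (sym ([]-no s (λ x → ¬p (proj₁ (g x)))))

  []-idem : {P : Set} (d : Dec P) → [ d ] * [ d ] ≡ [ d ]
  []-idem (yes _) = Int.*-identityˡ _
  []-idem (no _) = Int.*-zeroˡ _

  []-≥0 : {P : Set} (d : Dec P) → 0ℤ ≤ [ d ]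
  []-≥0 (yes _) = +≤+ z≤n
  []-≥0 (no _) = +≤+ z≤n

  []-≤1 : {P : Set} (d : Dec P) → [ d ] ≤ 1ℤ
  []-≤1 (yes _) = Int.≤-refl
  []-≤1 (no _) = +≤+ z≤n

  -- Under the bracket its condition may be assumed; this is how formulas that hold only for units
  -- enter sums over a whole ring.
  []-subst : {P : Set} (d : Dec P) {x y : ℤ} → (P → x ≡ y) → [ d ] * x ≡ [ d ] * y
  []-subst (yes p) h = cong (1ℤ *_) (h p)
  []-subst (no _) h = trans (Int.*-zeroˡ _) (sym (Int.*-zeroˡ _))

  []-mono : {P Q : Set} (d : Dec P) (e : Dec Q) → (P → Q) → [ d ] ≤ [ e ]
  []-mono (yes p) e f = Int.≤-reflexive (sym ([]-yes e (f p)))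
  []-mono (no _) e f = []-≥0 e

  module _ {A : Set} where

    sumL : List A → (A → ℤ) → ℤ
    sumL [] f = 0ℤ
    sumL (x ∷ xs) f = f x + sumL xs f

    sumL-cong : ∀ xs {f g} → (∀ x → f x ≡ g x) → sumL xs f ≡ sumL xs g
    sumL-cong [] h = refl
    sumL-cong (x ∷ xs) h = cong₂ _+_ (h x) (sumL-cong xs h)

    sumL-+ : ∀ xs f g → sumL xs (λ x → f x + g x) ≡ sumL xs f + sumL xs g
    sumL-+ [] f g = sym (Int.+-identityˡ _)
    sumL-+ (x ∷ xs) f g rewrite sumL-+ xs f g = lem (f x) (g x) (sumL xs f) (sumL xs g)
      where
      -- The solver has to see through the seal, so identities between integers are proved in opaque
      -- blocks of their own.
      opaque
        unfolding _+_
        lem : ∀ a b c d → a + b + (c + d) ≡ a + c + (b + d)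
        lem = solve-∀

    sumL-* : ∀ xs k f → sumL xs (λ x → k * f x) ≡ k * sumL xs f
    sumL-* [] k f = sym (Int.*-zeroʳ k)
    sumL-* (x ∷ xs) k f rewrite sumL-* xs k f = sym (Int.*-distribˡ-+ k (f x) _)

    sumL-mono : ∀ xs {f g} → (∀ x → f x ≤ g x) → sumL xs f ≤ sumL xs g
    sumL-mono [] h = Int.≤-refl
    sumL-mono (x ∷ xs) h = Int.+-mono-≤ (h x) (sumL-mono xs h)

    sumL-++ : ∀ xs ys f → sumL (xs ++ ys) f ≡ sumL xs f + sumL ys f
    sumL-++ [] ys f = sym (Int.+-identityˡ _)
    sumL-++ (x ∷ xs) ys f rewrite sumL-++ xs ys f = sym (Int.+-assoc (f x) _ _)

    sumL-0 : ∀ xs → sumL xs (λ _ → 0ℤ) ≡ 0ℤ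
    sumL-0 [] = refl
    sumL-0 (x ∷ xs) = trans (Int.+-identityˡ _) (sumL-0 xs)

  sumL-map : {A B : Set} (g : A → B) (xs : List A) (f : B → ℤ) → sumL (map g xs) f ≡ sumL xs (f ∘ g)
  sumL-map g [] f = refl
  sumL-map g (x ∷ xs) f = cong₂ _+_ refl (sumL-map g xs f)

  sumL-swap : {A B : Set} (xs : List A) (ys : List B) (f : A → B → ℤ) →
    sumL xs (λ x → sumL ys (f x)) ≡ sumL ys (λ y → sumL xs (λ x → f x y))
  sumL-swap [] ys f = sym (sumL-0 ys)
  sumL-swap (x ∷ xs) ys f rewrite sumL-swap xs ys f = sym (sumL-+ ys (f x) _)

  sumL-cartesianProduct : {A B : Set} (xs : List A) (ys : List B) (f : A × B → ℤ) →
    sumL (cartesianProduct xs ys) f ≡ sumL xs (λ x → sumL ys (λ y → f (x , y)))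
  sumL-cartesianProduct [] ys f = refl
  sumL-cartesianProduct (x ∷ xs) ys f =
    trans (sumL-++ (map (x ,_) ys) _ f) (cong₂ _+_ (sumL-map (x ,_) ys f) (sumL-cartesianProduct xs ys f))

  -- The equation `once` says at the same time that the list is complete and that it has no
  -- repetitions, in the form in which sums use it.
  record FinSet : Set₁ where
    infix 4 _≟_
    field
      Carrier : Set
      _≟_ : (x y : Carrier) → Dec (x ≡ y)
      enum : List Carrier
      once : ∀ a → sumL enum (λ x → [ x ≟ a ]) ≡ 1ℤ

  open FinSet public using () renaming (Carrier to ∣_∣)

  -- Sealed so that sums over concrete sets do not unfold during unification.
  opaque
    ∑ : (A : FinSet) → (∣ A ∣ → ℤ) → ℤ
    ∑ A f = sumL (FinSet.enum A) f

  syntax ∑ A (λ x → e) = ∑[ x ∈ A ] e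
  infix 5 ∑

  card : FinSet → ℤ
  card A = ∑[ _ ∈ A ] 1ℤ

  norm : (A : FinSet) → (∣ A ∣ → ℤ) → ℤ
  norm A f = ∑[ x ∈ A ] (f x * f x)

  inner : (A : FinSet) → (f g : ∣ A ∣ → ℤ) → ℤ
  inner A f g = ∑[ x ∈ A ] (f x * g x)

  module _ (A : FinSet) where
    open FinSet A hiding (Carrier)

    opaque
      unfolding ∑

      ∑-cong : ∀ {f g} → (∀ x → f x ≡ g x) → ∑ A f ≡ ∑ A g
      ∑-cong = sumL-cong enum

      ∑-+ : ∀ f g → ∑ A (λ x → f x + g x) ≡ ∑ A f + ∑ A g
      ∑-+ = sumL-+ enum

      ∑-*ˡ : ∀ k f → ∑ A (λ x → k * f x) ≡ k * ∑ A f
      ∑-*ˡ = sumL-* enum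

      ∑-mono : ∀ {f g} → (∀ x → f x ≤ g x) → ∑ A f ≤ ∑ A g
      ∑-mono = sumL-mono enum

      ∑-0 : ∑ A (λ _ → 0ℤ) ≡ 0ℤ
      ∑-0 = sumL-0 enum

      ∑-once : ∀ a → ∑ A (λ x → [ x ≟ a ]) ≡ 1ℤ
      ∑-once = once

      ∑-sumL : ∀ f → ∑ A f ≡ sumL enum f
      ∑-sumL f = refl

    ∑-*ʳ : ∀ k f → ∑ A (λ x → f x * k) ≡ ∑ A f * k
    ∑-*ʳ k f = begin
      ∑ A (λ x → f x * k) ≡⟨ ∑-cong (λ x → Int.*-comm (f x) k) ⟩
      ∑ A (λ x → k * f x) ≡⟨ ∑-*ˡ k f ⟩
      k * ∑ A f           ≡⟨ Int.*-comm k _ ⟩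
      ∑ A f * k ∎

    ∑-neg : ∀ f → ∑ A (λ x → - f x) ≡ - ∑ A f
    ∑-neg f = begin
      ∑ A (λ x → - f x)      ≡⟨ ∑-cong (λ x → sym (Int.-1*i≡-i (f x))) ⟩
      ∑ A (λ x → - 1ℤ * f x) ≡⟨ ∑-*ˡ (- 1ℤ) f ⟩
      - 1ℤ * ∑ A f           ≡⟨ Int.-1*i≡-i _ ⟩
      - ∑ A f ∎

    ∑-- : ∀ f g → ∑ A (λ x → f x - g x) ≡ ∑ A f - ∑ A g
    ∑-- f g = trans (∑-+ f (λ x → - g x)) (cong₂ _+_ refl (∑-neg g))

    ∑-≡0 : ∀ {f} → (∀ x → f x ≡ 0ℤ) → ∑ A f ≡ 0ℤ
    ∑-≡0 h = trans (∑-cong h) ∑-0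

    ∑-≥0 : ∀ {f} → (∀ x → 0ℤ ≤ f x) → 0ℤ ≤ ∑ A f
    ∑-≥0 {f} h = subst (_≤ ∑ A f) ∑-0 (∑-mono h)

    ∑-const : ∀ k → ∑ A (λ _ → k) ≡ card A * k
    ∑-const k = trans (∑-cong (λ _ → sym (Int.*-identityˡ k))) (∑-*ʳ k (λ _ → 1ℤ))

    ∑-δ : ∀ a f → ∑[ x ∈ A ] ([ x ≟ a ] * f x) ≡ f a
    ∑-δ a f = begin
      ∑[ x ∈ A ] ([ x ≟ a ] * f x) ≡⟨ ∑-cong (λ x → []-subst (x ≟ a) (cong f)) ⟩
      ∑[ x ∈ A ] ([ x ≟ a ] * f a) ≡⟨ ∑-*ʳ (f a) (λ x → [ x ≟ a ]) ⟩
      ∑ A (λ x → [ x ≟ a ]) * f a  ≡⟨ cong (_* f a) (∑-once a) ⟩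
      1ℤ * f a                     ≡⟨ Int.*-identityˡ _ ⟩
      f a ∎

    []-sym : ∀ x y → [ x ≟ y ] ≡ [ y ≟ x ]
    []-sym x y = []-cong (x ≟ y) (y ≟ x) sym sym

    ∑-δ′ : ∀ a f → ∑[ x ∈ A ] ([ a ≟ x ] * f x) ≡ f a
    ∑-δ′ a f = trans (∑-cong (λ x → cong (_* f x) ([]-sym a x))) (∑-δ a f)

    ∑-δ″ : ∀ a → ∑[ x ∈ A ] [ a ≟ x ] ≡ 1ℤ
    ∑-δ″ a = trans (∑-cong (λ x → []-sym a x)) (∑-once a)

    norm≥0 : ∀ f → 0ℤ ≤ norm A f
    norm≥0 f = ∑-≥0 (λ x → sq≥0 (f x))

    norm-cong : ∀ {f g} → (∀ x → f x ≡ g x) → norm A f ≡ norm A g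
    norm-cong h = ∑-cong (λ x → cong₂ _*_ (h x) (h x))

    -- If `a` were missing from the list, the sum in `once` would be 0.
    complete : ∀ a → a ∈ enum
    complete a = go enum (λ h → contradiction (trans (sym h) (once a)) λ ())
      where
      go : ∀ xs → ¬ (sumL xs (λ x → [ x ≟ a ]) ≡ 0ℤ) → a ∈ xs
      go [] h = ⊥-elim (h refl)
      go (x ∷ xs) h with x ≟ a
      ... | yes e = here (sym e)
      ... | no _ = there (go xs (λ e → h (trans (Int.+-identityˡ _) e)))

    search : {P : ∣ A ∣ → Set} → (∀ x → Dec (P x)) → Dec (∃ P)
    search P? = map′ satisfied (λ { (a , p) → lose (complete a) p }) (any? P? enum)

  ∑-swap : (A B : FinSet) (f : ∣ A ∣ → ∣ B ∣ → ℤ) → ∑[ x ∈ A ] ∑[ y ∈ B ] f x y ≡ ∑[ y ∈ B ] ∑[ x ∈ A ] f x y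
  ∑-swap A B f = begin
    ∑[ x ∈ A ] ∑[ y ∈ B ] f x y                                      ≡⟨ trans (∑-sumL A _) (sumL-cong (FinSet.enum A) λ x → ∑-sumL B (f x)) ⟩
    sumL (FinSet.enum A) (λ x → sumL (FinSet.enum B) (f x))           ≡⟨ sumL-swap (FinSet.enum A) (FinSet.enum B) f ⟩
    sumL (FinSet.enum B) (λ y → sumL (FinSet.enum A) (λ x → f x y))   ≡⟨ sym (trans (∑-sumL B _) (sumL-cong (FinSet.enum B) λ y → ∑-sumL A (λ x → f x y))) ⟩
    ∑[ y ∈ B ] ∑[ x ∈ A ] f x y ∎

  ∑-∑-* : (A B : FinSet) (f : ∣ A ∣ → ℤ) (g : ∣ B ∣ → ℤ) → ∑[ x ∈ A ] ∑[ y ∈ B ] (f x * g y) ≡ ∑ A f * ∑ B g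
  ∑-∑-* A B f g = trans (∑-cong A (λ x → ∑-*ˡ B (f x) g)) (∑-*ʳ A (∑ B g) f)

  ∑-fibre : (A B : FinSet) (φ : ∣ A ∣ → ∣ B ∣) (f : ∣ B ∣ → ℤ) →
    ∑[ x ∈ A ] f (φ x) ≡ ∑[ y ∈ B ] ((∑[ x ∈ A ] [ FinSet._≟_ B (φ x) y ]) * f y)
  ∑-fibre A B φ f = begin
    ∑[ x ∈ A ] f (φ x)                                ≡⟨ ∑-cong A (λ x → sym (∑-δ′ B (φ x) f)) ⟩
    ∑[ x ∈ A ] ∑[ y ∈ B ] ([ φ x ≟ y ] * f y)          ≡⟨ ∑-swap A B (λ x y → [ φ x ≟ y ] * f y) ⟩
    ∑[ y ∈ B ] ∑[ x ∈ A ] ([ φ x ≟ y ] * f y)          ≡⟨ ∑-cong B (λ y → ∑-*ʳ A (f y) (λ x → [ φ x ≟ y ])) ⟩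
    ∑[ y ∈ B ] ((∑[ x ∈ A ] [ φ x ≟ y ]) * f y) ∎
    where open FinSet B using (_≟_)

  ∑-reindex : (A B : FinSet) (φ : ∣ A ∣ → ∣ B ∣) (ψ : ∣ B ∣ → ∣ A ∣) →
    (∀ y → φ (ψ y) ≡ y) → (∀ x → ψ (φ x) ≡ x) → (f : ∣ B ∣ → ℤ) → ∑[ x ∈ A ] f (φ x) ≡ ∑ B f
  ∑-reindex A B φ ψ φψ ψφ f = trans (∑-fibre A B φ f) (∑-cong B λ y →
    trans (cong (_* f y) (trans (∑-cong A λ x →
      []-cong (FinSet._≟_ B (φ x) y) (FinSet._≟_ A x (ψ y)) (λ e → trans (sym (ψφ x)) (cong ψ e)) (λ e → trans (cong φ e) (φψ y)))
      (∑-once A (ψ y)))) (Int.*-identityˡ _))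

  infixr 4 _⊗_
  _⊗_ : FinSet → FinSet → FinSet
  A ⊗ B = record
    { Carrier = ∣ A ∣ × ∣ B ∣
    ; _≟_ = ≡-dec A._≟_ B._≟_
    ; enum = cartesianProduct A.enum B.enum
    ; once = λ { (a , b) → begin
        sumL (cartesianProduct A.enum B.enum) (λ x → [ ≡-dec A._≟_ B._≟_ x (a , b) ])
          ≡⟨ trans (sumL-cartesianProduct A.enum B.enum _) (sym (trans (∑-sumL A _) (sumL-cong A.enum λ x → ∑-sumL B _))) ⟩
        ∑[ x ∈ A ] ∑[ y ∈ B ] [ ≡-dec A._≟_ B._≟_ (x , y) (a , b) ]
          ≡⟨ ∑-cong A (λ x → ∑-cong B λ y → sym ([]-× (x A.≟ a) (y B.≟ b) (≡-dec A._≟_ B._≟_ (x , y) (a , b))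
               (λ { (refl , refl) → refl }) (λ { refl → refl , refl }))) ⟩
        ∑[ x ∈ A ] ∑[ y ∈ B ] ([ x A.≟ a ] * [ y B.≟ b ])
          ≡⟨ ∑-∑-* A B (λ x → [ x A.≟ a ]) (λ y → [ y B.≟ b ]) ⟩
        ∑ A (λ x → [ x A.≟ a ]) * ∑ B (λ y → [ y B.≟ b ])
          ≡⟨ cong₂ _*_ (∑-once A a) (∑-once B b) ⟩
        1ℤ * 1ℤ
          ≡⟨ Int.*-identityˡ 1ℤ ⟩
        1ℤ ∎ }
    }
    where
    module A = FinSet A
    module B = FinSet B

  ∑-⊗ : (A B : FinSet) (f : ∣ A ⊗ B ∣ → ℤ) → ∑ (A ⊗ B) f ≡ ∑[ x ∈ A ] ∑[ y ∈ B ] f (x , y)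
  ∑-⊗ A B f = trans (∑-sumL (A ⊗ B) f) (trans (sumL-cartesianProduct (FinSet.enum A) (FinSet.enum B) f)
    (sym (trans (∑-sumL A _) (sumL-cong (FinSet.enum A) λ x → ∑-sumL B _))))

  card-⊗ : (A B : FinSet) → card (A ⊗ B) ≡ card A * card B
  card-⊗ A B = trans (∑-⊗ A B (λ _ → 1ℤ)) (∑-const A (card B))

  norm-⊗ : (A B : FinSet) (f : ∣ A ⊗ B ∣ → ℤ) → norm (A ⊗ B) f ≡ ∑[ y ∈ B ] norm A (λ x → f (x , y))
  norm-⊗ A B f = trans (∑-⊗ A B _) (∑-swap A B _)

  module _ (A : FinSet) where
    open FinSet A hiding (Carrier)

    private
      vec≟ : ∀ {n} (xs ys : Vec ∣ A ∣ n) → Dec (xs ≡ ys)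
      vec≟ = Vec.≡-dec _≟_

      enumVec : ∀ n → List (Vec ∣ A ∣ n)
      enumVec zero = [] ∷ []
      enumVec (suc n) = map (λ { (x , xs) → x ∷ xs }) (cartesianProduct enum (enumVec n))

      onceVec : ∀ n (ys : Vec ∣ A ∣ n) → sumL (enumVec n) (λ xs → [ vec≟ xs ys ]) ≡ 1ℤ
      onceVec zero [] = Int.+-identityʳ 1ℤ
      onceVec (suc n) (y ∷ ys) = begin
        sumL (enumVec (suc n)) (λ xs → [ vec≟ xs (y ∷ ys) ])
          ≡⟨ sumL-map _ (cartesianProduct enum (enumVec n)) _ ⟩
        sumL (cartesianProduct enum (enumVec n)) (λ { (x , xs) → [ vec≟ (x ∷ xs) (y ∷ ys) ] })
          ≡⟨ sumL-cartesianProduct enum (enumVec n) _ ⟩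
        sumL enum (λ x → sumL (enumVec n) (λ xs → [ vec≟ (x ∷ xs) (y ∷ ys) ]))
          ≡⟨ sumL-cong enum (λ x → trans (sumL-cong (enumVec n) (λ xs → sym ([]-× (x ≟ y) (vec≟ xs ys) (vec≟ (x ∷ xs) (y ∷ ys))
               (λ { (refl , refl) → refl }) (λ { refl → refl , refl })))) (sumL-* (enumVec n) [ x ≟ y ] _)) ⟩
        sumL enum (λ x → [ x ≟ y ] * sumL (enumVec n) (λ xs → [ vec≟ xs ys ]))
          ≡⟨ trans (sym (∑-sumL A _)) (∑-δ A y (λ _ → sumL (enumVec n) (λ xs → [ vec≟ xs ys ]))) ⟩
        sumL (enumVec n) (λ xs → [ vec≟ xs ys ])
          ≡⟨ onceVec n ys ⟩
        1ℤ ∎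

    -- Coefficient vectors: counting them reduces a comparison of the numbers of unknowns and of
    -- equations to the pigeonhole principle.
    vecSet : ℕ → FinSet
    vecSet n = record { Carrier = Vec ∣ A ∣ n ; _≟_ = vec≟ ; enum = enumVec n ; once = onceVec n }

    card-vecSet : ∀ n → card (vecSet (suc n)) ≡ card A * card (vecSet n)
    card-vecSet n = trans (∑-sumL (vecSet (suc n)) _) (trans (sumL-map _ (cartesianProduct enum (enumVec n)) _) (trans (sym (∑-sumL (A ⊗ vecSet n) _)) (card-⊗ A (vecSet n))))

  -- Twice the defect of the inequality is ∑∑ (f x g y - f y g x)².
  cauchySchwarz : (A : FinSet) (f g : ∣ A ∣ → ℤ) → inner A f g * inner A f g ≤ norm A f * norm A g
  cauchySchwarz A f g = *-cancel {+ 2} (+<+ (ℕ.s≤s z≤n)) (≤-via (∑[ x ∈ A ] ∑[ y ∈ A ] (w x y * w x y))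
    (∑-≥0 A λ x → ∑-≥0 A λ y → sq≥0 (w x y)) (sym expand))
    where
    w : ∣ A ∣ → ∣ A ∣ → ℤ
    w x y = f x * g y - f y * g x
    opaque
     unfolding _+_ _*_ -_
     alg : ∀ a b c d → (a * b - c * d) * (a * b - c * d) ≡ (a * a) * (b * b) + ((d * d) * (c * c) - + 2 * ((a * d) * (c * b)))
     alg = solve-∀
     alg′ : ∀ F G I → F * G + (G * F - + 2 * (I * I)) ≡ + 2 * (F * G) - + 2 * (I * I)
     alg′ = solve-∀
    expand : ∑[ x ∈ A ] ∑[ y ∈ A ] (w x y * w x y) ≡ + 2 * (norm A f * norm A g) - + 2 * (inner A f g * inner A f g)
    expand = begin
      ∑[ x ∈ A ] ∑[ y ∈ A ] (w x y * w x y)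
        ≡⟨ ∑-cong A (λ x → trans (∑-cong A λ y → alg (f x) (g y) (f y) (g x)) (trans (∑-+ A _ _) (cong₂ _+_ refl (∑-- A _ _)))) ⟩
      ∑[ x ∈ A ] ((∑[ y ∈ A ] (f x * f x * (g y * g y))) + ((∑[ y ∈ A ] (g x * g x * (f y * f y))) - (∑[ y ∈ A ] (+ 2 * (f x * g x * (f y * g y))))))
        ≡⟨ trans (∑-+ A _ _) (cong₂ _+_ refl (∑-- A _ _)) ⟩
      (∑[ x ∈ A ] ∑[ y ∈ A ] (f x * f x * (g y * g y))) + ((∑[ x ∈ A ] ∑[ y ∈ A ] (g x * g x * (f y * f y))) - (∑[ x ∈ A ] ∑[ y ∈ A ] (+ 2 * (f x * g x * (f y * g y)))))
        ≡⟨ cong₂ _+_ (∑-∑-* A A _ _) (cong₂ _-_ (∑-∑-* A A _ _)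
             (trans (∑-cong A λ x → ∑-*ˡ A (+ 2) _) (trans (∑-*ˡ A (+ 2) _) (cong (+ 2 *_) (∑-∑-* A A _ _))))) ⟩
      norm A f * norm A g + (norm A g * norm A f - + 2 * (inner A f g * inner A f g))
        ≡⟨ alg′ (norm A f) (norm A g) (inner A f g) ⟩
      + 2 * (norm A f * norm A g) - + 2 * (inner A f g * inner A f g) ∎

  module _ (A B : FinSet) (φ : ∣ A ∣ → ∣ B ∣) (injective : ∀ x y → φ x ≡ φ y → x ≡ y) where

    injective-fibre≤1 : ∀ y → ∑[ x ∈ A ] [ FinSet._≟_ B (φ x) y ] ≤ 1ℤ
    injective-fibre≤1 y with search A (λ x → FinSet._≟_ B (φ x) y)
    ... | yes (x₀ , refl) = Int.≤-reflexive (trans (∑-cong A λ x → []-cong (FinSet._≟_ B (φ x) (φ x₀)) (FinSet._≟_ A x x₀) (injective x x₀) (cong φ)) (∑-once A x₀))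
    ... | no none = subst (_≤ 1ℤ) (sym (∑-≡0 A λ x → []-no (FinSet._≟_ B (φ x) y) (λ e → none (x , e)))) (+≤+ z≤n)

    ∑-injective : ∀ {f} → (∀ y → 0ℤ ≤ f y) → ∑[ x ∈ A ] f (φ x) ≤ ∑ B f
    ∑-injective {f} f≥0 = subst (_≤ ∑ B f) (sym (∑-fibre A B φ f)) (∑-mono B λ y →
      Int.≤-trans (*-monoʳ (f≥0 y) (injective-fibre≤1 y)) (Int.≤-reflexive (Int.*-identityˡ (f y))))

  -- A collision can be searched for. If there is none, `φ` is injective, and `∑-injective` for the
  -- constant 1 contradicts the inequality of cardinalities.
  pigeonhole : (A B : FinSet) (φ : ∣ A ∣ → ∣ B ∣) → card B < card A → ∃ λ x → ∃ λ y → ¬ x ≡ y × φ x ≡ φ y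
  pigeonhole A B φ h with search (A ⊗ A) (λ { (x , y) → ¬? (FinSet._≟_ A x y) ×-dec FinSet._≟_ B (φ x) (φ y) })
  ... | yes ((x , y) , x≢y , e) = x , y , x≢y , e
  ... | no none = ⊥-elim (Int.<⇒≱ h (∑-injective A B φ injective (λ _ → +≤+ z≤n)))
    where
    injective : ∀ x y → φ x ≡ φ y → x ≡ y
    injective x y e with FinSet._≟_ A x y
    ... | yes e′ = e′
    ... | no ne = ⊥-elim (none ((x , y) , ne , e))

  module _ (A : FinSet) (two : + 2 ≤ card A) where

    card-vecSet>0 : ∀ n → 0ℤ < card (vecSet A n)
    card-vecSet-< : ∀ n → card (vecSet A n) < card (vecSet A (suc n))

    card-vecSet>0 zero = subst (0ℤ <_) (sym (trans (∑-sumL (vecSet A 0) _) (Int.+-identityʳ 1ℤ))) (+<+ (ℕ.s≤s z≤n))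
    card-vecSet>0 (suc n) = Int.≤-<-trans (Int.<⇒≤ (card-vecSet>0 n)) (card-vecSet-< n)
    card-vecSet-< n = Int.<-≤-trans (double (card-vecSet>0 n)) (subst (+ 2 * card (vecSet A n) ≤_) (sym (card-vecSet A n)) (*-monoʳ (Int.<⇒≤ (card-vecSet>0 n)) two))
      where
      opaque
        unfolding _*_
        double : ∀ {x} → 0ℤ < x → x < + 2 * x
        double {+ suc m} _ = +<+ (ℕ.s≤s (ℕ.m<m+n m (ℕ.s≤s z≤n)))
        double {+ zero} (+<+ ())

    card-vecSet-mono : ∀ {m n} → m ℕ.< n → card (vecSet A m) < card (vecSet A n)
    card-vecSet-mono {m} {suc n} (ℕ.s≤s m≤n) with ℕ.m≤n⇒m<n∨m≡n m≤n
    ... | inj₁ m<n = Int.≤-<-trans (Int.<⇒≤ (card-vecSet-mono m<n)) (card-vecSet-< n)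
    ... | inj₂ refl = card-vecSet-< n

-- Finite commutative rings, units and changes of variable in sums.

module FiniteRings where
  open import Algebra using (IsCommutativeRing; CommutativeRing)
  import Algebra.Solver.Ring as RingSolver
  open import Algebra.Solver.Ring.AlmostCommutativeRing using (fromCommutativeRing; _-Raw-AlmostCommutative⟶_; AlmostCommutativeRing)
  import Algebra.Properties.Ring as RingProperties
  import Algebra.Properties.AbelianGroup as AbelianGroupProperties
  import Algebra.Properties.Semiring.Mult as Mult
  import Algebra.Properties.Semiring.Exp as Exp
  import Algebra.Properties.CommutativeSemiring.Exp as CommExp
  import Data.Integer as I
  import Data.Integer.Properties as P
  open import Data.Maybe using (Maybe; just; nothing)
  open import Level using (0ℓ)
  open import Relation.Nullary.Decidable using (_×-dec_)
  open ≡-Reasoning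
  open Int using (ℤ; +_; -[1+_]; 1ℤ)
  open FiniteSums

  record FinRing : Set₁ where
    infixl 6 _⊕_ _⊖_
    infixl 7 _·_
    infix 8 ⊝_
    field
      set : FinSet
      _⊕_ _·_ : ∣ set ∣ → ∣ set ∣ → ∣ set ∣
      ⊝_ : ∣ set ∣ → ∣ set ∣
      𝟘 𝟙 : ∣ set ∣
      isCommutativeRing : IsCommutativeRing _≡_ _⊕_ _·_ ⊝_ 𝟘 𝟙

    R : Set
    R = ∣ set ∣

    commutativeRing : CommutativeRing 0ℓ 0ℓ
    commutativeRing = record { isCommutativeRing = isCommutativeRing }

    _⊖_ : R → R → R
    x ⊖ y = x ⊕ ⊝ y

    open FinSet set public using (_≟_)

  module Ring (𝑹 : FinRing) where
    open FinRing 𝑹 public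
    open IsCommutativeRing isCommutativeRing public
      using (+-assoc; +-comm; *-assoc; *-comm; +-identityˡ; +-identityʳ; *-identityˡ; *-identityʳ;
             -‿inverseˡ; -‿inverseʳ; zeroˡ; zeroʳ; distribˡ; distribʳ)
    open CommutativeRing commutativeRing using (semiring; commutativeSemiring; ring; +-abelianGroup)
    open RingProperties ring using (-‿distribˡ-*; -‿distribʳ-*; -‿involutive; -0#≈0#)
    open AbelianGroupProperties +-abelianGroup using (⁻¹-∙-comm)
    open Mult semiring using (×-homo-+; ×1-homo-*) renaming (_×_ to _×ᴿ_)
    open Exp semiring public using (_^_; ^-homo-*; ^-assocʳ)
    open CommExp commutativeSemiring public using (^-distrib-*)

    fromℕ : ℕ → R
    fromℕ n = n ×ᴿ 𝟙

    fromℤ : ℤ → R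
    fromℤ (+ n) = fromℕ n
    fromℤ -[1+ n ] = ⊝ fromℕ (suc n)

    private
      fromℤ-neg : ∀ z → fromℤ (I.- z) ≡ ⊝ fromℤ z
      fromℤ-neg (+ zero) = sym -0#≈0#
      fromℤ-neg (+ suc n) = refl
      fromℤ-neg -[1+ n ] = sym (-‿involutive _)

      cancel : ∀ a b c → (a ⊕ b) ⊖ (a ⊕ c) ≡ b ⊖ c
      cancel a b c = begin
        (a ⊕ b) ⊖ (a ⊕ c)        ≡⟨ cong₂ _⊕_ (+-comm a b) (sym (⁻¹-∙-comm a c)) ⟩
        (b ⊕ a) ⊕ (⊝ a ⊕ ⊝ c)    ≡⟨ +-assoc b a _ ⟩
        b ⊕ (a ⊕ (⊝ a ⊕ ⊝ c))    ≡⟨ cong (b ⊕_) (sym (+-assoc a (⊝ a) (⊝ c))) ⟩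
        b ⊕ ((a ⊕ ⊝ a) ⊕ ⊝ c)    ≡⟨ cong (λ z → b ⊕ (z ⊕ ⊝ c)) (-‿inverseʳ a) ⟩
        b ⊕ (𝟘 ⊕ ⊝ c)            ≡⟨ cong (b ⊕_) (+-identityˡ _) ⟩
        b ⊖ c ∎

      fromℤ-⊖ : ∀ m n → fromℤ (m I.⊖ n) ≡ fromℕ m ⊖ fromℕ n
      fromℤ-⊖ m zero = trans (sym (+-identityʳ _)) (cong (fromℕ m ⊕_) (sym -0#≈0#))
      fromℤ-⊖ zero (suc n) = sym (+-identityˡ _)
      fromℤ-⊖ (suc m) (suc n) = begin
        fromℤ (suc m I.⊖ suc n)     ≡⟨ cong fromℤ (P.[1+m]⊖[1+n]≡m⊖n m n) ⟩
        fromℤ (m I.⊖ n)             ≡⟨ fromℤ-⊖ m n ⟩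
        fromℕ m ⊖ fromℕ n           ≡⟨ sym (cancel 𝟙 (fromℕ m) (fromℕ n)) ⟩
        fromℕ (suc m) ⊖ fromℕ (suc n) ∎

      fromℤ-+ : ∀ x y → fromℤ (x I.+ y) ≡ fromℤ x ⊕ fromℤ y
      fromℤ-+ (+ m) (+ n) = ×-homo-+ 𝟙 m n
      fromℤ-+ (+ m) -[1+ n ] = fromℤ-⊖ m (suc n)
      fromℤ-+ -[1+ m ] (+ n) = trans (fromℤ-⊖ n (suc m)) (+-comm _ _)
      fromℤ-+ -[1+ m ] -[1+ n ] = trans (cong (λ k → ⊝ fromℕ (suc k)) (sym (ℕ.+-suc m n)))
        (trans (cong ⊝_ (×-homo-+ 𝟙 (suc m) (suc n))) (sym (⁻¹-∙-comm _ _)))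

      fromℤ-* : ∀ x y → fromℤ (x I.* y) ≡ fromℤ x · fromℤ y
      fromℤ-* (+ m) (+ n) = trans (cong fromℤ (sym (P.pos-* m n))) (×1-homo-* m n)
      fromℤ-* (+ m) -[1+ n ] = begin
        fromℤ (+ m I.* (I.- (+ suc n)))  ≡⟨ cong fromℤ (sym (P.neg-distribʳ-* (+ m) (+ suc n))) ⟩
        fromℤ (I.- (+ m I.* + suc n))    ≡⟨ fromℤ-neg (+ m I.* + suc n) ⟩
        ⊝ fromℤ (+ m I.* + suc n)        ≡⟨ cong ⊝_ (fromℤ-* (+ m) (+ suc n)) ⟩
        ⊝ (fromℕ m · fromℕ (suc n))      ≡⟨ -‿distribʳ-* _ _ ⟩
        fromℕ m · ⊝ fromℕ (suc n) ∎
      fromℤ-* -[1+ m ] y = begin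
        fromℤ ((I.- (+ suc m)) I.* y)    ≡⟨ cong fromℤ (sym (P.neg-distribˡ-* (+ suc m) y)) ⟩
        fromℤ (I.- (+ suc m I.* y))      ≡⟨ fromℤ-neg (+ suc m I.* y) ⟩
        ⊝ fromℤ (+ suc m I.* y)          ≡⟨ cong ⊝_ (pos y) ⟩
        ⊝ (fromℕ (suc m) · fromℤ y)      ≡⟨ -‿distribˡ-* _ _ ⟩
        ⊝ fromℕ (suc m) · fromℤ y ∎
        where
        pos : ∀ y → fromℤ (+ suc m I.* y) ≡ fromℕ (suc m) · fromℤ y
        pos (+ n) = trans (cong fromℤ (sym (P.pos-* (suc m) n))) (×1-homo-* (suc m) n)
        pos -[1+ n ] = begin
          fromℤ (+ suc m I.* (I.- (+ suc n)))  ≡⟨ cong fromℤ (sym (P.neg-distribʳ-* (+ suc m) (+ suc n))) ⟩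
          fromℤ (I.- (+ suc m I.* + suc n))    ≡⟨ fromℤ-neg (+ suc m I.* + suc n) ⟩
          ⊝ fromℤ (+ suc m I.* + suc n)        ≡⟨ cong ⊝_ (pos (+ suc n)) ⟩
          ⊝ (fromℕ (suc m) · fromℕ (suc n))    ≡⟨ -‿distribʳ-* _ _ ⟩
          fromℕ (suc m) · ⊝ fromℕ (suc n) ∎

    fromℤ-hom-+ : ∀ x y → fromℤ (x Int.+ y) ≡ fromℤ x ⊕ fromℤ y
    fromℤ-hom-+ x y = trans (cong fromℤ (Int.+-def x y)) (fromℤ-+ x y)

    fromℤ-hom-neg : ∀ x → fromℤ (Int.- x) ≡ ⊝ fromℤ x
    fromℤ-hom-neg x = trans (cong fromℤ (Int.neg-def x)) (fromℤ-neg x)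

    fromℤ-1 : fromℤ 1ℤ ≡ 𝟙
    fromℤ-1 = +-identityʳ 𝟙

    fromℕ-hom-+ : ∀ m n → fromℕ (m ℕ.+ n) ≡ fromℕ m ⊕ fromℕ n
    fromℕ-hom-+ = ×-homo-+ 𝟙

    fromℕ-hom-* : ∀ m n → fromℕ (m ℕ.* n) ≡ fromℕ m · fromℕ n
    fromℕ-hom-* = ×1-homo-*

    private
      almostCommutativeRing : AlmostCommutativeRing 0ℓ 0ℓ
      almostCommutativeRing = fromCommutativeRing commutativeRing

      morphism : I.+-*-rawRing -Raw-AlmostCommutative⟶ almostCommutativeRing
      morphism = record
        { ⟦_⟧ = fromℤ
        ; +-homo = fromℤ-+
        ; *-homo = fromℤ-*
        ; -‿homo = fromℤ-neg
        ; 0-homo = refl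
        ; 1-homo = fromℤ-1
        }

      coeff≟ : ∀ x y → Maybe (fromℤ x ≡ fromℤ y)
      coeff≟ x y with x P.≟ y
      ... | yes e = just (cong fromℤ e)
      ... | no _ = nothing

    -- The coefficients are integers, so that signs and multiplicities cancel by computation. As
    -- `con (+ 1)` denotes 𝟙 ⊕ 𝟘, the element 𝟙 is passed to the solver as a variable.
    module Solver = RingSolver I.+-*-rawRing almostCommutativeRing morphism coeff≟
    open Solver public using (solve; _:=_; _:+_; _:*_; :-_; _:-_; _:^_; con)

    ⊖≡𝟘⇒≡ : ∀ {x y} → x ⊖ y ≡ 𝟘 → x ≡ y
    ⊖≡𝟘⇒≡ {x} {y} e = trans (solve 2 (λ x y → x := (x :- y) :+ y) refl x y) (trans (cong (_⊕ y) e) (+-identityˡ y))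

    ≡⇒⊖≡𝟘 : ∀ {x y} → x ≡ y → x ⊖ y ≡ 𝟘
    ≡⇒⊖≡𝟘 {x} refl = -‿inverseʳ x

    ⊕-cancelʳ : ∀ {x y} z → x ⊕ z ≡ y ⊕ z → x ≡ y
    ⊕-cancelʳ {x} {y} z e = trans (lem x) (trans (cong (_⊖ z) e) (sym (lem y)))
      where
      lem : ∀ x → x ≡ x ⊕ z ⊖ z
      lem x = solve 2 (λ x z → x := x :+ z :- z) refl x z

    private
      inverse? : ∀ x → Dec (∃ λ y → x · y ≡ 𝟙)
      inverse? x = search set (λ y → x · y ≟ 𝟙)

    -- The junk value at a non-unit is 𝟘.
    opaque
      inv : R → R
      inv x with inverse? x
      ... | yes (y , _) = y
      ... | no _ = 𝟘

    -- An equation rather than an existence statement: it is decidable and can be used directly for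
    -- rewriting.
    Unit : R → Set
    Unit x = x · inv x ≡ 𝟙

    unit? : ∀ x → Dec (Unit x)
    unit? x = x · inv x ≟ 𝟙

    opaque
      unfolding inv
      toUnit : ∀ {x y} → x · y ≡ 𝟙 → Unit x
      toUnit {x} {y} e with inverse? x
      ... | yes (_ , e′) = e′
      ... | no ¬i = ⊥-elim (¬i (y , e))

    unit-cancelˡ : ∀ {u x y} → Unit u → u · x ≡ u · y → x ≡ y
    unit-cancelˡ {u} {x} {y} U e = trans (lem x) (trans (cong (inv u ·_) e) (sym (lem y)))
      where
      lem : ∀ z → z ≡ inv u · (u · z)
      lem z = trans (sym (*-identityˡ z)) (trans (cong (_· z) (sym U)) (solve 3 (λ u v z → u :* v :* z := v :* (u :* z)) refl u (inv u) z))

    inv-unique : ∀ {x y} → x · y ≡ 𝟙 → inv x ≡ y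
    inv-unique e = unit-cancelˡ (toUnit e) (trans (toUnit e) (sym e))

    unit-· : ∀ {x y} → Unit x → Unit y → Unit (x · y)
    unit-· {x} {y} u v = toUnit (trans (solve 4 (λ x y z w → (x :* y) :* (z :* w) := (x :* z) :* (y :* w)) refl x y (inv x) (inv y))
      (trans (cong₂ _·_ u v) (*-identityˡ 𝟙)))

    inv-· : ∀ {x y} → Unit x → Unit y → inv (x · y) ≡ inv x · inv y
    inv-· {x} {y} u v = inv-unique (trans (solve 4 (λ x y z w → (x :* y) :* (z :* w) := (x :* z) :* (y :* w)) refl x y (inv x) (inv y))
      (trans (cong₂ _·_ u v) (*-identityˡ 𝟙)))

    unit-inv : ∀ {x} → Unit x → Unit (inv x)
    unit-inv u = toUnit (trans (*-comm _ _) u)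

    inv-inv : ∀ {x} → Unit x → inv (inv x) ≡ x
    inv-inv u = inv-unique (trans (*-comm _ _) u)

    unit-neg : ∀ {x} → Unit x → Unit (⊝ x)
    unit-neg {x} u = toUnit (trans (solve 2 (λ x y → (:- x) :* (:- y) := x :* y) refl x (inv x)) u)

    inv-neg : ∀ {x} → Unit x → inv (⊝ x) ≡ ⊝ inv x
    inv-neg {x} u = inv-unique (trans (solve 2 (λ x y → (:- x) :* (:- y) := x :* y) refl x (inv x)) u)

    unit-factorˡ : ∀ {x y} → Unit (x · y) → Unit x
    unit-factorˡ {x} {y} u = toUnit (trans (sym (*-assoc x y _)) u)

    𝟘^suc : ∀ n → 𝟘 ^ suc n ≡ 𝟘
    𝟘^suc n = zeroˡ _

    𝟙^ : ∀ n → 𝟙 ^ n ≡ 𝟙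
    𝟙^ zero = refl
    𝟙^ (suc n) = trans (*-identityˡ _) (𝟙^ n)

    ∑-shift : ∀ a f → ∑[ x ∈ set ] f (x ⊕ a) ≡ ∑ set f
    ∑-shift a f = ∑-reindex set set (_⊕ a) (_⊖ a)
      (λ y → solve 2 (λ y a → y :- a :+ a := y) refl y a) (λ y → solve 2 (λ y a → y :+ a :- a := y) refl y a) f

    ∑-shiftˡ : ∀ a f → ∑[ x ∈ set ] f (a ⊕ x) ≡ ∑ set f
    ∑-shiftˡ a f = trans (∑-cong set λ x → cong f (+-comm a x)) (∑-shift a f)

    ∑-negate : ∀ f → ∑[ x ∈ set ] f (⊝ x) ≡ ∑ set f
    ∑-negate f = ∑-reindex set set ⊝_ ⊝_ -‿involutive -‿involutive f

    ∑-scale : ∀ {u} → Unit u → ∀ f → ∑[ x ∈ set ] f (u · x) ≡ ∑ set f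
    ∑-scale {u} U f = ∑-reindex set set (u ·_) (inv u ·_) (lem U) (lem′ U) f
      where
      lem : Unit u → ∀ y → u · (inv u · y) ≡ y
      lem e y = trans (sym (*-assoc _ _ _)) (trans (cong (_· y) e) (*-identityˡ y))
      lem′ : Unit u → ∀ y → inv u · (u · y) ≡ y
      lem′ e y = trans (sym (*-assoc _ _ _)) (trans (cong (_· y) (trans (*-comm _ _) e)) (*-identityˡ y))

    -- Both sides sum over the solutions of x · y ≡ c.
    ∑-hyperbola : ∀ {c} → Unit c → ∀ (g : R → R → ℤ) → ∑[ x ∈ set ] ([ unit? x ] Int.* g x (c · inv x)) ≡ ∑[ y ∈ set ] ([ unit? y ] Int.* g (c · inv y) y)
    ∑-hyperbola {c} C g = begin
      ∑[ x ∈ set ] ([ unit? x ] Int.* g x (c · inv x))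
        ≡⟨ ∑-cong set (λ x → trans (sym (∑-δ′ set (c · inv x) (λ y → [ unit? x ] Int.* g x y))) (∑-cong set λ y → flip x y)) ⟩
      ∑[ x ∈ set ] ∑[ y ∈ set ] ([ c · inv y ≟ x ] Int.* ([ unit? y ] Int.* g x y))
        ≡⟨ ∑-swap set set _ ⟩
      ∑[ y ∈ set ] ∑[ x ∈ set ] ([ c · inv y ≟ x ] Int.* ([ unit? y ] Int.* g x y))
        ≡⟨ ∑-cong set (λ y → ∑-δ′ set (c · inv y) (λ x → [ unit? y ] Int.* g x y)) ⟩
      ∑[ y ∈ set ] ([ unit? y ] Int.* g (c · inv y) y) ∎
      where
      involutive : ∀ {x} → Unit x → c · inv (c · inv x) ≡ x
      involutive {x} u = trans (cong (c ·_) (trans (inv-· C (unit-inv u)) (cong (inv c ·_) (inv-inv u))))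
        (trans (sym (*-assoc c (inv c) x)) (trans (cong (_· x) C) (*-identityˡ x)))
      forth : ∀ {x y} → c · inv x ≡ y × Unit x → c · inv y ≡ x × Unit y
      forth (refl , u) = involutive u , unit-· C (unit-inv u)
      flip : ∀ x y → [ c · inv x ≟ y ] Int.* ([ unit? x ] Int.* g x y) ≡ [ c · inv y ≟ x ] Int.* ([ unit? y ] Int.* g x y)
      flip x y = trans (sym (Int.*-assoc _ _ _)) (trans (cong (Int._* g x y) (trans
        ([]-× (c · inv x ≟ y) (unit? x) (c · inv y ≟ x ×-dec unit? y) forth forth)
        (sym ([]-× (c · inv y ≟ x) (unit? y) (c · inv y ≟ x ×-dec unit? y) (λ z → z) (λ z → z))))) (Int.*-assoc _ _ _))

  module _ (𝑹 𝑺 : FinRing) where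
    private
      module R = Ring 𝑹
      module S = Ring 𝑺

    infixr 4 _⊗ᴿ_
    _⊗ᴿ_ : FinRing
    _⊗ᴿ_ = record
      { set = R.set ⊗ S.set
      ; _⊕_ = λ { (a , b) (c , d) → a R.⊕ c , b S.⊕ d }
      ; _·_ = λ { (a , b) (c , d) → a R.· c , b S.· d }
      ; ⊝_ = λ { (a , b) → R.⊝ a , S.⊝ b }
      ; 𝟘 = R.𝟘 , S.𝟘
      ; 𝟙 = R.𝟙 , S.𝟙
      ; isCommutativeRing = record
        { isRing = record
          { +-isAbelianGroup = record
            { isGroup = record
              { isMonoid = record
                { isSemigroup = record
                  { isMagma = record { isEquivalence = isEquivalence ; ∙-cong = λ { refl refl → refl } }
                  ; assoc = λ _ _ _ → cong₂ _,_ (R.+-assoc _ _ _) (S.+-assoc _ _ _) }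
                ; identity = (λ _ → cong₂ _,_ (R.+-identityˡ _) (S.+-identityˡ _)) , (λ _ → cong₂ _,_ (R.+-identityʳ _) (S.+-identityʳ _)) }
              ; inverse = (λ _ → cong₂ _,_ (R.-‿inverseˡ _) (S.-‿inverseˡ _)) , (λ _ → cong₂ _,_ (R.-‿inverseʳ _) (S.-‿inverseʳ _))
              ; ⁻¹-cong = λ { refl → refl } }
            ; comm = λ _ _ → cong₂ _,_ (R.+-comm _ _) (S.+-comm _ _) }
          ; *-cong = λ { refl refl → refl }
          ; *-assoc = λ _ _ _ → cong₂ _,_ (R.*-assoc _ _ _) (S.*-assoc _ _ _)
          ; *-identity = (λ _ → cong₂ _,_ (R.*-identityˡ _) (S.*-identityˡ _)) , (λ _ → cong₂ _,_ (R.*-identityʳ _) (S.*-identityʳ _))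
          ; distrib = (λ _ _ _ → cong₂ _,_ (R.distribˡ _ _ _) (S.distribˡ _ _ _)) , (λ _ _ _ → cong₂ _,_ (R.distribʳ _ _ _) (S.distribʳ _ _ _)) }
        ; *-comm = λ _ _ → cong₂ _,_ (R.*-comm _ _) (S.*-comm _ _) }
      }

  IsField : FinRing → Set
  IsField 𝑹 = (∀ x → ¬ x ≡ 𝟘 → Unit x) × ¬ 𝟙 ≡ 𝟘
    where open Ring 𝑹

  module Field (𝑹 : FinRing) (isField : IsField 𝑹) where
    open Ring 𝑹

    nonzero⇒unit : ∀ {x} → ¬ x ≡ 𝟘 → Unit x
    nonzero⇒unit = proj₁ isField _

    unit⇒nonzero : ∀ {x} → Unit x → ¬ x ≡ 𝟘
    unit⇒nonzero {x} u e = proj₂ isField (trans (sym u) (trans (cong (_· inv x) e) (zeroˡ _)))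

    ·-nonzero : ∀ {x y} → ¬ x ≡ 𝟘 → ¬ y ≡ 𝟘 → ¬ x · y ≡ 𝟘
    ·-nonzero a b = unit⇒nonzero (unit-· (nonzero⇒unit a) (nonzero⇒unit b))

    ^-nonzero : ∀ {x} n → ¬ x ≡ 𝟘 → ¬ x ^ n ≡ 𝟘
    ^-nonzero zero h = proj₂ isField
    ^-nonzero (suc n) h = ·-nonzero h (^-nonzero n h)

-- The rings ℤ/N and the projections between them.

module Residues where
  open import Data.Fin using (Fin; toℕ; fromℕ<)
  import Data.Fin as Fin
  import Data.Fin.Properties as Fin
  import Data.Integer as I
  import Data.Integer.Properties as P
  open import Data.Integer.DivMod using (_%ℕ_; _/ℕ_; n%ℕd<d; a≡a%ℕn+[a/ℕn]*n)
  open import Data.List using (applyUpTo)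
  open import Data.Nat.Coprimality using (Coprime; coprime-Bézout; coprime-divisor; prime⇒coprime)
  import Data.Nat.Coprimality as Coprime
  open import Data.Nat.DivMod using (m<n⇒m%n≡m; [m+kn]%n≡m%n)
  open import Data.Nat.Divisibility using (_∣_; divides; ∣-trans; ∣1⇒≡1)
  open import Data.Nat.GCD using (module Bézout)
  open import Data.Nat.Primality using (Prime; prime⇒irreducible)
  open import Function using (_∘_)
  open ≡-Reasoning
  open Int using (ℤ; +_; -[1+_]; 0ℤ; 1ℤ; _+_; _*_; -_; _-_; solve-∀)
  open FiniteSums
  open FiniteRings

  sumTo : ℕ → (ℕ → ℤ) → ℤ
  sumTo zero f = 0ℤ
  sumTo (suc n) f = f 0 + sumTo n (f ∘ suc)

  sumL-applyUpTo : {A : Set} (g : ℕ → A) (n : ℕ) (f : A → ℤ) → sumL (applyUpTo g n) f ≡ sumTo n (f ∘ g)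
  sumL-applyUpTo g zero f = refl
  sumL-applyUpTo g (suc n) f = cong₂ _+_ refl (sumL-applyUpTo (g ∘ suc) n f)

  sumTo-cong : ∀ n {f g} → (∀ i → i ℕ.< n → f i ≡ g i) → sumTo n f ≡ sumTo n g
  sumTo-cong zero h = refl
  sumTo-cong (suc n) h = cong₂ _+_ (h 0 (s≤s z≤n)) (sumTo-cong n (λ i i<n → h (suc i) (s≤s i<n)))

  sumTo-0 : ∀ n {f} → (∀ i → i ℕ.< n → f i ≡ 0ℤ) → sumTo n f ≡ 0ℤ
  sumTo-0 zero h = refl
  sumTo-0 (suc n) h = trans (cong₂ _+_ (h 0 (s≤s z≤n)) (sumTo-0 n (λ i i<n → h (suc i) (s≤s i<n)))) (Int.+-identityˡ 0ℤ)

  sumTo-split : ∀ a b f → sumTo (a ℕ.+ b) f ≡ sumTo a f + sumTo b (λ i → f (a ℕ.+ i))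
  sumTo-split zero b f = sym (Int.+-identityˡ _)
  sumTo-split (suc a) b f = trans (cong₂ _+_ refl (sumTo-split a b (f ∘ suc))) (sym (Int.+-assoc _ _ _))

  sumTo-δ : ∀ n k → k ℕ.< n → sumTo n (λ i → [ i ℕ.≟ k ]) ≡ 1ℤ
  sumTo-δ (suc n) zero h = trans (cong₂ _+_ ([]-yes (0 ℕ.≟ 0) refl) (sumTo-0 n (λ i _ → []-no (suc i ℕ.≟ 0) λ ()))) (Int.+-identityʳ 1ℤ)
  sumTo-δ (suc n) (suc k) (s≤s h) = trans (cong₂ _+_ ([]-no (0 ℕ.≟ suc k) λ ())
    (trans (sumTo-cong n (λ i _ → []-cong (suc i ℕ.≟ suc k) (i ℕ.≟ k) ℕ.suc-injective (cong suc))) (sumTo-δ n k h))) (Int.+-identityˡ 1ℤ)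

  sumTo-const : ∀ n k → sumTo n (λ _ → k) ≡ + n * k
  sumTo-const zero k = sym (Int.*-zeroˡ k)
  sumTo-const (suc n) k = trans (cong₂ _+_ refl (sumTo-const n k)) (sym (trans (cong (_* k) (Int.pos-+ 1 n))
    (trans (Int.*-distribʳ-+ k 1ℤ (+ n)) (cong₂ _+_ (Int.*-identityˡ k) refl))))

  infix 4 _∣ℤ_
  _∣ℤ_ : ℕ → ℤ → Set
  N ∣ℤ z = ∃ λ k → z ≡ k * + N

  opaque
    unfolding _+_ _*_ -_

    ∣ℤ-+ : ∀ {N x y} → N ∣ℤ x → N ∣ℤ y → N ∣ℤ x + y
    ∣ℤ-+ {N} (k , refl) (l , refl) = k + l , alg k l (+ N)
      where
      alg : ∀ k l n → k * n + l * n ≡ (k + l) * n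
      alg = solve-∀

    ∣ℤ-neg : ∀ {N x} → N ∣ℤ x → N ∣ℤ - x
    ∣ℤ-neg {N} (k , refl) = - k , alg k (+ N)
      where
      alg : ∀ k n → - (k * n) ≡ - k * n
      alg = solve-∀

    ∣ℤ-*ˡ : ∀ {N x} y → N ∣ℤ x → N ∣ℤ y * x
    ∣ℤ-*ˡ {N} y (k , refl) = y * k , alg y k (+ N)
      where
      alg : ∀ y k n → y * (k * n) ≡ y * k * n
      alg = solve-∀

    ∣ℤ-- : ∀ {N} x y z → N ∣ℤ x - y → N ∣ℤ y - z → N ∣ℤ x - z
    ∣ℤ-- x y z d e = subst (_ ∣ℤ_) (alg x y z) (∣ℤ-+ d e)
      where
      alg : ∀ x y z → x - y + (y - z) ≡ x - z
      alg = solve-∀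

    ∣ℤ-flip : ∀ {N} x y → N ∣ℤ x - y → N ∣ℤ y - x
    ∣ℤ-flip x y d = subst (_ ∣ℤ_) (alg x y) (∣ℤ-neg d)
      where
      alg : ∀ x y → - (x - y) ≡ y - x
      alg = solve-∀

    ∣ℤ-+-cong : ∀ {N} a b c d → N ∣ℤ a - b → N ∣ℤ c - d → N ∣ℤ (a + c) - (b + d)
    ∣ℤ-+-cong a b c d h k = subst (_ ∣ℤ_) (alg a b c d) (∣ℤ-+ h k)
      where
      alg : ∀ a b c d → a - b + (c - d) ≡ (a + c) - (b + d)
      alg = solve-∀

    ∣ℤ-*-cong : ∀ {N} a b c d → N ∣ℤ a - b → N ∣ℤ c - d → N ∣ℤ a * c - b * d
    ∣ℤ-*-cong a b c d h k = subst (_ ∣ℤ_) (alg a b c d) (∣ℤ-+ (∣ℤ-*ˡ c h) (∣ℤ-*ˡ b k))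
      where
      alg : ∀ a b c d → c * (a - b) + b * (c - d) ≡ a * c - b * d
      alg = solve-∀

    ∣ℤ-neg-cong : ∀ {N} a b → N ∣ℤ a - b → N ∣ℤ - a - - b
    ∣ℤ-neg-cong a b h = subst (_ ∣ℤ_) (alg a b) (∣ℤ-neg h)
      where
      alg : ∀ a b → - (a - b) ≡ - a - - b
      alg = solve-∀

    ∣ℤ-trans : ∀ {M N z} → M ∣ N → N ∣ℤ z → M ∣ℤ z
    ∣ℤ-trans {M} (divides q refl) (k , refl) = k * + q , trans (cong (k *_) (Int.pos-* q M)) (sym (Int.*-assoc k (+ q) (+ M)))

    small-congruent : ∀ {N m n} .{{_ : NonZero N}} → m ℕ.< N → n ℕ.< N → N ∣ℤ + m - + n → m ≡ n
    small-congruent {N} {m} {n} m< n< (k , e) = go k (trans (sym (alg (+ m) (+ n))) (cong (_+ + n) e))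
      where
      alg : ∀ m n → m - n + n ≡ m
      alg = solve-∀
      alg′ : ∀ k n t → k * n + t ≡ t + k * n
      alg′ = solve-∀
      alg″ : ∀ k n t → t ≡ (- k) * n + t + k * n
      alg″ = solve-∀
      fin : ∀ m n a → m ℕ.< N → n ℕ.< N → + m ≡ + n + + a * + N → m ≡ n
      fin m n a m< n< e = begin
        m                          ≡⟨ sym (m<n⇒m%n≡m m<) ⟩
        m ℕ.% N                    ≡⟨ cong (ℕ._% N) (P.+-injective (trans e (cong (λ w → + n + w) (sym (Int.pos-* a N))))) ⟩
        (n ℕ.+ a ℕ.* N) ℕ.% N      ≡⟨ [m+kn]%n≡m%n n a N ⟩
        n ℕ.% N                    ≡⟨ m<n⇒m%n≡m n< ⟩
        n ∎
      go : ∀ k → + m ≡ k * + N + + n → m ≡ n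
      go (+ a) e = fin m n a m< n< (trans e (alg′ (+ a) (+ N) (+ n)))
      go -[1+ a ] e = sym (fin n m (suc a) n< m< (trans (alg″ (+ suc a) (+ N) (+ n)) (cong (λ w → w + + suc a * + N) (sym e))))

  opaque
    class : (N : ℕ) .{{_ : NonZero N}} → ℤ → Fin N
    class N z = fromℕ< (n%ℕd<d z N)

    rep : ∀ {N} → Fin N → ℤ
    rep x = + toℕ x

  opaque
    unfolding _+_ _*_ -_ class rep

    rep-class : ∀ N .{{_ : NonZero N}} z → N ∣ℤ z - rep (class N z)
    rep-class N z = z /ℕ N , (begin
      z - + toℕ (fromℕ< (n%ℕd<d z N))        ≡⟨ cong (λ w → z - + w) (Fin.toℕ-fromℕ< (n%ℕd<d z N)) ⟩
      z - + (z %ℕ N)                         ≡⟨ cong (λ w → w - + (z %ℕ N)) (a≡a%ℕn+[a/ℕn]*n z N) ⟩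
      + (z %ℕ N) + (z /ℕ N) * + N - + (z %ℕ N) ≡⟨ alg (+ (z %ℕ N)) ((z /ℕ N) * + N) ⟩
      (z /ℕ N) * + N ∎)
      where
      alg : ∀ x y → x + y - x ≡ y
      alg = solve-∀

  opaque
    unfolding rep

    class-cong : ∀ N .{{_ : NonZero N}} {x y} → N ∣ℤ x - y → class N x ≡ class N y
    class-cong N {x} {y} d = Fin.toℕ-injective (small-congruent (Fin.toℕ<n (class N x)) (Fin.toℕ<n (class N y))
      (∣ℤ-- _ x _ (∣ℤ-flip x _ (rep-class N x)) (∣ℤ-- x y _ d (rep-class N y))))

    class-rep : ∀ N .{{_ : NonZero N}} (x : Fin N) → class N (rep x) ≡ x
    class-rep N x = Fin.toℕ-injective (small-congruent (Fin.toℕ<n (class N (rep x))) (Fin.toℕ<n x) (∣ℤ-flip (rep x) _ (rep-class N (rep x))))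

    rep-nat : ∀ {N} (x : Fin N) → rep x ≡ + toℕ x
    rep-nat x = refl

  class-≡⇒ : ∀ N .{{_ : NonZero N}} {x y} → class N x ≡ class N y → N ∣ℤ x - y
  class-≡⇒ N {x} {y} e = ∣ℤ-- x _ y (rep-class N x) (∣ℤ-flip y _ (subst (λ w → N ∣ℤ y - rep w) (sym e) (rep-class N y)))

  module _ (N : ℕ) .{{nz : NonZero N}} where
    private
      infixl 6 _⊕_
      infixl 7 _·_
      _⊕_ _·_ : Fin N → Fin N → Fin N
      x ⊕ y = class N (rep x + rep y)
      x · y = class N (rep x * rep y)
      ⊝_ : Fin N → Fin N
      ⊝ x = class N (- rep x)

      hom-+ : ∀ a b → class N a ⊕ class N b ≡ class N (a + b)
      hom-+ a b = class-cong N (∣ℤ-+-cong (rep (class N a)) a (rep (class N b)) b (∣ℤ-flip a _ (rep-class N a)) (∣ℤ-flip b _ (rep-class N b)))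

      hom-* : ∀ a b → class N a · class N b ≡ class N (a * b)
      hom-* a b = class-cong N (∣ℤ-*-cong (rep (class N a)) a (rep (class N b)) b (∣ℤ-flip a _ (rep-class N a)) (∣ℤ-flip b _ (rep-class N b)))

      hom-neg : ∀ a → ⊝ class N a ≡ class N (- a)
      hom-neg a = class-cong N (∣ℤ-neg-cong (rep (class N a)) a (∣ℤ-flip a _ (rep-class N a)))

      -- Every residue is the class of an integer and `class` respects the operations, so each ring
      -- law is inherited from ℤ.
      elim : (P : Fin N → Set) → (∀ a → P (class N a)) → ∀ x → P x
      elim P h x = subst P (class-rep N x) (h (rep x))

      +-assoc : ∀ x y z → x ⊕ y ⊕ z ≡ x ⊕ (y ⊕ z)
      +-assoc = elim _ λ a → elim _ λ b → elim _ λ c → begin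
        class N a ⊕ class N b ⊕ class N c   ≡⟨ cong (_⊕ class N c) (hom-+ a b) ⟩
        class N (a + b) ⊕ class N c         ≡⟨ hom-+ (a + b) c ⟩
        class N (a + b + c)                 ≡⟨ cong (class N) (Int.+-assoc a b c) ⟩
        class N (a + (b + c))               ≡⟨ sym (hom-+ a (b + c)) ⟩
        class N a ⊕ class N (b + c)         ≡⟨ cong (class N a ⊕_) (sym (hom-+ b c)) ⟩
        class N a ⊕ (class N b ⊕ class N c) ∎

      *-assoc : ∀ x y z → x · y · z ≡ x · (y · z)
      *-assoc = elim _ λ a → elim _ λ b → elim _ λ c → begin
        class N a · class N b · class N c   ≡⟨ cong (_· class N c) (hom-* a b) ⟩
        class N (a * b) · class N c         ≡⟨ hom-* (a * b) c ⟩
        class N (a * b * c)                 ≡⟨ cong (class N) (Int.*-assoc a b c) ⟩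
        class N (a * (b * c))               ≡⟨ sym (hom-* a (b * c)) ⟩
        class N a · class N (b * c)         ≡⟨ cong (class N a ·_) (sym (hom-* b c)) ⟩
        class N a · (class N b · class N c) ∎

      +-comm : ∀ x y → x ⊕ y ≡ y ⊕ x
      +-comm x y = cong (class N) (Int.+-comm (rep x) (rep y))

      *-comm : ∀ x y → x · y ≡ y · x
      *-comm x y = cong (class N) (Int.*-comm (rep x) (rep y))

      +-identityˡ : ∀ x → class N 0ℤ ⊕ x ≡ x
      +-identityˡ = elim _ λ a → trans (hom-+ 0ℤ a) (cong (class N) (Int.+-identityˡ a))

      *-identityˡ : ∀ x → class N 1ℤ · x ≡ x
      *-identityˡ = elim _ λ a → trans (hom-* 1ℤ a) (cong (class N) (Int.*-identityˡ a))

      +-inverseʳ : ∀ x → x ⊕ ⊝ x ≡ class N 0ℤ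
      +-inverseʳ = elim _ λ a → trans (cong (class N a ⊕_) (hom-neg a)) (trans (hom-+ a (- a)) (cong (class N) (Int.+-inverseʳ a)))

      distribˡ : ∀ x y z → x · (y ⊕ z) ≡ x · y ⊕ x · z
      distribˡ = elim _ λ a → elim _ λ b → elim _ λ c → begin
        class N a · (class N b ⊕ class N c)  ≡⟨ cong (class N a ·_) (hom-+ b c) ⟩
        class N a · class N (b + c)          ≡⟨ hom-* a (b + c) ⟩
        class N (a * (b + c))                ≡⟨ cong (class N) (Int.*-distribˡ-+ a b c) ⟩
        class N (a * b + a * c)              ≡⟨ sym (hom-+ (a * b) (a * c)) ⟩
        class N (a * b) ⊕ class N (a * c)    ≡⟨ sym (cong₂ _⊕_ (hom-* a b) (hom-* a c)) ⟩
        class N a · class N b ⊕ class N a · class N c ∎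

      once : ∀ a → sumL (applyUpTo (λ i → class N (+ i)) N) (λ x → [ x Fin.≟ a ]) ≡ 1ℤ
      once a = begin
        sumL (applyUpTo (λ i → class N (+ i)) N) (λ x → [ x Fin.≟ a ])
          ≡⟨ sumL-applyUpTo _ N _ ⟩
        sumTo N (λ i → [ class N (+ i) Fin.≟ a ])
          ≡⟨ sumTo-cong N (λ i i< → []-cong (class N (+ i) Fin.≟ a) (i ℕ.≟ toℕ a)
               (λ e → small-congruent i< (Fin.toℕ<n a) (subst (λ w → N ∣ℤ + i - w) (rep-nat a) (subst (λ w → N ∣ℤ + i - rep w) e (rep-class N (+ i)))))
               (λ e → trans (cong (class N) (trans (cong +_ e) (sym (rep-nat a)))) (class-rep N a))) ⟩
        sumTo N (λ i → [ i ℕ.≟ toℕ a ])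
          ≡⟨ sumTo-δ N (toℕ a) (Fin.toℕ<n a) ⟩
        1ℤ ∎

    ℤ/ : FinRing
    ℤ/ = record
      { set = record { Carrier = Fin N ; _≟_ = Fin._≟_ ; enum = applyUpTo (λ i → class N (+ i)) N ; once = once }
      ; _⊕_ = _⊕_
      ; _·_ = _·_
      ; ⊝_ = ⊝_
      ; 𝟘 = class N 0ℤ
      ; 𝟙 = class N 1ℤ
      ; isCommutativeRing = record
        { isRing = record
          { +-isAbelianGroup = record
            { isGroup = record
              { isMonoid = record
                { isSemigroup = record
                  { isMagma = record { isEquivalence = isEquivalence ; ∙-cong = cong₂ _⊕_ }
                  ; assoc = +-assoc }
                ; identity = +-identityˡ , (λ x → trans (+-comm x _) (+-identityˡ x)) }
              ; inverse = (λ x → trans (+-comm _ x) (+-inverseʳ x)) , +-inverseʳ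
              ; ⁻¹-cong = cong ⊝_ }
            ; comm = +-comm }
          ; *-cong = cong₂ _·_
          ; *-assoc = *-assoc
          ; *-identity = *-identityˡ , (λ x → trans (*-comm x _) (*-identityˡ x))
          ; distrib = distribˡ , (λ x y z → trans (*-comm (y ⊕ z) x) (trans (distribˡ x y z) (cong₂ _⊕_ (*-comm x y) (*-comm x z)))) }
        ; *-comm = *-comm }
      }

    class-+ : ∀ a b → class N (a + b) ≡ FinRing._⊕_ ℤ/ (class N a) (class N b)
    class-+ a b = sym (hom-+ a b)

    class-* : ∀ a b → class N (a * b) ≡ FinRing._·_ ℤ/ (class N a) (class N b)
    class-* a b = sym (hom-* a b)

    class-neg : ∀ a → class N (- a) ≡ FinRing.⊝_ ℤ/ (class N a)
    class-neg a = sym (hom-neg a)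

    ∑-ℤ/ : ∀ f → ∑ (FinRing.set ℤ/) f ≡ sumTo N (λ i → f (class N (+ i)))
    ∑-ℤ/ f = trans (∑-sumL (FinRing.set ℤ/) f) (sumL-applyUpTo _ N f)

    card-ℤ/ : card (FinRing.set ℤ/) ≡ + N
    card-ℤ/ = trans (∑-ℤ/ _) (trans (sumTo-const N 1ℤ) (Int.*-identityʳ _))

    open Ring ℤ/ using (fromℕ; fromℤ; Unit; inv; toUnit)

    fromℕ-class : ∀ n → fromℕ n ≡ class N (+ n)
    fromℕ-class zero = refl
    fromℕ-class (suc n) = trans (cong (class N 1ℤ ⊕_) (fromℕ-class n)) (trans (hom-+ 1ℤ (+ n)) (cong (class N) (sym (Int.pos-+ 1 n))))

    fromℤ-class : ∀ z → fromℤ z ≡ class N z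
    fromℤ-class (+ n) = fromℕ-class n
    fromℤ-class -[1+ n ] = trans (cong ⊝_ (fromℕ-class (suc n))) (trans (hom-neg (+ suc n)) (cong (class N) (Int.neg-def (+ suc n))))

    opaque
      unfolding _+_ _*_ -_

      coprime⇒unit : ∀ n → Coprime n N → Unit (class N (+ n))
      coprime⇒unit n c with coprime-Bézout c
      ... | Bézout.Identity.+- x y e = toUnit {y = class N (+ x)} (trans (hom-* (+ n) (+ x)) (class-cong N (+ y , (begin
        + n * + x - 1ℤ              ≡⟨ cong (λ w → w - 1ℤ) (trans (sym (Int.pos-* n x)) (cong +_ (trans (ℕ.*-comm n x) (sym e)))) ⟩
        + (1 ℕ.+ y ℕ.* N) - 1ℤ      ≡⟨ cong (λ w → w - 1ℤ) (trans (Int.pos-+ 1 (y ℕ.* N)) (cong (λ w → 1ℤ + w) (Int.pos-* y N))) ⟩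
        1ℤ + + y * + N - 1ℤ         ≡⟨ alg (+ y * + N) ⟩
        + y * + N ∎))))
        where
        alg : ∀ t → 1ℤ + t - 1ℤ ≡ t
        alg = solve-∀
      ... | Bézout.Identity.-+ x y e = toUnit {y = class N (- + x)} (trans (hom-* (+ n) (- + x)) (class-cong N (- + y , (begin
        + n * - + x - 1ℤ            ≡⟨ alg (+ n) (+ x) ⟩
        - (1ℤ + + x * + n)          ≡⟨ cong -_ (trans (cong (λ w → 1ℤ + w) (sym (Int.pos-* x n))) (sym (Int.pos-+ 1 (x ℕ.* n)))) ⟩
        - (+ (1 ℕ.+ x ℕ.* n))       ≡⟨ cong (λ w → - (+ w)) e ⟩
        - (+ (y ℕ.* N))             ≡⟨ cong -_ (Int.pos-* y N) ⟩
        - (+ y * + N)               ≡⟨ alg′ (+ y) (+ N) ⟩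
        - + y * + N ∎))))
        where
        alg : ∀ n x → n * - x - 1ℤ ≡ - (1ℤ + x * n)
        alg = solve-∀
        alg′ : ∀ n x → - (n * x) ≡ - n * x
        alg′ = solve-∀

  -- Every block of K consecutive integers meets the class exactly once.
  residue-blocks : ∀ K .{{_ : NonZero K}} u M → sumTo (M ℕ.* K) (λ i → [ class K (+ i) Fin.≟ u ]) ≡ + M
  residue-blocks K u zero = refl
  residue-blocks K u (suc M) = begin
    sumTo (K ℕ.+ M ℕ.* K) (λ i → [ class K (+ i) Fin.≟ u ])
      ≡⟨ sumTo-split K (M ℕ.* K) _ ⟩
    sumTo K (λ i → [ class K (+ i) Fin.≟ u ]) + sumTo (M ℕ.* K) (λ i → [ class K (+ (K ℕ.+ i)) Fin.≟ u ])
      ≡⟨ cong₂ _+_ (trans (sym (∑-ℤ/ K _)) (∑-once (FinRing.set (ℤ/ K)) u))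
           (trans (sumTo-cong (M ℕ.* K) (λ i _ → cong (λ w → [ w Fin.≟ u ]) (shift i))) (residue-blocks K u M)) ⟩
    1ℤ + + M
      ≡⟨ sym (Int.pos-+ 1 M) ⟩
    + suc M ∎
    where
    opaque
      unfolding _+_ _*_ -_
      shift : ∀ i → class K (+ (K ℕ.+ i)) ≡ class K (+ i)
      shift i = class-cong K (1ℤ , trans (cong (λ w → w - + i) (Int.pos-+ K i)) (alg (+ K) (+ i)))
        where
        alg : ∀ k i → k + i - i ≡ 1ℤ * k
        alg = solve-∀

  module Projection (N M K : ℕ) .{{nz : NonZero N}} .{{nzK : NonZero K}} (N≡MK : N ≡ M ℕ.* K) where
    private
      module A = Ring (ℤ/ N)
      module B = Ring (ℤ/ K)

    proj : Fin N → Fin K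
    proj x = class K (rep x)

    proj-class : ∀ z → proj (class N z) ≡ class K z
    proj-class z = class-cong K (∣ℤ-flip z _ (∣ℤ-trans (divides M N≡MK) (rep-class N z)))

    proj-⊕ : ∀ x y → proj (x A.⊕ y) ≡ proj x B.⊕ proj y
    proj-⊕ x y = trans (proj-class _) (class-+ K (rep x) (rep y))

    proj-· : ∀ x y → proj (x A.· y) ≡ proj x B.· proj y
    proj-· x y = trans (proj-class _) (class-* K (rep x) (rep y))

    proj-fibre : ∀ u → ∑[ x ∈ A.set ] [ proj x B.≟ u ] ≡ + M
    proj-fibre u = begin
      ∑[ x ∈ A.set ] [ proj x B.≟ u ]                ≡⟨ ∑-ℤ/ N _ ⟩
      sumTo N (λ i → [ proj (class N (+ i)) B.≟ u ]) ≡⟨ sumTo-cong N (λ i _ → cong (λ w → [ w B.≟ u ]) (proj-class (+ i))) ⟩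
      sumTo N (λ i → [ class K (+ i) B.≟ u ])        ≡⟨ trans (cong (λ n → sumTo n (λ i → [ class K (+ i) B.≟ u ])) N≡MK) (residue-blocks K u M) ⟩
      + M ∎

  coprime-* : ∀ {n a b} → Coprime n a → Coprime n b → Coprime n (a ℕ.* b)
  coprime-* {n} {a} {b} ca cb {d} (d∣n , d∣ab) = cb (d∣n , coprime-divisor (λ { (e∣d , e∣a) → ca (∣-trans e∣d d∣n , e∣a) }) d∣ab)

  coprime-^ : ∀ {n a} k → Coprime n a → Coprime n (a ℕ.^ k)
  coprime-^ zero c (_ , d∣1) = ∣1⇒≡1 d∣1
  coprime-^ (suc k) c = coprime-* c (coprime-^ k c)

  prime-coprime : ∀ {p n} → Prime p → ¬ p ∣ n → Coprime n p
  prime-coprime pr h {d} (d∣n , d∣p) with prime⇒irreducible pr d∣p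
  ... | inj₁ e = e
  ... | inj₂ refl = contradiction d∣n h

  residue-unit : ∀ p .{{_ : NonZero p}} → Prime p → ∀ x → ¬ x ≡ FinRing.𝟘 (ℤ/ p) → Ring.Unit (ℤ/ p) x
  residue-unit p pr x x≢0 = subst (Ring.Unit (ℤ/ p)) (class-rep p x) (subst (λ w → Ring.Unit (ℤ/ p) (class p w)) (sym (rep-nat x))
    (coprime⇒unit p (toℕ x) (Coprime.sym (prime⇒coprime pr {{ℕ.≢-nonZero (λ e → x≢0 (trans (sym (class-rep p x)) (cong (class p) (trans (rep-nat x) (cong +_ e)))))}} (Fin.toℕ<n x)))))

  opaque
    unfolding _+_ _*_ -_

    pos-∣ℤ : ∀ {d n} → d ∣ℤ + n → d ∣ n
    pos-∣ℤ {d} {n} (k , e) = subst (d ∣_) (trans (sym (P.abs-* k (+ d))) (cong I.∣_∣ (sym e))) (divides I.∣ k ∣ refl)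

    unit⇒coprime : ∀ N .{{_ : NonZero N}} n → Ring.Unit (ℤ/ N) (class N (+ n)) → Coprime n N
    unit⇒coprime N n u {d} (divides a ea , divides b eb) = ∣1⇒≡1 (pos-∣ℤ (subst (d ∣ℤ_) (alg (+ n * z) 1ℤ) (∣ℤ-+ d∣nz (∣ℤ-neg (∣ℤ-trans (divides b eb) N∣)))))
      where
      z : ℤ
      z = rep (Ring.inv (ℤ/ N) (class N (+ n)))
      N∣ : N ∣ℤ + n * z - 1ℤ
      N∣ = class-≡⇒ N (trans (class-* N (+ n) z) (trans (cong (FinRing._·_ (ℤ/ N) (class N (+ n))) (class-rep N _)) u))
      d∣nz : d ∣ℤ + n * z
      d∣nz = + a * z , trans (cong (λ m → + m * z) ea) (trans (cong (_* z) (Int.pos-* a d)) (alg′ (+ a) (+ d) z))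
        where
        alg′ : ∀ a d z → a * d * z ≡ a * z * d
        alg′ = solve-∀
      alg : ∀ x o → x + - (x - o) ≡ o
      alg = solve-∀

-- Weighted sums of translations, their transposes and orthogonal decompositions.

module Operators where
  open ≡-Reasoning
  open Int using (ℤ; 0ℤ; _*_; _≤_; _<_; solve-∀)
  open FiniteSums
  open FiniteRings

  private
    opaque
      unfolding _*_
      *-reassoc : ∀ s f h → s * f * h ≡ s * (f * h)
      *-reassoc = solve-∀
      *-exchange : ∀ s f h → s * (f * h) ≡ f * (s * h)
      *-exchange = solve-∀
      square-* : ∀ s x → s * x * (s * x) ≡ s * s * (x * x)
      square-* = solve-∀
      *-swapʳ : ∀ s x y → s * x * y ≡ s * y * x
      *-swapʳ = solve-∀
      *-swapᵒ : ∀ B n m → n * (B * m) ≡ m * (B * n)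
      *-swapᵒ = solve-∀

  inner-comm : (A : FinSet) (f g : ∣ A ∣ → ℤ) → inner A f g ≡ inner A g f
  inner-comm A f g = ∑-cong A (λ x → Int.*-comm (f x) (g x))

  module Operator (𝑮 : FinRing) (Y : FinSet) where
    open Ring 𝑮 renaming (set to G)

    -- A weighted sum of translations. Translations by v and by -v are transposes of each other, and
    -- all translations commute.
    op : (v : ∣ Y ∣ → R) (s : ∣ Y ∣ → ℤ) → (R → ℤ) → R → ℤ
    op v s f g = ∑[ y ∈ Y ] (s y * f (g ⊕ v y))

    op* : (v : ∣ Y ∣ → R) (s : ∣ Y ∣ → ℤ) → (R → ℤ) → R → ℤ
    op* v = op (λ y → ⊝ v y)

    module _ (v : ∣ Y ∣ → R) where

      op-adjoint : ∀ s f h → inner G (op v s f) h ≡ inner G f (op* v s h)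
      op-adjoint s f h = begin
        ∑[ g ∈ G ] (op v s f g * h g)
          ≡⟨ ∑-cong G (λ g → trans (sym (∑-*ʳ Y (h g) _)) (∑-cong Y λ y → *-reassoc (s y) (f (g ⊕ v y)) (h g))) ⟩
        ∑[ g ∈ G ] ∑[ y ∈ Y ] (s y * (f (g ⊕ v y) * h g))
          ≡⟨ ∑-swap G Y _ ⟩
        ∑[ y ∈ Y ] ∑[ g ∈ G ] (s y * (f (g ⊕ v y) * h g))
          ≡⟨ ∑-cong Y (λ y → trans (sym (∑-shift (⊝ v y) _)) (∑-cong G λ g →
               cong (λ w → s y * (f w * h (g ⊕ ⊝ v y))) (solve 2 (λ g u → g :+ (:- u) :+ u := g) refl g (v y)))) ⟩
        ∑[ y ∈ Y ] ∑[ g ∈ G ] (s y * (f g * h (g ⊕ ⊝ v y)))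
          ≡⟨ ∑-swap Y G _ ⟩
        ∑[ g ∈ G ] ∑[ y ∈ Y ] (s y * (f g * h (g ⊕ ⊝ v y)))
          ≡⟨ ∑-cong G (λ g → trans (∑-cong Y λ y → *-exchange (s y) (f g) _) (∑-*ˡ Y (f g) _)) ⟩
        ∑[ g ∈ G ] (f g * op* v s h g) ∎

      op-comm : ∀ w s t f g → op v s (op w t f) g ≡ op w t (op v s f) g
      op-comm w s t f g = begin
        ∑[ y ∈ Y ] (s y * (∑[ z ∈ Y ] (t z * f (g ⊕ v y ⊕ w z))))
          ≡⟨ ∑-cong Y (λ y → sym (∑-*ˡ Y (s y) _)) ⟩
        ∑[ y ∈ Y ] ∑[ z ∈ Y ] (s y * (t z * f (g ⊕ v y ⊕ w z)))
          ≡⟨ ∑-swap Y Y _ ⟩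
        ∑[ z ∈ Y ] ∑[ y ∈ Y ] (s y * (t z * f (g ⊕ v y ⊕ w z)))
          ≡⟨ ∑-cong Y (λ z → trans (∑-cong Y λ y → trans (*-exchange (s y) (t z) _)
               (cong (λ x → t z * (s y * f x)) (solve 3 (λ g a b → g :+ a :+ b := g :+ b :+ a) refl g (v y) (w z)))) (∑-*ˡ Y (t z) _)) ⟩
        ∑[ z ∈ Y ] (t z * (∑[ y ∈ Y ] (s y * f (g ⊕ w z ⊕ v y)))) ∎

      -- Since translations commute, the operator commutes with its transpose.
      op-normal : ∀ s f → norm G (op* v s f) ≡ norm G (op v s f)
      op-normal s f = begin
        inner G (op* v s f) (op* v s f)     ≡⟨ sym (op-adjoint s (op* v s f) f) ⟩
        inner G (op v s (op* v s f)) f      ≡⟨ inner-comm G _ _ ⟩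
        inner G f (op v s (op* v s f))      ≡⟨ ∑-cong G (λ g → cong (f g *_) (op-comm (λ y → ⊝ v y) s s f g)) ⟩
        inner G f (op* v s (op v s f))      ≡⟨ sym (op-adjoint s f (op v s f)) ⟩
        inner G (op v s f) (op v s f) ∎

      -- Cauchy-Schwarz over the terms present, whose number is `∑ Y s` because `s` is an indicator;
      -- translations preserve the norm.
      op-trivial : ∀ s → (∀ y → s y * s y ≡ s y) → ∀ f → norm G (op v s f) ≤ ∑ Y s * ∑ Y s * norm G f
      op-trivial s idem f = Int.≤-trans (∑-mono G pointwise) (Int.≤-reflexive total)
        where
        pointwise : ∀ g → op v s f g * op v s f g ≤ ∑ Y s * (∑[ y ∈ Y ] (s y * (f (g ⊕ v y) * f (g ⊕ v y))))
        pointwise g = subst₂ _≤_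
          (cong₂ _*_ cs cs) (cong₂ _*_ (∑-cong Y idem) (∑-cong Y λ y → trans (square-* (s y) _) (cong (_* (f (g ⊕ v y) * f (g ⊕ v y))) (idem y))))
          (cauchySchwarz Y s (λ y → s y * f (g ⊕ v y)))
          where
          cs : inner Y s (λ y → s y * f (g ⊕ v y)) ≡ op v s f g
          cs = ∑-cong Y λ y → trans (sym (Int.*-assoc (s y) (s y) _)) (cong (_* f (g ⊕ v y)) (idem y))
        total : ∑[ g ∈ G ] (∑ Y s * (∑[ y ∈ Y ] (s y * (f (g ⊕ v y) * f (g ⊕ v y))))) ≡ ∑ Y s * ∑ Y s * norm G f
        total = begin
          ∑[ g ∈ G ] (∑ Y s * (∑[ y ∈ Y ] (s y * (f (g ⊕ v y) * f (g ⊕ v y)))))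
            ≡⟨ ∑-*ˡ G (∑ Y s) _ ⟩
          ∑ Y s * (∑[ g ∈ G ] ∑[ y ∈ Y ] (s y * (f (g ⊕ v y) * f (g ⊕ v y))))
            ≡⟨ cong (∑ Y s *_) (∑-swap G Y _) ⟩
          ∑ Y s * (∑[ y ∈ Y ] ∑[ g ∈ G ] (s y * (f (g ⊕ v y) * f (g ⊕ v y))))
            ≡⟨ cong (∑ Y s *_) (∑-cong Y λ y → trans (∑-*ˡ G (s y) _) (cong (s y *_) (∑-shift (v y) (λ g → f g * f g)))) ⟩
          ∑ Y s * (∑[ y ∈ Y ] (s y * norm G f))
            ≡⟨ cong (∑ Y s *_) (∑-*ʳ Y (norm G f) s) ⟩
          ∑ Y s * (∑ Y s * norm G f)
            ≡⟨ sym (Int.*-assoc _ _ _) ⟩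
          ∑ Y s * ∑ Y s * norm G f ∎

      module Vanishing (K : FinSet) (κ : ∣ K ∣ → R) (card>0 : 0ℤ < card K) where

        MeanZero : (R → ℤ) → Set
        MeanZero f = ∀ g → ∑[ k ∈ K ] f (g ⊕ κ k) ≡ 0ℤ

        op-meanZero : ∀ w s {f} → MeanZero f → MeanZero (op w s f)
        op-meanZero w s {f} mz g = begin
          ∑[ k ∈ K ] ∑[ y ∈ Y ] (s y * f (g ⊕ κ k ⊕ w y))
            ≡⟨ ∑-swap K Y _ ⟩
          ∑[ y ∈ Y ] ∑[ k ∈ K ] (s y * f (g ⊕ κ k ⊕ w y))
            ≡⟨ ∑-cong Y (λ y → trans (∑-*ˡ K (s y) _) (cong (s y *_) (∑-cong K λ k → cong f
                 (solve 3 (λ g a b → g :+ a :+ b := g :+ b :+ a) refl g (κ k) (w y))))) ⟩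
          ∑[ y ∈ Y ] (s y * (∑[ k ∈ K ] f (g ⊕ w y ⊕ κ k)))
            ≡⟨ ∑-≡0 Y (λ y → trans (cong (s y *_) (mz (g ⊕ w y))) (Int.*-zeroʳ (s y))) ⟩
          0ℤ ∎

        -- An invariant function equals its own mean over the translates, and that mean vanishes.
        invariant⇒0 : ∀ {f} → MeanZero f → (∀ g k → f (g ⊕ κ k) ≡ f g) → ∀ g → f g ≡ 0ℤ
        invariant⇒0 {f} mz inv g = Int.*-cancel-≡0 card>0 (trans (sym (∑-const K (f g))) (trans (∑-cong K λ k → sym (inv g k)) (mz g)))

      module Classes (I : FinSet) (cl : ∣ Y ∣ → ∣ I ∣) (s : ∣ Y ∣ → ℤ)
        (𝓟 : (R → ℤ) → Set) (op-𝓟 : ∀ t {f} → 𝓟 f → 𝓟 (op v t f)) where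

        piece : ∣ I ∣ → ∣ Y ∣ → ℤ
        piece i y = s y * [ FinSet._≟_ I (cl y) i ]

        -- The pointwise vanishing is used twice: it makes the images of distinct pieces orthogonal,
        -- and it reduces X_i* X to X_i* X_i.
        Orthogonal : Set
        Orthogonal = ∀ {f} → 𝓟 f → ∀ i j → ¬ i ≡ j → ∀ g → op* v (piece i) (op v (piece j) f) g ≡ 0ℤ

        op-pieces : ∀ w f g → op w s f g ≡ ∑[ i ∈ I ] op w (piece i) f g
        op-pieces w f g = begin
          ∑[ y ∈ Y ] (s y * f (g ⊕ w y))
            ≡⟨ ∑-cong Y (λ y → trans (sym (Int.*-identityʳ _)) (trans (cong (_ *_) (sym (∑-δ″ I (cl y)))) (sym (∑-*ˡ I _ _)))) ⟩
          ∑[ y ∈ Y ] ∑[ i ∈ I ] (s y * f (g ⊕ w y) * [ FinSet._≟_ I (cl y) i ])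
            ≡⟨ ∑-swap Y I _ ⟩
          ∑[ i ∈ I ] ∑[ y ∈ Y ] (s y * f (g ⊕ w y) * [ FinSet._≟_ I (cl y) i ])
            ≡⟨ ∑-cong I (λ i → ∑-cong Y λ y → *-swapʳ (s y) _ _) ⟩
          ∑[ i ∈ I ] op w (piece i) f g ∎

        module _ (orth : Orthogonal) where

          inner-pieces : ∀ {f} → 𝓟 f → ∀ i j → inner G (op v (piece i) f) (op v (piece j) f) ≡ [ FinSet._≟_ I i j ] * inner G (op v (piece i) f) (op v (piece j) f)
          inner-pieces {f} pf i j with FinSet._≟_ I i j
          ... | yes _ = sym (Int.*-identityˡ _)
          ... | no i≢j = trans (op-adjoint (piece i) f (op v (piece j) f)) (trans (∑-≡0 G (λ g →
                  trans (cong (f g *_) (orth pf i j i≢j g)) (Int.*-zeroʳ (f g)))) (sym (Int.*-zeroˡ _)))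

          norm-pieces : ∀ {f} → 𝓟 f → norm G (op v s f) ≡ ∑[ i ∈ I ] norm G (op v (piece i) f)
          norm-pieces {f} pf = begin
            ∑[ g ∈ G ] (op v s f g * op v s f g)
              ≡⟨ ∑-cong G (λ g → trans (cong₂ _*_ (op-pieces v f g) (op-pieces v f g)) (sym (∑-∑-* I I _ _))) ⟩
            ∑[ g ∈ G ] ∑[ i ∈ I ] ∑[ j ∈ I ] (op v (piece i) f g * op v (piece j) f g)
              ≡⟨ trans (∑-swap G I _) (∑-cong I λ i → ∑-swap G I _) ⟩
            ∑[ i ∈ I ] ∑[ j ∈ I ] inner G (op v (piece i) f) (op v (piece j) f)
              ≡⟨ ∑-cong I (λ i → trans (∑-cong I λ j → inner-pieces pf i j) (∑-δ′ I i (λ j → inner G (op v (piece i) f) (op v (piece j) f)))) ⟩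
            ∑[ i ∈ I ] norm G (op v (piece i) f) ∎

          private
            collapse : ∀ {f} → 𝓟 f → ∀ i g → op* v (piece i) (op v s f) g ≡ op* v (piece i) (op v (piece i) f) g
            collapse {f} pf i g = begin
              op* v (piece i) (op v s f) g
                ≡⟨ ∑-cong Y (λ y → trans (cong (piece i y *_) (op-pieces v f _)) (sym (∑-*ˡ I _ _))) ⟩
              ∑[ y ∈ Y ] ∑[ j ∈ I ] (piece i y * op v (piece j) f (g ⊕ ⊝ v y))
                ≡⟨ ∑-swap Y I _ ⟩
              ∑[ j ∈ I ] op* v (piece i) (op v (piece j) f) g
                ≡⟨ ∑-cong I only ⟩
              ∑[ j ∈ I ] ([ FinSet._≟_ I i j ] * op* v (piece i) (op v (piece j) f) g)
                ≡⟨ ∑-δ′ I i _ ⟩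
              op* v (piece i) (op v (piece i) f) g ∎
              where
              only : ∀ j → op* v (piece i) (op v (piece j) f) g ≡ [ FinSet._≟_ I i j ] * op* v (piece i) (op v (piece j) f) g
              only j with FinSet._≟_ I i j
              ... | yes _ = sym (Int.*-identityˡ _)
              ... | no i≢j = trans (orth pf i j i≢j g) (sym (Int.*-zeroˡ _))

          -- With X the full operator and X i its pieces, ‖X f‖² = ⟨f , X* X f⟩ ≤ ‖f‖ ‖X* X f‖
          -- and X* X f = ∑ X i * (X i f) is again an orthogonal sum, so ‖X* X f‖² ≤ B ‖X f‖².
          norm-pieces-bound : ∀ B → 0ℤ ≤ B → (∀ {f} → 𝓟 f → ∀ i → norm G (op v (piece i) f) ≤ B * norm G f) →
            ∀ {f} → 𝓟 f → norm G (op v s f) ≤ B * norm G f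
          norm-pieces-bound B B≥0 bound {f} pf with Int._≤?_ n₁ 0ℤ
            where n₁ = norm G (op v s f)
          ... | yes n₁≤0 = Int.≤-trans n₁≤0 (Int.*-≥0 B≥0 (norm≥0 G f))
          ... | no n₁≰0 = Int.*-cancel (Int.≰⇒> n₁≰0) (Int.≤-trans step₁ (Int.≤-trans (Int.*-monoˡ (norm≥0 G f) step₂) (Int.≤-reflexive (*-swapᵒ B (norm G f) n₁))))
            where
            n₁ = norm G (op v s f)
            step₁ : n₁ * n₁ ≤ norm G f * norm G (op v s (op v s f))
            step₁ = subst₂ _≤_ (sym (cong₂ _*_ (op-adjoint s f (op v s f)) (op-adjoint s f (op v s f))))
              (cong (norm G f *_) (op-normal s (op v s f))) (cauchySchwarz G f (op* v s (op v s f)))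
            each : ∀ i → norm G (op v (piece i) (op v s f)) ≤ B * norm G (op v (piece i) f)
            each i = subst (_≤ B * norm G (op v (piece i) f)) (begin
              norm G (op v (piece i) (op v (piece i) f))   ≡⟨ sym (op-normal (piece i) (op v (piece i) f)) ⟩
              norm G (op* v (piece i) (op v (piece i) f))  ≡⟨ sym (norm-cong G (collapse pf i)) ⟩
              norm G (op* v (piece i) (op v s f))          ≡⟨ op-normal (piece i) (op v s f) ⟩
              norm G (op v (piece i) (op v s f)) ∎) (bound (op-𝓟 (piece i) pf) i)
            step₂ : norm G (op v s (op v s f)) ≤ B * n₁
            step₂ = subst₂ _≤_ (sym (norm-pieces (op-𝓟 s pf))) (trans (∑-*ˡ I B _) (cong (B *_) (sym (norm-pieces pf)))) (∑-mono I each)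

-- The Frobenius map in characteristic p.

module CharP where
  open import Algebra using (CommutativeRing)
  import Algebra.Properties.CommutativeSemiring.Binomial as Binomial
  import Algebra.Properties.Semiring.Binomial as BinomialExpansion
  import Algebra.Properties.Semiring.Mult as Mult
  import Algebra.Properties.Semiring.Sum as Sum
  open import Data.Fin using (Fin; zero; suc; toℕ; inject₁) renaming (fromℕ to maxFin)
  import Data.Fin.Properties as Fin
  open import Data.Nat using (_!)
  open import Data.Nat.Properties using (_!*_!≢0)
  open import Data.Nat.Combinatorics using (_C_; k![n∸k]!∣n!; nCn≡1)
  open import Data.Nat.Combinatorics.Specification using (nCk≡n!/k![n-k]!)
  open import Data.Nat.DivMod using (m/n*n≡m)
  open import Data.Nat.Divisibility using (_∣_; divides; ∣⇒≤; m∣m*n; ∣1⇒≡1)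
  open import Data.Nat.Primality using (Prime; euclidsLemma; prime⇒nonTrivial)
  open ≡-Reasoning
  open FiniteRings

  prime∤! : ∀ {p} → Prime p → ∀ k → k ℕ.< p → ¬ p ∣ k !
  prime∤! pr zero _ p∣1 = ℕ.nonTrivial⇒≢1 {{prime⇒nonTrivial pr}} (∣1⇒≡1 p∣1)
  prime∤! pr (suc k) k<p d with euclidsLemma (suc k) (k !) pr d
  ... | inj₁ d′ = ℕ.<⇒≱ k<p (∣⇒≤ d′)
  ... | inj₂ d′ = prime∤! pr k (ℕ.<-trans (ℕ.n<1+n k) k<p) d′

  -- The prime divides p!, which is this coefficient times k! (p - k)!, and it divides neither of
  -- the two factorials.
  prime∣C : ∀ {p} → Prime p → ∀ k → 0 ℕ.< k → k ℕ.< p → p ∣ p C k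
  prime∣C {suc p′} pr k 0<k k<p with euclidsLemma (suc p′ C k) (k ! ℕ.* (suc p′ ℕ.∸ k) !) pr (subst (suc p′ ∣_) (sym factorial) (m∣m*n (p′ !)))
    where
    instance _ = k !* (suc p′ ℕ.∸ k) !≢0
    factorial : (suc p′ C k) ℕ.* (k ! ℕ.* (suc p′ ℕ.∸ k) !) ≡ suc p′ !
    factorial = trans (cong (ℕ._* (k ! ℕ.* (suc p′ ℕ.∸ k) !)) (nCk≡n!/k![n-k]! (ℕ.<⇒≤ k<p))) (m/n*n≡m (k![n∸k]!∣n! (ℕ.<⇒≤ k<p)))
  ... | inj₁ d = d
  ... | inj₂ d with euclidsLemma (k !) ((suc p′ ℕ.∸ k) !) pr d
  ... | inj₁ d′ = ⊥-elim (prime∤! pr k k<p d′)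
  ... | inj₂ d′ = ⊥-elim (prime∤! pr (suc p′ ℕ.∸ k) (ℕ.∸-monoʳ-< 0<k (ℕ.<⇒≤ k<p)) d′)

  module _ (𝑹 : FinRing) (p′ : ℕ) (pr : Prime (suc p′)) where
    open Ring 𝑹
    open CommutativeRing commutativeRing using (semiring; commutativeSemiring)
    open Mult semiring using (×-assoc-*; ×-homo-1; ×-congʳ) renaming (_×_ to _×ᴿ_)
    open Sum semiring using (sum; sum-init-last; sum-cong-≗; sum-replicate-zero)
    private p = suc p′

    frobenius : fromℕ p ≡ 𝟘 → ∀ x y → (x ⊕ y) ^ p ≡ x ^ p ⊕ y ^ p
    frobenius char x y = begin
      (x ⊕ y) ^ p                                ≡⟨ Binomial.theorem commutativeSemiring p x y ⟩
      t zero ⊕ sum t′                            ≡⟨ cong₂ _⊕_ first (sum-init-last t′) ⟩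
      y ^ p ⊕ (sum (λ j → t′ (inject₁ j)) ⊕ t′ (maxFin p′))
        ≡⟨ cong (y ^ p ⊕_) (cong₂ _⊕_ (trans (sum-cong-≗ middle) (sum-replicate-zero p′)) final) ⟩
      y ^ p ⊕ (𝟘 ⊕ x ^ p)                        ≡⟨ trans (cong (y ^ p ⊕_) (+-identityˡ _)) (+-comm _ _) ⟩
      x ^ p ⊕ y ^ p ∎
      where
      t : Fin (suc p) → R
      t = BinomialExpansion.binomialTerm semiring x y p
      t′ : Fin p → R
      t′ k = t (suc k)
      ×-fromℕ : ∀ n z → n ×ᴿ z ≡ fromℕ n · z
      ×-fromℕ n z = trans (×-congʳ n (sym (*-identityˡ z))) (sym (×-assoc-* n 𝟙 z))
      multiple : ∀ n z → p ∣ n → n ×ᴿ z ≡ 𝟘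
      multiple n z (divides k e) = trans (×-fromℕ n z) (trans (cong (_· z) (trans (cong fromℕ e) (trans (fromℕ-hom-* k p) (trans (cong (fromℕ k ·_) char) (zeroʳ _))))) (zeroˡ z))
      first : t zero ≡ y ^ p
      first = trans (×-homo-1 _) (*-identityˡ _)
      middle : ∀ j → t′ (inject₁ j) ≡ 𝟘
      middle j = multiple (p C suc (toℕ (inject₁ j))) _ (prime∣C pr _ (s≤s z≤n) (s≤s (subst (ℕ._< p′) (sym (Fin.toℕ-inject₁ j)) (Fin.toℕ<n j))))
      final : t′ (maxFin p′) ≡ x ^ p
      final = begin
        (p C suc (toℕ (maxFin p′))) ×ᴿ (x ^ suc (toℕ (maxFin p′)) · y ^ (p ℕ.∸ suc (toℕ (maxFin p′))))
          ≡⟨ cong (λ k → (p C suc k) ×ᴿ (x ^ suc k · y ^ (p ℕ.∸ suc k))) (Fin.toℕ-fromℕ p′) ⟩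
        (p C p) ×ᴿ (x ^ p · y ^ (p′ ℕ.∸ p′))
          ≡⟨ cong₂ (λ a b → a ×ᴿ (x ^ p · y ^ b)) (nCn≡1 p) (ℕ.n∸n≡0 p′) ⟩
        1 ×ᴿ (x ^ p · 𝟙)
          ≡⟨ trans (×-homo-1 _) (*-identityʳ _) ⟩
        x ^ p ∎

-- Polynomial functions over a finite field: roots and linear dependence.

module Polynomials (𝑭 : FiniteRings.FinRing) (isField : FiniteRings.IsField 𝑭) where
  open FiniteRings
  open import Data.Vec using (Vec; []; _∷_; zipWith)
  open import Data.Vec.Relation.Unary.All using (All; []; _∷_)
  open import Function using (_∘_)
  open ≡-Reasoning
  open Int using (ℤ; +_; 1ℤ; _≤_)
  open FiniteSums
  open Ring 𝑭
  open Field 𝑭 isField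

  -- Mon n and Pol n are the functions given by a monic polynomial of degree n and by a polynomial
  -- of degree less than n.
  data Mon : ℕ → (R → R) → Set where
    one : ∀ {g} → (∀ x → g x ≡ 𝟙) → Mon 0 g
    step : ∀ {n g} a h → Mon n h → (∀ x → g x ≡ a ⊕ x · h x) → Mon (suc n) g

  data Pol : ℕ → (R → R) → Set where
    zero : ∀ {g} → (∀ x → g x ≡ 𝟘) → Pol 0 g
    step : ∀ {n g} a h → Pol n h → (∀ x → g x ≡ a ⊕ x · h x) → Pol (suc n) g

  Mon-cong : ∀ {n g h} → (∀ x → h x ≡ g x) → Mon n g → Mon n h
  Mon-cong e (one h) = one (λ x → trans (e x) (h x))
  Mon-cong e (step a k m h) = step a k m (λ x → trans (e x) (h x))

  Pol-cong : ∀ {n g h} → (∀ x → h x ≡ g x) → Pol n g → Pol n h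
  Pol-cong e (zero h) = zero (λ x → trans (e x) (h x))
  Pol-cong e (step a k m h) = step a k m (λ x → trans (e x) (h x))

  Pol-weaken : ∀ {m n g} → m ℕ.≤ n → Pol m g → Pol n g
  Pol-weaken {n = zero} z≤n (zero h) = zero h
  Pol-weaken {n = suc n} z≤n (zero h) = step 𝟘 (λ _ → 𝟘) (Pol-weaken z≤n (zero (λ _ → refl)))
    (λ x → trans (h x) (solve 1 (λ x → con (+ 0) := con (+ 0) :+ x :* con (+ 0)) refl x))
  Pol-weaken (s≤s m≤n) (step a k p h) = step a k (Pol-weaken m≤n p) h

  Pol-+ : ∀ {n g h} → Pol n g → Pol n h → Pol n (λ x → g x ⊕ h x)
  Pol-+ (zero e) (zero e′) = zero (λ x → trans (cong₂ _⊕_ (e x) (e′ x)) (+-identityˡ 𝟘))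
  Pol-+ (step a k p e) (step b l r e′) = step (a ⊕ b) (λ x → k x ⊕ l x) (Pol-+ p r) (λ x → trans (cong₂ _⊕_ (e x) (e′ x))
    (solve 5 (λ a b x k l → a :+ x :* k :+ (b :+ x :* l) := a :+ b :+ x :* (k :+ l)) refl a b x (k x) (l x)))

  Pol-scale : ∀ {n g} c → Pol n g → Pol n (λ x → c · g x)
  Pol-scale c (zero e) = zero (λ x → trans (cong (c ·_) (e x)) (zeroʳ c))
  Pol-scale c (step a k p e) = step (c · a) (λ x → c · k x) (Pol-scale c p) (λ x → trans (cong (c ·_) (e x))
    (solve 4 (λ c a x k → c :* (a :+ x :* k) := c :* a :+ x :* (c :* k)) refl c a x (k x)))

  Pol-· : ∀ {m n g h} → Pol m g → Pol (suc n) h → Pol (m ℕ.+ n) (λ x → g x · h x)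
  Pol-· (zero e) r = Pol-weaken z≤n (zero (λ x → trans (cong (_· _) (e x)) (zeroˡ _)))
  Pol-· {suc m} {n} {g} {h} (step a k p e) r =
    Pol-cong (λ x → trans (cong (_· h x) (e x)) (solve 4 (λ a x k h → (a :+ x :* k) :* h := a :* h :+ (con (+ 0) :+ x :* (k :* h))) refl a x (k x) (h x)))
      (Pol-+ (Pol-weaken (s≤s (ℕ.m≤n+m n m)) (Pol-scale a r)) (step 𝟘 _ (Pol-· p r) (λ _ → refl)))

  Mon⇒Pol : ∀ {n g} → Mon n g → Pol (suc n) g
  Mon⇒Pol (one e) = step 𝟙 (λ _ → 𝟘) (zero (λ _ → refl)) (λ x → trans (e x) (solve 2 (λ o x → o := o :+ x :* con (+ 0)) refl 𝟙 x))
  Mon⇒Pol (step a k m e) = step a k (Mon⇒Pol m) e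

  Mon-+Pol : ∀ {m n g h} → n ℕ.≤ m → Mon m g → Pol n h → Mon m (λ x → g x ⊕ h x)
  Mon-+Pol _ m (zero e) = Mon-cong (λ x → trans (cong (_ ⊕_) (e x)) (+-identityʳ _)) m
  Mon-+Pol (s≤s n≤m) (step a k m e) (step b l p e′) = step (a ⊕ b) (λ x → k x ⊕ l x) (Mon-+Pol n≤m m p) (λ x → trans (cong₂ _⊕_ (e x) (e′ x))
    (solve 5 (λ a b x k l → a :+ x :* k :+ (b :+ x :* l) := a :+ b :+ x :* (k :+ l)) refl a b x (k x) (l x)))

  Mon-· : ∀ {m n g h} → Mon m g → Mon n h → Mon (m ℕ.+ n) (λ x → g x · h x)
  Mon-· (one e) r = Mon-cong (λ x → trans (cong (_· _) (e x)) (*-identityˡ _)) r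
  Mon-· {suc m} {n} {g} {h} (step a k p e) r =
    Mon-cong (λ x → trans (cong (_· h x) (e x)) (solve 4 (λ a x k h → (a :+ x :* k) :* h := con (+ 0) :+ x :* (k :* h) :+ a :* h) refl a x (k x) (h x)))
      (Mon-+Pol (s≤s (ℕ.m≤n+m n m)) (step 𝟘 _ (Mon-· p r) (λ _ → refl)) (Pol-scale a (Mon⇒Pol r)))

  Mon-X^ : ∀ n → Mon n (_^ n)
  Mon-X^ zero = one (λ _ → refl)
  Mon-X^ (suc n) = step 𝟘 (_^ n) (Mon-X^ n) (λ x → sym (+-identityˡ _))

  Mon-^ : ∀ {n g} → Mon n g → ∀ k → Mon (k ℕ.* n) (λ x → g x ^ k)
  Mon-^ m zero = one (λ _ → refl)
  Mon-^ m (suc k) = Mon-· m (Mon-^ m k)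

  Pol-^ : ∀ {n g} → Pol (suc n) g → ∀ k → Pol (suc (k ℕ.* n)) (λ x → g x ^ k)
  Pol-^ p zero = Mon⇒Pol (one (λ _ → refl))
  Pol-^ {n} p (suc k) = Pol-· p (Pol-^ p k)

  divide : ∀ {n g} → Mon (suc n) g → ∀ r → ∃ λ h → Mon n h × (∀ x → g x ≡ g r ⊕ (x ⊖ r) · h x)
  divide {zero} {g} (step a k (one e) e′) r = (λ _ → 𝟙) , one (λ _ → refl) , λ x →
    trans (e′ x) (trans (cong (λ w → a ⊕ x · w) (e x))
      (trans (solve 4 (λ a x r o → a :+ x :* o := a :+ r :* o :+ (x :- r) :* o) refl a x r 𝟙)
        (cong (_⊕ (x ⊖ r) · 𝟙) (sym (trans (e′ r) (cong (λ w → a ⊕ r · w) (e r)))))))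
  divide {suc n} {g} (step a k m e′) r with divide m r
  ... | h , mh , eh = (λ x → k r ⊕ x · h x) , step (k r) h mh (λ _ → refl) , λ x →
    trans (e′ x) (trans (cong (λ w → a ⊕ x · w) (eh x))
      (trans (solve 5 (λ a x r k h → a :+ x :* (k :+ (x :- r) :* h) := a :+ r :* k :+ (x :- r) :* (k :+ x :* h)) refl a x r (k r) (h x))
        (cong (_⊕ (x ⊖ r) · (k r ⊕ x · h x)) (sym (e′ r)))))

  roots : ∀ {n g} → Mon n g → ∑[ x ∈ set ] [ g x ≟ 𝟘 ] ≤ + n
  roots {zero} {g} (one e) = Int.≤-reflexive (∑-≡0 set λ x → []-no (g x ≟ 𝟘) (λ e′ → proj₂ isField (trans (sym (e x)) e′)))
  roots {suc n} {g} m with search set (λ x → g x ≟ 𝟘)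
  ... | no none = subst (_≤ + suc n) (sym (∑-≡0 set λ x → []-no (g x ≟ 𝟘) (λ e → none (x , e)))) (Int.+≥0 (suc n))
  ... | yes (r , gr≡0) with divide m r
  ... | h , mh , eh = Int.≤-trans (∑-mono set λ x → bound x)
          (Int.≤-trans (Int.≤-reflexive (trans (∑-+ set _ _) (cong₂ Int._+_ (∑-once set r) refl)))
            (Int.≤-trans (Int.+-mono-≤ {1ℤ} Int.≤-refl (roots mh)) (Int.≤-reflexive (sym (Int.pos-+ 1 n)))))
    where
    bound : ∀ x → [ g x ≟ 𝟘 ] ≤ [ x ≟ r ] Int.+ [ h x ≟ 𝟘 ]
    bound x with x ≟ r
    ... | yes _ = subst (_≤ _) (Int.+-identityʳ _) (Int.+-mono-≤ ([]-≤1 (g x ≟ 𝟘)) ([]-≥0 (h x ≟ 𝟘)))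
    ... | no x≢r = subst ([ g x ≟ 𝟘 ] ≤_) (sym (Int.+-identityˡ _)) ([]-mono (g x ≟ 𝟘) (h x ≟ 𝟘) λ gx≡0 → zeroProduct gx≡0)
      where
      zeroProduct : g x ≡ 𝟘 → h x ≡ 𝟘
      zeroProduct gx≡0 with h x ≟ 𝟘
      ... | yes e = e
      ... | no ne = ⊥-elim (·-nonzero (λ e → x≢r (⊖≡𝟘⇒≡ e)) ne (trans (sym (+-identityˡ _)) (trans (cong (_⊕ (x ⊖ r) · h x) (sym gr≡0)) (trans (sym (eh x)) gx≡0))))

  comb : ∀ {n} → Vec R n → (ℕ → R → R) → R → R
  comb [] e x = 𝟘
  comb (b ∷ bs) e x = b · e 0 x ⊕ comb bs (e ∘ suc) x

  -- Monic polynomials of strictly increasing degree are independent.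
  comb-leading : ∀ {n} (b : Vec R n) (e : ℕ → R → R) s → (∀ d → Mon (d ℕ.+ s) (e d)) →
    All (_≡ 𝟘) b ⊎ (∃ λ N → ∃ λ β → ∃ λ g → s ℕ.≤ N × N ℕ.< n ℕ.+ s × ¬ β ≡ 𝟘 × Mon N g × (∀ x → comb b e x ≡ β · g x))
  comb-leading [] e s me = inj₁ []
  comb-leading {suc n} (b ∷ bs) e s me with comb-leading bs (e ∘ suc) (suc s) (λ d → subst (λ k → Mon k (e (suc d))) (sym (ℕ.+-suc d s)) (me (suc d)))
  ... | inj₂ (N , β , g , s<N , N< , β≢0 , mg , eq) = inj₂ (N , β , (λ x → g x ⊕ inv β · (b · e 0 x)) , ℕ.<⇒≤ s<N , subst (N ℕ.<_) (ℕ.+-suc n s) N< , β≢0 ,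
    Mon-+Pol s<N mg (Pol-scale (inv β) (Pol-scale b (Mon⇒Pol (me 0)))) , λ x → begin
      b · e 0 x ⊕ comb bs (e ∘ suc) x            ≡⟨ cong (b · e 0 x ⊕_) (eq x) ⟩
      b · e 0 x ⊕ β · g x                        ≡⟨ cong (_⊕ β · g x) (sym (trans (cong (_· (b · e 0 x)) (nonzero⇒unit β≢0)) (*-identityˡ _))) ⟩
      β · inv β · (b · e 0 x) ⊕ β · g x          ≡⟨ solve 4 (λ β i t g → β :* i :* t :+ β :* g := β :* (g :+ i :* t)) refl β (inv β) (b · e 0 x) (g x) ⟩
      β · (g x ⊕ inv β · (b · e 0 x)) ∎)
  ... | inj₁ z with b ≟ 𝟘
  ... | yes b≡0 = inj₁ (b≡0 ∷ z)
  ... | no b≢0 = inj₂ (s , b , e 0 , ℕ.≤-refl , s≤s (ℕ.m≤n+m s n) , b≢0 , me 0 , λ x → trans (cong (b · e 0 x ⊕_) (vanish bs z (e ∘ suc) x)) (+-identityʳ _))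
    where
    vanish : ∀ {n} (bs : Vec R n) → All (_≡ 𝟘) bs → ∀ e x → comb bs e x ≡ 𝟘
    vanish [] [] e x = refl
    vanish (b ∷ bs) (z ∷ zs) e x = trans (cong₂ _⊕_ (trans (cong (_· e 0 x) z) (zeroˡ _)) (vanish bs zs (e ∘ suc) x)) (+-identityˡ 𝟘)

  private
    eval : ∀ {n} → Vec R n → R → R
    eval [] x = 𝟘
    eval (a ∷ as) x = a ⊕ x · eval as x

    coefficients : ∀ {n g} → Pol n g → ∃ λ as → ∀ x → g x ≡ eval {n} as x
    coefficients (zero e) = [] , e
    coefficients (step a k p e) with coefficients p
    ... | as , h = a ∷ as , λ x → trans (e x) (cong (λ w → a ⊕ x · w) (h x))

    zeros : ∀ {n} → Vec R n
    zeros {zero} = []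
    zeros {suc n} = 𝟘 ∷ zeros

    eval-zeros : ∀ {n} x → eval (zeros {n}) x ≡ 𝟘
    eval-zeros {zero} x = refl
    eval-zeros {suc n} x = trans (cong (λ w → 𝟘 ⊕ x · w) (eval-zeros {n} x)) (solve 1 (λ x → con (+ 0) :+ x :* con (+ 0) := con (+ 0)) refl x)

    axpy : ∀ {n} → R → Vec R n → Vec R n → Vec R n
    axpy b = zipWith (λ u w → b · u ⊕ w)

    eval-axpy : ∀ {n} b (us ws : Vec R n) x → eval (axpy b us ws) x ≡ b · eval us x ⊕ eval ws x
    eval-axpy b [] [] x = solve 1 (λ b → con (+ 0) := b :* con (+ 0) :+ con (+ 0)) refl b
    eval-axpy b (u ∷ us) (w ∷ ws) x = trans (cong (λ t → b · u ⊕ w ⊕ x · t) (eval-axpy b us ws x))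
      (solve 6 (λ b u w x s t → b :* u :+ w :+ x :* (b :* s :+ t) := b :* (u :+ x :* s) :+ (w :+ x :* t)) refl b u w x (eval us x) (eval ws x))

    lin : ∀ {n m} → Vec R n → (ℕ → Vec R m) → Vec R m
    lin [] W = zeros
    lin (b ∷ bs) W = axpy b (W 0) (lin bs (W ∘ suc))

    eval-lin : ∀ {n m} (b : Vec R n) (W : ℕ → Vec R m) (e : ℕ → R → R) → (∀ d → d ℕ.< n → ∀ x → e d x ≡ eval (W d) x) → ∀ x → eval (lin b W) x ≡ comb b e x
    eval-lin {m = m} [] W e h x = eval-zeros {m} x
    eval-lin (b ∷ bs) W e h x = trans (eval-axpy b (W 0) (lin bs (W ∘ suc)) x)
      (cong₂ _⊕_ (cong (b ·_) (sym (h 0 (s≤s z≤n) x))) (eval-lin bs (W ∘ suc) (e ∘ suc) (λ d d< → h (suc d) (s≤s d<)) x))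

    comb-- : ∀ {n} (b b′ : Vec R n) e x → comb (zipWith _⊖_ b b′) e x ≡ comb b e x ⊖ comb b′ e x
    comb-- [] [] e x = solve 0 (con (+ 0) := con (+ 0) :- con (+ 0)) refl
    comb-- (b ∷ bs) (b′ ∷ bs′) e x = trans (cong ((b ⊖ b′) · e 0 x ⊕_) (comb-- bs bs′ (e ∘ suc) x))
      (solve 5 (λ b c t u w → (b :- c) :* t :+ (u :- w) := b :* t :+ u :- (c :* t :+ w)) refl b b′ (e 0 x) _ _)

    sub-zero : ∀ {n} (b b′ : Vec R n) → All (_≡ 𝟘) (zipWith _⊖_ b b′) → b ≡ b′
    sub-zero [] [] [] = refl
    sub-zero (b ∷ bs) (b′ ∷ bs′) (z ∷ zs) = cong₂ _∷_ (⊖≡𝟘⇒≡ z) (sub-zero bs bs′ zs)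

    module _ {n m} (e : ℕ → R → R) (pe : ∀ d → d ℕ.< n → Pol m (e d)) where
      table : ℕ → Vec R m
      table d with d ℕ.<? n
      ... | yes d<n = proj₁ (coefficients (pe d d<n))
      ... | no _ = zeros

      eval-table : ∀ d → d ℕ.< n → ∀ x → e d x ≡ eval (table d) x
      eval-table d d< x with d ℕ.<? n
      ... | yes d<n = proj₂ (coefficients (pe d d<n)) x
      ... | no d≮n = ⊥-elim (d≮n d<)

  -- By the pigeonhole principle two combinations have the same coefficients.
  dependent : ∀ {n m} → + 2 ≤ card set → m ℕ.< n → (e : ℕ → R → R) → (∀ d → d ℕ.< n → Pol m (e d)) →
    ∃ λ b → ¬ All (_≡ 𝟘) b × (∀ x → comb {n} b e x ≡ 𝟘)
  dependent {n} {m} two m<n e pe with pigeonhole (vecSet set n) (vecSet set m) (λ b → lin b (table e pe)) (card-vecSet-mono set two m<n)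
  ... | b , b′ , b≢b′ , φb≡φb′ = zipWith _⊖_ b b′ , (λ z → b≢b′ (sub-zero b b′ z)) , λ x →
    trans (comb-- b b′ e x) (≡⇒⊖≡𝟘 (trans (sym (eval-lin b _ e (eval-table e pe) x)) (trans (cong (λ w → eval w x) φb≡φb′) (eval-lin b′ _ e (eval-table e pe) x))))

-- Stepanov's count of the points where x + c / x has a given trace.

module Stepanov (𝑭 : FiniteRings.FinRing) (isField : FiniteRings.IsField 𝑭) where
  open FiniteRings
  open import Data.Nat.DivMod using (m≡m%n+[m/n]*n; m%n<n; m<n*o⇒m/o<n)
  open import Data.Nat.Tactic.RingSolver using (solve-∀)
  open import Data.Vec using (Vec; []; _∷_; map)
  open import Data.Vec.Relation.Unary.All using (All; []; _∷_)
  open import Function using (_∘_)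
  open ≡-Reasoning
  open Int using (ℤ; +_; 1ℤ; _≤_)
  open FiniteSums
  open Polynomials 𝑭 isField
  open Ring 𝑭
  open Field 𝑭 isField

  module Frobenius (p′ : ℕ) (frobenius : ∀ x y → (x ⊕ y) ^ suc p′ ≡ x ^ suc p′ ⊕ y ^ suc p′) where

    p : ℕ
    p = suc p′

    frobenius^ : ∀ j x y → (x ⊕ y) ^ (p ℕ.^ j) ≡ x ^ (p ℕ.^ j) ⊕ y ^ (p ℕ.^ j)
    frobenius^ zero x y = distribʳ 𝟙 x y
    frobenius^ (suc j) x y = begin
      (x ⊕ y) ^ (p ℕ.* p ℕ.^ j)                     ≡⟨ sym (^-assocʳ (x ⊕ y) p (p ℕ.^ j)) ⟩
      ((x ⊕ y) ^ p) ^ (p ℕ.^ j)                     ≡⟨ cong (_^ (p ℕ.^ j)) (frobenius x y) ⟩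
      (x ^ p ⊕ y ^ p) ^ (p ℕ.^ j)                   ≡⟨ frobenius^ j (x ^ p) (y ^ p) ⟩
      (x ^ p) ^ (p ℕ.^ j) ⊕ (y ^ p) ^ (p ℕ.^ j)     ≡⟨ cong₂ _⊕_ (^-assocʳ x p (p ℕ.^ j)) (^-assocʳ y p (p ℕ.^ j)) ⟩
      x ^ (p ℕ.* p ℕ.^ j) ⊕ y ^ (p ℕ.* p ℕ.^ j) ∎

    𝟘^p^ : ∀ j → 𝟘 ^ (p ℕ.^ j) ≡ 𝟘
    𝟘^p^ zero = *-identityʳ 𝟘
    𝟘^p^ (suc j) = trans (sym (^-assocʳ 𝟘 p (p ℕ.^ j))) (trans (cong (_^ (p ℕ.^ j)) (𝟘^suc p′)) (𝟘^p^ j))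

    -- The trace polynomial z + z^p + z^(p²) + ... with j terms; in a field with p^j elements it is
    -- the trace to the prime field.
    tsum : ℕ → R → R
    tsum zero z = 𝟘
    tsum (suc j) z = tsum j z ⊕ z ^ (p ℕ.^ j)

    -- The last k terms are the p^j-th power of the first k. With two equal halves the trace becomes
    -- τ + τ^Q, the relation on which Stepanov's construction rests.
    tsum-+ : ∀ j k z → tsum (j ℕ.+ k) z ≡ tsum j z ⊕ tsum k z ^ (p ℕ.^ j)
    tsum-+ j zero z = begin
      tsum (j ℕ.+ 0) z                    ≡⟨ cong (λ n → tsum n z) (ℕ.+-identityʳ j) ⟩
      tsum j z                            ≡⟨ sym (+-identityʳ _) ⟩
      tsum j z ⊕ 𝟘                        ≡⟨ cong (tsum j z ⊕_) (sym (𝟘^p^ j)) ⟩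
      tsum j z ⊕ 𝟘 ^ (p ℕ.^ j) ∎
    tsum-+ j (suc k) z = begin
      tsum (j ℕ.+ suc k) z                                              ≡⟨ cong (λ n → tsum n z) (ℕ.+-suc j k) ⟩
      tsum (j ℕ.+ k) z ⊕ z ^ (p ℕ.^ (j ℕ.+ k))                          ≡⟨ cong₂ _⊕_ (tsum-+ j k z) (trans (cong (z ^_)
                                                                            (trans (ℕ.^-distribˡ-+-* p j k) (ℕ.*-comm (p ℕ.^ j) (p ℕ.^ k)))) (sym (^-assocʳ z (p ℕ.^ k) (p ℕ.^ j)))) ⟩
      tsum j z ⊕ tsum k z ^ (p ℕ.^ j) ⊕ (z ^ (p ℕ.^ k)) ^ (p ℕ.^ j)     ≡⟨ +-assoc _ _ _ ⟩
      tsum j z ⊕ (tsum k z ^ (p ℕ.^ j) ⊕ (z ^ (p ℕ.^ k)) ^ (p ℕ.^ j))   ≡⟨ cong (tsum j z ⊕_) (sym (frobenius^ j (tsum k z) (z ^ (p ℕ.^ k)))) ⟩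
      tsum j z ⊕ (tsum k z ⊕ z ^ (p ℕ.^ k)) ^ (p ℕ.^ j) ∎

    -- Stepanov's method over the field of Q² elements. Write d = i + P (l + p k) with i < P, l < p,
    -- k < P + 2 and T = x^P · tsum (suc m′) (f x). If x is good then T^Q = x^(PQ) (θ - x^(-P) T), so the
    -- Q-th power of H = ∑ b_d^Q x^(i + kQ + P(p-1-l)) T^l is, up to a power of x,
    -- G = ∑ b_d x^(iQ + k) (θ x^P - T)^l x^(P(p-1-l)). There are more b_d than coefficients of G, so
    -- G = 0 has a nontrivial solution; H is a nonzero polynomial as its terms have distinct degrees,
    -- and it vanishes at every good x.
    module Bound (m′ : ℕ) (c θ : R) (c^p : c ^ p ≡ c) (p≥2 : 2 ℕ.≤ p) (card≥2 : + 2 ≤ card set) where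

      P Q : ℕ
      P = p ℕ.^ m′
      Q = p ℕ.^ suc m′

      f : R → R
      f x = x ⊕ c · inv x

      private
        instance
          P≢0 : NonZero P
          P≢0 = ℕ.m^n≢0 p m′

        c^p^ : ∀ j → c ^ (p ℕ.^ j) ≡ c
        c^p^ zero = *-identityʳ c
        c^p^ (suc j) = trans (sym (^-assocʳ c p (p ℕ.^ j))) (trans (cong (_^ (p ℕ.^ j)) c^p) (c^p^ j))

        inv-pow : ∀ {x} → Unit x → ∀ {a b} → b ℕ.≤ a → x ^ a · inv x ^ b ≡ x ^ (a ℕ.∸ b)
        inv-pow {x} u {a} {b} b≤a = begin
          x ^ a · inv x ^ b                        ≡⟨ cong (λ n → x ^ n · inv x ^ b) (sym (ℕ.m∸n+n≡m b≤a)) ⟩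
          x ^ (a ℕ.∸ b ℕ.+ b) · inv x ^ b          ≡⟨ cong (_· inv x ^ b) (^-homo-* x (a ℕ.∸ b) b) ⟩
          x ^ (a ℕ.∸ b) · x ^ b · inv x ^ b        ≡⟨ *-assoc _ _ _ ⟩
          x ^ (a ℕ.∸ b) · (x ^ b · inv x ^ b)      ≡⟨ cong (x ^ (a ℕ.∸ b) ·_) (trans (sym (^-distrib-* x (inv x) b)) (trans (cong (_^ b) u) (𝟙^ b))) ⟩
          x ^ (a ℕ.∸ b) · 𝟙                        ≡⟨ *-identityʳ _ ⟩
          x ^ (a ℕ.∸ b) ∎

        -- The trace polynomial of x + c / x cleared of denominators: P is the highest power of x
        -- that is needed, as the exponents are p^j with j ≤ m′.
        T : ℕ → R → R
        T zero x = 𝟘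
        T (suc j) x = T j x ⊕ (x ^ (P ℕ.+ p ℕ.^ j) ⊕ c · x ^ (P ℕ.∸ p ℕ.^ j))

        T-tsum : ∀ {x} → Unit x → ∀ j → j ℕ.≤ suc m′ → T j x ≡ x ^ P · tsum j (f x)
        T-tsum u zero _ = sym (zeroʳ _)
        T-tsum {x} u (suc j) (s≤s j≤m′) = begin
          T j x ⊕ (x ^ (P ℕ.+ p ℕ.^ j) ⊕ c · x ^ (P ℕ.∸ p ℕ.^ j))
            ≡⟨ cong₂ _⊕_ (T-tsum u j (ℕ.m≤n⇒m≤1+n j≤m′)) (cong₂ _⊕_ (^-homo-* x P (p ℕ.^ j)) (cong (c ·_) (sym (inv-pow u (ℕ.^-monoʳ-≤ p j≤m′))))) ⟩
          x ^ P · tsum j (f x) ⊕ (x ^ P · x ^ (p ℕ.^ j) ⊕ c · (x ^ P · inv x ^ (p ℕ.^ j)))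
            ≡⟨ solve 5 (λ a t b c d → a :* t :+ (a :* b :+ c :* (a :* d)) := a :* (t :+ (b :+ c :* d))) refl (x ^ P) (tsum j (f x)) (x ^ (p ℕ.^ j)) c (inv x ^ (p ℕ.^ j)) ⟩
          x ^ P · (tsum j (f x) ⊕ (x ^ (p ℕ.^ j) ⊕ c · inv x ^ (p ℕ.^ j)))
            ≡⟨ cong (λ w → x ^ P · (tsum j (f x) ⊕ w)) (begin
                 x ^ (p ℕ.^ j) ⊕ c · inv x ^ (p ℕ.^ j)              ≡⟨ cong (λ w → x ^ (p ℕ.^ j) ⊕ w · inv x ^ (p ℕ.^ j)) (sym (c^p^ j)) ⟩
                 x ^ (p ℕ.^ j) ⊕ c ^ (p ℕ.^ j) · inv x ^ (p ℕ.^ j)  ≡⟨ cong (x ^ (p ℕ.^ j) ⊕_) (sym (^-distrib-* c (inv x) (p ℕ.^ j))) ⟩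
                 x ^ (p ℕ.^ j) ⊕ (c · inv x) ^ (p ℕ.^ j)            ≡⟨ sym (frobenius^ j x (c · inv x)) ⟩
                 f x ^ (p ℕ.^ j) ∎) ⟩
          x ^ P · (tsum j (f x) ⊕ f x ^ (p ℕ.^ j)) ∎

        P≥1 : 1 ℕ.≤ P
        P≥1 = ℕ.m^n>0 p m′

        T-Pol : ∀ j → j ℕ.≤ m′ → Pol (P ℕ.+ P) (T j)
        T-Pol zero _ = Pol-weaken z≤n (zero (λ _ → refl))
        T-Pol (suc j) j<m′ = Pol-+ (T-Pol j (ℕ.<⇒≤ j<m′)) (Pol-+
          (Pol-weaken (subst (ℕ._≤ P ℕ.+ P) (ℕ.+-suc P (p ℕ.^ j)) (ℕ.+-monoʳ-≤ P (ℕ.^-monoʳ-< p p≥2 j<m′))) (Mon⇒Pol (Mon-X^ (P ℕ.+ p ℕ.^ j))))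
          (Pol-weaken (ℕ.≤-trans (s≤s (ℕ.m∸n≤m P (p ℕ.^ j))) (ℕ.+-monoˡ-≤ P P≥1)) (Pol-scale c (Mon⇒Pol (Mon-X^ (P ℕ.∸ p ℕ.^ j))))))

        -- The last summand contributes x^(2 P); all other terms have lower degree.
        T-Mon : Mon (P ℕ.+ P) (T (suc m′))
        T-Mon = Mon-cong (λ x → solve 3 (λ a b c → a :+ (b :+ c) := b :+ (a :+ c)) refl (T m′ x) _ _)
          (Mon-+Pol ℕ.≤-refl (Mon-X^ (P ℕ.+ P)) (Pol-+ (T-Pol m′ ℕ.≤-refl)
            (Pol-weaken (ℕ.≤-trans (s≤s (ℕ.m∸n≤m P P)) (ℕ.+-monoˡ-≤ P P≥1)) (Pol-scale c (Mon⇒Pol (Mon-X^ (P ℕ.∸ P)))))))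

        i j l k r : ℕ → ℕ
        i d = d ℕ.% P
        j d = d ℕ./ P
        l d = j d ℕ.% p
        k d = j d ℕ./ p
        r d = p′ ℕ.∸ l d

        l≤p′ : ∀ d → l d ℕ.≤ p′
        l≤p′ d = ℕ.s≤s⁻¹ (m%n<n (j d) p)

        l+r : ∀ d → l d ℕ.+ r d ≡ p′
        l+r d = ℕ.m+[n∸m]≡n (l≤p′ d)

        e e′ : ℕ → R → R
        e d x = x ^ (i d ℕ.+ k d ℕ.* Q ℕ.+ P ℕ.* r d) · T (suc m′) x ^ l d
        e′ d x = x ^ (i d ℕ.* Q ℕ.+ k d) · ((θ · x ^ P ⊕ ⊝ 𝟙 · T (suc m′) x) ^ l d · x ^ (P ℕ.* r d))

        -- T has degree 2 P, while a unit of the digit l is worth only P in d. The factor x^(P (p -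
        -- 1 - l)) compensates, so the degrees become consecutive.
        e-degree : ∀ d → i d ℕ.+ k d ℕ.* Q ℕ.+ P ℕ.* r d ℕ.+ l d ℕ.* (P ℕ.+ P) ≡ d ℕ.+ P ℕ.* p′
        e-degree d = begin
          i d ℕ.+ k d ℕ.* (p ℕ.* P) ℕ.+ P ℕ.* r d ℕ.+ l d ℕ.* (P ℕ.+ P)
            ≡⟨ alg (i d) (k d) p P (r d) (l d) ⟩
          i d ℕ.+ (l d ℕ.+ k d ℕ.* p) ℕ.* P ℕ.+ P ℕ.* (l d ℕ.+ r d)
            ≡⟨ cong₂ (λ a b → i d ℕ.+ a ℕ.* P ℕ.+ P ℕ.* b) (sym (m≡m%n+[m/n]*n (j d) p)) (l+r d) ⟩
          i d ℕ.+ j d ℕ.* P ℕ.+ P ℕ.* p′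
            ≡⟨ cong (ℕ._+ P ℕ.* p′) (sym (m≡m%n+[m/n]*n d P)) ⟩
          d ℕ.+ P ℕ.* p′ ∎
          where
          alg : ∀ i k p P r l → i ℕ.+ k ℕ.* (p ℕ.* P) ℕ.+ P ℕ.* r ℕ.+ l ℕ.* (P ℕ.+ P) ≡ i ℕ.+ (l ℕ.+ k ℕ.* p) ℕ.* P ℕ.+ P ℕ.* (l ℕ.+ r)
          alg = solve-∀

        e-Mon : ∀ d → Mon (d ℕ.+ P ℕ.* p′) (e d)
        e-Mon d = subst (λ n → Mon n (e d)) (e-degree d) (Mon-· (Mon-X^ _) (Mon-^ T-Mon (l d)))

        -- This is P Q + 2 Q, whereas each `e′ d` has degree at most P Q + Q - P + 1. So there are
        -- more unknowns than coefficients once Q ≥ 3.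
        D : ℕ
        D = (P ℕ.+ 2) ℕ.* p ℕ.* P

        e′-Pol : 3 ℕ.≤ Q → ∀ d → d ℕ.< D → Pol (ℕ.pred D) (e′ d)
        e′-Pol Q≥3 d d<D = Pol-weaken bound (Pol-· (Mon⇒Pol (Mon-X^ (i d ℕ.* Q ℕ.+ k d))) (Pol-·
          (Pol-^ (Pol-+ (Pol-scale θ (Pol-weaken (s≤s (ℕ.m≤m+n P P)) (Mon⇒Pol (Mon-X^ P)))) (Pol-scale (⊝ 𝟙) (Mon⇒Pol T-Mon))) (l d))
          (Mon⇒Pol (Mon-X^ (P ℕ.* r d)))))
          where
          k≤ : k d ℕ.≤ suc P
          k≤ = ℕ.s≤s⁻¹ (subst (k d ℕ.<_) (ℕ.+-comm P 2) (m<n*o⇒m/o<n {j d} {P ℕ.+ 2} {p} (m<n*o⇒m/o<n {d} {(P ℕ.+ 2) ℕ.* p} {P} d<D)))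
          i≤ : i d ℕ.* Q ℕ.+ Q ℕ.≤ P ℕ.* Q
          i≤ = subst (ℕ._≤ P ℕ.* Q) (ℕ.+-comm Q (i d ℕ.* Q)) (ℕ.*-monoˡ-≤ Q (m%n<n d P))
          lr≤ : l d ℕ.* (P ℕ.+ P) ℕ.+ P ℕ.* r d ℕ.≤ p′ ℕ.* (P ℕ.+ P)
          lr≤ = ℕ.≤-trans (ℕ.+-monoʳ-≤ (l d ℕ.* (P ℕ.+ P)) (subst (ℕ._≤ r d ℕ.* (P ℕ.+ P)) (ℕ.*-comm (r d) P) (ℕ.*-monoʳ-≤ (r d) (ℕ.m≤m+n P P))))
            (ℕ.≤-reflexive (trans (sym (ℕ.*-distribʳ-+ (P ℕ.+ P) (l d) (r d))) (cong (ℕ._* (P ℕ.+ P)) (l+r d))))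
          alg₁ : ∀ a k t Q P → suc (suc (a ℕ.+ k ℕ.+ t)) ℕ.+ (Q ℕ.+ (P ℕ.+ P)) ≡ (a ℕ.+ Q) ℕ.+ k ℕ.+ t ℕ.+ (2 ℕ.+ (P ℕ.+ P))
          alg₁ = solve-∀
          alg₂ : ∀ p′ P → (P ℕ.* (suc p′ ℕ.* P)) ℕ.+ suc P ℕ.+ p′ ℕ.* (P ℕ.+ P) ℕ.+ (2 ℕ.+ (P ℕ.+ P)) ≡ (P ℕ.+ 2) ℕ.* suc p′ ℕ.* P ℕ.+ (3 ℕ.+ P)
          alg₂ = solve-∀
          bound : suc (i d ℕ.* Q ℕ.+ k d) ℕ.+ (l d ℕ.* (P ℕ.+ P) ℕ.+ P ℕ.* r d) ℕ.≤ ℕ.pred D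
          -- Adding Q + 2 P to both sides avoids truncated subtraction: it completes i Q to at most
          -- P Q.
          bound = ℕ.<⇒≤pred (ℕ.+-cancelʳ-≤ (Q ℕ.+ (P ℕ.+ P)) _ D (ℕ.≤-trans (ℕ.≤-reflexive (alg₁ (i d ℕ.* Q) (k d) _ Q P))
            (ℕ.≤-trans (ℕ.+-monoˡ-≤ _ (ℕ.+-mono-≤ (ℕ.+-mono-≤ i≤ k≤) lr≤)) (ℕ.≤-trans (ℕ.≤-reflexive (alg₂ p′ P))
              (ℕ.+-monoʳ-≤ D (ℕ.+-mono-≤ Q≥3 (ℕ.m≤m+n P P)))))))

        D>0 : 0 ℕ.< D
        D>0 = ℕ.*-mono-≤ {1} {(P ℕ.+ 2) ℕ.* p} {1} {P} (ℕ.*-mono-≤ {1} {P ℕ.+ 2} {1} {p} (ℕ.≤-trans P≥1 (ℕ.m≤m+n P 2)) (s≤s z≤n)) P≥1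

      good : R → ℤ
      good x = [ unit? x ] Int.* [ tsum (suc m′ ℕ.+ suc m′) (f x) ≟ θ ]

      module _ (fermat : ∀ x → x ^ (Q ℕ.* Q) ≡ x) where

        private
          module _ {x : R} (u : Unit x) (eq : tsum (suc m′ ℕ.+ suc m′) (f x) ≡ θ) where
            τ : R
            τ = tsum (suc m′) (f x)

            -- Over the field with Q² elements the full trace is τ + τ^Q, and it equals θ at a good
            -- point.
            τ^Q : τ ^ Q ≡ θ ⊖ τ
            τ^Q = begin
              τ ^ Q           ≡⟨ solve 2 (λ a b → b := a :+ b :- a) refl τ (τ ^ Q) ⟩
              τ ⊕ τ ^ Q ⊖ τ   ≡⟨ cong (_⊖ τ) (trans (sym (tsum-+ (suc m′) (suc m′) (f x))) eq) ⟩
              θ ⊖ τ ∎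

            Tτ : T (suc m′) x ≡ x ^ P · τ
            Tτ = T-tsum u (suc m′) ℕ.≤-refl

            T^Q : T (suc m′) x ^ Q ≡ x ^ (P ℕ.* Q) · (θ ⊖ τ)
            T^Q = trans (cong (_^ Q) Tτ) (trans (^-distrib-* (x ^ P) τ Q) (cong₂ _·_ (^-assocʳ x P Q) τ^Q))

            twist : θ · x ^ P ⊕ ⊝ 𝟙 · T (suc m′) x ≡ x ^ P · (θ ⊖ τ)
            twist = trans (cong (λ w → θ · x ^ P ⊕ ⊝ 𝟙 · w) Tτ)
              (trans (cong (λ w → θ · x ^ P ⊕ w) (trans (sym (*-assoc (⊝ 𝟙) _ _)) (cong (_· τ) (trans (solve 2 (λ o t → (:- o) :* t := :- (o :* t)) refl 𝟙 (x ^ P)) (cong ⊝_ (*-identityˡ _))))))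
                (solve 3 (λ θ a t → θ :* a :+ (:- a) :* t := a :* (θ :- t)) refl θ (x ^ P) τ))

            -- By `fermat` the Q-th power turns β^Q into β and x^(k Q) into x^k, and it turns T into
            -- x^(P Q) (θ - τ). The extra factor x^(P (p - 1)) supplies the x^(P l) needed to write
            -- (θ - τ)^l as a polynomial in x.
            term : ∀ β d → (β ^ Q · e d x) ^ Q · x ^ (P ℕ.* p′) ≡ x ^ (P ℕ.* p′ ℕ.* Q) · (β · e′ d x)
            term β d = begin
              (β ^ Q · (x ^ E₁ · Tx ^ l d)) ^ Q · x ^ (P ℕ.* p′)
                ≡⟨ cong (_· x ^ (P ℕ.* p′)) (trans (^-distrib-* (β ^ Q) _ Q) (cong₂ _·_ (trans (^-assocʳ β Q Q) (fermat β))
                     (trans (^-distrib-* (x ^ E₁) (Tx ^ l d) Q) (cong₂ _·_ (^-assocʳ x E₁ Q) T^lQ)))) ⟩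
              β · (x ^ (E₁ ℕ.* Q) · (x ^ (P ℕ.* Q ℕ.* l d) · w ^ l d)) · x ^ (P ℕ.* p′)
                ≡⟨ solve 5 (λ β a b w c → β :* (a :* (b :* w)) :* c := (a :* b) :* (β :* (w :* c))) refl β (x ^ (E₁ ℕ.* Q)) (x ^ (P ℕ.* Q ℕ.* l d)) (w ^ l d) (x ^ (P ℕ.* p′)) ⟩
              (x ^ (E₁ ℕ.* Q) · x ^ (P ℕ.* Q ℕ.* l d)) · (β · (w ^ l d · x ^ (P ℕ.* p′)))
                ≡⟨ cong₂ (λ a b → a · (β · (w ^ l d · b))) exps exps′ ⟩
              x ^ (P ℕ.* p′ ℕ.* Q) · x ^ (i d ℕ.* Q ℕ.+ k d) · (β · (w ^ l d · (x ^ (P ℕ.* l d) · x ^ (P ℕ.* r d))))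
                ≡⟨ solve 6 (λ a b β w c d → a :* b :* (β :* (w :* (c :* d))) := a :* (β :* (b :* (c :* w :* d)))) refl (x ^ (P ℕ.* p′ ℕ.* Q)) (x ^ (i d ℕ.* Q ℕ.+ k d)) β (w ^ l d) (x ^ (P ℕ.* l d)) (x ^ (P ℕ.* r d)) ⟩
              x ^ (P ℕ.* p′ ℕ.* Q) · (β · (x ^ (i d ℕ.* Q ℕ.+ k d) · ((x ^ (P ℕ.* l d) · w ^ l d) · x ^ (P ℕ.* r d))))
                ≡⟨ cong (λ v → x ^ (P ℕ.* p′ ℕ.* Q) · (β · (x ^ (i d ℕ.* Q ℕ.+ k d) · (v · x ^ (P ℕ.* r d)))))
                     (sym (trans (cong (_^ l d) twist) (trans (^-distrib-* (x ^ P) w (l d)) (cong (_· w ^ l d) (^-assocʳ x P (l d)))))) ⟩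
              x ^ (P ℕ.* p′ ℕ.* Q) · (β · e′ d x) ∎
              where
              Tx = T (suc m′) x
              w = θ ⊖ τ
              E₁ = i d ℕ.+ k d ℕ.* Q ℕ.+ P ℕ.* r d
              T^lQ : (Tx ^ l d) ^ Q ≡ x ^ (P ℕ.* Q ℕ.* l d) · w ^ l d
              T^lQ = begin
                (Tx ^ l d) ^ Q                  ≡⟨ trans (^-assocʳ Tx (l d) Q) (trans (cong (Tx ^_) (ℕ.*-comm (l d) Q)) (sym (^-assocʳ Tx Q (l d)))) ⟩
                (Tx ^ Q) ^ l d                  ≡⟨ cong (_^ l d) T^Q ⟩
                (x ^ (P ℕ.* Q) · w) ^ l d       ≡⟨ ^-distrib-* _ w (l d) ⟩
                (x ^ (P ℕ.* Q)) ^ l d · w ^ l d ≡⟨ cong (_· w ^ l d) (^-assocʳ x (P ℕ.* Q) (l d)) ⟩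
                x ^ (P ℕ.* Q ℕ.* l d) · w ^ l d ∎
              alg : ∀ i k Q P r l → (i ℕ.+ k ℕ.* Q ℕ.+ P ℕ.* r) ℕ.* Q ℕ.+ P ℕ.* Q ℕ.* l ≡ P ℕ.* (l ℕ.+ r) ℕ.* Q ℕ.+ (i ℕ.* Q ℕ.+ Q ℕ.* Q ℕ.* k)
              alg = solve-∀
              exps : x ^ (E₁ ℕ.* Q) · x ^ (P ℕ.* Q ℕ.* l d) ≡ x ^ (P ℕ.* p′ ℕ.* Q) · x ^ (i d ℕ.* Q ℕ.+ k d)
              exps = begin
                x ^ (E₁ ℕ.* Q) · x ^ (P ℕ.* Q ℕ.* l d)
                  ≡⟨ sym (^-homo-* x (E₁ ℕ.* Q) _) ⟩
                x ^ (E₁ ℕ.* Q ℕ.+ P ℕ.* Q ℕ.* l d)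
                  ≡⟨ cong (x ^_) (trans (alg (i d) (k d) Q P (r d) (l d)) (cong (λ n → P ℕ.* n ℕ.* Q ℕ.+ (i d ℕ.* Q ℕ.+ Q ℕ.* Q ℕ.* k d)) (l+r d))) ⟩
                x ^ (P ℕ.* p′ ℕ.* Q ℕ.+ (i d ℕ.* Q ℕ.+ Q ℕ.* Q ℕ.* k d))
                  ≡⟨ ^-homo-* x (P ℕ.* p′ ℕ.* Q) _ ⟩
                x ^ (P ℕ.* p′ ℕ.* Q) · x ^ (i d ℕ.* Q ℕ.+ Q ℕ.* Q ℕ.* k d)
                  ≡⟨ cong (x ^ (P ℕ.* p′ ℕ.* Q) ·_) (trans (^-homo-* x (i d ℕ.* Q) _) (trans (cong (x ^ (i d ℕ.* Q) ·_)
                       (trans (sym (^-assocʳ x (Q ℕ.* Q) (k d))) (cong (_^ k d) (fermat x)))) (sym (^-homo-* x (i d ℕ.* Q) (k d))))) ⟩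
                x ^ (P ℕ.* p′ ℕ.* Q) · x ^ (i d ℕ.* Q ℕ.+ k d) ∎
              exps′ : x ^ (P ℕ.* p′) ≡ x ^ (P ℕ.* l d) · x ^ (P ℕ.* r d)
              exps′ = trans (cong (x ^_) (trans (cong (P ℕ.*_) (sym (l+r d))) (ℕ.*-distribˡ-+ P (l d) (r d)))) (^-homo-* x (P ℕ.* l d) (P ℕ.* r d))

            terms : ∀ {n} (b : Vec R n) (g g′ : ℕ → R → R) {A B : R} → (∀ β d → (β ^ Q · g d x) ^ Q · A ≡ B · (β · g′ d x)) →
              comb (map (_^ Q) b) g x ^ Q · A ≡ B · comb b g′ x
            terms [] g g′ h = trans (cong (_· _) (𝟘^p^ (suc m′))) (trans (zeroˡ _) (sym (zeroʳ _)))
            terms (β ∷ bs) g g′ {A} {B} h = begin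
              (β ^ Q · g 0 x ⊕ comb (map (_^ Q) bs) (g ∘ suc) x) ^ Q · A
                ≡⟨ cong (_· A) (frobenius^ (suc m′) _ _) ⟩
              ((β ^ Q · g 0 x) ^ Q ⊕ comb (map (_^ Q) bs) (g ∘ suc) x ^ Q) · A
                ≡⟨ distribʳ A _ _ ⟩
              (β ^ Q · g 0 x) ^ Q · A ⊕ comb (map (_^ Q) bs) (g ∘ suc) x ^ Q · A
                ≡⟨ cong₂ _⊕_ (h β 0) (terms bs (g ∘ suc) (g′ ∘ suc) (λ β d → h β (suc d))) ⟩
              B · (β · g′ 0 x) ⊕ B · comb bs (g′ ∘ suc) x
                ≡⟨ sym (distribˡ B _ _) ⟩
              B · (β · g′ 0 x ⊕ comb bs (g′ ∘ suc) x) ∎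

          ^Q-zero : ∀ {n} (b : Vec R n) → All (_≡ 𝟘) (map (_^ Q) b) → All (_≡ 𝟘) b
          ^Q-zero [] [] = []
          ^Q-zero (β ∷ b) (z ∷ zs) = trans (sym (fermat β)) (trans (sym (^-assocʳ β Q Q)) (trans (cong (_^ Q) z) (𝟘^p^ (suc m′)))) ∷ ^Q-zero b zs

        private
          alg : ∀ P p′ → (P ℕ.+ 2) ℕ.* suc p′ ℕ.* P ℕ.+ P ℕ.* p′ ℕ.+ P ≡ suc p′ ℕ.* P ℕ.* P ℕ.+ 3 ℕ.* (suc p′ ℕ.* P)
          alg = solve-∀

          size : D ℕ.+ P ℕ.* p′ ℕ.≤ Q ℕ.* P ℕ.+ 3 ℕ.* Q
          size = ℕ.≤-trans (ℕ.m≤m+n _ P) (ℕ.≤-reflexive (alg P p′))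

          module _ (b : Vec R D) (vanish : ∀ x → comb b e′ x ≡ 𝟘) (γ : R) (γ≢0 : ¬ γ ≡ 𝟘) (g : R → R) (eq : ∀ x → comb (map (_^ Q) b) e x ≡ γ · g x) where
            zero-at : ∀ {x} → Unit x → tsum (suc m′ ℕ.+ suc m′) (f x) ≡ θ → g x ≡ 𝟘
            zero-at {x} u tr = by-cases (g x ≟ 𝟘)
              where
              H≡0 : (γ · g x) ^ Q · x ^ (P ℕ.* p′) ≡ 𝟘
              H≡0 = begin
                (γ · g x) ^ Q · x ^ (P ℕ.* p′)               ≡⟨ cong (λ w → w ^ Q · x ^ (P ℕ.* p′)) (sym (eq x)) ⟩
                comb (map (_^ Q) b) e x ^ Q · x ^ (P ℕ.* p′) ≡⟨ terms u tr b e e′ (term u tr) ⟩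
                x ^ (P ℕ.* p′ ℕ.* Q) · comb b e′ x           ≡⟨ cong (x ^ (P ℕ.* p′ ℕ.* Q) ·_) (vanish x) ⟩
                x ^ (P ℕ.* p′ ℕ.* Q) · 𝟘                     ≡⟨ zeroʳ _ ⟩
                𝟘 ∎
              by-cases : Dec (g x ≡ 𝟘) → g x ≡ 𝟘
              by-cases (yes z) = z
              by-cases (no nz) = ⊥-elim (·-nonzero (^-nonzero Q (·-nonzero γ≢0 nz)) (^-nonzero (P ℕ.* p′) (unit⇒nonzero u)) H≡0)

            good≤ : ∀ x → good x ≤ [ g x ≟ 𝟘 ]
            good≤ x = by-cases (unit? x) (tsum (suc m′ ℕ.+ suc m′) (f x) ≟ θ)
              where
              by-cases : (d : Dec (Unit x)) (d′ : Dec (tsum (suc m′ ℕ.+ suc m′) (f x) ≡ θ)) → [ d ] Int.* [ d′ ] ≤ [ g x ≟ 𝟘 ]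
              by-cases (no _) d = subst (_≤ [ g x ≟ 𝟘 ]) (sym (Int.*-zeroˡ _)) ([]-≥0 (g x ≟ 𝟘))
              by-cases (yes _) (no _) = subst (_≤ [ g x ≟ 𝟘 ]) (sym (Int.*-zeroʳ _)) ([]-≥0 (g x ≟ 𝟘))
              by-cases (yes u) (yes tr) = subst₂ _≤_ (sym (Int.*-identityˡ 1ℤ)) (sym ([]-yes (g x ≟ 𝟘) (zero-at u tr))) Int.≤-refl

        -- The main term Q P = Q² / p is what equidistribution of the trace predicts; the error 3 Q
        -- is of square-root size in the field with Q² elements.
        point-count : 3 ℕ.≤ Q → ∑ set good ≤ + (Q ℕ.* P ℕ.+ 3 ℕ.* Q)
        point-count Q≥3 = from-dependence (dependent {D} {ℕ.pred D} card≥2 (ℕ.≤-reflexive (ℕ.suc-pred D {{ℕ.>-nonZero D>0}})) e′ (e′-Pol Q≥3))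
          where
          from-dependence : (∃ λ b → ¬ All (_≡ 𝟘) b × (∀ x → comb {D} b e′ x ≡ 𝟘)) → ∑ set good ≤ + (Q ℕ.* P ℕ.+ 3 ℕ.* Q)
          from-dependence (b , b≢0 , vanish) = from-leading (comb-leading (map (_^ Q) b) e (P ℕ.* p′) e-Mon)
            where
            from-leading : (All (_≡ 𝟘) (map (_^ Q) b) ⊎ (∃ λ N → ∃ λ β → ∃ λ g → P ℕ.* p′ ℕ.≤ N × N ℕ.< D ℕ.+ P ℕ.* p′ × ¬ β ≡ 𝟘 × Mon N g × (∀ x → comb (map (_^ Q) b) e x ≡ β · g x))) →
              ∑ set good ≤ + (Q ℕ.* P ℕ.+ 3 ℕ.* Q)
            from-leading (inj₁ z) = ⊥-elim (b≢0 (^Q-zero b z))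
            from-leading (inj₂ (N , γ , g , _ , N< , γ≢0 , mg , eq)) =
              Int.≤-trans (∑-mono set (good≤ b vanish γ γ≢0 g eq)) (Int.≤-trans (roots mg) (Int.+≤+ (ℕ.≤-trans (ℕ.<⇒≤ N<) size)))

-- The tower of quadratic extensions with its traces.

module Tower where
  open import Data.Fin using (Fin; toℕ)
  import Data.Nat.Tactic.RingSolver as ℕ-Solver
  open import Data.Nat.Primality using (Prime; prime⇒nonTrivial)
  open import Data.Product.Properties using (,-injectiveˡ)
  open import Relation.Nullary.Decidable using (_×-dec_; ¬?)
  open ≡-Reasoning
  open Int using (ℤ; +_; 0ℤ; 1ℤ; _≤_; _+_; _*_; -_; _-_; solve-∀)
  open FiniteSums
  open FiniteRings
  open Residues

  module QuadraticExtension (𝑭 : FinRing) (isField : IsField 𝑭) (δ : FinRing.R 𝑭) (nonsquare : ∀ s → ¬ FinRing._·_ 𝑭 s s ≡ δ) where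
    open Ring 𝑭
    open Field 𝑭 isField

    𝑬 : FinRing
    𝑬 = record
      { set = set ⊗ set
      ; _⊕_ = λ { (a , b) (c , d) → a ⊕ c , b ⊕ d }
      ; _·_ = λ { (a , b) (c , d) → a · c ⊕ δ · (b · d) , a · d ⊕ b · c }
      ; ⊝_ = λ { (a , b) → ⊝ a , ⊝ b }
      ; 𝟘 = 𝟘 , 𝟘
      ; 𝟙 = 𝟙 , 𝟘
      ; isCommutativeRing = record
        { isRing = record
          { +-isAbelianGroup = record
            { isGroup = record
              { isMonoid = record
                { isSemigroup = record
                  { isMagma = record { isEquivalence = isEquivalence ; ∙-cong = λ { refl refl → refl } }
                  ; assoc = λ _ _ _ → cong₂ _,_ (+-assoc _ _ _) (+-assoc _ _ _) }
                ; identity = (λ _ → cong₂ _,_ (+-identityˡ _) (+-identityˡ _)) , (λ _ → cong₂ _,_ (+-identityʳ _) (+-identityʳ _)) }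
              ; inverse = (λ _ → cong₂ _,_ (-‿inverseˡ _) (-‿inverseˡ _)) , (λ _ → cong₂ _,_ (-‿inverseʳ _) (-‿inverseʳ _))
              ; ⁻¹-cong = λ { refl → refl } }
            ; comm = λ _ _ → cong₂ _,_ (+-comm _ _) (+-comm _ _) }
          ; *-cong = λ { refl refl → refl }
          ; *-assoc = λ { (a , b) (c , d) (e , f) → cong₂ _,_
              (solve 7 (λ δ a b c d e f → (a :* c :+ δ :* (b :* d)) :* e :+ δ :* ((a :* d :+ b :* c) :* f)
                := a :* (c :* e :+ δ :* (d :* f)) :+ δ :* (b :* (c :* f :+ d :* e))) refl δ a b c d e f)
              (solve 7 (λ δ a b c d e f → (a :* c :+ δ :* (b :* d)) :* f :+ (a :* d :+ b :* c) :* e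
                := a :* (c :* f :+ d :* e) :+ b :* (c :* e :+ δ :* (d :* f))) refl δ a b c d e f) }
          ; *-identity = (λ { (a , b) → one-· a b }) , (λ { (a , b) → trans (·-comm (a , b) (𝟙 , 𝟘)) (one-· a b) })
          ; distrib = (λ { (a , b) (c , d) (e , f) → distr a b c d e f })
                    , (λ { (a , b) (c , d) (e , f) → trans (·-comm (c ⊕ e , d ⊕ f) (a , b)) (trans (distr a b c d e f)
                         (cong₂ (λ { (x , y) (z , w) → x ⊕ z , y ⊕ w }) (·-comm (a , b) (c , d)) (·-comm (a , b) (e , f)))) }) }
        ; *-comm = ·-comm }
      }
      where
      _·′_ : R × R → R × R → R × R
      (a , b) ·′ (c , d) = a · c ⊕ δ · (b · d) , a · d ⊕ b · c
      ·-comm : ∀ x y → x ·′ y ≡ y ·′ x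
      ·-comm (a , b) (c , d) = cong₂ _,_ (solve 5 (λ δ a b c d → a :* c :+ δ :* (b :* d) := c :* a :+ δ :* (d :* b)) refl δ a b c d)
        (solve 4 (λ a b c d → a :* d :+ b :* c := c :* b :+ d :* a) refl a b c d)
      one-· : ∀ a b → (𝟙 , 𝟘) ·′ (a , b) ≡ (a , b)
      one-· a b = cong₂ _,_ (trans (cong₂ _⊕_ (*-identityˡ a) (trans (cong (δ ·_) (zeroˡ b)) (zeroʳ δ))) (+-identityʳ a))
        (trans (cong₂ _⊕_ (*-identityˡ b) (zeroˡ a)) (+-identityʳ b))
      distr : ∀ a b c d e f → (a , b) ·′ (c ⊕ e , d ⊕ f) ≡ (proj₁ ((a , b) ·′ (c , d)) ⊕ proj₁ ((a , b) ·′ (e , f)) , proj₂ ((a , b) ·′ (c , d)) ⊕ proj₂ ((a , b) ·′ (e , f)))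
      distr a b c d e f = cong₂ _,_
        (solve 7 (λ δ a b c d e f → a :* (c :+ e) :+ δ :* (b :* (d :+ f)) := a :* c :+ δ :* (b :* d) :+ (a :* e :+ δ :* (b :* f))) refl δ a b c d e f)
        (solve 6 (λ a b c d e f → a :* (d :+ f) :+ b :* (c :+ e) := a :* d :+ b :* c :+ (a :* f :+ b :* e)) refl a b c d e f)

    module E = Ring 𝑬

    normE : R → R → R
    normE a b = a · a ⊖ δ · (b · b)

    -- A zero with b ≠ 0 would make δ the square of a / b.
    norm-zero : ∀ a b → normE a b ≡ 𝟘 → (a , b) ≡ (𝟘 , 𝟘)
    norm-zero a b h = by-cases (b ≟ 𝟘) (a ≟ 𝟘)
      where
      a²≡δb² : a · a ≡ δ · (b · b)
      a²≡δb² = ⊖≡𝟘⇒≡ h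
      by-cases : Dec (b ≡ 𝟘) → Dec (a ≡ 𝟘) → (a , b) ≡ (𝟘 , 𝟘)
      by-cases (yes refl) (yes refl) = refl
      by-cases (yes refl) (no a≢0) = ⊥-elim (·-nonzero a≢0 a≢0 (trans a²≡δb² (trans (cong (δ ·_) (zeroˡ 𝟘)) (zeroʳ δ))))
      by-cases (no b≢0) _ = ⊥-elim (nonsquare (a · inv b) (begin
        a · inv b · (a · inv b)              ≡⟨ solve 2 (λ a i → a :* i :* (a :* i) := a :* a :* (i :* i)) refl a (inv b) ⟩
        a · a · (inv b · inv b)              ≡⟨ cong (_· (inv b · inv b)) a²≡δb² ⟩
        δ · (b · b) · (inv b · inv b)        ≡⟨ solve 3 (λ δ b i → δ :* (b :* b) :* (i :* i) := δ :* ((b :* i) :* (b :* i))) refl δ b (inv b) ⟩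
        δ · ((b · inv b) · (b · inv b))      ≡⟨ cong (λ w → δ · (w · w)) (nonzero⇒unit b≢0) ⟩
        δ · (𝟙 · 𝟙)                          ≡⟨ trans (cong (δ ·_) (*-identityˡ 𝟙)) (*-identityʳ δ) ⟩
        δ ∎))

    conj-inverse : ∀ a b → Unit (normE a b) → (a , b) E.· (a · inv (normE a b) , ⊝ b · inv (normE a b)) ≡ (𝟙 , 𝟘)
    conj-inverse a b u = cong₂ _,_
      (trans (solve 4 (λ δ a b i → a :* (a :* i) :+ δ :* (b :* ((:- b) :* i)) := (a :* a :- δ :* (b :* b)) :* i) refl δ a b (inv (normE a b))) u)
      (solve 3 (λ a b i → a :* ((:- b) :* i) :+ b :* (a :* i) := con (+ 0)) refl a b (inv (normE a b)))

    E-isField : IsField 𝑬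
    E-isField = (λ { (a , b) ne → E.toUnit (conj-inverse a b (nonzero⇒unit (λ h → ne (norm-zero a b h)))) }) , (λ e → proj₂ isField (,-injectiveˡ e))

    scalar-⊕ : ∀ a b → (a , 𝟘) E.⊕ (b , 𝟘) ≡ (a ⊕ b , 𝟘)
    scalar-⊕ a b = cong (a ⊕ b ,_) (+-identityˡ 𝟘)

    scalar-· : ∀ a b → (a , 𝟘) E.· (b , 𝟘) ≡ (a · b , 𝟘)
    scalar-· a b = cong₂ _,_ (solve 3 (λ δ a b → a :* b :+ δ :* (con (+ 0) :* con (+ 0)) := a :* b) refl δ a b)
      (solve 2 (λ a b → a :* con (+ 0) :+ con (+ 0) :* b := con (+ 0)) refl a b)

    scalar-^ : ∀ a k → (a , 𝟘) E.^ k ≡ (a ^ k , 𝟘)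
    scalar-^ a zero = refl
    scalar-^ a (suc k) = trans (cong ((a , 𝟘) E.·_) (scalar-^ a k)) (scalar-· a (a ^ k))

    scalar-fromℕ : ∀ n → E.fromℕ n ≡ (fromℕ n , 𝟘)
    scalar-fromℕ zero = refl
    scalar-fromℕ (suc n) = trans (cong (E.𝟙 E.⊕_) (scalar-fromℕ n)) (scalar-⊕ 𝟙 (fromℕ n))

    scalar-unit : ∀ {a} → Unit a → E.Unit (a , 𝟘)
    scalar-unit {a} u = E.toUnit {y = inv a , 𝟘} (trans (scalar-· a (inv a)) (cong (_, 𝟘) u))

    √δ^ : ∀ h → (𝟘 , 𝟙) E.^ suc (h ℕ.+ h) ≡ (𝟘 , δ ^ h)
    √δ^ h = begin
      (𝟘 , 𝟙) E.· (𝟘 , 𝟙) E.^ (h ℕ.+ h)              ≡⟨ cong ((𝟘 , 𝟙) E.·_) (trans (E.^-homo-* (𝟘 , 𝟙) h h) (sym (E.^-distrib-* (𝟘 , 𝟙) (𝟘 , 𝟙) h))) ⟩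
      (𝟘 , 𝟙) E.· ((𝟘 , 𝟙) E.· (𝟘 , 𝟙)) E.^ h        ≡⟨ cong (λ w → (𝟘 , 𝟙) E.· w E.^ h) (cong₂ _,_ (trans (cong₂ _⊕_ (zeroˡ 𝟘) (trans (cong (δ ·_) (*-identityˡ 𝟙)) (*-identityʳ δ))) (+-identityˡ δ))
                                                           (trans (cong₂ _⊕_ (zeroˡ 𝟙) (zeroʳ 𝟙)) (+-identityˡ 𝟘))) ⟩
      (𝟘 , 𝟙) E.· (δ , 𝟘) E.^ h                      ≡⟨ cong ((𝟘 , 𝟙) E.·_) (scalar-^ δ h) ⟩
      (𝟘 , 𝟙) E.· (δ ^ h , 𝟘)                        ≡⟨ cong₂ _,_ (solve 3 (λ o δ d → con (+ 0) :* d :+ δ :* (o :* con (+ 0)) := con (+ 0)) refl 𝟙 δ (δ ^ h))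
                                                           (trans (cong₂ _⊕_ (zeroˡ 𝟘) (*-identityˡ _)) (+-identityˡ _)) ⟩
      (𝟘 , δ ^ h) ∎

  module _ (p′ : ℕ) (pr : Prime (suc p′)) where
    private
      p = suc p′
      𝑭ₚ = ℤ/ p
      module Fₚ = Ring 𝑭ₚ

    -- A field with p^n elements. `Tr` has values in `Fin p`, so that the operators of all levels
    -- act on functions on ℤ/p; `ι` embeds the prime field, and `ι-Tr` ties `Tr` to the trace
    -- polynomial of Stepanov's count. The equation `c^p` keeps c in the prime field.
    record Level (n : ℕ) : Set₁ where
      field
        ring : FinRing
        isField : IsField ring
      open Ring ring
      field
        char : fromℕ p ≡ 𝟘
        two-unit : Unit (𝟙 ⊕ 𝟙)
        card≡ : card set ≡ + (p ℕ.^ n)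
        fermat : ∀ x → x ^ (p ℕ.^ n) ≡ x
        c : R
        c-unit : Unit c
        c^p : c ^ p ≡ c
      open Stepanov.Frobenius ring isField p′ (CharP.frobenius ring p′ pr char) public using (tsum)
      field
        Tr : R → Fin p
        Tr-⊕ : ∀ x y → Tr (x ⊕ y) ≡ Tr x Fₚ.⊕ Tr y
        Tr-count : ∀ t → + p * (∑[ z ∈ set ] [ Tr z Fₚ.≟ t ]) ≡ + (p ℕ.^ n)
        ι : Fin p → R
        ι-injective : ∀ {s t} → ι s ≡ ι t → s ≡ t
        ι-Tr : ∀ z → ι (Tr z) ≡ tsum n z

    module _ (h₀ : ℕ) (odd : p ≡ suc (h₀ ℕ.+ h₀)) where

      halve : ∀ n → ∃ λ h → p ℕ.^ n ≡ suc (h ℕ.+ h)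
      halve zero = 0 , refl
      halve (suc n) with halve n
      ... | h , e = h₀ ℕ.+ h ℕ.+ (h₀ ℕ.* h ℕ.+ h₀ ℕ.* h) , trans (cong₂ ℕ._*_ odd e) (alg h₀ h)
        where
        alg : ∀ a b → suc (a ℕ.+ a) ℕ.* suc (b ℕ.+ b) ≡ suc (a ℕ.+ b ℕ.+ (a ℕ.* b ℕ.+ a ℕ.* b) ℕ.+ (a ℕ.+ b ℕ.+ (a ℕ.* b ℕ.+ a ℕ.* b)))
        alg = ℕ-Solver.solve-∀

      p≥2 : 2 ℕ.≤ p
      p≥2 = ℕ.nonTrivial⇒n>1 p {{prime⇒nonTrivial pr}}

      module LevelProperties {n : ℕ} (n≥1 : 1 ℕ.≤ n) (𝓛 : Level n) where
        open Level 𝓛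
        open Ring ring
        open Field ring isField

        half : ℕ
        half = proj₁ (halve n)

        q≡ : p ℕ.^ n ≡ suc (half ℕ.+ half)
        q≡ = proj₂ (halve n)

        half≥1 : 1 ℕ.≤ half
        half≥1 = positive half (ℕ.s≤s⁻¹ (subst (2 ℕ.≤_) q≡ (ℕ.≤-trans (subst (2 ℕ.≤_) (sym (ℕ.^-identityʳ p)) p≥2) (ℕ.^-monoʳ-≤ p n≥1))))
          where
          positive : ∀ h → 1 ℕ.≤ h ℕ.+ h → 1 ℕ.≤ h
          positive (suc h) _ = s≤s z≤n

        card≥2 : + 2 ≤ card set
        card≥2 = subst (+ 2 ≤_) (sym (trans card≡ (cong +_ q≡))) (Int.+≤+ (s≤s (ℕ.≤-trans half≥1 (ℕ.m≤m+n half half))))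

        unit-power : ∀ {x} → ¬ x ≡ 𝟘 → x ^ (half ℕ.+ half) ≡ 𝟙
        unit-power {x} x≢0 = unit-cancelˡ (nonzero⇒unit x≢0) (trans (cong (x ^_) (sym q≡)) (trans (fermat x) (sym (*-identityʳ x))))

        minus-one : ∀ {y} → ¬ y ≡ 𝟙 → y · y ≡ 𝟙 → y ≡ ⊝ 𝟙
        minus-one {y} y≢1 y² = ⊖≡𝟘⇒≡ (by-cases (y ⊖ ⊝ 𝟙 ≟ 𝟘))
          where
          by-cases : Dec (y ⊖ ⊝ 𝟙 ≡ 𝟘) → y ⊖ ⊝ 𝟙 ≡ 𝟘
          by-cases (yes e) = e
          by-cases (no ne) = ⊥-elim (·-nonzero (λ e → y≢1 (⊖≡𝟘⇒≡ e)) ne (trans (solve 2 (λ y o → (y :- o) :* (y :- (:- o)) := y :* y :- o :* o) refl y 𝟙)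
            (≡⇒⊖≡𝟘 (trans y² (sym (*-identityˡ 𝟙))))))

        private
          open Polynomials ring isField using (Mon; Mon-+Pol; Mon-X^; Pol-scale; Mon⇒Pol; one; roots)

          -- Otherwise all 2 half nonzero elements would be roots of x^half - 1.
          not-all-squares : ¬ (∀ x → ¬ x ≡ 𝟘 → x ^ half ≡ 𝟙)
          not-all-squares all = ℕ.<⇒≱ (ℕ.m<m+n half half≥1) (Int.drop‿+≤+ (Int.≤-trans (Int.≤-reflexive count) (Int.≤-trans (∑-mono set each) (roots poly))))
            where
            poly : Mon half (λ x → x ^ half ⊕ ⊝ 𝟙 · 𝟙)
            poly = Mon-+Pol half≥1 (Mon-X^ half) (Pol-scale (⊝ 𝟙) (Mon⇒Pol (one (λ _ → refl))))
            each : ∀ x → 1ℤ - [ x ≟ 𝟘 ] ≤ [ x ^ half ⊕ ⊝ 𝟙 · 𝟙 ≟ 𝟘 ]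
            each x with x ≟ 𝟘
            ... | yes _ = subst (_≤ [ x ^ half ⊕ ⊝ 𝟙 · 𝟙 ≟ 𝟘 ]) (sym (Int.+-inverseʳ 1ℤ)) ([]-≥0 (x ^ half ⊕ ⊝ 𝟙 · 𝟙 ≟ 𝟘))
            ... | no ne = Int.≤-reflexive (trans (alg 1ℤ) (sym ([]-yes (x ^ half ⊕ ⊝ 𝟙 · 𝟙 ≟ 𝟘) (trans (cong₂ _⊕_ (all x ne) (*-identityʳ _)) (-‿inverseʳ 𝟙)))))
              where
              opaque
                unfolding _+_ _*_ -_
                alg : ∀ x → x - 0ℤ ≡ x
                alg = solve-∀
            count : + (half ℕ.+ half) ≡ ∑[ x ∈ set ] (1ℤ - [ x ≟ 𝟘 ])
            count = sym (trans (∑-- set _ _) (trans (cong₂ _-_ (trans card≡ (cong +_ q≡)) (∑-once set 𝟘)) (trans (cong₂ _-_ (Int.pos-+ 1 (half ℕ.+ half)) refl) (alg 1ℤ _))))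
              where
              opaque
                unfolding _+_ _*_ -_
                alg : ∀ x y → x + y - x ≡ y
                alg = solve-∀

          -- Euler's criterion: an element whose power with exponent `half` is not 1 is a nonsquare.
          found : ∃ λ x → ¬ x ≡ 𝟘 × ¬ x ^ half ≡ 𝟙
          found with search set (λ x → ¬? (x ≟ 𝟘) ×-dec ¬? (x ^ half ≟ 𝟙))
          ... | yes w = w
          ... | no none = ⊥-elim (not-all-squares all)
            where
            all : ∀ x → ¬ x ≡ 𝟘 → x ^ half ≡ 𝟙
            all x x≢0 with x ^ half ≟ 𝟙
            ... | yes e = e
            ... | no ne = ⊥-elim (none (x , x≢0 , ne))

        δ : R
        δ = proj₁ found

        δ≢0 : ¬ δ ≡ 𝟘
        δ≢0 = proj₁ (proj₂ found)

        δ^half : δ ^ half ≡ ⊝ 𝟙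
        δ^half = minus-one (proj₂ (proj₂ found)) (trans (sym (^-homo-* δ half half)) (unit-power δ≢0))

        nonsquare : ∀ s → ¬ s · s ≡ δ
        nonsquare s e = proj₂ (proj₂ found) (begin
          δ ^ half                ≡⟨ cong (_^ half) (sym e) ⟩
          (s · s) ^ half          ≡⟨ ^-distrib-* s s half ⟩
          s ^ half · s ^ half     ≡⟨ sym (^-homo-* s half half) ⟩
          s ^ (half ℕ.+ half)     ≡⟨ unit-power (λ s≡0 → δ≢0 (trans (sym e) (trans (cong (_· s) s≡0) (zeroˡ s)))) ⟩
          𝟙 ∎)

        open QuadraticExtension ring isField δ nonsquare public

        private
          q = p ℕ.^ n
          E-char : E.fromℕ p ≡ E.𝟘
          E-char = trans (scalar-fromℕ p) (cong (_, 𝟘) char)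
          open Stepanov.Frobenius 𝑬 E-isField p′ (CharP.frobenius 𝑬 p′ pr E-char) using (frobenius^; 𝟘^p^) renaming (tsum to tsumE; tsum-+ to tsumE-+)

          conj : R × R → R × R
          conj (a , b) = a , ⊝ b

          -- The q-th power is additive and fixes a and b, and it maps √δ to δ^half √δ = -√δ because
          -- q = 2 half + 1.
          power-conj : ∀ z → z E.^ q ≡ conj z
          power-conj (a , b) = begin
            (a , b) E.^ q                                         ≡⟨ cong (E._^ q) split ⟩
            ((a , 𝟘) E.⊕ (b , 𝟘) E.· (𝟘 , 𝟙)) E.^ q               ≡⟨ frobenius^ n (a , 𝟘) _ ⟩
            (a , 𝟘) E.^ q E.⊕ ((b , 𝟘) E.· (𝟘 , 𝟙)) E.^ q         ≡⟨ cong₂ E._⊕_ (trans (scalar-^ a q) (cong (_, 𝟘) (fermat a)))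
                                                                       (trans (E.^-distrib-* (b , 𝟘) (𝟘 , 𝟙) q) (cong₂ E._·_ (trans (scalar-^ b q) (cong (_, 𝟘) (fermat b)))
                                                                          (trans (cong ((𝟘 , 𝟙) E.^_) q≡) (trans (√δ^ half) (cong (𝟘 ,_) δ^half))))) ⟩
            (a , 𝟘) E.⊕ (b , 𝟘) E.· (𝟘 , ⊝ 𝟙)                     ≡⟨ cong₂ _,_ (solve 4 (λ δ a b o → a :+ (b :* con (+ 0) :+ δ :* (con (+ 0) :* (:- o))) := a) refl δ a b 𝟙)
                                                                       (trans (solve 2 (λ b o → con (+ 0) :+ (b :* (:- o) :+ con (+ 0) :* con (+ 0)) := :- (b :* o)) refl b 𝟙) (cong ⊝_ (*-identityʳ b))) ⟩
            (a , ⊝ b) ∎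
            where
            split : (a , b) ≡ (a , 𝟘) E.⊕ (b , 𝟘) E.· (𝟘 , 𝟙)
            split = cong₂ _,_ (solve 4 (λ δ a b o → a := a :+ (b :* con (+ 0) :+ δ :* (con (+ 0) :* o))) refl δ a b 𝟙)
              (sym (trans (solve 2 (λ b o → con (+ 0) :+ (b :* o :+ con (+ 0) :* con (+ 0)) := b :* o) refl b 𝟙) (*-identityʳ b)))

          q² : p ℕ.^ (n ℕ.+ n) ≡ q ℕ.* q
          q² = ℕ.^-distribˡ-+-* p n n

          E-fermat : ∀ z → z E.^ (p ℕ.^ (n ℕ.+ n)) ≡ z
          E-fermat z@(a , b) = begin
            z E.^ (p ℕ.^ (n ℕ.+ n))   ≡⟨ cong (z E.^_) q² ⟩
            z E.^ (q ℕ.* q)           ≡⟨ sym (E.^-assocʳ z q q) ⟩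
            (z E.^ q) E.^ q           ≡⟨ trans (cong (E._^ q) (power-conj z)) (power-conj (a , ⊝ b)) ⟩
            (a , ⊝ (⊝ b))             ≡⟨ cong (a ,_) (solve 1 (λ b → :- (:- b) := b) refl b) ⟩
            z ∎

          tsumE-^ : ∀ k z → tsumE k z E.^ q ≡ tsumE k (z E.^ q)
          tsumE-^ zero z = 𝟘^p^ n
          tsumE-^ (suc k) z = trans (frobenius^ n _ _) (cong₂ E._⊕_ (tsumE-^ k z)
            (trans (E.^-assocʳ z (p ℕ.^ k) q) (trans (cong (z E.^_) (ℕ.*-comm (p ℕ.^ k) q)) (sym (E.^-assocʳ z q (p ℕ.^ k))))))

          tsumE-⊕ : ∀ k z w → tsumE k (z E.⊕ w) ≡ tsumE k z E.⊕ tsumE k w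
          tsumE-⊕ zero z w = sym (E.+-identityˡ E.𝟘)
          tsumE-⊕ (suc k) z w = trans (cong₂ E._⊕_ (tsumE-⊕ k z w) (frobenius^ k z w))
            (E.solve 4 (λ a b c d → a E.:+ b E.:+ (c E.:+ d) E.:= a E.:+ c E.:+ (b E.:+ d)) refl _ _ _ _)

          tsumE-scalar : ∀ k a → tsumE k (a , 𝟘) ≡ (tsum k a , 𝟘)
          tsumE-scalar zero a = refl
          tsumE-scalar (suc k) a = trans (cong₂ E._⊕_ (tsumE-scalar k a) (scalar-^ a (p ℕ.^ k))) (scalar-⊕ _ _)

          -- Transitivity of the trace: the terms of the sum pair up to the smaller trace of z +
          -- z^q, which is z plus its conjugate, hence 2 a.
          E-ι-Tr : ∀ z → (ι (Tr (proj₁ z ⊕ proj₁ z)) , 𝟘) ≡ tsumE (n ℕ.+ n) z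
          E-ι-Tr z@(a , b) = sym (begin
            tsumE (n ℕ.+ n) z                        ≡⟨ tsumE-+ n n z ⟩
            tsumE n z E.⊕ tsumE n z E.^ q            ≡⟨ cong (tsumE n z E.⊕_) (trans (tsumE-^ n z) (cong (tsumE n) (power-conj z))) ⟩
            tsumE n z E.⊕ tsumE n (conj z)           ≡⟨ sym (tsumE-⊕ n z (conj z)) ⟩
            tsumE n (z E.⊕ conj z)                   ≡⟨ cong (λ w → tsumE n (a ⊕ a , w)) (-‿inverseʳ b) ⟩
            tsumE n (a ⊕ a , 𝟘)                      ≡⟨ tsumE-scalar n (a ⊕ a) ⟩
            (tsum n (a ⊕ a) , 𝟘)                     ≡⟨ cong (_, 𝟘) (sym (ι-Tr (a ⊕ a))) ⟩
            (ι (Tr (a ⊕ a)) , 𝟘) ∎)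

          -- The trace depends on a alone, and doubling permutes the smaller field.
          E-Tr-count : ∀ t → + p * (∑[ z ∈ set ⊗ set ] [ Tr (proj₁ z ⊕ proj₁ z) Fₚ.≟ t ]) ≡ + (p ℕ.^ (n ℕ.+ n))
          E-Tr-count t = begin
            + p * (∑[ z ∈ set ⊗ set ] [ Tr (proj₁ z ⊕ proj₁ z) Fₚ.≟ t ])
              ≡⟨ cong (+ p *_) (trans (∑-⊗ set set _) (trans (∑-swap set set _) (∑-const set _))) ⟩
            + p * (card set * (∑[ a ∈ set ] [ Tr (a ⊕ a) Fₚ.≟ t ]))
              ≡⟨ cong (λ w → + p * (card set * w)) (trans (∑-cong set λ a → cong (λ w → [ Tr w Fₚ.≟ t ])
                   (sym (trans (distribʳ a 𝟙 𝟙) (cong₂ _⊕_ (*-identityˡ a) (*-identityˡ a))))) (∑-scale two-unit (λ a → [ Tr a Fₚ.≟ t ]))) ⟩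
            + p * (card set * (∑[ a ∈ set ] [ Tr a Fₚ.≟ t ]))
              ≡⟨ alg (+ p) (card set) _ ⟩
            card set * (+ p * (∑[ a ∈ set ] [ Tr a Fₚ.≟ t ]))
              ≡⟨ cong₂ _*_ card≡ (Tr-count t) ⟩
            + q * + q
              ≡⟨ trans (sym (Int.pos-* q q)) (cong +_ (sym q²)) ⟩
            + (p ℕ.^ (n ℕ.+ n)) ∎
            where
            opaque
              unfolding _+_ _*_ -_
              alg : ∀ x y z → x * (y * z) ≡ y * (x * z)
              alg = solve-∀

        double : Level (n ℕ.+ n)
        double = record
          { ring = 𝑬
          ; isField = E-isField
          ; char = E-char
          ; two-unit = subst E.Unit (sym (scalar-⊕ 𝟙 𝟙)) (scalar-unit two-unit)
          ; card≡ = trans (card-⊗ set set) (trans (cong₂ _*_ card≡ card≡) (trans (sym (Int.pos-* q q)) (cong +_ (sym q²))))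
          ; fermat = E-fermat
          ; c = c , 𝟘
          ; c-unit = scalar-unit c-unit
          ; c^p = trans (scalar-^ c p) (cong (_, 𝟘) c^p)
          ; Tr = λ z → Tr (proj₁ z ⊕ proj₁ z)
          ; Tr-⊕ = λ { (a , _) (b , _) → trans (cong Tr (solve 2 (λ a b → a :+ b :+ (a :+ b) := a :+ a :+ (b :+ b)) refl a b)) (Tr-⊕ (a ⊕ a) (b ⊕ b)) }
          ; Tr-count = E-Tr-count
          ; ι = λ t → ι t , 𝟘
          ; ι-injective = λ e → ι-injective (,-injectiveˡ e)
          ; ι-Tr = E-ι-Tr
          }

      base-isField : IsField 𝑭ₚ
      base-isField = residue-unit p pr
        , (λ e → contradiction (small-congruent p≥2 (s≤s z≤n) (class-≡⇒ p e)) λ ())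

      base : (c₀ : Fin p) → Fₚ.Unit c₀ → Level 1
      base c₀ u = record
        { ring = 𝑭ₚ
        ; isField = base-isField
        ; char = char
        ; two-unit = two-unit
        ; card≡ = trans (card-ℤ/ p) (cong +_ (sym (ℕ.^-identityʳ p)))
        ; fermat = λ x → trans (cong (x Fₚ.^_) (ℕ.^-identityʳ p)) (fermat x)
        ; c = c₀
        ; c-unit = u
        ; c^p = fermat c₀
        ; Tr = λ x → x
        ; Tr-⊕ = λ _ _ → refl
        ; Tr-count = λ t → trans (cong (+ p *_) (∑-once Fₚ.set t)) (trans (Int.*-identityʳ _) (cong +_ (sym (ℕ.^-identityʳ p))))
        ; ι = λ t → t
        ; ι-injective = λ e → e
        ; ι-Tr = λ z → sym (trans (Fₚ.+-identityˡ _) (Fₚ.*-identityʳ z))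
        }
        where
        char : Fₚ.fromℕ p ≡ Fₚ.𝟘
        char = trans (fromℕ-class p p) (class-cong p (1ℤ , trans (alg (+ p)) (sym (Int.*-identityˡ _))))
          where
          opaque
            unfolding _+_ _*_ -_
            alg : ∀ x → x - 0ℤ ≡ x
            alg = solve-∀
        -- Every residue is a sum of ones, and the Frobenius map is additive.
        fermatℕ : ∀ n → Fₚ.fromℕ n Fₚ.^ p ≡ Fₚ.fromℕ n
        fermatℕ zero = Fₚ.𝟘^suc p′
        fermatℕ (suc n) = trans (CharP.frobenius 𝑭ₚ p′ pr char Fₚ.𝟙 (Fₚ.fromℕ n)) (cong₂ Fₚ._⊕_ (Fₚ.𝟙^ p) (fermatℕ n))
        fermat : ∀ x → x Fₚ.^ p ≡ x
        fermat x = subst (λ y → y Fₚ.^ p ≡ y) (trans (fromℕ-class p (toℕ x)) (trans (cong (class p) (sym (rep-nat x))) (class-rep p x))) (fermatℕ (toℕ x))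
        two-unit : Fₚ.Unit (Fₚ.𝟙 Fₚ.⊕ Fₚ.𝟙)
        -- The inverse of 2 is (p + 1) / 2, that is `suc h₀`.
        two-unit = Fₚ.toUnit {y = Fₚ.fromℕ (suc h₀)} (begin
          (Fₚ.𝟙 Fₚ.⊕ Fₚ.𝟙) Fₚ.· Fₚ.fromℕ (suc h₀)            ≡⟨ trans (Fₚ.distribʳ _ _ _) (cong₂ Fₚ._⊕_ (Fₚ.*-identityˡ _) (Fₚ.*-identityˡ _)) ⟩
          Fₚ.fromℕ (suc h₀) Fₚ.⊕ Fₚ.fromℕ (suc h₀)           ≡⟨ sym (Fₚ.fromℕ-hom-+ (suc h₀) (suc h₀)) ⟩
          Fₚ.fromℕ (suc h₀ ℕ.+ suc h₀)                       ≡⟨ cong Fₚ.fromℕ (trans (cong suc (ℕ.+-suc h₀ h₀)) (cong suc (sym odd))) ⟩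
          Fₚ.𝟙 Fₚ.⊕ Fₚ.fromℕ p                               ≡⟨ trans (cong (Fₚ.𝟙 Fₚ.⊕_) char) (Fₚ.+-identityʳ _) ⟩
          Fₚ.𝟙 ∎)

-- The relation between the operators of a field and of its quadratic extension.

module Doubling where
  open import Data.Fin using (Fin)
  open import Data.Nat.Primality using (Prime)
  open import Data.Product.Properties using (,-injectiveʳ)
  open ≡-Reasoning
  open Int using (ℤ; +_; 0ℤ; _≤_; _+_; _*_; -_; _-_; solve-∀)
  open FiniteSums
  open FiniteRings
  open Residues
  open Operators
  open Tower

  private
    opaque
      unfolding _+_ _*_ -_
      *-reassoc : ∀ a b c → a * (b * c) ≡ a * b * c
      *-reassoc = solve-∀
      cancel-sum : ∀ a b c → a - b - c + (b + c) ≡ a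
      cancel-sum = solve-∀
      2q-q-q≡0 : ∀ q → + 2 * q - q - q ≡ 0ℤ
      2q-q-q≡0 = solve-∀
      minus-sum : ∀ a b c → a - (b + c) ≡ a - b - c
      minus-sum = solve-∀

  term≤∑ : (A : FinSet) {f : ∣ A ∣ → ℤ} → (∀ x → 0ℤ ≤ f x) → ∀ a → f a ≤ ∑ A f
  term≤∑ A {f} f≥0 a = subst (_≤ ∑ A f) (∑-δ A a f) (∑-mono A each)
    where
    each : ∀ x → [ FinSet._≟_ A x a ] * f x ≤ f x
    each x = subst ([ FinSet._≟_ A x a ] * f x ≤_) (Int.*-identityˡ (f x)) (Int.*-monoʳ (f≥0 x) ([]-≤1 (FinSet._≟_ A x a)))

  ∑≡0⇒≡0 : (A : FinSet) {f : ∣ A ∣ → ℤ} → (∀ x → 0ℤ ≤ f x) → ∑ A f ≡ 0ℤ → ∀ a → f a ≡ 0ℤ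
  ∑≡0⇒≡0 A {f} f≥0 e a = Int.≤-antisym (subst (f a ≤_) e (term≤∑ A f≥0 a)) (f≥0 a)

  module _ (p′ : ℕ) (pr : Prime (suc p′)) where
    private
      p = suc p′
      𝑭ₚ = ℤ/ p
      module Fₚ = Ring 𝑭ₚ

    module LevelOperator {n : ℕ} (𝓛 : Level p′ pr n) where
      open Level 𝓛
      open Ring ring
      open Operator 𝑭ₚ set

      f : R → R
      f x = x ⊕ c · inv x

      U : R → ℤ
      U x = [ unit? x ]

      X : (Fin p → ℤ) → Fin p → ℤ
      X = op (λ x → Tr (f x)) U

      Tr-𝟘 : Tr 𝟘 ≡ Fₚ.𝟘
      Tr-𝟘 = Fₚ.⊕-cancelʳ (Tr 𝟘) (trans (sym (Tr-⊕ 𝟘 𝟘)) (trans (cong Tr (+-identityˡ 𝟘)) (sym (Fₚ.+-identityˡ _))))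

      Tr-⊝ : ∀ z → Tr (⊝ z) ≡ Fₚ.⊝ Tr z
      Tr-⊝ z = Fₚ.⊕-cancelʳ (Tr z) (trans (sym (Tr-⊕ (⊝ z) z)) (trans (cong Tr (-‿inverseˡ z)) (trans Tr-𝟘 (sym (Fₚ.-‿inverseˡ _)))))

      U-neg : ∀ x → U (⊝ x) ≡ U x
      U-neg x = []-cong (unit? (⊝ x)) (unit? x) (λ u → subst Unit (solve 1 (λ x → :- (:- x) := x) refl x) (unit-neg u)) unit-neg

      -- The function x + c / x is odd, and x ↦ -x permutes the units.
      X-selfAdjoint : ∀ v w → inner Fₚ.set (X v) w ≡ inner Fₚ.set v (X w)
      X-selfAdjoint v w = trans (op-adjoint (λ x → Tr (f x)) U v w) (∑-cong Fₚ.set λ s → cong (v s *_) (begin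
        ∑[ x ∈ set ] (U x * w (s Fₚ.⊕ Fₚ.⊝ Tr (f x)))
          ≡⟨ ∑-cong set (λ x → trans ([]-subst (unit? x) (λ u → cong (λ t → w (s Fₚ.⊕ t)) (trans (sym (Tr-⊝ (f x))) (cong Tr (f-neg u)))))
               (cong (_* w (s Fₚ.⊕ Tr (f (⊝ x)))) (sym (U-neg x)))) ⟩
        ∑[ x ∈ set ] (U (⊝ x) * w (s Fₚ.⊕ Tr (f (⊝ x))))
          ≡⟨ ∑-negate (λ x → U x * w (s Fₚ.⊕ Tr (f x))) ⟩
        ∑[ x ∈ set ] (U x * w (s Fₚ.⊕ Tr (f x))) ∎))
        where
        f-neg : ∀ {x} → Unit x → ⊝ f x ≡ f (⊝ x)
        f-neg {x} u = trans (solve 3 (λ x c i → :- (x :+ c :* i) := (:- x) :+ c :* (:- i)) refl x c (inv x)) (cong (λ w → ⊝ x ⊕ c · w) (sym (inv-neg u)))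

      -- The trace takes all values equally often; the factor p makes `Tr-count` applicable.
      ∑-Tr : ∀ v → ∑ Fₚ.set v ≡ 0ℤ → ∀ s → ∑[ h ∈ set ] v (s Fₚ.⊕ Tr h) ≡ 0ℤ
      ∑-Tr v v≡0 s = Int.*-cancel-≡0 (Int.+>0 p) (begin
        + p * (∑[ h ∈ set ] v (s Fₚ.⊕ Tr h))
          ≡⟨ cong (+ p *_) (∑-fibre set Fₚ.set Tr (λ t → v (s Fₚ.⊕ t))) ⟩
        + p * (∑[ t ∈ Fₚ.set ] ((∑[ h ∈ set ] [ Tr h Fₚ.≟ t ]) * v (s Fₚ.⊕ t)))
          ≡⟨ sym (∑-*ˡ Fₚ.set (+ p) _) ⟩
        ∑[ t ∈ Fₚ.set ] (+ p * ((∑[ h ∈ set ] [ Tr h Fₚ.≟ t ]) * v (s Fₚ.⊕ t)))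
          ≡⟨ ∑-cong Fₚ.set (λ t → trans (*-reassoc (+ p) _ _) (cong (_* v (s Fₚ.⊕ t)) (Tr-count t))) ⟩
        ∑[ t ∈ Fₚ.set ] (+ (p ℕ.^ n) * v (s Fₚ.⊕ t))
          ≡⟨ ∑-*ˡ Fₚ.set (+ (p ℕ.^ n)) _ ⟩
        + (p ℕ.^ n) * (∑[ t ∈ Fₚ.set ] v (s Fₚ.⊕ t))
          ≡⟨ cong (+ (p ℕ.^ n) *_) (trans (Fₚ.∑-shiftˡ s v) v≡0) ⟩
        + (p ℕ.^ n) * 0ℤ
          ≡⟨ Int.*-zeroʳ _ ⟩
        0ℤ ∎)

    module _ (h₀ : ℕ) (odd : p ≡ suc (h₀ ℕ.+ h₀)) {n : ℕ} (n≥1 : 1 ℕ.≤ n) (𝓛 : Level p′ pr n) where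
      open Level 𝓛
      open Ring ring
      open Field ring isField
      open LevelProperties p′ pr h₀ odd n≥1 𝓛 using (δ; δ≢0; nonsquare; double; 𝑬; normE; norm-zero; conj-inverse; E-isField; module E)
      open LevelOperator 𝓛
      private
        module XE = LevelOperator double
        open Polynomials ring isField using (Mon; Mon-+Pol; Mon-X^; Pol-scale; Mon⇒Pol; one; roots)

        sq-count : R → ℤ
        sq-count D = ∑[ u ∈ set ] [ u · u ≟ D ]

        nsq-count : R → ℤ
        nsq-count D = ∑[ w ∈ set ] [ δ · (w · w) ≟ D ]

        sq-zero : ∀ {u} → u · u ≡ 𝟘 → u ≡ 𝟘
        sq-zero {u} e with u ≟ 𝟘
        ... | yes z = z
        ... | no nz = ⊥-elim (·-nonzero nz nz e)

        sq-count≤2 : ∀ D → sq-count D ≤ + 2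
        sq-count≤2 D = Int.≤-trans (∑-mono set λ u → []-mono (u · u ≟ D) (u ^ 2 ⊕ ⊝ D · 𝟙 ≟ 𝟘) λ e → trans (cong₂ _⊕_ (trans (cong (u ·_) (*-identityʳ u)) e) (*-identityʳ _)) (-‿inverseʳ D))
          (roots {2} {λ u → u ^ 2 ⊕ ⊝ D · 𝟙} (Mon-+Pol (s≤s z≤n) (Mon-X^ 2) (Pol-scale (⊝ D) (Mon⇒Pol (one (λ _ → refl))))))

        nsq-count≤2 : ∀ D → nsq-count D ≤ + 2
        nsq-count≤2 D = subst (_≤ + 2) (∑-cong set λ w → []-cong (w · w ≟ inv δ · D) (δ · (w · w) ≟ D)
            (λ e → trans (cong (δ ·_) e) (trans (sym (*-assoc δ (inv δ) D)) (trans (cong (_· D) (nonzero⇒unit δ≢0)) (*-identityˡ D))))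
            (λ e → unit-cancelˡ (nonzero⇒unit δ≢0) (trans e (sym (trans (sym (*-assoc δ (inv δ) D)) (trans (cong (_· D) (nonzero⇒unit δ≢0)) (*-identityˡ D)))))))
          (sq-count≤2 (inv δ · D))

        -- For D = 0 both counts are 1. Otherwise D cannot be both u² and δ w², by `norm-zero`, so
        -- one count is 0 and the other counts the roots of a quadratic polynomial.
        counts≤2 : ∀ D → sq-count D + nsq-count D ≤ + 2
        counts≤2 D = by-cases (D ≟ 𝟘) (search set (λ u → u · u ≟ D))
          where
          by-cases : Dec (D ≡ 𝟘) → Dec (∃ λ u → u · u ≡ D) → sq-count D + nsq-count D ≤ + 2
          by-cases (yes refl) _ = Int.≤-reflexive (trans (cong₂ _+_
            (trans (∑-cong set λ u → []-cong (u · u ≟ 𝟘) (u ≟ 𝟘) sq-zero (λ { refl → zeroˡ 𝟘 })) (∑-once set 𝟘))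
            (trans (∑-cong set λ w → []-cong (δ · (w · w) ≟ 𝟘) (w ≟ 𝟘) (λ e → sq-zero (unit-cancelˡ (nonzero⇒unit δ≢0) (trans e (sym (zeroʳ δ))))) (λ { refl → trans (cong (δ ·_) (zeroˡ 𝟘)) (zeroʳ δ) })) (∑-once set 𝟘)))
            (sym (Int.pos-+ 1 1)))
          by-cases (no D≢0) (yes (u , u²≡D)) = subst (_≤ + 2) (sym (trans (cong₂ _+_ refl (∑-≡0 set λ w → []-no (δ · (w · w) ≟ D) (none w))) (Int.+-identityʳ _))) (sq-count≤2 D)
            where
            none : ∀ w → ¬ δ · (w · w) ≡ D
            none w e = D≢0 (trans (sym e) (trans (cong (λ t → δ · (t · t)) w≡0) (trans (cong (δ ·_) (zeroˡ 𝟘)) (zeroʳ δ))))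
              where
              w≡0 : w ≡ 𝟘
              w≡0 = ,-injectiveʳ (norm-zero u w (≡⇒⊖≡𝟘 (trans u²≡D (sym e))))
          by-cases (no _) (no none) = subst (_≤ + 2) (sym (trans (cong₂ _+_ (∑-≡0 set λ u → []-no (u · u ≟ D) (λ e → none (u , e))) refl) (Int.+-identityˡ _))) (nsq-count≤2 D)

        ∑-counts : ∀ (φ : R → R) → ∑[ D ∈ set ] (∑[ u ∈ set ] [ φ u ≟ D ]) ≡ card set
        ∑-counts φ = trans (∑-swap set set _) (∑-cong set λ u → ∑-δ″ set (φ u))

        -- Both sides have the same sum over all D, so no inequality in `counts≤2` can be strict.
        counts≡2 : ∀ D → sq-count D + nsq-count D ≡ + 2
        counts≡2 D = trans (sym (trans (cong₂ _+_ gap≡0 refl) (Int.+-identityˡ _))) (cancel-sum (+ 2) (sq-count D) (nsq-count D))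
          where
          gap : R → ℤ
          gap D = + 2 - sq-count D - nsq-count D
          gap≡0 : gap D ≡ 0ℤ
          gap≡0 = ∑≡0⇒≡0 set (λ D → subst (0ℤ ≤_) (minus-sum (+ 2) (sq-count D) (nsq-count D)) (Int.≤⇒0≤- (counts≤2 D)))
            (trans (∑-- set _ _) (trans (cong₂ _-_ (trans (∑-- set _ _) (cong₂ _-_ (trans (∑-const set (+ 2)) (Int.*-comm _ _)) (∑-counts (λ u → u · u)))) (∑-counts (λ w → δ · (w · w)))) (2q-q-q≡0 (card set)))) D

        -- Every element is a square or δ times a square, with two representations in all.
        ∑-squares : ∀ (g : R → ℤ) → (∑[ u ∈ set ] g (u · u)) + (∑[ w ∈ set ] g (δ · (w · w))) ≡ + 2 * ∑ set g
        ∑-squares g = begin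
          (∑[ u ∈ set ] g (u · u)) + (∑[ w ∈ set ] g (δ · (w · w)))
            ≡⟨ cong₂ _+_ (∑-fibre set set _ g) (∑-fibre set set _ g) ⟩
          (∑[ D ∈ set ] (sq-count D * g D)) + (∑[ D ∈ set ] (nsq-count D * g D))
            ≡⟨ sym (∑-+ set _ _) ⟩
          ∑[ D ∈ set ] (sq-count D * g D + nsq-count D * g D)
            ≡⟨ ∑-cong set (λ D → trans (sym (Int.*-distribʳ-+ (g D) (sq-count D) (nsq-count D))) (cong (_* g D) (counts≡2 D))) ⟩
          ∑[ D ∈ set ] (+ 2 * g D)
            ≡⟨ ∑-*ˡ set (+ 2) g ⟩
          + 2 * ∑ set g ∎

        Unit-·⇒ : ∀ x y → [ unit? x ] * [ unit? y ] ≡ [ unit? (x · y) ]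
        Unit-·⇒ x y = []-× (unit? x) (unit? y) (unit? (x · y)) (λ { (u , v) → unit-· u v })
          (λ u → unit-factorˡ u , unit-factorˡ (subst Unit (*-comm x y) u))

        -- The substitution x = h + u, y = h - u, invertible because 2 is a unit.
        ∑-sum-difference : ∀ (F : R → R → ℤ) → ∑[ x ∈ set ] ∑[ y ∈ set ] F x y ≡ ∑[ h ∈ set ] ∑[ u ∈ set ] F (h ⊕ u) (h ⊖ u)
        ∑-sum-difference F = begin
          ∑[ x ∈ set ] ∑[ y ∈ set ] F x y
            ≡⟨ ∑-cong set (λ x → sym (∑-shift (⊝ x) (F x))) ⟩
          ∑[ x ∈ set ] ∑[ t ∈ set ] F x (t ⊖ x)
            ≡⟨ ∑-swap set set _ ⟩
          ∑[ t ∈ set ] ∑[ x ∈ set ] F x (t ⊖ x)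
            ≡⟨ sym (∑-scale two-unit (λ t → ∑[ x ∈ set ] F x (t ⊖ x))) ⟩
          ∑[ h ∈ set ] ∑[ x ∈ set ] F x ((𝟙 ⊕ 𝟙) · h ⊖ x)
            ≡⟨ ∑-cong set (λ h → sym (∑-shiftˡ h (λ x → F x ((𝟙 ⊕ 𝟙) · h ⊖ x)))) ⟩
          ∑[ h ∈ set ] ∑[ u ∈ set ] F (h ⊕ u) ((𝟙 ⊕ 𝟙) · h ⊖ (h ⊕ u))
            ≡⟨ ∑-cong set (λ h → ∑-cong set λ u → cong (F (h ⊕ u)) (trans (cong (_⊖ (h ⊕ u)) (trans (distribʳ h 𝟙 𝟙) (cong₂ _⊕_ (*-identityˡ h) (*-identityˡ h))))
                 (solve 2 (λ h u → h :+ h :- (h :+ u) := h :- u) refl h u))) ⟩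
          ∑[ h ∈ set ] ∑[ u ∈ set ] F (h ⊕ u) (h ⊖ u) ∎

        module _ (v : Fin p → ℤ) (s : Fin p) where
          -- The value of x + c / x + y + c / y when x + y = 2 h and x y = m, whether x and y lie in
          -- the field or are conjugate over it.
          slope : R → R → R
          slope h m = h ⊕ h ⊕ (h ⊕ h) · (c · inv m)

          Φ : R → R → ℤ
          Φ h m = U m * v (s Fₚ.⊕ Tr (slope h m))

          XX : X (X v) s ≡ ∑[ h ∈ set ] ∑[ u ∈ set ] Φ h (h · h ⊖ u · u)
          XX = begin
            ∑[ x ∈ set ] (U x * (∑[ y ∈ set ] (U y * v (s Fₚ.⊕ Tr (f x) Fₚ.⊕ Tr (f y)))))
              ≡⟨ ∑-cong set (λ x → trans (sym (∑-*ˡ set (U x) _)) (∑-cong set λ y → trans (*-reassoc (U x) (U y) _) (cong (_* v (s Fₚ.⊕ Tr (f x) Fₚ.⊕ Tr (f y))) (Unit-·⇒ x y)))) ⟩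
            ∑[ x ∈ set ] ∑[ y ∈ set ] (U (x · y) * v (s Fₚ.⊕ Tr (f x) Fₚ.⊕ Tr (f y)))
              ≡⟨ ∑-sum-difference (λ x y → U (x · y) * v (s Fₚ.⊕ Tr (f x) Fₚ.⊕ Tr (f y))) ⟩
            ∑[ h ∈ set ] ∑[ u ∈ set ] (U ((h ⊕ u) · (h ⊖ u)) * v (s Fₚ.⊕ Tr (f (h ⊕ u)) Fₚ.⊕ Tr (f (h ⊖ u))))
              ≡⟨ ∑-cong set (λ h → ∑-cong set λ u → trans ([]-subst (unit? ((h ⊕ u) · (h ⊖ u))) (λ U′ → cong v (step h u U′)))
                   (cong (Φ h) (solve 2 (λ h u → (h :+ u) :* (h :- u) := h :* h :- u :* u) refl h u))) ⟩
            ∑[ h ∈ set ] ∑[ u ∈ set ] Φ h (h · h ⊖ u · u) ∎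
            where
            step : ∀ h u → Unit ((h ⊕ u) · (h ⊖ u)) → s Fₚ.⊕ Tr (f (h ⊕ u)) Fₚ.⊕ Tr (f (h ⊖ u)) ≡ s Fₚ.⊕ Tr (slope h ((h ⊕ u) · (h ⊖ u)))
            step h u U′ = trans (Fₚ.+-assoc s _ _) (cong (s Fₚ.⊕_) (trans (sym (Tr-⊕ _ _)) (cong Tr (begin
              x ⊕ c · inv x ⊕ (y ⊕ c · inv y)
                ≡⟨ cong₂ (λ a b → x ⊕ c · a ⊕ (y ⊕ c · b)) (sym (trans (cong (_· inv x) uy) (*-identityˡ _))) (sym (trans (cong (_· inv y) ux) (*-identityˡ _))) ⟩
              x ⊕ c · (y · inv y · inv x) ⊕ (y ⊕ c · (x · inv x · inv y))
                ≡⟨ solve 5 (λ x y c i j → x :+ c :* (y :* j :* i) :+ (y :+ c :* (x :* i :* j)) := (x :+ y) :+ (x :+ y) :* (c :* (i :* j))) refl x y c (inv x) (inv y) ⟩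
              (x ⊕ y) ⊕ (x ⊕ y) · (c · (inv x · inv y))
                ≡⟨ cong₂ (λ a b → a ⊕ a · (c · b)) (solve 2 (λ h u → h :+ u :+ (h :- u) := h :+ h) refl h u) (sym (inv-· ux uy)) ⟩
              slope h (x · y) ∎))))
              where
              x = h ⊕ u
              y = h ⊖ u
              ux : Unit x
              ux = unit-factorˡ U′
              uy : Unit y
              uy = unit-factorˡ (subst Unit (*-comm x y) U′)

          unitE⇒ : ∀ h w → E.Unit (h , w) → Unit (normE h w)
          unitE⇒ h w u = nonzero⇒unit λ e → Field.unit⇒nonzero 𝑬 E-isField u (norm-zero h w e)

          invE : ∀ h w → Unit (normE h w) → E.inv (h , w) ≡ (h · inv (normE h w) , ⊝ w · inv (normE h w))
          invE h w u = E.inv-unique (conj-inverse h w u)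

          stepE : ∀ h w i → h ⊕ (c · (h · i) ⊕ δ · (𝟘 · (⊝ w · i))) ⊕ (h ⊕ (c · (h · i) ⊕ δ · (𝟘 · (⊝ w · i)))) ≡ h ⊕ h ⊕ (h ⊕ h) · (c · i)
          stepE h w i = solve 5 (λ h w c i δ → h :+ (c :* (h :* i) :+ δ :* (con (+ 0) :* ((:- w) :* i))) :+ (h :+ (c :* (h :* i) :+ δ :* (con (+ 0) :* ((:- w) :* i))))
                 := h :+ h :+ (h :+ h) :* (c :* i)) refl h w c i δ

          traceE : ∀ h w → Unit (normE h w) → proj₁ (XE.f (h , w)) ⊕ proj₁ (XE.f (h , w)) ≡ slope h (normE h w)
          traceE h w u = trans (cong (λ z → (h ⊕ (c · proj₁ z ⊕ δ · (𝟘 · proj₂ z))) ⊕ (h ⊕ (c · proj₁ z ⊕ δ · (𝟘 · proj₂ z)))) (invE h w u)) (stepE h w (inv (normE h w)))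

          UE : ∀ h w → XE.U (h , w) ≡ U (normE h w)
          UE h w = []-cong (E.unit? (h , w)) (unit? (normE h w)) (unitE⇒ h w) (λ u → E.toUnit (conj-inverse h w u))

          termE : ∀ h w → XE.U (h , w) * v (s Fₚ.⊕ Level.Tr double (XE.f (h , w))) ≡ Φ h (normE h w)
          termE h w = trans (cong (λ t → t * v (s Fₚ.⊕ Tr (proj₁ (XE.f (h , w)) ⊕ proj₁ (XE.f (h , w))))) (UE h w))
            ([]-subst (unit? (normE h w)) (λ u → cong (λ t → v (s Fₚ.⊕ Tr t)) (traceE h w u)))

          XEv : XE.X v s ≡ ∑[ h ∈ set ] ∑[ w ∈ set ] Φ h (normE h w)
          XEv = trans (∑-⊗ set set (λ z → XE.U z * v (s Fₚ.⊕ Level.Tr double (XE.f z)))) (∑-cong set λ h → ∑-cong set λ w → termE h w)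

          module _ (v≡0 : ∑ Fₚ.set v ≡ 0ℤ) where
            -- The slope is 2 (1 + c / m) h. Unless m = -c the coefficient of h is invertible, so
            -- the sum runs over the whole field and vanishes by `∑-Tr`.
            slope-sum : ∀ m → Unit m → ∑[ h ∈ set ] v (s Fₚ.⊕ Tr (slope h m)) ≡ [ m ≟ ⊝ c ] * (card set * v s)
            slope-sum m u = by-cases (m ≟ ⊝ c)
              where
              κ = (𝟙 ⊕ 𝟙) · (𝟙 ⊕ c · inv m)
              slope≡ : ∀ h → slope h m ≡ κ · h
              slope≡ h = sym (trans (cong (_· h) (distribʳ _ 𝟙 𝟙)) (trans (cong (λ t → (t ⊕ t) · h) (*-identityˡ _)) (trans
                (solve 3 (λ o k h → (o :+ k :+ (o :+ k)) :* h := o :* h :+ o :* h :+ (h :+ h) :* k) refl 𝟙 (c · inv m) h)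
                (cong (λ t → t ⊕ t ⊕ (h ⊕ h) · (c · inv m)) (*-identityˡ h)))))
              by-cases : (d : Dec (m ≡ ⊝ c)) → ∑[ h ∈ set ] v (s Fₚ.⊕ Tr (slope h m)) ≡ [ d ] * (card set * v s)
              by-cases (yes refl) = trans (∑-cong set λ h → cong v (trans (cong (λ t → s Fₚ.⊕ Tr t) (trans (slope≡ h) (trans (cong (_· h) κ≡0) (zeroˡ h))))
                  (trans (cong (s Fₚ.⊕_) Tr-𝟘) (Fₚ.+-identityʳ s)))) (trans (∑-const set (v s)) (sym (Int.*-identityˡ _)))
                where
                κ≡0 : κ ≡ 𝟘
                κ≡0 = trans (cong ((𝟙 ⊕ 𝟙) ·_) (trans (cong (λ t → 𝟙 ⊕ c · t) (inv-neg c-unit)) (trans (cong (𝟙 ⊕_) (solve 2 (λ c i → c :* (:- i) := :- (c :* i)) refl c (inv c)))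
                  (trans (cong (λ t → 𝟙 ⊕ ⊝ t) c-unit) (-‿inverseʳ 𝟙))))) (zeroʳ _)
              by-cases (no m≢) = trans (∑-cong set λ h → cong (λ t → v (s Fₚ.⊕ Tr t)) (slope≡ h)) (trans (∑-scale (unit-· two-unit (nonzero⇒unit κ′≢0)) (λ h → v (s Fₚ.⊕ Tr h)))
                  (trans (∑-Tr v v≡0 s) (sym (Int.*-zeroˡ _))))
                where
                κ′≢0 : ¬ 𝟙 ⊕ c · inv m ≡ 𝟘
                κ′≢0 e = m≢ (⊖≡𝟘⇒≡ (begin
                  m ⊖ ⊝ c                    ≡⟨ solve 2 (λ m c → m :- (:- c) := m :+ c) refl m c ⟩
                  m ⊕ c                      ≡⟨ cong₂ _⊕_ (sym (*-identityʳ m)) (sym (trans (cong (c ·_) u) (*-identityʳ c))) ⟩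
                  m · 𝟙 ⊕ c · (m · inv m)    ≡⟨ solve 4 (λ m o c i → m :* o :+ c :* (m :* i) := m :* (o :+ c :* i)) refl m 𝟙 c (inv m) ⟩
                  m · (𝟙 ⊕ c · inv m)        ≡⟨ trans (cong (m ·_) e) (zeroʳ m) ⟩
                  𝟘 ∎))

            -- When the sum over h is taken first, only the norm m = -c survives.
            Φ-total : ∑[ h ∈ set ] ∑[ D ∈ set ] Φ h (h · h ⊖ D) ≡ card set * v s
            Φ-total = begin
              ∑[ h ∈ set ] ∑[ D ∈ set ] Φ h (h · h ⊖ D)
                ≡⟨ ∑-cong set (λ h → ∑-reindex set set (λ D → h · h ⊖ D) (λ D → h · h ⊖ D) (λ D → solve 2 (λ a D → a :- (a :- D) := D) refl (h · h) D) (λ D → solve 2 (λ a D → a :- (a :- D) := D) refl (h · h) D) (Φ h)) ⟩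
              ∑[ h ∈ set ] ∑[ m ∈ set ] Φ h m
                ≡⟨ ∑-swap set set _ ⟩
              ∑[ m ∈ set ] ∑[ h ∈ set ] (U m * v (s Fₚ.⊕ Tr (slope h m)))
                ≡⟨ ∑-cong set (λ m → trans (∑-*ˡ set (U m) _) ([]-subst (unit? m) (slope-sum m))) ⟩
              ∑[ m ∈ set ] (U m * ([ m ≟ ⊝ c ] * (card set * v s)))
                ≡⟨ ∑-cong set (λ m → trans (*-reassoc (U m) _ _) (cong (_* (card set * v s)) ([]-× (unit? m) (m ≟ ⊝ c) (m ≟ ⊝ c) proj₂ (λ { refl → unit-neg c-unit , refl })))) ⟩
              ∑[ m ∈ set ] ([ m ≟ ⊝ c ] * (card set * v s))
                ≡⟨ ∑-δ set (⊝ c) (λ _ → card set * v s) ⟩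
              card set * v s ∎

      -- Both X² and the operator of the quadratic extension are sums over pairs with a given half-trace
      -- h and norm h² - D, where D = u² for x, y = h ± u and D = δ w² for z = h + w √δ.
      doubling : ∀ v → ∑ Fₚ.set v ≡ 0ℤ → ∀ s → X (X v) s + XE.X v s ≡ + 2 * (+ (p ℕ.^ n) * v s)
      doubling v v≡0 s = begin
        X (X v) s + XE.X v s
          ≡⟨ cong₂ _+_ (XX v s) (XEv v s) ⟩
        (∑[ h ∈ set ] ∑[ u ∈ set ] Φ v s h (h · h ⊖ u · u)) + (∑[ h ∈ set ] ∑[ w ∈ set ] Φ v s h (h · h ⊖ δ · (w · w)))
          ≡⟨ sym (∑-+ set _ _) ⟩
        ∑[ h ∈ set ] ((∑[ u ∈ set ] Φ v s h (h · h ⊖ u · u)) + (∑[ w ∈ set ] Φ v s h (h · h ⊖ δ · (w · w))))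
          ≡⟨ ∑-cong set (λ h → ∑-squares (λ D → Φ v s h (h · h ⊖ D))) ⟩
        ∑[ h ∈ set ] (+ 2 * (∑[ D ∈ set ] Φ v s h (h · h ⊖ D)))
          ≡⟨ trans (∑-*ˡ set (+ 2) _) (cong (+ 2 *_) (trans (Φ-total v s v≡0) (cong (_* v s) card≡))) ⟩
        + 2 * (+ (p ℕ.^ n) * v s) ∎

-- The bound for the one-dimensional operator modulo an odd prime.

module PrimeBound where
  open import Data.Fin using (Fin)
  open import Data.Nat.Primality using (Prime)
  open ≡-Reasoning
  open Int using (ℤ; +_; -[1+_]; 0ℤ; 1ℤ; _≤_; _<_; _+_; _*_; -_; _-_; solve-∀)
  open FiniteSums
  open FiniteRings
  open Residues
  open Operators
  open Tower
  open Doubling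

  private
    opaque
      unfolding _+_ _*_ -_
      *-reassoc : ∀ a b c → a * b * c ≡ a * (b * c)
      *-reassoc = solve-∀
      square-minus : ∀ a b → (a - b) * (a - b) ≡ a * a + b * b - + 2 * (b * a)
      square-minus = solve-∀
      double-minus : ∀ n c → n + n - + 2 * c ≡ + 2 * (n - c)
      double-minus = solve-∀
      *-distrib-minus : ∀ u n c → u * (n - c) ≡ u * n - u * c
      *-distrib-minus = solve-∀
      upper-alg : ∀ Q P p N I K → K ≡ (Q * P + + 3 * Q) * (p * N) → p * P ≡ Q → (Q * Q - 1ℤ) * N - I ≤ K → - I ≤ N * (+ 3 * p * Q + 1ℤ)
      upper-alg Q P p N I K refl pP h = subst₂ _≤_ (lhs Q N I) (rhs Q P p N pP) (Int.+-mono-≤ h (Int.≤-refl { - ((Q * Q - 1ℤ) * N)}))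
        where
        lhs : ∀ Q N I → (Q * Q - 1ℤ) * N - I + - ((Q * Q - 1ℤ) * N) ≡ - I
        lhs = solve-∀
        rhs′ : ∀ Q pP p N → (Q * pP + + 3 * Q * p) * N + - ((Q * Q - 1ℤ) * N) ≡ N * (+ 3 * p * Q + 1ℤ) + Q * (pP - Q) * N
        rhs′ = solve-∀
        reassoc : ∀ Q P p N → (Q * P + + 3 * Q) * (p * N) ≡ (Q * (p * P) + + 3 * Q * p) * N
        reassoc = solve-∀
        zz : ∀ Q N → Q * (Q - Q) * N ≡ 0ℤ
        zz = solve-∀
        rhs : ∀ Q P p N → p * P ≡ Q → (Q * P + + 3 * Q) * (p * N) + - ((Q * Q - 1ℤ) * N) ≡ N * (+ 3 * p * Q + 1ℤ)
        rhs Q P p N e = trans (cong (_+ - ((Q * Q - 1ℤ) * N)) (reassoc Q P p N)) (trans (cong (λ w → (Q * w + + 3 * Q * p) * N + - ((Q * Q - 1ℤ) * N)) e)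
          (trans (rhs′ Q Q p N) (trans (cong (λ w → N * (+ 3 * p * Q + 1ℤ) + w) (zz Q N)) (Int.+-identityʳ _))))

      -- Here -I = w + 2 q N, so I² = w² + 4 q N w + 4 q² N². Dropping w² and dividing by N gives
      -- the claim.
      recurrence-alg : ∀ q N w M M′ I → 0ℤ < N → w ≡ M - + 4 * q * N → I ≡ + 2 * (q * N) - M → I * I ≤ M′ * N → + 4 * q * w ≤ M′ - + 4 * (q * q) * N
      recurrence-alg q N w M M′ I N>0 refl refl h = Int.*-cancel N>0 (Int.≤-trans (Int.≤-via (w′ * w′) (Int.sq≥0 w′) (e₁ q N M)) (subst (w′ * w′ + + 4 * q * N * w′ ≤_) (e₃ q N M′) (Int.≤-trans (Int.≤-reflexive (e₂ q N M)) (Int.+-mono-≤ h (Int.≤-refl { - (+ 4 * (q * q) * N * N)})))))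
        where
        w′ : ℤ
        w′ = M - + 4 * q * N
        e₁ : ∀ q N M → (M - + 4 * q * N) * (M - + 4 * q * N) + + 4 * q * N * (M - + 4 * q * N) - N * (+ 4 * q * (M - + 4 * q * N)) ≡ (M - + 4 * q * N) * (M - + 4 * q * N)
        e₁ = solve-∀
        e₂ : ∀ q N M → (M - + 4 * q * N) * (M - + 4 * q * N) + + 4 * q * N * (M - + 4 * q * N) ≡ (+ 2 * (q * N) - M) * (+ 2 * (q * N) - M) + - (+ 4 * (q * q) * N * N)
        e₂ = solve-∀
        e₃ : ∀ q N M′ → M′ * N + - (+ 4 * (q * q) * N * N) ≡ N * (M′ - + 4 * (q * q) * N)
        e₃ = solve-∀

      weaken-alg : ∀ q N M I p → 0ℤ ≤ q * N → I ≡ + 2 * (q * N) - M → - I ≤ N * (+ 3 * p * q + 1ℤ) → M - + 4 * q * N ≤ N * (+ 3 * p * q + 1ℤ)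
      weaken-alg q N M I p h refl k = Int.≤-trans (Int.≤-via (+ 2 * (q * N)) (Int.*-≥0 (Int.+≥0 2) h) (e q N M)) k
        where
        e : ∀ q N M → - (+ 2 * (q * N) - M) - (M - + 4 * q * N) ≡ + 2 * (q * N)
        e = solve-∀

      final-alg : ∀ p N q A w → 0ℤ < q → 0ℤ ≤ p → 0ℤ ≤ N → A * q ≤ p * w → w ≤ N * (+ 3 * p * q + 1ℤ) → A ≤ p * N * (+ 3 * p + 1ℤ)
      final-alg p N q A w q>0 p≥0 N≥0 h k = Int.*-cancel q>0 (subst (_≤ q * (p * N * (+ 3 * p + 1ℤ))) (Int.*-comm A q) (Int.≤-trans h (Int.≤-trans (Int.*-monoˡ p≥0 k)
          (Int.≤-via (p * N * (q - 1ℤ)) (Int.*-≥0 (Int.*-≥0 p≥0 N≥0) (Int.≤⇒0≤- (Int.<⇒1+≤ q>0))) (e p N q)))))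
        where
        e : ∀ p N q → q * (p * N * (+ 3 * p + 1ℤ)) - p * (N * (+ 3 * p * q + 1ℤ)) ≡ p * N * (q - 1ℤ)
        e = solve-∀

      step-alg : ∀ A q p w W → 0ℤ ≤ q → 0ℤ ≤ p → A * q ≤ p * w → + 4 * q * w ≤ W → + 4 * A * (q * q) ≤ p * W
      step-alg A q p w W q≥0 p≥0 h k = Int.≤-trans (subst₂ _≤_ (e₁ A q) (e₂ p q w) (Int.*-monoˡ (Int.*-≥0 (Int.+≥0 4) q≥0) h)) (Int.*-monoˡ p≥0 k)
        where
        e₁ : ∀ A q → + 4 * q * (A * q) ≡ + 4 * A * (q * q)
        e₁ = solve-∀
        e₂ : ∀ p q w → + 4 * q * (p * w) ≡ p * (+ 4 * q * w)
        e₂ = solve-∀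

      start-alg : ∀ p M N → + 4 * p * N < M → 0ℤ ≤ p → 1ℤ * p ≤ p * (M - + 4 * p * N)
      start-alg p M N h p≥0 = subst (_≤ p * (M - + 4 * p * N)) (Int.*-comm p 1ℤ) (Int.*-monoˡ p≥0 (Int.≤-via (M - (1ℤ + + 4 * p * N)) (Int.≤⇒0≤- (Int.<⇒1+≤ h)) (e p M N)))
        where
        e : ∀ p M N → M - + 4 * p * N - 1ℤ ≡ M - (1ℤ + + 4 * p * N)
        e = solve-∀

  four-powers : ∀ k → k ℕ.< 4 ℕ.^ k
  four-powers zero = s≤s z≤n
  four-powers (suc k) = ℕ.≤-trans (s≤s (four-powers k)) (ℕ.+-monoˡ-≤ (4 ℕ.^ k) (ℕ.m^n>0 4 k) ⟨≤⟩ ℕ.+-monoʳ-≤ (4 ℕ.^ k) (ℕ.m≤m+n (4 ℕ.^ k) _))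
    where
    _⟨≤⟩_ = ℕ.≤-trans

  module _ (p′ : ℕ) (pr : Prime (suc p′)) (h₀ : ℕ) (odd : suc p′ ≡ suc (h₀ ℕ.+ h₀)) (v : Fin (suc p′) → ℤ) (v≡0 : ∑ (FinRing.set (ℤ/ (suc p′))) v ≡ 0ℤ) where
    private
      p = suc p′
      𝑭ₚ = ℤ/ p
      module Fₚ = Ring 𝑭ₚ
      N = norm Fₚ.set v

      p≥3 : 3 ℕ.≤ p
      p≥3 = go h₀ odd (p≥2 p′ pr h₀ odd)
        where
        go : ∀ h → p ≡ suc (h ℕ.+ h) → 2 ℕ.≤ p → 3 ℕ.≤ p
        go zero e (s≤s h) = ⊥-elim (ℕ.<⇒≱ h (ℕ.≤-reflexive (ℕ.suc-injective e)))
        go (suc h) e _ = subst (3 ℕ.≤_) (sym e) (s≤s (s≤s (subst (1 ℕ.≤_) (sym (ℕ.+-suc h h)) (s≤s z≤n))))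

      corr : Fin p → ℤ
      corr t = ∑[ s ∈ Fₚ.set ] (v (s Fₚ.⊕ t) * v s)

      -- Twice this number is the squared norm of v minus its translate by t.
      dev≥0 : ∀ t → 0ℤ ≤ N - corr t
      dev≥0 t = Int.*-cancel {+ 2} (Int.+>0 2) (subst₂ _≤_ (sym (Int.*-zeroʳ (+ 2))) expand (∑-≥0 Fₚ.set λ s → Int.sq≥0 (v s - v (s Fₚ.⊕ t))))
        where
        expand : ∑[ s ∈ Fₚ.set ] ((v s - v (s Fₚ.⊕ t)) * (v s - v (s Fₚ.⊕ t))) ≡ + 2 * (N - corr t)
        expand = trans (∑-cong Fₚ.set λ s → square-minus (v s) (v (s Fₚ.⊕ t))) (trans (∑-- Fₚ.set _ _)
          (trans (cong₂ _-_ (trans (∑-+ Fₚ.set _ _) (cong₂ _+_ refl (Fₚ.∑-shift t (λ s → v s * v s)))) (∑-*ˡ Fₚ.set (+ 2) _)) (double-minus N (corr t))))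

      ∑-corr : ∑ Fₚ.set corr ≡ 0ℤ
      ∑-corr = trans (∑-swap Fₚ.set Fₚ.set _) (∑-≡0 Fₚ.set λ s → trans (∑-*ʳ Fₚ.set (v s) _) (trans (cong (_* v s) (trans (Fₚ.∑-shiftˡ s v) v≡0)) (Int.*-zeroˡ _)))

      module LevelBound {n : ℕ} (𝓛 : Level p′ pr n) where
        open Level 𝓛
        open Ring ring
        open Field ring isField
        open LevelOperator p′ pr 𝓛

        ∑U : ∑ set U ≡ + (p ℕ.^ n) - 1ℤ
        ∑U = trans (∑-cong set each) (trans (∑-- set _ _) (cong₂ _-_ card≡ (∑-once set 𝟘)))
          where
          each : ∀ x → U x ≡ 1ℤ - [ x ≟ 𝟘 ]
          each x = by-cases (x ≟ 𝟘)
            where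
            opaque
              unfolding _+_ _*_ -_
              e₀ : 1ℤ ≡ 1ℤ - 0ℤ
              e₀ = refl
              e₁ : 0ℤ ≡ 1ℤ - 1ℤ
              e₁ = refl
            by-cases : (d : Dec (x ≡ 𝟘)) → U x ≡ 1ℤ - [ d ]
            by-cases (yes e) = trans ([]-no (unit? x) (λ u → unit⇒nonzero u e)) e₁
            by-cases (no ne) = trans ([]-yes (unit? x) (nonzero⇒unit ne)) e₀

        point : Fin p → ℤ
        point t = ∑[ x ∈ set ] (U x * [ Tr (f x) Fₚ.≟ t ])

        I : ℤ
        I = inner Fₚ.set (X v) v

        I≡ : I ≡ ∑[ x ∈ set ] (U x * corr (Tr (f x)))
        I≡ = begin
          ∑[ s ∈ Fₚ.set ] (X v s * v s)
            ≡⟨ ∑-cong Fₚ.set (λ s → trans (sym (∑-*ʳ set (v s) _)) (∑-cong set λ x → *-reassoc (U x) _ (v s))) ⟩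
          ∑[ s ∈ Fₚ.set ] ∑[ x ∈ set ] (U x * (v (s Fₚ.⊕ Tr (f x)) * v s))
            ≡⟨ ∑-swap Fₚ.set set _ ⟩
          ∑[ x ∈ set ] ∑[ s ∈ Fₚ.set ] (U x * (v (s Fₚ.⊕ Tr (f x)) * v s))
            ≡⟨ ∑-cong set (λ x → ∑-*ˡ Fₚ.set (U x) _) ⟩
          ∑[ x ∈ set ] (U x * corr (Tr (f x))) ∎

        deviation-sum : ∑[ t ∈ Fₚ.set ] (point t * (N - corr t)) ≡ (+ (p ℕ.^ n) - 1ℤ) * N - I
        deviation-sum = begin
          ∑[ t ∈ Fₚ.set ] (point t * (N - corr t))
            ≡⟨ ∑-cong Fₚ.set (λ t → trans (sym (∑-*ʳ set (N - corr t) _)) (∑-cong set λ x → *-reassoc (U x) _ _)) ⟩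
          ∑[ t ∈ Fₚ.set ] ∑[ x ∈ set ] (U x * ([ Tr (f x) Fₚ.≟ t ] * (N - corr t)))
            ≡⟨ ∑-swap Fₚ.set set _ ⟩
          ∑[ x ∈ set ] ∑[ t ∈ Fₚ.set ] (U x * ([ Tr (f x) Fₚ.≟ t ] * (N - corr t)))
            ≡⟨ ∑-cong set (λ x → trans (∑-*ˡ Fₚ.set (U x) _) (cong (U x *_) (∑-δ′ Fₚ.set (Tr (f x)) (λ t → N - corr t)))) ⟩
          ∑[ x ∈ set ] (U x * (N - corr (Tr (f x))))
            ≡⟨ trans (∑-cong set λ x → *-distrib-minus (U x) N _) (∑-- set _ _) ⟩
          (∑[ x ∈ set ] (U x * N)) - (∑[ x ∈ set ] (U x * corr (Tr (f x))))
            ≡⟨ cong₂ _-_ (trans (∑-*ʳ set N U) (cong (_* N) ∑U)) (sym I≡) ⟩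
          (+ (p ℕ.^ n) - 1ℤ) * N - I ∎

        -- As v has sum zero, the numbers N - corr t are nonnegative with sum p N. An upper bound
        -- for the point counts therefore becomes a lower bound for I.
        point-bound⇒ : ∀ K → (∀ t → point t ≤ K) → (+ (p ℕ.^ n) - 1ℤ) * N - I ≤ K * (+ p * N)
        point-bound⇒ K h = subst₂ _≤_ deviation-sum total (∑-mono Fₚ.set λ t → Int.*-monoʳ (dev≥0 t) (h t))
          where
          opaque
            unfolding _+_ _*_ -_
            e : ∀ x → x - 0ℤ ≡ x
            e = solve-∀
          total : ∑[ t ∈ Fₚ.set ] (K * (N - corr t)) ≡ K * (+ p * N)
          total = trans (∑-*ˡ Fₚ.set K _) (cong (K *_) (trans (∑-- Fₚ.set _ _) (trans (cong₂ _-_ (trans (∑-const Fₚ.set N) (cong (_* N) (card-ℤ/ p))) ∑-corr) (e _))))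

      module _ {n : ℕ} (n≥1 : 1 ℕ.≤ n) (𝓛 : Level p′ pr n) where
        private
          𝓔 = LevelProperties.double p′ pr h₀ odd n≥1 𝓛
          module XF = LevelOperator p′ pr 𝓛
          module XE = LevelOperator p′ pr 𝓔
          module BE = LevelBound 𝓔
          q = + (p ℕ.^ n)

        M : ℤ
        M = norm Fₚ.set (XF.X v)

        -- The doubling identity paired with v; by self-adjointness the inner product of X² v and v
        -- is the squared norm of X v.
        I≡2qN-M : BE.I ≡ + 2 * (q * N) - M
        I≡2qN-M = begin
          ∑[ s ∈ Fₚ.set ] (XE.X v s * v s)
            ≡⟨ ∑-cong Fₚ.set (λ s → trans (cong (_* v s) (from (doubling p′ pr h₀ odd n≥1 𝓛 v v≡0 s))) (e′ q (v s) (XF.X (XF.X v) s))) ⟩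
          ∑[ s ∈ Fₚ.set ] (+ 2 * q * (v s * v s) - XF.X (XF.X v) s * v s)
            ≡⟨ trans (∑-- Fₚ.set _ _) (cong₂ _-_ (trans (∑-*ˡ Fₚ.set (+ 2 * q) _) (*-reassoc (+ 2) q N)) (XF.X-selfAdjoint (XF.X v) v)) ⟩
          + 2 * (q * N) - M ∎
          where
          opaque
            unfolding _+_ _*_ -_
            from : ∀ {a b d} → a + b ≡ d → b ≡ d - a
            from {a} {b} refl = e a b
              where
              e : ∀ a b → b ≡ a + b - a
              e = solve-∀
            e′ : ∀ q v x → (+ 2 * (q * v) - x) * v ≡ + 2 * q * (v * v) - x * v
            e′ = solve-∀

      -- Stepanov's count is applied in the quadratic extension. Its main term Q P p N = Q² N
      -- cancels against (Q² - 1) N, which leaves an error linear in Q.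
      points : ∀ {n} (n≥1 : 1 ℕ.≤ n) (𝓛 : Level p′ pr n) → - LevelBound.I (LevelProperties.double p′ pr h₀ odd n≥1 𝓛) ≤ N * (+ 3 * + p * + (p ℕ.^ n) + 1ℤ)
      points {suc m′} n≥1 𝓛 = upper-alg (+ Q) (+ P) (+ p) N BE.I _ refl (sym (Int.pos-* p P))
        (subst₂ (λ a b → (a - 1ℤ) * N - BE.I ≤ b * (+ p * N)) q² K≡ (BE.point-bound⇒ (+ (Q ℕ.* P ℕ.+ 3 ℕ.* Q)) bound))
        where
        𝓔 = LevelProperties.double p′ pr h₀ odd n≥1 𝓛
        module BE = LevelBound 𝓔
        module L = Level 𝓔
        open Ring L.ring
        P = p ℕ.^ m′
        Q = p ℕ.^ suc m′
        q²ℕ : p ℕ.^ (suc m′ ℕ.+ suc m′) ≡ Q ℕ.* Q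
        q²ℕ = ℕ.^-distribˡ-+-* p (suc m′) (suc m′)
        q² : + (p ℕ.^ (suc m′ ℕ.+ suc m′)) ≡ + Q * + Q
        q² = trans (cong +_ q²ℕ) (Int.pos-* Q Q)
        K≡ : + (Q ℕ.* P ℕ.+ 3 ℕ.* Q) ≡ + Q * + P + + 3 * + Q
        K≡ = trans (Int.pos-+ (Q ℕ.* P) (3 ℕ.* Q)) (cong₂ _+_ (Int.pos-* Q P) (Int.pos-* 3 Q))
        Q≥3 : 3 ℕ.≤ Q
        Q≥3 = ℕ.≤-trans p≥3 (ℕ.m≤m*n p P {{ℕ.m^n≢0 p m′}})
        bound : ∀ t → BE.point t ≤ + (Q ℕ.* P ℕ.+ 3 ℕ.* Q)
        bound t = subst (_≤ + (Q ℕ.* P ℕ.+ 3 ℕ.* Q)) (∑-cong set λ x → cong ([ unit? x ] *_)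
            ([]-cong (L.tsum (suc m′ ℕ.+ suc m′) (x ⊕ L.c · inv x) ≟ L.ι t) (L.Tr (x ⊕ L.c · inv x) Fₚ.≟ t)
              (λ e → L.ι-injective (trans (L.ι-Tr _) e)) (λ e → trans (sym (L.ι-Tr _)) (cong L.ι e))))
          (S.point-count (λ x → trans (cong (x ^_) (sym q²ℕ)) (L.fermat x)) Q≥3)
          where
          module S = Stepanov.Frobenius.Bound L.ring L.isField p′ (CharP.frobenius L.ring p′ pr L.char) m′ L.c (L.ι t) L.c^p (p≥2 p′ pr h₀ odd)
            (LevelProperties.card≥2 p′ pr h₀ odd {suc m′ ℕ.+ suc m′} (s≤s z≤n) 𝓔)

      module _ (N>0 : 0ℤ < N) where
        -- M is the squared norm of X v. By the doubling identity an excess of M over 4 q N at one level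
        -- is multiplied by at least 4 q at the next, where q is squared; by Stepanov's bound the excess
        -- is at most a constant times q at every level.
        growth : ∀ k {n} (n≥1 : 1 ℕ.≤ n) (𝓛 : Level p′ pr n) A → A * + (p ℕ.^ n) ≤ + p * (M n≥1 𝓛 - + 4 * + (p ℕ.^ n) * N) →
          + (4 ℕ.^ k) * A ≤ + p * N * (+ 3 * + p + 1ℤ)
        growth zero {n} n≥1 𝓛 A h = subst (_≤ + p * N * (+ 3 * + p + 1ℤ)) (sym (Int.*-identityˡ A))
          (final-alg (+ p) N (+ (p ℕ.^ n)) A _ (Int.+>0 (p ℕ.^ n) {{ℕ.m^n≢0 p n}}) (Int.+≥0 p) (Int.<⇒≤ N>0) h
            (weaken-alg (+ (p ℕ.^ n)) N (M n≥1 𝓛) _ (+ p) (Int.*-≥0 (Int.+≥0 (p ℕ.^ n)) (Int.<⇒≤ N>0)) (I≡2qN-M n≥1 𝓛) (points n≥1 𝓛)))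
        growth (suc k) {n} n≥1 𝓛 A h = subst (_≤ + p * N * (+ 3 * + p + 1ℤ)) (trans (reassoc (+ (4 ℕ.^ k)) A) (cong (_* A) (sym (Int.pos-* 4 (4 ℕ.^ k)))))
          (growth k n+n≥1 𝓔 (+ 4 * A)
            (subst (λ r → + 4 * A * r ≤ + p * (M n+n≥1 𝓔 - + 4 * r * N)) (sym q²)
              (step-alg A q (+ p) (M n≥1 𝓛 - + 4 * q * N) (M n+n≥1 𝓔 - + 4 * (q * q) * N) (Int.+≥0 (p ℕ.^ n)) (Int.+≥0 p) h
                (recurrence-alg q N (M n≥1 𝓛 - + 4 * q * N) (M n≥1 𝓛) (M n+n≥1 𝓔) (LevelBound.I 𝓔) N>0
                  refl (I≡2qN-M n≥1 𝓛) (cauchySchwarz Fₚ.set (LevelOperator.X p′ pr 𝓔 v) v)))))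
          where
          𝓔 = LevelProperties.double p′ pr h₀ odd n≥1 𝓛
          q = + (p ℕ.^ n)
          n+n≥1 : 1 ℕ.≤ n ℕ.+ n
          n+n≥1 = ℕ.≤-trans n≥1 (ℕ.m≤m+n n n)
          q² : + (p ℕ.^ (n ℕ.+ n)) ≡ q * q
          q² = trans (cong +_ (ℕ.^-distribˡ-+-* p n n)) (Int.pos-* (p ℕ.^ n) (p ℕ.^ n))
          opaque
            unfolding _+_ _*_ -_
            reassoc : ∀ k A → k * (+ 4 * A) ≡ + 4 * k * A
            reassoc = solve-∀

    module _ (c₀ : Fin p) (c-unit : Fₚ.Unit c₀) where
      open Operator 𝑭ₚ Fₚ.set

      -- If it failed, the integer M - 4 p N would be at least 1, and `growth` would bound all
      -- powers of 4 by one number. The case N = 0 is apart, since the growth argument divides by N.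
      kloosterman-bound : norm Fₚ.set (op (λ x → x Fₚ.⊕ c₀ Fₚ.· Fₚ.inv x) (λ x → [ Fₚ.unit? x ]) v) ≤ + 4 * + p * N
      kloosterman-bound = by-cases (Int._≤?_ N 0ℤ) (Int._≤?_ (M ℕ.≤-refl 𝓑) (+ 4 * + p * N))
        where
        𝓑 : Level p′ pr 1
        𝓑 = base p′ pr h₀ odd c₀ c-unit
        no-bound : ∀ Z → ¬ (∀ k → + (4 ℕ.^ k) * 1ℤ ≤ Z)
        no-bound (+ z) h = ℕ.<⇒≱ (four-powers z) (Int.drop‿+≤+ (subst (_≤ + z) (Int.*-identityʳ _) (h z)))
        no-bound -[1+ z ] h with subst (_≤ -[1+ z ]) (Int.*-identityʳ _) (h 0)
        ... | ()
        by-cases : Dec (N ≤ 0ℤ) → Dec (M ℕ.≤-refl 𝓑 ≤ + 4 * + p * N) → M ℕ.≤-refl 𝓑 ≤ + 4 * + p * N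
        by-cases _ (yes h) = h
        by-cases (yes N≤0) (no _) = Int.≤-trans (op-trivial _ (λ x → [ Fₚ.unit? x ]) (λ x → []-idem (Fₚ.unit? x)) v)
          (Int.≤-reflexive (trans (null _) (sym (null _))))
          where
          null : ∀ S → S * N ≡ 0ℤ
          null S = trans (cong (S *_) (Int.≤-antisym N≤0 (norm≥0 Fₚ.set v))) (Int.*-zeroʳ S)
        by-cases (no N≰0) (no M≰) = ⊥-elim (no-bound _ (λ k → growth (Int.≰⇒> N≰0) k ℕ.≤-refl 𝓑 1ℤ
          (subst (λ r → 1ℤ * + r ≤ + p * (M ℕ.≤-refl 𝓑 - + 4 * + r * N)) (sym (ℕ.^-identityʳ p)) (start-alg (+ p) (M ℕ.≤-refl 𝓑) N (Int.≰⇒> M≰) (Int.+≥0 p)))))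

-- The Radon transform over the lines of the plane and the bound modulo an odd prime.

module Radon where
  open import Data.Fin using (Fin)
  open import Data.Nat.Primality using (Prime)
  open ≡-Reasoning
  open Int using (ℤ; +_; 0ℤ; 1ℤ; _≤_; _+_; _*_; -_; _-_; solve-∀)
  open FiniteSums
  open FiniteRings
  open Residues
  open Operators
  open Tower using (base-isField)
  open PrimeBound

  private
    opaque
      unfolding _+_ _*_ -_
      minus-distrib-* : ∀ u v x → (u - v) * x ≡ u * x - v * x
      minus-distrib-* = solve-∀
      0-minus : ∀ x → 0ℤ - x ≡ - x
      0-minus = solve-∀
      square-neg : ∀ x → (- x) * (- x) ≡ x * x
      square-neg = solve-∀
      0≡1-1 : 0ℤ ≡ 1ℤ - 1ℤ
      0≡1-1 = refl
      1≡1-0 : 1ℤ ≡ 1ℤ - 0ℤ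
      1≡1-0 = refl
      regroup-p : ∀ p n → + 4 * p * (p * n + 0ℤ * 0ℤ) ≡ p * (+ 4 * p * n)
      regroup-p = solve-∀

  module Transform (𝑭 : FinRing) (isField : IsField 𝑭) where
    open Ring 𝑭 renaming (set to F)
    open Field 𝑭 isField

    -- The sum over the line x + k y = z; `line∞` supplies the remaining direction, the horizontal
    -- lines.
    line : (R × R → ℤ) → R → R → ℤ
    line f k z = ∑[ y ∈ F ] f (z ⊖ k · y , y)

    line∞ : (R × R → ℤ) → R → ℤ
    line∞ f y = ∑[ x ∈ F ] f (x , y)

    ∑-line : ∀ f k → ∑ F (line f k) ≡ ∑ (F ⊗ F) f
    ∑-line f k = trans (∑-swap F F _) (trans (∑-cong F λ y → ∑-shift (⊝ (k · y)) (λ z → f (z , y))) (trans (∑-swap F F _) (sym (∑-⊗ F F f))))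

    ∑-line∞ : ∀ f → ∑ F (line∞ f) ≡ ∑ (F ⊗ F) f
    ∑-line∞ f = trans (∑-swap F F _) (sym (∑-⊗ F F f))

    private
      module _ (f : R × R → ℤ) where
        pair : R → R → ℤ
        pair y y′ = ∑[ k ∈ F ] ∑[ z ∈ F ] (f (z ⊖ k · y , y) * f (z ⊖ k · y′ , y′))

        row : R → ℤ
        row y = ∑[ x ∈ F ] (f (x , y) * f (x , y))

        -- Two points on distinct horizontal lines lie on exactly one line x + k y = z.
        pair≡ : ∀ y y′ → pair y y′ + [ y ≟ y′ ] * (line∞ f y * line∞ f y′) ≡ [ y ≟ y′ ] * (card F * row y) + line∞ f y * line∞ f y′
        pair≡ y y′ = by-cases (y ≟ y′)
          where
          by-cases : (d : Dec (y ≡ y′)) → pair y y′ + [ d ] * (line∞ f y * line∞ f y′) ≡ [ d ] * (card F * row y) + line∞ f y * line∞ f y′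
          by-cases (yes refl) = cong₂ _+_ (trans (trans (∑-cong F λ k → ∑-shift (⊝ (k · y)) (λ z → f (z , y) * f (z , y))) (∑-const F (row y))) (sym (Int.*-identityˡ _))) (Int.*-identityˡ _)
          by-cases (no y≢y′) = trans (trans (cong₂ _+_ both (Int.*-zeroˡ _)) (Int.+-identityʳ _)) (sym (trans (cong₂ _+_ (Int.*-zeroˡ _) refl) (Int.+-identityˡ _)))
            where
            d = y ⊖ y′
            unit-d : Unit d
            unit-d = nonzero⇒unit λ e → y≢y′ (⊖≡𝟘⇒≡ e)
            both : pair y y′ ≡ line∞ f y * line∞ f y′
            both = begin
              ∑[ k ∈ F ] ∑[ z ∈ F ] (f (z ⊖ k · y , y) * f (z ⊖ k · y′ , y′))
                ≡⟨ ∑-cong F (λ k → trans (sym (∑-shift (k · y) (λ z → f (z ⊖ k · y , y) * f (z ⊖ k · y′ , y′)))) (∑-cong F λ x → cong₂ (λ a b → f (a , y) * f (b , y′))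
                     (solve 2 (λ x t → x :+ t :- t := x) refl x (k · y)) (solve 4 (λ x k y w → x :+ k :* y :- k :* w := x :+ (y :- w) :* k) refl x k y y′))) ⟩
              ∑[ k ∈ F ] ∑[ x ∈ F ] (f (x , y) * f (x ⊕ d · k , y′))
                ≡⟨ ∑-swap F F _ ⟩
              ∑[ x ∈ F ] ∑[ k ∈ F ] (f (x , y) * f (x ⊕ d · k , y′))
                ≡⟨ ∑-cong F (λ x → trans (∑-*ˡ F (f (x , y)) _) (cong (f (x , y) *_) (trans (∑-scale unit-d (λ t → f (x ⊕ t , y′))) (∑-shiftˡ x (λ t → f (t , y′)))))) ⟩
              ∑[ x ∈ F ] (f (x , y) * line∞ f y′)
                ≡⟨ ∑-*ʳ F (line∞ f y′) _ ⟩
              line∞ f y * line∞ f y′ ∎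

    -- Expanding the squares weights each pair of points by the number of lines through both: one
    -- line for distinct points, card F + 1 for equal ones.
    plancherel : ∀ f → (∑[ k ∈ F ] norm F (line f k)) + norm F (line∞ f) ≡ card F * norm (F ⊗ F) f + ∑ (F ⊗ F) f * ∑ (F ⊗ F) f
    plancherel f = begin
      (∑[ k ∈ F ] norm F (line f k)) + norm F (line∞ f)
        ≡⟨ cong₂ _+_ expand (sym (∑-cong F λ y → ∑-δ′ F y (λ y′ → line∞ f y * line∞ f y′))) ⟩
      (∑[ y ∈ F ] ∑[ y′ ∈ F ] pair f y y′) + (∑[ y ∈ F ] ∑[ y′ ∈ F ] ([ y ≟ y′ ] * (line∞ f y * line∞ f y′)))
        ≡⟨ sym (trans (∑-cong F λ y → ∑-+ F _ _) (∑-+ F _ _)) ⟩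
      ∑[ y ∈ F ] ∑[ y′ ∈ F ] (pair f y y′ + [ y ≟ y′ ] * (line∞ f y * line∞ f y′))
        ≡⟨ ∑-cong F (λ y → ∑-cong F λ y′ → pair≡ f y y′) ⟩
      ∑[ y ∈ F ] ∑[ y′ ∈ F ] ([ y ≟ y′ ] * (card F * row f y) + line∞ f y * line∞ f y′)
        ≡⟨ trans (∑-cong F λ y → ∑-+ F _ _) (∑-+ F _ _) ⟩
      (∑[ y ∈ F ] ∑[ y′ ∈ F ] ([ y ≟ y′ ] * (card F * row f y))) + (∑[ y ∈ F ] ∑[ y′ ∈ F ] (line∞ f y * line∞ f y′))
        ≡⟨ cong₂ _+_ (trans (∑-cong F λ y → ∑-δ′ F y (λ _ → card F * row f y)) (trans (∑-*ˡ F (card F) _) (cong (card F *_) (sym (norm-⊗ F F f)))))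
             (trans (∑-∑-* F F _ _) (cong₂ _*_ (∑-line∞ f) (∑-line∞ f))) ⟩
      card F * norm (F ⊗ F) f + ∑ (F ⊗ F) f * ∑ (F ⊗ F) f ∎
      where
      expand : ∑[ k ∈ F ] norm F (line f k) ≡ ∑[ y ∈ F ] ∑[ y′ ∈ F ] pair f y y′
      expand = begin
        ∑[ k ∈ F ] ∑[ z ∈ F ] (line f k z * line f k z)
          ≡⟨ ∑-cong F (λ k → trans (∑-cong F λ z → sym (∑-∑-* F F _ _)) (trans (∑-swap F F _) (∑-cong F λ y → ∑-swap F F _))) ⟩
        ∑[ k ∈ F ] ∑[ y ∈ F ] ∑[ y′ ∈ F ] ∑[ z ∈ F ] (f (z ⊖ k · y , y) * f (z ⊖ k · y′ , y′))
          ≡⟨ trans (∑-swap F F _) (∑-cong F λ y → ∑-swap F F _) ⟩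
        ∑[ y ∈ F ] ∑[ y′ ∈ F ] pair f y y′ ∎

  module _ (p′ : ℕ) (pr : Prime (suc p′)) (h₀ : ℕ) (odd : suc p′ ≡ suc (h₀ ℕ.+ h₀)) (c : Fin (suc p′)) where
    private
      p = suc p′
      𝑭ₚ = ℤ/ p
      isField = base-isField p′ pr h₀ odd
    open Ring 𝑭ₚ renaming (set to F)
    open Field 𝑭ₚ isField
    open Transform 𝑭ₚ isField
    open Operator (𝑭ₚ ⊗ᴿ 𝑭ₚ) F
    private
      module One = Operator 𝑭ₚ F

      U : R → ℤ
      U x = [ unit? x ]

      X : (R × R → ℤ) → R × R → ℤ
      X = op (λ y → y , c · inv y) U

      X₁ : R → (R → ℤ) → R → ℤ
      X₁ c = One.op (λ x → x ⊕ c · inv x) U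

      -- Translation by (x , c / x) takes the line with parameter z to the one with parameter z + x
      -- + k c / x.
      line-X : ∀ f k z → line (X f) k z ≡ X₁ (k · c) (line f k) z
      line-X f k z = begin
        ∑[ y ∈ F ] ∑[ x ∈ F ] (U x * f (z ⊖ k · y ⊕ x , y ⊕ c · inv x))
          ≡⟨ ∑-swap F F _ ⟩
        ∑[ x ∈ F ] ∑[ y ∈ F ] (U x * f (z ⊖ k · y ⊕ x , y ⊕ c · inv x))
          ≡⟨ ∑-cong F (λ x → trans (∑-*ˡ F (U x) _) (cong (U x *_) (trans (sym (∑-shift (⊝ (c · inv x)) (λ y → f (z ⊖ k · y ⊕ x , y ⊕ c · inv x))))
               (∑-cong F λ y → cong₂ (λ a b → f (a , b))
                 (solve 6 (λ z k y c i x → z :- k :* (y :- c :* i) :+ x := z :+ (x :+ k :* c :* i) :- k :* y) refl z k y c (inv x) x)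
                 (solve 2 (λ y t → y :- t :+ t := y) refl y (c · inv x)))))) ⟩
        ∑[ x ∈ F ] (U x * line f k (z ⊕ (x ⊕ k · c · inv x))) ∎

      -- For the two degenerate directions, k = 0 and the horizontal one, where the shift is x or c
      -- / x alone: the full sum vanishes, and only the term at 0 is missing from it.
      ∑-units : ∀ v → ∑ F v ≡ 0ℤ → ∀ z → ∑[ x ∈ F ] (U x * v (z ⊕ x)) ≡ - v z
      ∑-units v v≡0 z = begin
        ∑[ x ∈ F ] (U x * v (z ⊕ x))
          ≡⟨ ∑-cong F (λ x → trans (cong (_* v (z ⊕ x)) (each x (x ≟ 𝟘))) (trans (minus-distrib-* 1ℤ [ x ≟ 𝟘 ] (v (z ⊕ x))) (cong₂ _-_ (Int.*-identityˡ _) refl))) ⟩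
        ∑[ x ∈ F ] (v (z ⊕ x) - [ x ≟ 𝟘 ] * v (z ⊕ x))
          ≡⟨ trans (∑-- F _ _) (cong₂ _-_ (trans (∑-shiftˡ z v) v≡0) (trans (∑-δ F 𝟘 (λ x → v (z ⊕ x))) (cong v (+-identityʳ z)))) ⟩
        0ℤ - v z
          ≡⟨ 0-minus (v z) ⟩
        - v z ∎
        where
        each : ∀ x (d : Dec (x ≡ 𝟘)) → U x ≡ 1ℤ - [ d ]
        each x (yes e) = trans ([]-no (unit? x) (λ u → unit⇒nonzero u e)) 0≡1-1
        each x (no ne) = trans ([]-yes (unit? x) (nonzero⇒unit ne)) 1≡1-0

      weaken : ∀ v → norm F v ≤ + 4 * + p * norm F v
      weaken v = subst (_≤ + 4 * + p * norm F v) (Int.*-identityˡ _) (Int.*-monoʳ (norm≥0 F v) (subst (1ℤ ≤_) (Int.pos-* 4 p) (Int.+≤+ (s≤s z≤n))))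

      norm-neg : ∀ v w → (∀ z → w z ≡ - v z) → norm F w ≤ + 4 * + p * norm F v
      norm-neg v w h = subst (_≤ + 4 * + p * norm F v) (sym (∑-cong F λ z → trans (cong₂ _*_ (h z) (h z)) (square-neg (v z)))) (weaken v)

    prime-bound : Unit c → ∀ f → ∑ (F ⊗ F) f ≡ 0ℤ → norm (F ⊗ F) (X f) ≤ + 4 * + p * norm (F ⊗ F) f
    prime-bound C f f≡0 = Int.*-cancel (Int.+>0 p) (Int.≤-trans lower (Int.≤-trans (Int.+-mono-≤ (∑-mono F each) each∞) (Int.≤-reflexive upper)))
      where
      -- `plancherel` for X f, with the square of its total dropped.
      lower : + p * norm (F ⊗ F) (X f) ≤ (∑[ k ∈ F ] norm F (line (X f) k)) + norm F (line∞ (X f))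
      lower = subst₂ _≤_ (trans (Int.+-identityʳ _) (cong (_* norm (F ⊗ F) (X f)) (card-ℤ/ p))) (sym (plancherel (X f))) (Int.+-mono-≤ (Int.≤-refl {card F * norm (F ⊗ F) (X f)}) (Int.sq≥0 (∑ (F ⊗ F) (X f))))
      each : ∀ k → norm F (line (X f) k) ≤ + 4 * + p * norm F (line f k)
      each k = subst (_≤ + 4 * + p * norm F (line f k)) (sym (norm-cong F (line-X f k))) (by-cases (k ≟ 𝟘))
        where
        by-cases : Dec (k ≡ 𝟘) → norm F (X₁ (k · c) (line f k)) ≤ + 4 * + p * norm F (line f k)
        by-cases (no k≢0) = kloosterman-bound p′ pr h₀ odd (line f k) (trans (∑-line f k) f≡0) (k · c) (unit-· (nonzero⇒unit k≢0) C)
        by-cases (yes refl) = norm-neg (line f k) _ (λ z → trans (∑-cong F λ x → cong (λ t → U x * line f k (z ⊕ t)) (trans (cong (x ⊕_) (trans (cong (_· inv x) (zeroˡ c)) (zeroˡ _))) (+-identityʳ x)))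
          (∑-units (line f k) (trans (∑-line f k) f≡0) z))
      each∞ : norm F (line∞ (X f)) ≤ + 4 * + p * norm F (line∞ f)
      each∞ = norm-neg (line∞ f) _ (λ z → begin
        ∑[ a ∈ F ] ∑[ x ∈ F ] (U x * f (a ⊕ x , z ⊕ c · inv x))
          ≡⟨ trans (∑-swap F F _) (∑-cong F λ x → trans (∑-*ˡ F (U x) _) (cong (U x *_) (∑-shift x (λ a → f (a , z ⊕ c · inv x))))) ⟩
        ∑[ x ∈ F ] (U x * line∞ f (z ⊕ c · inv x))
          ≡⟨ ∑-hyperbola C (λ _ y → line∞ f (z ⊕ y)) ⟩
        ∑[ y ∈ F ] (U y * line∞ f (z ⊕ y))
          ≡⟨ ∑-units (line∞ f) (trans (∑-line∞ f) f≡0) z ⟩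
        - line∞ f z ∎)
      upper : (∑[ k ∈ F ] (+ 4 * + p * norm F (line f k))) + + 4 * + p * norm F (line∞ f) ≡ + p * (+ 4 * + p * norm (F ⊗ F) f)
      upper = begin
        (∑[ k ∈ F ] (+ 4 * + p * norm F (line f k))) + + 4 * + p * norm F (line∞ f)
          ≡⟨ trans (cong₂ _+_ (∑-*ˡ F (+ 4 * + p) _) refl) (sym (Int.*-distribˡ-+ (+ 4 * + p) _ _)) ⟩
        + 4 * + p * ((∑[ k ∈ F ] norm F (line f k)) + norm F (line∞ f))
          ≡⟨ cong (+ 4 * + p *_) (trans (plancherel f) (cong₂ (λ a b → a * norm (F ⊗ F) f + b * b) (card-ℤ/ p) f≡0)) ⟩
        + 4 * + p * (+ p * norm (F ⊗ F) f + 0ℤ * 0ℤ)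
          ≡⟨ regroup-p (+ p) (norm (F ⊗ F) f) ⟩
        + p * (+ 4 * + p * norm (F ⊗ F) f) ∎

-- Weighted correlations along the hyperbola and their vanishing.

module Primitive (𝑹 : FiniteRings.FinRing) (c : FiniteRings.FinRing.R 𝑹) (C : FiniteRings.Ring.Unit 𝑹 c) where
  open FiniteRings
  open ≡-Reasoning
  open Int using (ℤ; +_; 0ℤ; _<_; _+_; _*_; solve-∀)
  open FiniteSums
  open Operators

  open Ring 𝑹
  private
    module G = Ring (𝑹 ⊗ᴿ 𝑹)
    gset = set ⊗ set

    opaque
      unfolding _+_ _*_
      *-reassoc : ∀ a b x → a * (b * x) ≡ a * b * x
      *-reassoc = solve-∀

  U : R → ℤ
  U y = [ unit? y ]

  vec : R → R × R
  vec y = y , c · inv y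

  open Operator (𝑹 ⊗ᴿ 𝑹) set public using (op; op*)
  open Operator (𝑹 ⊗ᴿ 𝑹) set using (op-adjoint; op-trivial; op-normal; module Vanishing; module Classes)

  X : (R × R → ℤ) → R × R → ℤ
  X = op vec U

  Weight : Set
  Weight = R → R → ℤ

  -- Contains the products X_i* X_j of pieces, by `Z-op`, but its weight may also impose conditions
  -- that link y and y′.
  Z : Weight → (R × R → ℤ) → R × R → ℤ
  Z W f g = ∑[ y ∈ set ] ∑[ y′ ∈ set ] (W y y′ * f (g G.⊖ vec y G.⊕ vec y′))

  Z-cong : ∀ {W W′} → (∀ y y′ → W y y′ ≡ W′ y y′) → ∀ f g → Z W f g ≡ Z W′ f g
  Z-cong e f g = ∑-cong set λ y → ∑-cong set λ y′ → cong (_* f _) (e y y′)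

  Z-op : ∀ s t f g → op* vec s (op vec t f) g ≡ Z (λ y y′ → s y * t y′) f g
  Z-op s t f g = ∑-cong set λ y → trans (sym (∑-*ˡ set (s y) _)) (∑-cong set λ y′ → *-reassoc (s y) (t y′) _)

  -- The hypothesis `divides-ε` says that ε lies in every nonzero principal ideal; in ℤ/pⁿ it is
  -- pⁿ⁻¹.
  module Moves (ε : R) (card>0 : 0ℤ < card gset) (divides-ε : ∀ {Δ} → ¬ Δ ≡ 𝟘 → ∀ x → ∃ λ w → w · Δ ≡ ε · x) where

    κ : R × R → R × R
    κ (x , y) = ε · x , ε · y

    open Vanishing vec gset κ card>0 public using (MeanZero; op-meanZero; invariant⇒0)

    Inv₂ : Weight → Set
    Inv₂ W = ∀ f g x → Z W f (g G.⊕ (𝟘 , ε · x)) ≡ Z W f g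

    -- The substitution y ↦ y + π w, y′ ↦ y′ + π w fixes y′ - y and shifts c / y′ - c / y by w Δ.
    -- As w Δ attains every multiple of ε, the weighted correlation of f is invariant under (0 , ε x).
    module _ (π : R) (Good : R → R → Set) (good? : ∀ y y′ → Dec (Good y y′)) (Δ : R → R → R)
      (good-move : ∀ {y y′} w → Good y y′ → Good (y ⊕ π · w) (y′ ⊕ π · w))
      (move-inverse : ∀ {y y′} w → Good y y′ → c · inv (y′ ⊕ π · w) ⊖ c · inv (y ⊕ π · w) ≡ c · inv y′ ⊖ c · inv y ⊕ w · Δ y y′)
      (Δ-const : ∀ {y y′ z z′} → Good y y′ → Good z z′ → Δ y y′ ≡ Δ z z′)
      (Δ≢0 : ∀ {y y′} → Good y y′ → ¬ Δ y y′ ≡ 𝟘) where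

      move-invariance : Inv₂ (λ y y′ → [ good? y y′ ])
      move-invariance f g x with search (set ⊗ set) (λ { (y , y′) → good? y y′ })
      ... | no none = trans (null _) (sym (null _))
        where
        null : ∀ g → Z (λ y y′ → [ good? y y′ ]) f g ≡ 0ℤ
        null g = ∑-≡0 set λ y → ∑-≡0 set λ y′ → trans (cong (_* _) ([]-no (good? y y′) (λ h → none ((y , y′) , h)))) (Int.*-zeroˡ _)
      ... | yes ((y₀ , y₀′) , good₀) = sym (begin
        ∑[ y ∈ set ] ∑[ y′ ∈ set ] ([ good? y y′ ] * f (g G.⊖ vec y G.⊕ vec y′))
          ≡⟨ sym (trans (∑-cong set λ y → ∑-shift a (λ y′ → [ good? (y ⊕ a) y′ ] * f (g G.⊖ vec (y ⊕ a) G.⊕ vec y′))) (∑-shift a (λ y → ∑[ y′ ∈ set ] ([ good? y y′ ] * f (g G.⊖ vec y G.⊕ vec y′))))) ⟩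
        ∑[ y ∈ set ] ∑[ y′ ∈ set ] ([ good? (y ⊕ a) (y′ ⊕ a) ] * f (g G.⊖ vec (y ⊕ a) G.⊕ vec (y′ ⊕ a)))
          ≡⟨ ∑-cong set (λ y → ∑-cong set λ y′ → trans (cong (_* f (g G.⊖ vec (y ⊕ a) G.⊕ vec (y′ ⊕ a))) ([]-cong (good? (y ⊕ a) (y′ ⊕ a)) (good? y y′) back (good-move w)))
               ([]-subst (good? y y′) (λ h → cong f (shifted h)))) ⟩
        ∑[ y ∈ set ] ∑[ y′ ∈ set ] ([ good? y y′ ] * f (g G.⊕ (𝟘 , ε · x) G.⊖ vec y G.⊕ vec y′)) ∎)
        where
        w : R
        w = proj₁ (divides-ε (Δ≢0 good₀) x)
        a : R
        a = π · w
        back : ∀ {y y′} → Good (y ⊕ a) (y′ ⊕ a) → Good y y′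
        back {y} {y′} h = subst₂ Good (undo y) (undo y′) (good-move (⊝ w) h)
          where
          undo : ∀ y → y ⊕ a ⊕ π · ⊝ w ≡ y
          undo y = solve 3 (λ y p w → y :+ p :* w :+ p :* (:- w) := y) refl y π w
        shifted : ∀ {y y′} → Good y y′ → g G.⊖ vec (y ⊕ a) G.⊕ vec (y′ ⊕ a) ≡ g G.⊕ (𝟘 , ε · x) G.⊖ vec y G.⊕ vec y′
        shifted {y} {y′} h = cong₂ _,_
          (solve 4 (λ g y z a → g :- (y :+ a) :+ (z :+ a) := g :+ con (+ 0) :- y :+ z) refl (proj₁ g) y y′ a)
          (begin
            proj₂ g ⊖ c · inv (y ⊕ a) ⊕ c · inv (y′ ⊕ a)
              ≡⟨ solve 3 (λ g s t → g :- s :+ t := g :+ (t :- s)) refl (proj₂ g) _ _ ⟩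
            proj₂ g ⊕ (c · inv (y′ ⊕ a) ⊖ c · inv (y ⊕ a))
              ≡⟨ cong (proj₂ g ⊕_) (trans (move-inverse w h) (cong (c · inv y′ ⊖ c · inv y ⊕_) (trans (cong (w ·_) (Δ-const h good₀)) (proj₂ (divides-ε (Δ≢0 good₀) x))))) ⟩
            proj₂ g ⊕ (c · inv y′ ⊖ c · inv y ⊕ ε · x)
              ≡⟨ solve 4 (λ g s t e → g :+ (t :- s :+ e) := g :+ e :- s :+ t) refl (proj₂ g) (c · inv y) (c · inv y′) (ε · x) ⟩
            proj₂ g ⊕ ε · x ⊖ c · inv y ⊕ c · inv y′ ∎)

    twist : Weight → Weight
    twist W x x′ = W (c · inv x) (c · inv x′)

    onUnits : Weight → Weight
    onUnits W y y′ = U y * (U y′ * W y y′)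

    swapped : (R × R → ℤ) → R × R → ℤ
    swapped f (a , b) = f (b , a)

    -- The substitution y = c / x exchanges the two coordinates of the hyperbola. Invariance in the
    -- first coordinate is thus invariance in the second for the twisted weight.
    Z-swap : ∀ W f g → Z (onUnits W) f g ≡ Z (onUnits (twist W)) (swapped f) (proj₂ g , proj₁ g)
    Z-swap W f (a , b) = begin
      ∑[ y ∈ set ] ∑[ y′ ∈ set ] (U y * (U y′ * W y y′) * F y (c · inv y) y′ (c · inv y′))
        ≡⟨ ∑-cong set (λ y → pull y (W y) (F y (c · inv y))) ⟩
      ∑[ y ∈ set ] (U y * (∑[ y′ ∈ set ] (U y′ * (W y y′ * F y (c · inv y) y′ (c · inv y′)))))
        ≡⟨ ∑-cong set (λ y → cong (U y *_) (∑-hyperbola C (λ y′ t′ → W y y′ * F y (c · inv y) y′ t′))) ⟩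
      ∑[ y ∈ set ] (U y * (∑[ x′ ∈ set ] (U x′ * (W y (c · inv x′) * F y (c · inv y) (c · inv x′) x′))))
        ≡⟨ ∑-hyperbola C (λ y t → ∑[ x′ ∈ set ] (U x′ * (W y (c · inv x′) * F y t (c · inv x′) x′))) ⟩
      ∑[ x ∈ set ] (U x * (∑[ x′ ∈ set ] (U x′ * (W (c · inv x) (c · inv x′) * F (c · inv x) x (c · inv x′) x′))))
        ≡⟨ sym (∑-cong set (λ x → pull x (twist W x) (λ x′ t′ → F (c · inv x) x t′ x′))) ⟩
      ∑[ x ∈ set ] ∑[ x′ ∈ set ] (U x * (U x′ * twist W x x′) * F (c · inv x) x (c · inv x′) x′) ∎
      where
      F : R → R → R → R → ℤ
      F y t y′ t′ = f (a ⊖ y ⊕ y′ , b ⊖ t ⊕ t′)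
      pull : ∀ y (w : R → ℤ) (h : R → R → ℤ) → ∑[ y′ ∈ set ] (U y * (U y′ * w y′) * h y′ (c · inv y′)) ≡ U y * (∑[ y′ ∈ set ] (U y′ * (w y′ * h y′ (c · inv y′))))
      pull y w h = trans (∑-cong set λ y′ → assoc (U y) (U y′) (w y′) _) (∑-*ˡ set (U y) _)
        where
        opaque
          unfolding _+_ _*_
          assoc : ∀ a b c d → a * (b * c) * d ≡ a * (b * (c * d))
          assoc = solve-∀

    -- The correlation becomes invariant under ε R × ε R, while it inherits from f the mean zero
    -- over the translates by this ideal.
    Z-vanishes : ∀ W → Inv₂ (onUnits W) → Inv₂ (onUnits (twist W)) → ∀ {f} → MeanZero f → ∀ g → Z (onUnits W) f g ≡ 0ℤ
    Z-vanishes W inv₂ inv₁ {f} mz = invariant⇒0 meanZero invariant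
      where
      Z′ = Z (onUnits W) f
      meanZero : MeanZero Z′
      meanZero g = begin
        ∑[ k ∈ gset ] ∑[ y ∈ set ] ∑[ y′ ∈ set ] (onUnits W y y′ * f (g G.⊕ κ k G.⊖ vec y G.⊕ vec y′))
          ≡⟨ trans (∑-swap gset set _) (∑-cong set λ y → ∑-swap gset set _) ⟩
        ∑[ y ∈ set ] ∑[ y′ ∈ set ] ∑[ k ∈ gset ] (onUnits W y y′ * f (g G.⊕ κ k G.⊖ vec y G.⊕ vec y′))
          ≡⟨ ∑-≡0 set (λ y → ∑-≡0 set λ y′ → trans (∑-*ˡ gset (onUnits W y y′) _) (trans (cong (onUnits W y y′ *_)
               (trans (∑-cong gset λ k → cong f (G.solve 4 (λ g k a b → g G.:+ k G.:- a G.:+ b G.:= g G.:- a G.:+ b G.:+ k) refl g (κ k) (vec y) (vec y′))) (mz (g G.⊖ vec y G.⊕ vec y′)))) (Int.*-zeroʳ _))) ⟩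
        0ℤ ∎
      invariant₁ : ∀ g x → Z′ (g G.⊕ (ε · x , 𝟘)) ≡ Z′ g
      invariant₁ g x = trans (Z-swap W f (g G.⊕ (ε · x , 𝟘))) (trans (inv₁ (swapped f) (proj₂ g , proj₁ g) x) (sym (Z-swap W f g)))
      invariant : ∀ g k → Z′ (g G.⊕ κ k) ≡ Z′ g
      invariant g (x , y) = trans (cong Z′ (cong₂ _,_ (solve 2 (λ g a → g :+ a := g :+ con (+ 0) :+ a) refl (proj₁ g) (ε · x)) (solve 2 (λ g b → g :+ b := g :+ b :+ con (+ 0)) refl (proj₂ g) (ε · y))))
        (trans (invariant₁ (g G.⊕ (𝟘 , ε · y)) x) (inv₂ f g y))

-- Square classes and residue classes in rings with nilpotent elements.

module PrimitiveBound (𝑹 : FiniteRings.FinRing) (c : FiniteRings.FinRing.R 𝑹) (C : FiniteRings.Ring.Unit 𝑹 c) where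
  open FiniteRings
  open import Data.Product.Properties using (,-injectiveʳ)
  open import Relation.Nullary.Decidable using (_×-dec_)
  open ≡-Reasoning
  open Int using (ℤ; +_; 0ℤ; 1ℤ; _≤_; _<_; _+_; _*_; solve-∀)
  open FiniteSums
  open Operators
  open Primitive 𝑹 c C

  open Ring 𝑹
  private
    module G = Ring (𝑹 ⊗ᴿ 𝑹)
    gset = set ⊗ set

    opaque
      unfolding _+_ _*_
      *-interchange : ∀ u v a b → u * a * (v * b) ≡ u * (v * (a * b))
      *-interchange = solve-∀
      *-reassoc : ∀ u v a b → u * (v * (a * b)) ≡ u * v * (a * b)
      *-reassoc = solve-∀
      *-pullʳ : ∀ u v a b d → u * (v * (a * b * d)) ≡ u * (v * (a * b)) * d
      *-pullʳ = solve-∀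

  -- The geometric series for 1 / (y + a), which ends because a³ = 0.
  nilpotent-inverse : ∀ {y a} → Unit y → a · a · a ≡ 𝟘 → (y ⊕ a) · (inv y ⊖ a · (inv y · inv y) ⊕ a · a · (inv y · inv y · inv y)) ≡ 𝟙
  nilpotent-inverse {y} {a} u a³ = begin
    (y ⊕ a) · (i ⊖ a · (i · i) ⊕ a · a · (i · i · i))
      ≡⟨ solve 3 (λ y a i → (y :+ a) :* (i :- a :* (i :* i) :+ a :* a :* (i :* i :* i)) := y :* i :+ a :* i :- (y :* i) :* (a :* i) :+ (y :* i) :* (a :* i :* (a :* i)) :- a :* i :* (a :* i) :+ a :* a :* a :* (i :* i :* i)) refl y a i ⟩
    y · i ⊕ a · i ⊖ (y · i) · (a · i) ⊕ (y · i) · (a · i · (a · i)) ⊖ a · i · (a · i) ⊕ a · a · a · (i · i · i)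
      ≡⟨ cong₂ (λ e z → e ⊕ a · i ⊖ e · (a · i) ⊕ e · (a · i · (a · i)) ⊖ a · i · (a · i) ⊕ z · (i · i · i)) u a³ ⟩
    𝟙 ⊕ a · i ⊖ 𝟙 · (a · i) ⊕ 𝟙 · (a · i · (a · i)) ⊖ a · i · (a · i) ⊕ 𝟘 · (i · i · i)
      ≡⟨ cong₂ (λ s t → 𝟙 ⊕ a · i ⊖ s ⊕ t ⊖ a · i · (a · i) ⊕ 𝟘 · (i · i · i)) (*-identityˡ _) (*-identityˡ _) ⟩
    𝟙 ⊕ a · i ⊖ a · i ⊕ a · i · (a · i) ⊖ a · i · (a · i) ⊕ 𝟘 · (i · i · i)
      ≡⟨ solve 4 (λ o s t z → o :+ s :- s :+ t :- t :+ con (+ 0) :* z := o) refl 𝟙 (a · i) (a · i · (a · i)) (i · i · i) ⟩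
    𝟙 ∎
    where i = inv y

  inv-difference : ∀ {y y′} → Unit y → Unit y′ → inv y′ ⊖ inv y ≡ (y ⊖ y′) · (inv y · inv y′)
  inv-difference {y} {y′} u u′ = begin
    inv y′ ⊖ inv y                                        ≡⟨ cong₂ _⊖_ (sym (trans (cong (_· inv y′) u) (*-identityˡ _))) (sym (trans (cong (_· inv y) u′) (*-identityˡ _))) ⟩
    y · inv y · inv y′ ⊖ y′ · inv y′ · inv y              ≡⟨ solve 4 (λ y z i j → y :* i :* j :- z :* j :* i := (y :- z) :* (i :* j)) refl y y′ (inv y) (inv y′) ⟩
    (y ⊖ y′) · (inv y · inv y′) ∎

  module Nilpotent (π : R) (π³ : π · π · π ≡ 𝟘) where

    private
      cube : ∀ w → π · w · (π · w) · (π · w) ≡ 𝟘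
      cube w = trans (solve 2 (λ p w → p :* w :* (p :* w) :* (p :* w) := p :* p :* p :* (w :* w :* w)) refl π w) (trans (cong (_· (w · w · w)) π³) (zeroˡ _))

    unit-move : ∀ {y} w → Unit y → Unit (y ⊕ π · w)
    unit-move w u = toUnit (nilpotent-inverse u (cube w))

    inv-move : ∀ {y} w → Unit y → inv (y ⊕ π · w) ≡ inv y ⊖ π · w · (inv y · inv y) ⊕ π · w · (π · w) · (inv y · inv y · inv y)
    inv-move w u = inv-unique (nilpotent-inverse u (cube w))

    -- The coefficient of w in the expansion of c / (y′ + π w) - c / (y + π w).
    Δ : R → R → R
    Δ y y′ = ⊝ c · (π · (inv y′ · inv y′) ⊖ π · (inv y · inv y))

    -- Terms from w³ on vanish because π³ = 0, and the last hypothesis removes the term with w².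
    move-inverse : ∀ {y y′} w → Unit y → Unit y′ → π · π · (inv y′ · inv y′ · inv y′ ⊖ inv y · inv y · inv y) ≡ 𝟘 →
      c · inv (y′ ⊕ π · w) ⊖ c · inv (y ⊕ π · w) ≡ c · inv y′ ⊖ c · inv y ⊕ w · Δ y y′
    move-inverse {y} {y′} w u u′ h = begin
      c · inv (y′ ⊕ π · w) ⊖ c · inv (y ⊕ π · w)
        ≡⟨ cong₂ (λ s t → c · s ⊖ c · t) (inv-move w u′) (inv-move w u) ⟩
      c · (j ⊖ π · w · (j · j) ⊕ π · w · (π · w) · (j · j · j)) ⊖ c · (i ⊖ π · w · (i · i) ⊕ π · w · (π · w) · (i · i · i))
        ≡⟨ solve 5 (λ c p w i j → c :* (j :- p :* w :* (j :* j) :+ p :* w :* (p :* w) :* (j :* j :* j)) :- c :* (i :- p :* w :* (i :* i) :+ p :* w :* (p :* w) :* (i :* i :* i))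
             := c :* j :- c :* i :+ w :* ((:- c) :* (p :* (j :* j) :- p :* (i :* i))) :+ c :* w :* w :* (p :* p :* (j :* j :* j :- i :* i :* i))) refl c π w i j ⟩
      c · j ⊖ c · i ⊕ w · Δ y y′ ⊕ c · w · w · (π · π · (j · j · j ⊖ i · i · i))
        ≡⟨ trans (cong (c · j ⊖ c · i ⊕ w · Δ y y′ ⊕_) (trans (cong (c · w · w ·_) h) (zeroʳ _))) (+-identityʳ _) ⟩
      c · j ⊖ c · i ⊕ w · Δ y y′ ∎
      where
      i = inv y
      j = inv y′

  module _ (ε : R) (card>0 : 0ℤ < card gset) (divides-ε : ∀ {Δ} → ¬ Δ ≡ 𝟘 → ∀ x → ∃ λ w → w · Δ ≡ ε · x) where
    open Moves ε card>0 divides-ε public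
    open Operator (𝑹 ⊗ᴿ 𝑹) set using (op-adjoint; op-trivial; module Classes)

    module SquareClasses (π : R) (π² : π · π ≡ 𝟘) where
      private
        π³ : π · π · π ≡ 𝟘
        π³ = trans (cong (_· π) π²) (zeroˡ π)
      open Nilpotent π π³

      I : FinSet
      I = set ⊗ set

      -- With π = p^j, multiplication by π records a residue modulo p^(n - j) without leaving the
      -- ring. On units either component determines the other: `Δ` sees the second, and keeping both
      -- lets the substitution y = c / x act on classes, as `σ` below.
      cl : R → R × R
      cl y = π · (y · y) , π · (inv y · inv y)

      open Classes vec I cl U MeanZero (op-meanZero vec) public

      private
        cl-move : ∀ {y} w → Unit y → cl (y ⊕ π · w) ≡ cl y
        cl-move {y} w u = cong₂ _,_
          (trans (solve 3 (λ p y w → p :* ((y :+ p :* w) :* (y :+ p :* w)) := p :* (y :* y) :+ p :* p :* (w :* (y :+ y) :+ p :* w :* w)) refl π y w)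
            (trans (cong (λ z → π · (y · y) ⊕ z · (w · (y ⊕ y) ⊕ π · w · w)) π²) (trans (cong (π · (y · y) ⊕_) (zeroˡ _)) (+-identityʳ _))))
          (trans (cong (λ z → π · (z · z)) (trans (inv-move w u) (solve 3 (λ p w i → i :- p :* w :* (i :* i) :+ p :* w :* (p :* w) :* (i :* i :* i) := i :+ p :* (w :* (p :* w) :* (i :* i :* i) :- w :* (i :* i))) refl π w (inv y))))
            (trans (solve 3 (λ p i t → p :* ((i :+ p :* t) :* (i :+ p :* t)) := p :* (i :* i) :+ p :* p :* (t :* (i :+ i) :+ p :* t :* t)) refl π (inv y) t)
              (trans (cong (λ z → π · (inv y · inv y) ⊕ z · (t · (inv y ⊕ inv y) ⊕ π · t · t)) π²) (trans (cong (π · (inv y · inv y) ⊕_) (zeroˡ _)) (+-identityʳ _)))))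
          where
          t : R
          t = w · (π · w) · (inv y · inv y · inv y) ⊖ w · (inv y · inv y)

        cl₂⇒cl₁ : ∀ {y y′} → Unit y → Unit y′ → π · (inv y · inv y) ≡ π · (inv y′ · inv y′) → π · (y · y) ≡ π · (y′ · y′)
        cl₂⇒cl₁ {y} {y′} u u′ e = begin
          π · (y · y)                                   ≡⟨ sym (times-one u′) ⟩
          π · (y · y) · ((y′ · inv y′) · (y′ · inv y′)) ≡⟨ solve 4 (λ p y z j → p :* (y :* y) :* ((z :* j) :* (z :* j)) := p :* (j :* j) :* (y :* y :* (z :* z))) refl π y y′ (inv y′) ⟩
          π · (inv y′ · inv y′) · (y · y · (y′ · y′))   ≡⟨ cong (_· (y · y · (y′ · y′))) (sym e) ⟩
          π · (inv y · inv y) · (y · y · (y′ · y′))     ≡⟨ solve 4 (λ p y z i → p :* (i :* i) :* (y :* y :* (z :* z)) := p :* (z :* z) :* ((y :* i) :* (y :* i))) refl π y y′ (inv y) ⟩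
          π · (y′ · y′) · ((y · inv y) · (y · inv y))   ≡⟨ times-one u ⟩
          π · (y′ · y′) ∎
          where
          times-one : ∀ {x z} → Unit x → z · ((x · inv x) · (x · inv x)) ≡ z
          times-one {x} {z} u = trans (cong (λ t → z · (t · t)) u) (trans (cong (z ·_) (*-identityˡ 𝟙)) (*-identityʳ z))

        W : R × R → R × R → Weight
        W i j y y′ = [ FinSet._≟_ I (cl y) i ] * [ FinSet._≟_ I (cl y′) j ]

        -- Here `Δ` is -c times the difference of the second components of the two classes. It is
        -- therefore constant on the pairs concerned, and nonzero as the classes are distinct.
        inv₂ : ∀ i j → ¬ i ≡ j → Inv₂ (onUnits (W i j))
        inv₂ i j i≢j f g x = trans (Z-cong same f (g G.⊕ (𝟘 , ε · x))) (trans (move-invariance π Good good? Δ good-move move-inv Δ-const Δ≢0 f g x) (sym (Z-cong same f g)))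
          where
          Good : R → R → Set
          Good y y′ = (Unit y × Unit y′) × (cl y ≡ i × cl y′ ≡ j)
          good? : ∀ y y′ → Dec (Good y y′)
          good? y y′ = (unit? y ×-dec unit? y′) ×-dec (FinSet._≟_ I (cl y) i ×-dec FinSet._≟_ I (cl y′) j)
          same : ∀ y y′ → onUnits (W i j) y y′ ≡ [ good? y y′ ]
          same y y′ = trans (*-reassoc (U y) (U y′) _ _) (trans (cong₂ _*_ ([]-× (unit? y) (unit? y′) (unit? y ×-dec unit? y′) (λ z → z) (λ z → z))
            ([]-× (FinSet._≟_ I (cl y) i) (FinSet._≟_ I (cl y′) j) (FinSet._≟_ I (cl y) i ×-dec FinSet._≟_ I (cl y′) j) (λ z → z) (λ z → z)))
            ([]-× (unit? y ×-dec unit? y′) (FinSet._≟_ I (cl y) i ×-dec FinSet._≟_ I (cl y′) j) (good? y y′) (λ z → z) (λ z → z)))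
          good-move : ∀ {y y′} w → Good y y′ → Good (y ⊕ π · w) (y′ ⊕ π · w)
          good-move w ((u , u′) , e , e′) = (unit-move w u , unit-move w u′) , trans (cl-move w u) e , trans (cl-move w u′) e′
          move-inv : ∀ {y y′} w → Good y y′ → c · inv (y′ ⊕ π · w) ⊖ c · inv (y ⊕ π · w) ≡ c · inv y′ ⊖ c · inv y ⊕ w · Δ y y′
          move-inv {y} {y′} w ((u , u′) , _) = move-inverse w u u′ (trans (cong (_· (inv y′ · inv y′ · inv y′ ⊖ inv y · inv y · inv y)) π²) (zeroˡ _))
          Δ-const : ∀ {y y′ z z′} → Good y y′ → Good z z′ → Δ y y′ ≡ Δ z z′
          Δ-const (_ , e , e′) (_ , t , t′) = cong₂ (λ a b → ⊝ c · (a ⊖ b)) (trans (,-injectiveʳ e′) (sym (,-injectiveʳ t′))) (trans (,-injectiveʳ e) (sym (,-injectiveʳ t)))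
          Δ≢0 : ∀ {y y′} → Good y y′ → ¬ Δ y y′ ≡ 𝟘
          Δ≢0 {y} {y′} ((u , u′) , e , e′) h = i≢j (trans (sym e) (trans (cong₂ _,_ (cl₂⇒cl₁ u u′ same₂) same₂) e′))
            where
            same₂ : π · (inv y · inv y) ≡ π · (inv y′ · inv y′)
            same₂ = sym (⊖≡𝟘⇒≡ (unit-cancelˡ (unit-neg C) (trans h (sym (zeroʳ _)))))

        σ : R × R → R × R
        σ (a , b) = c · c · b , inv c · inv c · a

        σσ : ∀ i → σ (σ i) ≡ i
        σσ (a , b) = cong₂ _,_ (cancel c (inv c) a C) (cancel (inv c) c b (trans (*-comm _ _) C))
          where
          cancel : ∀ x y z → x · y ≡ 𝟙 → x · x · (y · y · z) ≡ z
          cancel x y z e = trans (solve 3 (λ x y z → x :* x :* (y :* y :* z) := (x :* y) :* ((x :* y) :* z)) refl x y z) (trans (cong (λ t → t · (t · z)) e) (trans (*-identityˡ _) (*-identityˡ z)))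

        cl-twist : ∀ {x} → Unit x → cl (c · inv x) ≡ σ (cl x)
        cl-twist {x} u = cong₂ _,_ (solve 3 (λ p c i → p :* (c :* i :* (c :* i)) := c :* c :* (p :* (i :* i))) refl π c (inv x))
          (trans (cong (λ t → π · (t · t)) (trans (inv-· C (unit-inv u)) (cong (inv c ·_) (inv-inv u)))) (solve 3 (λ p d x → p :* (d :* x :* (d :* x)) := d :* d :* (p :* (x :* x))) refl π (inv c) x))

        cl-twist-≟ : ∀ {x} i → Unit x → [ FinSet._≟_ I (cl (c · inv x)) i ] ≡ [ FinSet._≟_ I (cl x) (σ i) ]
        cl-twist-≟ {x} i u = []-cong (FinSet._≟_ I (cl (c · inv x)) i) (FinSet._≟_ I (cl x) (σ i))
          (λ e → trans (sym (σσ (cl x))) (cong σ (trans (sym (cl-twist u)) e))) (λ e → trans (cl-twist u) (trans (cong σ e) (σσ i)))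

        twist-W : ∀ i j x x′ → onUnits (twist (W i j)) x x′ ≡ onUnits (W (σ i) (σ j)) x x′
        twist-W i j x x′ = []-subst (unit? x) (λ u → []-subst (unit? x′) (λ u′ → cong₂ _*_ (cl-twist-≟ i u) (cl-twist-≟ j u′)))

        vanishes : ∀ {f} → MeanZero f → ∀ i j → ¬ i ≡ j → ∀ g → Z (onUnits (W i j)) f g ≡ 0ℤ
        vanishes {f₀} mz i j i≢j = Z-vanishes (W i j) (inv₂ i j i≢j)
          (λ f g x → trans (Z-cong (twist-W i j) f (g G.⊕ (𝟘 , ε · x))) (trans (inv₂ (σ i) (σ j) (λ e → i≢j (trans (sym (σσ i)) (trans (cong σ e) (σσ j)))) f g x) (sym (Z-cong (twist-W i j) f g)))) {f₀} mz

      orthogonal : Orthogonal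
      orthogonal {f} mz i j i≢j g = trans (Z-op (piece i) (piece j) f g) (trans (Z-cong (λ y y′ → *-interchange (U y) (U y′) _ _) f g) (vanishes {f} mz i j i≢j g))

      piece-idem : ∀ i y → piece i y * piece i y ≡ piece i y
      piece-idem i y = trans (cong₂ _*_ e e) (trans ([]-idem (unit? y ×-dec FinSet._≟_ I (cl y) i)) (sym e))
        where
        e : piece i y ≡ [ unit? y ×-dec FinSet._≟_ I (cl y) i ]
        e = []-× (unit? y) (FinSet._≟_ I (cl y) i) (unit? y ×-dec FinSet._≟_ I (cl y) i) (λ z → z) (λ z → z)

      bound : ∀ B → 0ℤ ≤ B → (∀ {f} → MeanZero f → ∀ i → norm gset (op vec (piece i) f) ≤ B * norm gset f) → ∀ {f} → MeanZero f → norm gset (X f) ≤ B * norm gset f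
      bound = norm-pieces-bound (λ {f} → orthogonal {f})

    -- To be applied modulo p^(2 m + 1) with π = p^m and ϖ = p^(m + 1): then ϖ y records y modulo
    -- p^m, and π y records it modulo p^(m + 1).
    module ResidueClasses (π ϖ : R) (π³ : π · π · π ≡ 𝟘) (ϖπ : ϖ · π ≡ 𝟘) (annihilator : ∀ {x} → ϖ · x ≡ 𝟘 → ∃ λ t → x ≡ π · t) (two : Unit (𝟙 ⊕ 𝟙)) where
      open Nilpotent π π³

      private
        difference : ∀ {x y} → ϖ · x ≡ ϖ · y → ∃ λ t → x ⊖ y ≡ π · t
        difference {x} {y} e = annihilator (trans (solve 3 (λ p x y → p :* (x :- y) := p :* x :- p :* y) refl ϖ x y) (≡⇒⊖≡𝟘 e))

        double-unit : ∀ {x} → Unit x → Unit (x ⊕ x)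
        double-unit {x} u = subst Unit (trans (distribʳ x 𝟙 𝟙) (cong₂ _⊕_ (*-identityˡ x) (*-identityˡ x))) (unit-· two u)

        Good : R → R → R → R → Set
        Good r d y y′ = (Unit y × Unit y′) × (ϖ · y ≡ ϖ · r × ϖ · y′ ≡ ϖ · r) × π · (y ⊖ y′) ≡ d

        good? : ∀ r d y y′ → Dec (Good r d y y′)
        good? r d y y′ = (unit? y ×-dec unit? y′) ×-dec ((ϖ · y ≟ ϖ · r ×-dec ϖ · y′ ≟ ϖ · r) ×-dec π · (y ⊖ y′) ≟ d)

        -- d is killed by the maximal ideal, so d · y only depends on y modulo it.
        absorb : ∀ {r d y y′ z} → Good r d y y′ → ϖ · z ≡ ϖ · r → d · z ≡ d · r
        absorb {r} {d} {y} {y′} {z} (_ , (e , e′) , h) ez = subst (λ D → D · z ≡ D · r) h (by-differences (difference (trans e (sym e′))) (difference ez))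
          where
          by-differences : (∃ λ t → y ⊖ y′ ≡ π · t) → (∃ λ s → z ⊖ r ≡ π · s) → π · (y ⊖ y′) · z ≡ π · (y ⊖ y′) · r
          by-differences (t , h) (s , k) = ⊖≡𝟘⇒≡ (trans (solve 3 (λ d z r → d :* z :- d :* r := d :* (z :- r)) refl (π · (y ⊖ y′)) z r)
            (trans (cong₂ (λ a b → π · a · b) h k) (trans (solve 3 (λ p t s → p :* (p :* t) :* (p :* s) := p :* p :* p :* (t :* s)) refl π t s) (trans (cong (_· (t · s)) π³) (zeroˡ _)))))

        absorb-inv : ∀ {r d y} → Unit r → Unit y → d · y ≡ d · r → d · inv y ≡ d · inv r
        absorb-inv {r} {d} {y} ur uy e = begin
          d · inv y                  ≡⟨ sym (trans (cong (λ t → d · (t · inv y)) ur) (cong (d ·_) (*-identityˡ _))) ⟩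
          d · (r · inv r · inv y)    ≡⟨ solve 4 (λ d r i j → d :* (r :* i :* j) := d :* r :* (i :* j)) refl d r (inv r) (inv y) ⟩
          d · r · (inv r · inv y)    ≡⟨ cong (_· (inv r · inv y)) (sym e) ⟩
          d · y · (inv r · inv y)    ≡⟨ solve 4 (λ d y i j → d :* y :* (i :* j) := d :* i :* (y :* j)) refl d y (inv r) (inv y) ⟩
          d · inv r · (y · inv y)    ≡⟨ trans (cong (d · inv r ·_) uy) (*-identityʳ _) ⟩
          d · inv r ∎

        -- The value is -2 c d / r³: next to d, each of the inverses of y and y′ may be replaced by
        -- that of r.
        Δ≡ : ∀ {r d y y′} → Unit r → Good r d y y′ → Δ y y′ ≡ ⊝ c · (d · (inv r · inv r · (inv r ⊕ inv r)))
        Δ≡ {r} {d} {y} {y′} ur h@((u , u′) , (e , e′) , refl) = cong (⊝ c ·_) (begin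
          π · (j · j) ⊖ π · (i · i)            ≡⟨ solve 3 (λ p i j → p :* (j :* j) :- p :* (i :* i) := p :* (j :- i) :* (i :+ j)) refl π i j ⟩
          π · (j ⊖ i) · (i ⊕ j)                ≡⟨ cong (λ t → π · t · (i ⊕ j)) (inv-difference u u′) ⟩
          π · ((y ⊖ y′) · (i · j)) · (i ⊕ j)   ≡⟨ solve 4 (λ p t i j → p :* (t :* (i :* j)) :* (i :+ j) := p :* t :* i :* j :* i :+ p :* t :* j :* j :* i) refl π (y ⊖ y′) i j ⟩
          D · i · j · i ⊕ D · j · j · i        ≡⟨ cong₂ _⊕_ (three eᵢ eⱼ eᵢ) (three eⱼ eⱼ eᵢ) ⟩
          D · ρ · ρ · ρ ⊕ D · ρ · ρ · ρ        ≡⟨ solve 2 (λ d r → d :* r :* r :* r :+ d :* r :* r :* r := d :* (r :* r :* (r :+ r))) refl D ρ ⟩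
          D · (ρ · ρ · (ρ ⊕ ρ)) ∎)
          where
          i = inv y
          j = inv y′
          ρ = inv r
          D = π · (y ⊖ y′)
          eᵢ : D · i ≡ D · ρ
          eᵢ = absorb-inv ur u (absorb h e)
          eⱼ : D · j ≡ D · ρ
          eⱼ = absorb-inv ur u′ (absorb h e′)
          three : ∀ {a b c′} → D · a ≡ D · ρ → D · b ≡ D · ρ → D · c′ ≡ D · ρ → D · a · b · c′ ≡ D · ρ · ρ · ρ
          three {a} {b} {c′} ea eb ec = begin
            D · a · b · c′    ≡⟨ cong (λ t → t · b · c′) ea ⟩
            D · ρ · b · c′    ≡⟨ solve 4 (λ d r b c → d :* r :* b :* c := d :* b :* r :* c) refl D ρ b c′ ⟩
            D · b · ρ · c′    ≡⟨ cong (λ t → t · ρ · c′) eb ⟩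
            D · ρ · ρ · c′    ≡⟨ solve 3 (λ d r c → d :* r :* r :* c := d :* c :* r :* r) refl D ρ c′ ⟩
            D · c′ · ρ · ρ    ≡⟨ cong (λ t → t · ρ · ρ) ec ⟩
            D · ρ · ρ · ρ ∎

        W : R → R → Weight
        W r d y y′ = [ ϖ · y ≟ ϖ · r ] * [ ϖ · y′ ≟ ϖ · r ] * [ π · (y ⊖ y′) ≟ d ]

        onUnits-W : ∀ r d y y′ → onUnits (W r d) y y′ ≡ [ good? r d y y′ ]
        onUnits-W r d y y′ = trans (*-reassoc (U y) (U y′) _ _) (trans (cong₂ _*_ ([]-× (unit? y) (unit? y′) (unit? y ×-dec unit? y′) (λ z → z) (λ z → z))
          (trans (cong (_* [ π · (y ⊖ y′) ≟ d ]) ([]-× (ϖ · y ≟ ϖ · r) (ϖ · y′ ≟ ϖ · r) (ϖ · y ≟ ϖ · r ×-dec ϖ · y′ ≟ ϖ · r) (λ z → z) (λ z → z)))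
            ([]-× (ϖ · y ≟ ϖ · r ×-dec ϖ · y′ ≟ ϖ · r) (π · (y ⊖ y′) ≟ d) ((ϖ · y ≟ ϖ · r ×-dec ϖ · y′ ≟ ϖ · r) ×-dec π · (y ⊖ y′) ≟ d) (λ z → z) (λ z → z))))
          ([]-× (unit? y ×-dec unit? y′) ((ϖ · y ≟ ϖ · r ×-dec ϖ · y′ ≟ ϖ · r) ×-dec π · (y ⊖ y′) ≟ d) (good? r d y y′) (λ z → z) (λ z → z)))

        -- `Δ` is nonzero because d is and 2 is a unit; the term of second order contains π³, as y
        -- and y′ agree up to a multiple of π.
        inv₂ : ∀ r d → Unit r → ¬ d ≡ 𝟘 → Inv₂ (onUnits (W r d))
        inv₂ r d ur d≢0 f g x = trans (Z-cong (onUnits-W r d) f (g G.⊕ (𝟘 , ε · x)))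
            (trans (move-invariance π (Good r d) (good? r d) Δ good-move move-inv (λ h k → trans (Δ≡ ur h) (sym (Δ≡ ur k))) Δ≢0 f g x) (sym (Z-cong (onUnits-W r d) f g)))
          where
          ϖ-move : ∀ y w → ϖ · (y ⊕ π · w) ≡ ϖ · y
          ϖ-move y w = trans (solve 4 (λ q y p w → q :* (y :+ p :* w) := q :* y :+ q :* p :* w) refl ϖ y π w) (trans (cong (λ t → ϖ · y ⊕ t · w) ϖπ) (trans (cong (ϖ · y ⊕_) (zeroˡ w)) (+-identityʳ _)))
          good-move : ∀ {y y′} w → Good r d y y′ → Good r d (y ⊕ π · w) (y′ ⊕ π · w)
          good-move {y} {y′} w ((u , u′) , (e , e′) , h) = (unit-move w u , unit-move w u′) , (trans (ϖ-move y w) e , trans (ϖ-move y′ w) e′) ,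
            trans (cong (π ·_) (solve 3 (λ y z a → y :+ a :- (z :+ a) := y :- z) refl y y′ (π · w))) h
          move-inv : ∀ {y y′} w → Good r d y y′ → c · inv (y′ ⊕ π · w) ⊖ c · inv (y ⊕ π · w) ≡ c · inv y′ ⊖ c · inv y ⊕ w · Δ y y′
          move-inv {y} {y′} w ((u , u′) , (e , e′) , _) with difference (trans e (sym e′))
          ... | t , h = move-inverse w u u′ (begin
            π · π · (j · j · j ⊖ i · i · i)                         ≡⟨ solve 3 (λ p i j → p :* p :* (j :* j :* j :- i :* i :* i) := p :* p :* ((j :- i) :* (j :* j :+ j :* i :+ i :* i))) refl π i j ⟩
            π · π · ((j ⊖ i) · (j · j ⊕ j · i ⊕ i · i))             ≡⟨ cong (λ s → π · π · (s · (j · j ⊕ j · i ⊕ i · i))) (trans (inv-difference u u′) (cong (_· (i · j)) h)) ⟩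
            π · π · (π · t · (i · j) · (j · j ⊕ j · i ⊕ i · i))     ≡⟨ solve 4 (λ p t a b → p :* p :* (p :* t :* a :* b) := p :* p :* p :* (t :* a :* b)) refl π t (i · j) _ ⟩
            π · π · π · (t · (i · j) · (j · j ⊕ j · i ⊕ i · i))     ≡⟨ trans (cong (_· (t · (i · j) · (j · j ⊕ j · i ⊕ i · i))) π³) (zeroˡ _) ⟩
            𝟘 ∎)
            where
            i = inv y
            j = inv y′
          Δ≢0 : ∀ {y y′} → Good r d y y′ → ¬ Δ y y′ ≡ 𝟘
          Δ≢0 h e = d≢0 (unit-cancelˡ (unit-· (unit-neg C) (unit-· (unit-· (unit-inv ur) (unit-inv ur)) (double-unit (unit-inv ur))))
            (trans (solve 3 (λ c s d → c :* s :* d := c :* (d :* s)) refl (⊝ c) _ d) (trans (sym (Δ≡ ur h)) (trans e (sym (zeroʳ _))))))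

        -- The substitution y ↦ c / y changes d = π (y - y′) into -c d / r².
        twistᵈ : R → R → R
        twistᵈ r d = ⊝ (d · (c · (inv r · inv r)))

        c-inv-inv : ∀ {x} → Unit x → c · inv (c · inv x) ≡ x
        c-inv-inv {x} u = trans (cong (c ·_) (trans (inv-· C (unit-inv u)) (cong (inv c ·_) (inv-inv u))))
          (trans (sym (*-assoc c (inv c) x)) (trans (cong (_· x) C) (*-identityˡ x)))

        twist-good : ∀ {r d y y′} → Unit r → Good r d y y′ → Good (c · inv r) (twistᵈ r d) (c · inv y) (c · inv y′)
        twist-good {r} {d} {y} {y′} ur h@((u , u′) , (e , e′) , refl) = (unit-· C (unit-inv u) , unit-· C (unit-inv u′)) , (residue u e , residue u′ e′) , (begin
            π · (c · i ⊖ c · j)                     ≡⟨ solve 4 (λ p c i j → p :* (c :* i :- c :* j) := :- (p :* c :* (j :- i))) refl π c i j ⟩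
            ⊝ (π · c · (j ⊖ i))                     ≡⟨ cong (λ t → ⊝ (π · c · t)) (inv-difference u u′) ⟩
            ⊝ (π · c · ((y ⊖ y′) · (i · j)))        ≡⟨ solve 5 (λ p c t i j → :- (p :* c :* (t :* (i :* j))) := :- (c :* (p :* t :* i :* j))) refl π c (y ⊖ y′) i j ⟩
            ⊝ (c · (D · i · j))                     ≡⟨ cong (λ t → ⊝ (c · (t · j))) (absorb-inv ur u (absorb h e)) ⟩
            ⊝ (c · (D · ρ · j))                     ≡⟨ solve 4 (λ c d r j → :- (c :* (d :* r :* j)) := :- (c :* (d :* j :* r))) refl c D ρ j ⟩
            ⊝ (c · (D · j · ρ))                     ≡⟨ cong (λ t → ⊝ (c · (t · ρ))) (absorb-inv ur u′ (absorb h e′)) ⟩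
            ⊝ (c · (D · ρ · ρ))                     ≡⟨ solve 3 (λ c d r → :- (c :* (d :* r :* r)) := :- (d :* (c :* (r :* r)))) refl c D ρ ⟩
            ⊝ (D · (c · (ρ · ρ))) ∎)
          where
          i = inv y
          j = inv y′
          ρ = inv r
          D = π · (y ⊖ y′)
          residue : ∀ {z} → Unit z → ϖ · z ≡ ϖ · r → ϖ · (c · inv z) ≡ ϖ · (c · inv r)
          residue {z} uz ez = trans (solve 3 (λ p c i → p :* (c :* i) := c :* (p :* i)) refl ϖ c (inv z)) (trans (cong (c ·_) (absorb-inv ur uz ez)) (solve 3 (λ c p i → c :* (p :* i) := p :* (c :* i)) refl c ϖ (inv r)))

        twist-twistᵈ : ∀ {r d} → Unit r → twistᵈ (c · inv r) (twistᵈ r d) ≡ d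
        twist-twistᵈ {r} {d} ur = begin
          ⊝ (⊝ (d · (c · (ρ · ρ))) · (c · (inv (c · ρ) · inv (c · ρ))))   ≡⟨ cong (λ t → ⊝ (⊝ (d · (c · (ρ · ρ))) · (c · (t · t)))) (trans (inv-· C (unit-inv ur)) (cong (inv c ·_) (inv-inv ur))) ⟩
          ⊝ (⊝ (d · (c · (ρ · ρ))) · (c · (inv c · r · (inv c · r))))     ≡⟨ solve 5 (λ d c s k r → :- ((:- (d :* (c :* (s :* s)))) :* (c :* (k :* r :* (k :* r)))) := d :* ((c :* k) :* (c :* k) :* ((r :* s) :* (r :* s)))) refl d c ρ (inv c) r ⟩
          d · ((c · inv c) · (c · inv c) · ((r · ρ) · (r · ρ)))           ≡⟨ cong₂ (λ s t → d · (s · s · (t · t))) C ur ⟩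
          d · (𝟙 · 𝟙 · (𝟙 · 𝟙))                                           ≡⟨ trans (cong (λ t → d · (t · t)) (*-identityˡ 𝟙)) (trans (cong (d ·_) (*-identityˡ 𝟙)) (*-identityʳ d)) ⟩
          d ∎
          where ρ = inv r

        twist-W : ∀ {r d} → Unit r → ∀ x x′ → onUnits (twist (W r d)) x x′ ≡ onUnits (W (c · inv r) (twistᵈ r d)) x x′
        twist-W {r} {d} ur x x′ = trans ([]-subst (unit? x) (λ u → []-subst (unit? x′) (λ u′ → flip u u′))) refl
          where
          r′ = c · inv r
          d′ = twistᵈ r d
          flip : Unit x → Unit x′ → W r d (c · inv x) (c · inv x′) ≡ W r′ d′ x x′
          flip u u′ = trans (value r d (unit-· C (unit-inv u)) (unit-· C (unit-inv u′))) (trans ([]-cong (good? r d (c · inv x) (c · inv x′)) (good? r′ d′ x x′) forth (λ h → back h)) (sym (value r′ d′ u u′)))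
            where
            value : ∀ r d {y y′} → Unit y → Unit y′ → W r d y y′ ≡ [ good? r d y y′ ]
            value r d {y} {y′} u u′ = trans (sym (trans (cong₂ _*_ ([]-yes (unit? y) u) (trans (cong (_* W r d y y′) ([]-yes (unit? y′) u′)) (Int.*-identityˡ _))) (Int.*-identityˡ _))) (onUnits-W r d y y′)
            forth : Good r d (c · inv x) (c · inv x′) → Good r′ d′ x x′
            forth h = subst₂ (Good r′ d′) (c-inv-inv u) (c-inv-inv u′) (twist-good ur h)
            back : Good r′ d′ x x′ → Good r d (c · inv x) (c · inv x′)
            back h = subst₂ (λ s t → Good s t (c · inv x) (c · inv x′)) (c-inv-inv ur) (twist-twistᵈ ur) (twist-good (unit-· C (unit-inv ur)) h)

        twistᵈ≢0 : ∀ {r d} → Unit r → ¬ d ≡ 𝟘 → ¬ twistᵈ r d ≡ 𝟘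
        twistᵈ≢0 {r} {d} ur d≢0 e = d≢0 (trans (sym (twist-twistᵈ ur)) (trans (cong (twistᵈ (c · inv r)) e) (solve 1 (λ t → :- (con (+ 0) :* t) := con (+ 0)) refl _)))

        vanishes : ∀ {f} → MeanZero f → ∀ r d → Unit r → ¬ d ≡ 𝟘 → ∀ g → Z (onUnits (W r d)) f g ≡ 0ℤ
        vanishes {f₀} mz r d ur d≢0 = Z-vanishes (W r d) (inv₂ r d ur d≢0)
          (λ f g x → trans (Z-cong (twist-W ur) f (g G.⊕ (𝟘 , ε · x))) (trans (inv₂ (c · inv r) (twistᵈ r d) (unit-· C (unit-inv ur)) (twistᵈ≢0 ur d≢0) f g x) (sym (Z-cong (twist-W ur) f g)))) {f₀} mz

      residue : R → R → ℤ
      residue r y = U y * [ ϖ · y ≟ ϖ · r ]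

      refined : R → R → R → ℤ
      refined r ρ y = residue r y * [ π · y ≟ ρ ]

      private
        -- Pairs in the residue class are sorted by d = π (y - y′). Each d ≠ 0 contributes nothing,
        -- by `vanishes`, and the pairs with π y = π y′ are those of the refined classes with
        -- themselves.
        split : ∀ {f} → MeanZero f → ∀ r → Unit r → ∀ g → op* vec (residue r) (op vec (residue r) f) g ≡ ∑[ ρ ∈ set ] op* vec (refined r ρ) (op vec (refined r ρ) f) g
        split {f} mz r ur g = begin
          op* vec (residue r) (op vec (residue r) f) g
            ≡⟨ Z-op (residue r) (residue r) f g ⟩
          Z (λ y y′ → residue r y * residue r y′) f g
            ≡⟨ Z-sum (λ d y y′ → [ π · (y ⊖ y′) ≟ d ]) (λ y y′ → residue r y * residue r y′) (λ y y′ → ∑-δ″ set (π · (y ⊖ y′))) ⟩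
          ∑[ d ∈ set ] Z (λ y y′ → residue r y * residue r y′ * [ π · (y ⊖ y′) ≟ d ]) f g
            ≡⟨ ∑-cong set (λ d → Z-cong (λ y y′ → trans (cong (_* [ π · (y ⊖ y′) ≟ d ]) (*-interchange (U y) (U y′) _ _)) (sym (*-pullʳ (U y) (U y′) _ _ _))) f g) ⟩
          ∑[ d ∈ set ] Z (onUnits (W r d)) f g
            ≡⟨ trans (∑-cong set only) (∑-δ set 𝟘 (λ d → Z (onUnits (W r d)) f g)) ⟩
          Z (onUnits (W r 𝟘)) f g
            ≡⟨ Z-cong (λ y y′ → trans (*-pullʳ (U y) (U y′) _ _ _) (cong₂ _*_ (sym (*-interchange (U y) (U y′) _ _)) (diagonal y y′))) f g ⟩
          Z (λ y y′ → residue r y * residue r y′ * (∑[ ρ ∈ set ] ([ π · y ≟ ρ ] * [ π · y′ ≟ ρ ]))) f g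
            ≡⟨ Z-∑ (λ y y′ → residue r y * residue r y′) (λ ρ y y′ → [ π · y ≟ ρ ] * [ π · y′ ≟ ρ ]) ⟩
          ∑[ ρ ∈ set ] Z (λ y y′ → residue r y * residue r y′ * ([ π · y ≟ ρ ] * [ π · y′ ≟ ρ ])) f g
            ≡⟨ ∑-cong set (λ ρ → trans (Z-cong (λ y y′ → regroup (residue r y) (residue r y′) _ _) f g) (sym (Z-op (refined r ρ) (refined r ρ) f g))) ⟩
          ∑[ ρ ∈ set ] op* vec (refined r ρ) (op vec (refined r ρ) f) g ∎
          where
          opaque
            unfolding _+_ _*_
            regroup : ∀ a b c d → a * b * (c * d) ≡ a * c * (b * d)
            regroup = solve-∀
          Z-∑ : ∀ (V : Weight) (S : R → Weight) → Z (λ y y′ → V y y′ * (∑[ d ∈ set ] S d y y′)) f g ≡ ∑[ d ∈ set ] Z (λ y y′ → V y y′ * S d y y′) f g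
          Z-∑ V S = trans (∑-cong set λ y → trans (∑-cong set λ y′ → trans (cong (_* f _) (sym (∑-*ˡ set (V y y′) _))) (sym (∑-*ʳ set (f _) _))) (∑-swap set set _)) (∑-swap set set _)
          Z-sum : ∀ (S : R → Weight) (V : Weight) → (∀ y y′ → ∑[ d ∈ set ] S d y y′ ≡ 1ℤ) → Z V f g ≡ ∑[ d ∈ set ] Z (λ y y′ → V y y′ * S d y y′) f g
          Z-sum S V one = trans (Z-cong (λ y y′ → sym (trans (cong (V y y′ *_) (one y y′)) (Int.*-identityʳ _))) f g) (Z-∑ V S)
          only : ∀ d → Z (onUnits (W r d)) f g ≡ [ d ≟ 𝟘 ] * Z (onUnits (W r d)) f g
          only d = by-cases (d ≟ 𝟘)
            where
            by-cases : (e : Dec (d ≡ 𝟘)) → Z (onUnits (W r d)) f g ≡ [ e ] * Z (onUnits (W r d)) f g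
            by-cases (yes _) = sym (Int.*-identityˡ _)
            by-cases (no d≢0) = trans (vanishes {f} mz r d ur d≢0 g) (sym (Int.*-zeroˡ _))
          diagonal : ∀ y y′ → [ π · (y ⊖ y′) ≟ 𝟘 ] ≡ ∑[ ρ ∈ set ] ([ π · y ≟ ρ ] * [ π · y′ ≟ ρ ])
          diagonal y y′ = trans ([]-cong (π · (y ⊖ y′) ≟ 𝟘) (π · y′ ≟ π · y)
              (λ e → sym (⊖≡𝟘⇒≡ (trans (solve 3 (λ p y z → p :* y :- p :* z := p :* (y :- z)) refl π y y′) e)))
              (λ e → trans (solve 3 (λ p y z → p :* (y :- z) := p :* y :- p :* z) refl π y y′) (≡⇒⊖≡𝟘 (sym e))))
            (sym (∑-δ′ set (π · y) (λ ρ → [ π · y′ ≟ ρ ])))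

        refined-idem : ∀ r ρ y → refined r ρ y * refined r ρ y ≡ refined r ρ y
        refined-idem r ρ y = trans (cong₂ _*_ e e) (trans ([]-idem d) (sym e))
          where
          d = (unit? y ×-dec ϖ · y ≟ ϖ · r) ×-dec π · y ≟ ρ
          e : refined r ρ y ≡ [ d ]
          e = trans (cong (_* [ π · y ≟ ρ ]) ([]-× (unit? y) (ϖ · y ≟ ϖ · r) (unit? y ×-dec ϖ · y ≟ ϖ · r) (λ z → z) (λ z → z)))
            ([]-× (unit? y ×-dec ϖ · y ≟ ϖ · r) (π · y ≟ ρ) d (λ z → z) (λ z → z))

      -- The trivial bound for a refined piece is the square of its size; one factor is at most N₂,
      -- and the other sums over ρ to at most N₁.
      residue-bound : ∀ N₁ N₂ r → 0ℤ ≤ N₂ → Unit r → ∑ set (residue r) ≤ N₁ → (∀ ρ → ∑ set (refined r ρ) ≤ N₂) →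
        ∀ {f} → MeanZero f → norm gset (op vec (residue r) f) ≤ N₂ * N₁ * norm gset f
      residue-bound N₁ N₂ r N₂≥0 ur b₁ b₂ {f} mz = Int.≤-trans (Int.≤-reflexive decompose) (Int.≤-trans (∑-mono set each) (Int.≤-trans (Int.≤-reflexive collect) (Int.*-monoʳ (norm≥0 gset f) (Int.*-monoˡ N₂≥0 b₁))))
        where
        count≥0 : ∀ ρ → 0ℤ ≤ ∑ set (refined r ρ)
        count≥0 ρ = ∑-≥0 set λ y → subst (0ℤ ≤_) (refined-idem r ρ y) (Int.sq≥0 (refined r ρ y))
        decompose : norm gset (op vec (residue r) f) ≡ ∑[ ρ ∈ set ] norm gset (op vec (refined r ρ) f)
        decompose = begin
          norm gset (op vec (residue r) f)
            ≡⟨ op-adjoint vec (residue r) f (op vec (residue r) f) ⟩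
          ∑[ g ∈ gset ] (f g * op* vec (residue r) (op vec (residue r) f) g)
            ≡⟨ ∑-cong gset (λ g → trans (cong (f g *_) (split {f} mz r ur g)) (sym (∑-*ˡ set (f g) _))) ⟩
          ∑[ g ∈ gset ] ∑[ ρ ∈ set ] (f g * op* vec (refined r ρ) (op vec (refined r ρ) f) g)
            ≡⟨ ∑-swap gset set _ ⟩
          ∑[ ρ ∈ set ] inner gset f (op* vec (refined r ρ) (op vec (refined r ρ) f))
            ≡⟨ ∑-cong set (λ ρ → sym (op-adjoint vec (refined r ρ) f (op vec (refined r ρ) f))) ⟩
          ∑[ ρ ∈ set ] norm gset (op vec (refined r ρ) f) ∎
        each : ∀ ρ → norm gset (op vec (refined r ρ) f) ≤ N₂ * ∑ set (refined r ρ) * norm gset f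
        each ρ = Int.≤-trans (op-trivial vec (refined r ρ) (refined-idem r ρ) f) (Int.*-monoʳ (norm≥0 gset f) (Int.*-monoʳ (count≥0 ρ) (b₂ ρ)))
        total : ∑[ ρ ∈ set ] ∑ set (refined r ρ) ≡ ∑ set (residue r)
        total = trans (∑-swap set set _) (∑-cong set λ y → trans (∑-*ˡ set (residue r y) _) (trans (cong (residue r y *_) (∑-δ″ set (π · y))) (Int.*-identityʳ _)))
        collect : ∑[ ρ ∈ set ] (N₂ * ∑ set (refined r ρ) * norm gset f) ≡ N₂ * ∑ set (residue r) * norm gset f
        collect = trans (∑-*ʳ set (norm gset f) _) (cong (_* norm gset f) (trans (∑-*ˡ set N₂ _) (cong (N₂ *_) total)))

-- Arithmetic modulo prime powers.

module PrimePower where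
  open import Data.Fin using (toℕ)
  open import Data.Nat.Divisibility using (_∣_; divides)
  open import Data.Nat.Primality using (Prime; prime⇒nonZero; prime⇒nonTrivial)
  open import Relation.Nullary.Decidable using (_×-dec_)
  open ≡-Reasoning
  open Int using (ℤ; +_; 0ℤ; 1ℤ; _≤_; _<_; _+_; _*_; -_; _-_; solve-∀)
  open FiniteSums
  open FiniteRings
  open Residues
  open Operators

  module _ (p : ℕ) (pr : Prime p) where
    private
      instance
        p≢0 : NonZero p
        p≢0 = prime⇒nonZero pr

    power≢0 : ∀ n → NonZero (p ℕ.^ n)
    power≢0 n = ℕ.m^n≢0 p n

    module PowerRing (n : ℕ) where
      instance
        pⁿ≢0 : NonZero (p ℕ.^ n)
        pⁿ≢0 = power≢0 n

      N : ℕ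
      N = p ℕ.^ n

      𝑹 : FinRing
      𝑹 = ℤ/ N

      open Ring 𝑹 public

      cls : ℤ → R
      cls = class N

      pw : ℕ → R
      pw j = cls (+ (p ℕ.^ j))

      cls-≡⇒ : ∀ {x y} → cls x ≡ cls y → N ∣ℤ x - y
      cls-≡⇒ = class-≡⇒ N

      cls-≡0⇒ : ∀ {x} → cls x ≡ 𝟘 → N ∣ℤ x
      cls-≡0⇒ {x} e = subst (N ∣ℤ_) (alg x) (cls-≡⇒ e)
        where
        opaque
          unfolding _+_ _*_ -_
          alg : ∀ x → x - 0ℤ ≡ x
          alg = solve-∀

      ⇒cls-≡0 : ∀ {x} → N ∣ℤ x → cls x ≡ 𝟘
      ⇒cls-≡0 {x} d = class-cong N (subst (N ∣ℤ_) (sym (alg x)) d)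
        where
        opaque
          unfolding _+_ _*_ -_
          alg : ∀ x → x - 0ℤ ≡ x
          alg = solve-∀

      pw-+ : ∀ i j → pw i · pw j ≡ pw (i ℕ.+ j)
      pw-+ i j = trans (sym (class-* N (+ (p ℕ.^ i)) (+ (p ℕ.^ j)))) (cong cls (trans (sym (Int.pos-* (p ℕ.^ i) (p ℕ.^ j))) (cong +_ (sym (ℕ.^-distribˡ-+-* p i j)))))

      pw-0 : ∀ {j} → n ℕ.≤ j → pw j ≡ 𝟘
      pw-0 {j} n≤j = ⇒cls-≡0 (+ (p ℕ.^ (j ℕ.∸ n)) , trans (cong +_ (trans (cong (p ℕ.^_) (sym (ℕ.m∸n+n≡m n≤j))) (ℕ.^-distribˡ-+-* p (j ℕ.∸ n) n))) (Int.pos-* (p ℕ.^ (j ℕ.∸ n)) N))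

      card-R : card set ≡ + N
      card-R = card-ℤ/ N

      cancel-power : ∀ {j l x} → n ≡ j ℕ.+ l → pw j · cls x ≡ 𝟘 → p ℕ.^ l ∣ℤ x
      cancel-power {j} {l} {x} refl e = from (cls-≡0⇒ (trans (class-* N (+ (p ℕ.^ j)) x) e))
        where
        opaque
          unfolding _+_ _*_ -_
          alg : ∀ a k b → a * (k * b) ≡ k * (a * b)
          alg = solve-∀
          cancel : ∀ a .{{_ : NonZero a}} x y → + a * x ≡ + a * y → x ≡ y
          cancel (suc a) x y e = P.*-cancelˡ-≡ (+ suc a) x y e
            where import Data.Integer.Properties as P
        from : N ∣ℤ + (p ℕ.^ j) * x → p ℕ.^ l ∣ℤ x
        from (k , h) = k , cancel (p ℕ.^ j) {{power≢0 j}} _ _ (trans h (trans (cong (k *_) (trans (cong +_ (ℕ.^-distribˡ-+-* p j l)) (Int.pos-* (p ℕ.^ j) (p ℕ.^ l)))) (sym (alg (+ (p ℕ.^ j)) k (+ (p ℕ.^ l))))))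

      -- Multiplication by p^j remembers exactly the residue modulo p^(n - j), and reduction to that
      -- modulus has fibres of p^j elements.
      fibre≡ : ∀ {j} → j ℕ.≤ n → ∀ r → ∑[ y ∈ set ] [ pw j · y ≟ pw j · r ] ≡ + (p ℕ.^ j)
      fibre≡ {j} j≤n r = trans (∑-cong set λ y → []-cong (pw j · y ≟ pw j · r) (FinRing._≟_ (ℤ/ K) (proj y) (proj r)) (reduce y) (expand y)) (proj-fibre (proj r))
        where
        l = n ℕ.∸ j
        K = p ℕ.^ l
        instance
          K≢0 : NonZero K
          K≢0 = power≢0 l
        n≡ : n ≡ j ℕ.+ l
        n≡ = sym (ℕ.m+[n∸m]≡n j≤n)
        N≡ : N ≡ p ℕ.^ j ℕ.* K
        N≡ = trans (cong (p ℕ.^_) n≡) (ℕ.^-distribˡ-+-* p j l)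
        open Projection N (p ℕ.^ j) K N≡
        difference : ∀ y → pw j · cls (rep y - rep r) ≡ pw j · y ⊖ pw j · r
        difference y = begin
          pw j · cls (rep y - rep r)            ≡⟨ cong (pw j ·_) (trans (class-+ N (rep y) (- rep r)) (cong₂ _⊕_ (class-rep N y) (trans (class-neg N (rep r)) (cong ⊝_ (class-rep N r))))) ⟩
          pw j · (y ⊖ r)                        ≡⟨ solve 3 (λ p y r → p :* (y :- r) := p :* y :- p :* r) refl (pw j) y r ⟩
          pw j · y ⊖ pw j · r ∎
        reduce : ∀ y → pw j · y ≡ pw j · r → proj y ≡ proj r
        reduce y e = class-cong K (cancel-power {j} {l} n≡ (trans (difference y) (≡⇒⊖≡𝟘 e)))
        expand : ∀ y → proj y ≡ proj r → pw j · y ≡ pw j · r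
        expand y e with class-≡⇒ K e
        ... | k , h = ⊖≡𝟘⇒≡ (trans (sym (difference y)) (trans (sym (class-* N (+ (p ℕ.^ j)) (rep y - rep r))) (⇒cls-≡0 (k , trans (cong (+ (p ℕ.^ j) *_) h)
          (trans (alg (+ (p ℕ.^ j)) k (+ K)) (cong (k *_) (trans (sym (Int.pos-* (p ℕ.^ j) K)) (cong +_ (sym N≡)))))))))
          where
          opaque
            unfolding _+_ _*_ -_
            alg : ∀ a k b → a * (k * b) ≡ k * (a * b)
            alg = solve-∀

      fibre≤ : ∀ j r → ∑[ y ∈ set ] [ pw j · y ≟ pw j · r ] ≤ + (p ℕ.^ j)
      fibre≤ j r = by-cases (ℕ.≤-total j n)
        where
        by-cases : j ℕ.≤ n ⊎ n ℕ.≤ j → ∑[ y ∈ set ] [ pw j · y ≟ pw j · r ] ≤ + (p ℕ.^ j)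
        by-cases (inj₂ n≤j) = Int.≤-trans (∑-mono set λ y → []-≤1 (pw j · y ≟ pw j · r)) (Int.≤-trans (Int.≤-reflexive card-R) (Int.+≤+ (ℕ.^-monoʳ-≤ p n≤j)))
        by-cases (inj₁ j≤n) = Int.≤-reflexive (fibre≡ j≤n r)

    module _ (n′ : ℕ) where
      open PowerRing (suc n′)

      private
        p∣N : p ∣ N
        p∣N = divides (p ℕ.^ n′) (ℕ.*-comm p (p ℕ.^ n′))

      not-unit⇒ : ∀ z → ¬ Unit (cls z) → p ∣ℤ z
      not-unit⇒ z ¬u = by-cases (FinRing._≟_ (ℤ/ p) (class p z) (class p 0ℤ))
        where
        opaque
          unfolding _+_ _*_ -_
          alg : ∀ x → x - 0ℤ ≡ x
          alg = solve-∀
        m = toℕ (cls z)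
        p∣z⇐ : p ∣ m → p ∣ℤ z
        p∣z⇐ (divides k e) = subst (p ∣ℤ_) (alg′ z (rep (cls z))) (∣ℤ-+ (∣ℤ-trans p∣N (rep-class N z)) (+ k , trans (rep-nat (cls z)) (trans (cong +_ e) (Int.pos-* k p))))
          where
          opaque
            unfolding _+_ _*_ -_
            alg′ : ∀ z r → z - r + r ≡ z
            alg′ = solve-∀
        by-cases : Dec (class p z ≡ class p 0ℤ) → p ∣ℤ z
        by-cases (yes e) = subst (p ∣ℤ_) (alg z) (class-≡⇒ p e)
        by-cases (no ne) = ⊥-elim (¬u (subst Unit (trans (cong cls (sym (rep-nat (cls z)))) (class-rep N (cls z)))
          (coprime⇒unit N m (coprime-^ (suc n′) (prime-coprime pr (λ d → ne (class-cong p (subst (p ∣ℤ_) (sym (alg z)) (p∣z⇐ d)))))))))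

      p∣⇒not-unit : ∀ z → p ∣ℤ z → ¬ Unit (cls z)
      p∣⇒not-unit z (k , e) u = contradiction (p∣1 (class-≡⇒ N (trans (class-* N z (rep (inv (cls z)))) (trans (cong (cls z ·_) (class-rep N (inv (cls z)))) u)))) (λ d → ℕ.nonTrivial⇒≢1 {{prime⇒nonTrivial pr}} (Data.Nat.Divisibility.∣1⇒≡1 d))
        where
        import Data.Nat.Divisibility
        p∣1 : N ∣ℤ z * rep (inv (cls z)) - 1ℤ → p ∣ 1
        p∣1 d = pos-∣ℤ (subst (p ∣ℤ_) (alg (z * rep (inv (cls z))) 1ℤ) (∣ℤ-+ (subst (p ∣ℤ_) (Int.*-comm _ z) (∣ℤ-*ˡ (rep (inv (cls z))) (k , e))) (∣ℤ-neg (∣ℤ-trans p∣N d))))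
          where
          opaque
            unfolding _+_ _*_ -_
            alg : ∀ x o → x + - (x - o) ≡ o
            alg = solve-∀

      local : ∀ {x y} → Unit x → ¬ Unit y → Unit (x ⊕ y)
      local {x} {y} ux ¬uy with unit? (x ⊕ y)
      ... | yes u = u
      ... | no ¬u = ⊥-elim (p∣⇒not-unit (rep x) (subst (p ∣ℤ_) (alg (rep x) (rep y)) (∣ℤ-+ (not-unit⇒ (rep x + rep y) (λ u → ¬u (subst Unit (trans (class-+ N (rep x) (rep y)) (cong₂ _⊕_ (class-rep N x) (class-rep N y))) u)))
          (∣ℤ-neg (not-unit⇒ (rep y) (λ u → ¬uy (subst Unit (class-rep N y) u)))))) (subst Unit (sym (class-rep N x)) ux))
        where
        opaque
          unfolding _+_ _*_ -_
          alg : ∀ x y → x + y + - y ≡ x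
          alg = solve-∀

    -- A unit modulo p^(k + 1) divides everything; otherwise z = z′ p, and the claim for z′ with the
    -- next smaller exponent is multiplied by p. It is stated for integers because the modulus
    -- changes in the induction.
    divides-socle : ∀ k z → ¬ p ℕ.^ suc k ∣ℤ z → ∃ λ w → p ℕ.^ suc k ∣ℤ w * z - + (p ℕ.^ k)
    divides-socle k z ¬d with Ring.unit? (ℤ/ (p ℕ.^ suc k) {{power≢0 (suc k)}}) (class (p ℕ.^ suc k) {{power≢0 (suc k)}} z)
    ... | yes u = w , class-≡⇒ N (begin
        cls (w * z)                          ≡⟨ class-* N w z ⟩
        cls w · cls z                        ≡⟨ cong (_· cls z) (trans (class-* N (+ (p ℕ.^ k)) (rep (inv (cls z)))) (cong (pw k ·_) (class-rep N _))) ⟩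
        pw k · inv (cls z) · cls z           ≡⟨ trans (*-assoc _ _ _) (cong (pw k ·_) (trans (*-comm _ _) u)) ⟩
        pw k · 𝟙                             ≡⟨ *-identityʳ _ ⟩
        pw k ∎)
      where
      open PowerRing (suc k)
      w = + (p ℕ.^ k) * rep (inv (cls z))
    divides-socle zero z ¬d | no ¬u = ⊥-elim (¬d (subst (_∣ℤ z) (sym (ℕ.^-identityʳ p)) (not-unit⇒ 0 z ¬u)))
    divides-socle (suc k) z ¬d | no ¬u with not-unit⇒ (suc k) z ¬u
    ... | z′ , refl with divides-socle k z′ (λ { (t , e) → ¬d (t , trans (cong (_* + p) e) (trans (Int.*-assoc t _ _) (cong (t *_) (trans (sym (Int.pos-* (p ℕ.^ suc k) p)) (cong +_ (ℕ.*-comm (p ℕ.^ suc k) p))))))  })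
    ... | w , t , e = w , t , trans (lift (+ p) w z′ (+ (p ℕ.^ k)) (sym (trans (cong +_ (ℕ.*-comm p (p ℕ.^ k))) (Int.pos-* (p ℕ.^ k) p)))) (trans (cong (_* + p) e) (trans (Int.*-assoc t _ _) (cong (t *_) (trans (sym (Int.pos-* (p ℕ.^ suc k) p)) (cong +_ (ℕ.*-comm (p ℕ.^ suc k) p))))))
      where
      opaque
        unfolding _+_ _*_ -_
        lift : ∀ P w z q {q′} → q * P ≡ q′ → w * (z * P) - q′ ≡ (w * z - q) * P
        lift P w z q refl = alg P w z q
          where
          alg : ∀ P w z q → w * (z * P) - q * P ≡ (w * z - q) * P
          alg = solve-∀

    module Primitives (n′ : ℕ) (c : FinRing.R (PowerRing.𝑹 (suc n′))) (C : Ring.Unit (PowerRing.𝑹 (suc n′)) c) where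
      open PowerRing (suc n′)
      open Primitive 𝑹 c C using (X; U; vec; op)
      private
        gset = set ⊗ set

      ε : R
      ε = pw n′

      card>0 : 0ℤ < card gset
      card>0 = subst (0ℤ <_) (sym (trans (card-⊗ set set) (trans (cong₂ _*_ card-R card-R) (sym (Int.pos-* N N))))) (Int.+>0 (N ℕ.* N) {{ℕ.m*n≢0 N N}})

      divides-ε : ∀ {Δ} → ¬ Δ ≡ 𝟘 → ∀ x → ∃ λ w → w · Δ ≡ ε · x
      divides-ε {Δ} Δ≢0 x with divides-socle n′ (rep Δ) (λ d → Δ≢0 (trans (sym (class-rep N Δ)) (⇒cls-≡0 d)))
      ... | w , d = cls w · x , trans (solve 3 (λ w x d → w :* x :* d := w :* d :* x) refl (cls w) x Δ)
        (cong (_· x) (trans (cong (cls w ·_) (sym (class-rep N Δ))) (trans (sym (class-* N w (rep Δ))) (class-cong N d))))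

      open PrimitiveBound 𝑹 c C using (module SquareClasses; module ResidueClasses; MeanZero)

      Primitive : (R × R → ℤ) → Set
      Primitive = MeanZero ε card>0 divides-ε

      module Squares (j : ℕ) (n≤2j : suc n′ ℕ.≤ j ℕ.+ j) where
        π : R
        π = pw j
        π² : π · π ≡ 𝟘
        π² = trans (pw-+ j j) (pw-0 n≤2j)
        open SquareClasses ε card>0 divides-ε π π² public

        bound-by-count : ∀ M → 0ℤ ≤ M → (∀ i → ∑ set (piece i) ≤ M) → ∀ {f} → Primitive f → norm gset (X f) ≤ M * M * norm gset f
        bound-by-count M M≥0 count = bound (M * M) (Int.*-≥0 M≥0 M≥0) (λ {f} _ i → Int.≤-trans (op-trivial vec (piece i) (piece-idem i) f)
            (Int.*-monoʳ (norm≥0 gset f) (Int.≤-trans (Int.*-monoʳ (piece≥0 i) (count i)) (Int.*-monoˡ M≥0 (count i)))))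
          where
          open Operator (𝑹 ⊗ᴿ 𝑹) set using (op-trivial)
          piece≥0 : ∀ i → 0ℤ ≤ ∑ set (piece i)
          piece≥0 i = ∑-≥0 set λ y → subst (0ℤ ≤_) (piece-idem i y) (Int.sq≥0 (piece i y))

        class-factors : ∀ {y y₀} → cl y ≡ cl y₀ → π · ((y ⊖ y₀) · (y ⊕ y₀)) ≡ 𝟘
        class-factors {y} {y₀} e = trans (solve 3 (λ p y z → p :* ((y :- z) :* (y :+ z)) := p :* (y :* y) :- p :* (z :* z)) refl π y y₀) (≡⇒⊖≡𝟘 (cong proj₁ e))

        -- The class of y₀ is contained in the two residue classes of y₀ and -y₀, each with at most
        -- p^k elements.
        count-by-sign : ∀ k → (∀ {y y₀} → Unit y → Unit y₀ → cl y ≡ cl y₀ → pw k · y ≡ pw k · y₀ ⊎ pw k · y ≡ pw k · ⊝ y₀) → ∀ i → ∑ set (piece i) ≤ + 2 * + (p ℕ.^ k)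
        count-by-sign k sign i = by-cases (search set (λ y → unit? y ×-dec FinSet._≟_ I (cl y) i))
          where
          opaque
            unfolding _+_ _*_ -_
            double : ∀ a → a + a ≡ + 2 * a
            double = solve-∀
          merge : ∀ y → piece i y ≡ [ unit? y ×-dec FinSet._≟_ I (cl y) i ]
          merge y = []-× (unit? y) (FinSet._≟_ I (cl y) i) (unit? y ×-dec FinSet._≟_ I (cl y) i) (λ z → z) (λ z → z)
          by-cases : Dec (∃ λ y → Unit y × cl y ≡ i) → ∑ set (piece i) ≤ + 2 * + (p ℕ.^ k)
          by-cases (no none) = Int.≤-trans (Int.≤-reflexive (∑-≡0 set λ y → trans (merge y) ([]-no (unit? y ×-dec FinSet._≟_ I (cl y) i) (λ h → none (y , h))))) (Int.*-≥0 (Int.+≥0 2) (Int.+≥0 (p ℕ.^ k)))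
          by-cases (yes (y₀ , u₀ , refl)) = Int.≤-trans (∑-mono set each) (Int.≤-trans (Int.≤-reflexive (∑-+ set _ _)) (Int.≤-trans (Int.+-mono-≤ (fibre≤ k y₀) (fibre≤ k (⊝ y₀))) (Int.≤-reflexive (double _))))
            where
            each : ∀ y → piece i y ≤ [ pw k · y ≟ pw k · y₀ ] + [ pw k · y ≟ pw k · ⊝ y₀ ]
            each y = subst (_≤ [ pw k · y ≟ pw k · y₀ ] + [ pw k · y ≟ pw k · ⊝ y₀ ]) (sym (merge y)) (go (unit? y ×-dec FinSet._≟_ I (cl y) i))
              where
              a≥0 = []-≥0 (pw k · y ≟ pw k · y₀)
              b≥0 = []-≥0 (pw k · y ≟ pw k · ⊝ y₀)
              go : (d : Dec (Unit y × cl y ≡ i)) → [ d ] ≤ [ pw k · y ≟ pw k · y₀ ] + [ pw k · y ≟ pw k · ⊝ y₀ ]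
              go (no _) = subst (_≤ [ pw k · y ≟ pw k · y₀ ] + [ pw k · y ≟ pw k · ⊝ y₀ ]) (Int.+-identityʳ 0ℤ) (Int.+-mono-≤ a≥0 b≥0)
              go (yes (u , e)) with sign u u₀ e
              ... | inj₁ h = subst (_≤ [ pw k · y ≟ pw k · y₀ ] + [ pw k · y ≟ pw k · ⊝ y₀ ]) (Int.+-identityʳ 1ℤ) (Int.+-mono-≤ (Int.≤-reflexive (sym ([]-yes (pw k · y ≟ pw k · y₀) h))) b≥0)
              ... | inj₂ h = subst (_≤ [ pw k · y ≟ pw k · y₀ ] + [ pw k · y ≟ pw k · ⊝ y₀ ]) (Int.+-identityˡ 1ℤ) (Int.+-mono-≤ a≥0 (Int.≤-reflexive (sym ([]-yes (pw k · y ≟ pw k · ⊝ y₀) h))))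

-- The bound for primitive functions modulo prime powers.

module PrimePowerBound where
  open import Data.Fin using (toℕ)
  import Data.Nat.Tactic.RingSolver as ℕ-Solver
  open import Data.Fin.Properties using (toℕ<n)
  open import Data.Nat.Divisibility using (_∣_; ∣⇒≤)
  open import Data.Nat.Primality using (Prime; prime⇒nonTrivial; prime[2])
  open import Relation.Nullary.Decidable using (_×-dec_)
  open ≡-Reasoning
  open Int using (ℤ; +_; 0ℤ; 1ℤ; _≤_; _+_; _*_; -_; _-_; solve-∀)
  open FiniteSums
  open FiniteRings
  open Residues
  open Operators
  open PrimePower

  private
    opaque
      unfolding _+_ _*_ -_
      four : ∀ P n → + 2 * P * (+ 2 * P) * n ≡ + 4 * (P * P) * n
      four = solve-∀
      parallelogram : ∀ x y → + 2 * (x * x + y * y) - (x + y) * (x + y) ≡ (x - y) * (x - y)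
      parallelogram = solve-∀
      distribute : ∀ a b f → (a + b) * f ≡ a * f + b * f
      distribute = solve-∀
      collect : ∀ B n → + 2 * (B * n + B * n) ≡ + 4 * B * n
      collect = solve-∀

  parity : ∀ n → (∃ λ j → n ≡ j ℕ.+ j) ⊎ (∃ λ j → n ≡ suc (j ℕ.+ j))
  parity zero = inj₁ (0 , refl)
  parity (suc n) with parity n
  ... | inj₁ (j , refl) = inj₂ (j , refl)
  ... | inj₂ (j , refl) = inj₁ (suc j , cong suc (sym (ℕ.+-suc j j)))

  norm-+ : (A : FinSet) (f g : ∣ A ∣ → ℤ) → norm A (λ x → f x + g x) ≤ + 2 * (norm A f + norm A g)
  norm-+ A f g = subst (norm A (λ x → f x + g x) ≤_) (trans (∑-*ˡ A (+ 2) _) (cong (+ 2 *_) (∑-+ A _ _)))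
    (∑-mono A λ x → Int.≤-via ((f x - g x) * (f x - g x)) (Int.sq≥0 (f x - g x)) (parallelogram (f x) (g x)))

  module OddPrime (p′ : ℕ) (pr : Prime (suc p′)) (h₀ : ℕ) (odd : suc p′ ≡ suc (h₀ ℕ.+ h₀)) where
    private
      p = suc p′

      prime-case : ∀ N .{{_ : NonZero N}} → N ≡ p → ∀ c (C : Ring.Unit (ℤ/ N) c) f → ∑ (FinRing.set (ℤ/ N) ⊗ FinRing.set (ℤ/ N)) f ≡ 0ℤ →
        norm (FinRing.set (ℤ/ N) ⊗ FinRing.set (ℤ/ N)) (Primitive.X (ℤ/ N) c C f) ≤ + 4 * + N * norm (FinRing.set (ℤ/ N) ⊗ FinRing.set (ℤ/ N)) f
      prime-case N refl c C f = Radon.prime-bound p′ pr h₀ odd c C f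

    module _ (n′ : ℕ) (c : FinRing.R (PowerRing.𝑹 p pr (suc n′))) (C : Ring.Unit (PowerRing.𝑹 p pr (suc n′)) c) where
      open PowerRing p pr (suc n′)
      open Primitives p pr n′ c C
      open Primitive 𝑹 c C using (X; U; vec; op)
      private
        gset = set ⊗ set

        p≢2 : ¬ p ∣ 2
        p≢2 d = odd-two h₀ (ℕ.suc-injective (trans (sym (ℕ.≤-antisym (∣⇒≤ d) (ℕ.nonTrivial⇒n>1 p {{prime⇒nonTrivial pr}}))) odd))
          where
          odd-two : ∀ h → ¬ 1 ≡ h ℕ.+ h
          odd-two (suc h) e = contradiction (trans (ℕ.suc-injective e) (ℕ.+-suc h h)) λ ()

        two : Unit (𝟙 ⊕ 𝟙)
        two = by-cases (unit? (𝟙 ⊕ 𝟙))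
          where
          by-cases : Dec (Unit (𝟙 ⊕ 𝟙)) → Unit (𝟙 ⊕ 𝟙)
          by-cases (yes u) = u
          by-cases (no ¬u) = ⊥-elim (p≢2 (pos-∣ℤ (subst (p ∣ℤ_) (sym (Int.pos-+ 1 1)) (not-unit⇒ p pr n′ (1ℤ + 1ℤ) (λ u → ¬u (subst Unit (class-+ N 1ℤ 1ℤ) u))))))

        double-unit : ∀ {x} → Unit x → Unit (x ⊕ x)
        double-unit {x} u = subst Unit (trans (distribʳ x 𝟙 𝟙) (cong₂ _⊕_ (*-identityˡ x) (*-identityˡ x))) (unit-· two u)

        -- y + y₀ and y - y₀ differ by the unit 2 y₀, so in a local ring one of them is a unit and
        -- can be cancelled.
        sign : ∀ {π y y₀} → Unit y₀ → π · ((y ⊖ y₀) · (y ⊕ y₀)) ≡ 𝟘 → π · y ≡ π · y₀ ⊎ π · y ≡ π · ⊝ y₀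
        sign {π} {y} {y₀} u₀ e = by-cases (unit? (y ⊖ y₀))
          where
          by-cases : Dec (Unit (y ⊖ y₀)) → π · y ≡ π · y₀ ⊎ π · y ≡ π · ⊝ y₀
          by-cases (yes u) = inj₂ (⊖≡𝟘⇒≡ (trans (solve 3 (λ p y z → p :* y :- p :* (:- z) := p :* (y :+ z)) refl π y y₀)
            (unit-cancelˡ u (trans (solve 3 (λ s p t → s :* (p :* t) := p :* (s :* t)) refl (y ⊖ y₀) π (y ⊕ y₀)) (trans e (sym (zeroʳ _)))))))
          by-cases (no ¬u) = inj₁ (⊖≡𝟘⇒≡ (trans (solve 3 (λ p y z → p :* y :- p :* z := p :* (y :- z)) refl π y y₀)
            (unit-cancelˡ (subst Unit (solve 2 (λ y z → z :+ z :+ (y :- z) := y :+ z) refl y y₀) (local p pr n′ (double-unit u₀) ¬u))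
              (trans (solve 3 (λ t p s → t :* (p :* s) := p :* (s :* t)) refl (y ⊕ y₀) π (y ⊖ y₀)) (trans e (sym (zeroʳ _)))))))

        -- The square classes have at most 2 p^j elements, and (2 p^j)² = 4 N.
        even-case : ∀ j → suc n′ ≡ j ℕ.+ j → ∀ {f} → Primitive f → norm gset (X f) ≤ + 4 * + N * norm gset f
        even-case j n≡ {f} pf = subst (norm gset (X f) ≤_) (trans (four (+ (p ℕ.^ j)) (norm gset f)) (cong (λ t → + 4 * t * norm gset f) (trans (sym (Int.pos-* (p ℕ.^ j) (p ℕ.^ j))) (cong +_ (sym (trans (cong (p ℕ.^_) n≡) (ℕ.^-distribˡ-+-* p j j)))))))
          (bound-by-count (+ 2 * + (p ℕ.^ j)) (Int.*-≥0 (Int.+≥0 2) (Int.+≥0 (p ℕ.^ j))) (count-by-sign j (λ {y} {y₀} u u₀ e → sign u₀ (class-factors e))) {f} pf)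
          where open Squares j (ℕ.≤-reflexive n≡)

        -- The trivial bound (2 p^(m + 1))² = 4 p N for a square class would lose a factor p. So
        -- each class is split into two residue classes modulo p^m, whose operators are decomposed
        -- further modulo p^(m + 1).
        odd-case : ∀ m → 1 ℕ.≤ m → suc n′ ≡ suc (m ℕ.+ m) → ∀ {f} → Primitive f → norm gset (X f) ≤ + 4 * + N * norm gset f
        odd-case m m≥1 n≡ {f} pf = bound (+ 4 * + N) (Int.*-≥0 (Int.+≥0 4) (Int.+≥0 N)) (λ {f} → piece-bound {f}) {f} pf
          where
          open Squares (suc m) (subst (ℕ._≤ suc m ℕ.+ suc m) (sym n≡) (s≤s (ℕ.+-monoʳ-≤ m (ℕ.n≤1+n m))))
          τ ϖ : R
          τ = pw m
          ϖ = π
          n≡′ : suc n′ ≡ suc m ℕ.+ m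
          n≡′ = n≡
          τ³ : τ · τ · τ ≡ 𝟘
          τ³ = trans (cong (_· τ) (pw-+ m m)) (trans (pw-+ (m ℕ.+ m) m) (pw-0 (subst (ℕ._≤ m ℕ.+ m ℕ.+ m) (sym n≡) (subst (ℕ._≤ m ℕ.+ m ℕ.+ m) (ℕ.+-comm (m ℕ.+ m) 1) (ℕ.+-monoʳ-≤ (m ℕ.+ m) m≥1)))))
          ϖτ : ϖ · τ ≡ 𝟘
          ϖτ = trans (pw-+ (suc m) m) (pw-0 (ℕ.≤-reflexive n≡))
          annihilator : ∀ {x} → ϖ · x ≡ 𝟘 → ∃ λ t → x ≡ τ · t
          annihilator {x} e with cancel-power {suc m} {m} n≡′ (trans (cong (ϖ ·_) (class-rep N x)) e)
          ... | k , h = cls k , trans (sym (class-rep N x)) (trans (cong cls h) (trans (class-* N k _) (*-comm _ _)))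
          open PrimitiveBound.ResidueClasses 𝑹 c C ε card>0 divides-ε τ ϖ τ³ ϖτ annihilator two using (residue; refined; residue-bound)

          ϖ≢0 : ¬ ϖ ≡ 𝟘
          ϖ≢0 e = ℕ.<⇒≱ (ℕ.^-monoʳ-< p (ℕ.nonTrivial⇒n>1 p {{prime⇒nonTrivial pr}}) (subst (suc m ℕ.<_) (sym n≡) (s≤s (ℕ.m<m+n m m≥1))))
            (∣⇒≤ {{power≢0 p pr (suc m)}} (pos-∣ℤ (cls-≡0⇒ e)))

          residue≤ : ∀ r → ∑ set (residue r) ≤ + (p ℕ.^ suc m)
          residue≤ r = Int.≤-trans (∑-mono set λ y → subst (residue r y ≤_) (Int.*-identityˡ _) (Int.*-monoʳ ([]-≥0 (ϖ · y ≟ ϖ · r)) ([]-≤1 (unit? y)))) (fibre≤ (suc m) r)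

          refined≤ : ∀ r ρ → ∑ set (refined r ρ) ≤ + (p ℕ.^ m)
          refined≤ r ρ = Int.≤-trans (∑-mono set drop) (by-cases (search set (λ y → τ · y ≟ ρ)))
            where
            drop : ∀ y → refined r ρ y ≤ [ τ · y ≟ ρ ]
            drop y = subst (refined r ρ y ≤_) (Int.*-identityˡ _) (Int.*-monoʳ ([]-≥0 (τ · y ≟ ρ)) (Int.≤-trans (Int.*-monoʳ ([]-≥0 (ϖ · y ≟ ϖ · r)) ([]-≤1 (unit? y))) (subst (_≤ 1ℤ) (sym (Int.*-identityˡ _)) ([]-≤1 (ϖ · y ≟ ϖ · r)))))
            by-cases : Dec (∃ λ y → τ · y ≡ ρ) → ∑[ y ∈ set ] [ τ · y ≟ ρ ] ≤ + (p ℕ.^ m)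
            by-cases (yes (y₀ , refl)) = fibre≤ m y₀
            by-cases (no none) = subst (_≤ + (p ℕ.^ m)) (sym (∑-≡0 set λ y → []-no (τ · y ≟ ρ) (λ e → none (y , e)))) (Int.+≥0 (p ℕ.^ m))

          residue-norm : ∀ {f} → Primitive f → ∀ r → Unit r → norm gset (op vec (residue r) f) ≤ + N * norm gset f
          residue-norm {f} pf r ur = subst (λ t → norm gset (op vec (residue r) f) ≤ t * norm gset f)
            (trans (sym (Int.pos-* (p ℕ.^ m) (p ℕ.^ suc m))) (cong +_ (trans (sym (ℕ.^-distribˡ-+-* p m (suc m))) (cong (p ℕ.^_) (trans (ℕ.+-suc m m) (sym n≡))))))
            (residue-bound (+ (p ℕ.^ suc m)) (+ (p ℕ.^ m)) r (Int.+≥0 (p ℕ.^ m)) ur (residue≤ r) (refined≤ r) {f} pf)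

          -- A square class is the disjoint union of the residue classes of ± y₀.
          class⇒ : ∀ {y y₀} → Unit y → Unit y₀ → ϖ · y ≡ ϖ · y₀ → cl y ≡ cl y₀
          class⇒ {y} {y₀} u u₀ e = cong₂ _,_ (square e) (square inv-e)
            where
            square : ∀ {y y₀} → ϖ · y ≡ ϖ · y₀ → ϖ · (y · y) ≡ ϖ · (y₀ · y₀)
            square {y} {y₀} e = trans (solve 2 (λ p y → p :* (y :* y) := p :* y :* y) refl ϖ y) (trans (cong (_· y) e) (trans (solve 3 (λ p y z → p :* z :* y := p :* y :* z) refl ϖ y y₀)
              (trans (cong (_· y₀) e) (*-assoc ϖ y₀ y₀))))
            inv-e : ϖ · inv y ≡ ϖ · inv y₀
            inv-e = begin
              ϖ · inv y                    ≡⟨ sym (trans (cong (ϖ · inv y ·_) u₀) (*-identityʳ _)) ⟩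
              ϖ · inv y · (y₀ · inv y₀)    ≡⟨ solve 4 (λ p i z j → p :* i :* (z :* j) := p :* z :* (i :* j)) refl ϖ (inv y) y₀ (inv y₀) ⟩
              ϖ · y₀ · (inv y · inv y₀)    ≡⟨ cong (_· (inv y · inv y₀)) (sym e) ⟩
              ϖ · y · (inv y · inv y₀)     ≡⟨ solve 4 (λ p y i j → p :* y :* (i :* j) := p :* j :* (y :* i)) refl ϖ y (inv y) (inv y₀) ⟩
              ϖ · inv y₀ · (y · inv y)     ≡⟨ trans (cong (ϖ · inv y₀ ·_) u) (*-identityʳ _) ⟩
              ϖ · inv y₀ ∎

          cl-neg : ∀ {y} → Unit y → cl (⊝ y) ≡ cl y
          cl-neg {y} u = cong₂ _,_ (solve 2 (λ p y → p :* ((:- y) :* (:- y)) := p :* (y :* y)) refl ϖ y)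
            (trans (cong (λ t → ϖ · (t · t)) (inv-neg u)) (solve 2 (λ p y → p :* ((:- y) :* (:- y)) := p :* (y :* y)) refl ϖ (inv y)))

          piece-split : ∀ {y₀} → Unit y₀ → ∀ y → piece (cl y₀) y ≡ residue y₀ y + residue (⊝ y₀) y
          piece-split {y₀} u₀ y = by-cases (unit? y)
            where
            by-cases : (d : Dec (Unit y)) → [ d ] * [ FinSet._≟_ I (cl y) (cl y₀) ] ≡ [ d ] * [ ϖ · y ≟ ϖ · y₀ ] + [ d ] * [ ϖ · y ≟ ϖ · ⊝ y₀ ]
            by-cases (no _) = trans (Int.*-zeroˡ _) (sym (trans (cong₂ _+_ (Int.*-zeroˡ _) (Int.*-zeroˡ _)) (Int.+-identityˡ 0ℤ)))
            by-cases (yes u) = trans (Int.*-identityˡ _) (trans (go (ϖ · y ≟ ϖ · y₀) (ϖ · y ≟ ϖ · ⊝ y₀)) (sym (cong₂ _+_ (Int.*-identityˡ _) (Int.*-identityˡ _))))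
              where
              D = FinSet._≟_ I (cl y) (cl y₀)
              go : (a : Dec (ϖ · y ≡ ϖ · y₀)) (b : Dec (ϖ · y ≡ ϖ · ⊝ y₀)) → [ D ] ≡ [ a ] + [ b ]
              go (yes e) (yes e′) = ⊥-elim (ϖ≢0 (unit-cancelˡ (double-unit u₀) (trans (solve 2 (λ p z → (z :+ z) :* p := p :* z :- p :* (:- z)) refl ϖ y₀) (trans (≡⇒⊖≡𝟘 (trans (sym e) e′)) (sym (zeroʳ _))))))
              go (yes e) (no _) = trans ([]-yes D (class⇒ u u₀ e)) (sym (Int.+-identityʳ 1ℤ))
              go (no _) (yes e) = trans ([]-yes D (trans (class⇒ u (unit-neg u₀) e) (cl-neg u₀))) (sym (Int.+-identityˡ 1ℤ))
              go (no ne) (no ne′) = trans ([]-no D (λ e → neither (sign u₀ (class-factors e)))) (sym (Int.+-identityˡ 0ℤ))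
                where
                neither : ϖ · y ≡ ϖ · y₀ ⊎ ϖ · y ≡ ϖ · ⊝ y₀ → _
                neither (inj₁ e) = ne e
                neither (inj₂ e) = ne′ e

          -- Two residue classes, each contributing at most N, combine under `norm-+` to 2 (N + N) =
          -- 4 N.
          piece-bound : ∀ {f} → Primitive f → ∀ i → norm gset (op vec (piece i) f) ≤ + 4 * + N * norm gset f
          piece-bound {f} pf i = by-cases (search set (λ y → unit? y ×-dec FinSet._≟_ I (cl y) i))
            where
            by-cases : Dec (∃ λ y → Unit y × cl y ≡ i) → norm gset (op vec (piece i) f) ≤ + 4 * + N * norm gset f
            by-cases (no none) = subst (_≤ + 4 * + N * norm gset f) (sym (∑-≡0 gset λ g → trans (cong (_* op vec (piece i) f g) (null g)) (Int.*-zeroˡ _))) (Int.*-≥0 (Int.*-≥0 (Int.+≥0 4) (Int.+≥0 N)) (norm≥0 gset f))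
              where
              null : ∀ g → op vec (piece i) f g ≡ 0ℤ
              null g = ∑-≡0 set λ y → trans (cong (_* f _) (trans ([]-× (unit? y) (FinSet._≟_ I (cl y) i) (unit? y ×-dec FinSet._≟_ I (cl y) i) (λ z → z) (λ z → z))
                ([]-no (unit? y ×-dec FinSet._≟_ I (cl y) i) (λ h → none (y , h))))) (Int.*-zeroˡ _)
            by-cases (yes (y₀ , u₀ , refl)) = Int.≤-trans (Int.≤-reflexive (norm-cong gset split)) (Int.≤-trans (norm-+ gset _ _)
              (Int.≤-trans (Int.*-monoˡ (Int.+≥0 2) (Int.+-mono-≤ (residue-norm {f} pf y₀ u₀) (residue-norm {f} pf (⊝ y₀) (unit-neg u₀)))) (Int.≤-reflexive (collect (+ N) (norm gset f)))))
              where
              split : ∀ g → op vec (piece i) f g ≡ op vec (residue y₀) f g + op vec (residue (⊝ y₀)) f g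
              split g = trans (∑-cong set λ y → trans (cong (_* f _) (piece-split u₀ y)) (distribute _ _ _)) (∑-+ set _ _)

      primitive-bound : ∀ {f} → Primitive f → norm gset (X f) ≤ + 4 * + N * norm gset f
      primitive-bound = by-cases n′ refl (parity (suc n′))
        where
        by-cases : ∀ k → n′ ≡ k → (∃ λ j → suc n′ ≡ j ℕ.+ j) ⊎ (∃ λ j → suc n′ ≡ suc (j ℕ.+ j)) → ∀ {f} → Primitive f → norm gset (X f) ≤ + 4 * + N * norm gset f
        -- For exponent 1 the element ε is 1, and being primitive means having sum zero.
        by-cases zero refl _ {f} pf = prime-case N (ℕ.^-identityʳ p) c C f (trans (∑-cong gset λ { (x , y) → cong f (cong₂ _,_ (unshift x) (unshift y)) }) (pf (𝟘 , 𝟘)))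
          where
          unshift : ∀ x → x ≡ 𝟘 ⊕ ε · x
          unshift x = sym (trans (+-identityˡ _) (*-identityˡ x))
        by-cases (suc _) _ (inj₁ (j , e)) {f} pf = even-case j e {f} pf
        by-cases (suc _) e′ (inj₂ (zero , e)) = contradiction (trans (sym e′) (ℕ.suc-injective e)) λ ()
        by-cases (suc _) _ (inj₂ (suc j , e)) {f} pf = odd-case (suc j) (s≤s z≤n) e {f} pf

  module EvenPrime (n′ : ℕ) (c : FinRing.R (PowerRing.𝑹 2 prime[2] (suc n′))) (C : Ring.Unit (PowerRing.𝑹 2 prime[2] (suc n′)) c) where
    open PowerRing 2 prime[2] (suc n′)
    open Primitives 2 prime[2] n′ c C
    open Primitive 𝑹 c C using (X; U; vec; op)
    private
      gset = set ⊗ set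

      -- j is (n′ + 1) / 2 rounded up, the least exponent with square-zero 2^j.
      half : ∃ λ j → suc n′ ℕ.≤ j ℕ.+ j × j ℕ.+ j ℕ.≤ suc (suc n′)
      half with parity (suc n′)
      ... | inj₁ (j , e) = j , ℕ.≤-reflexive e , ℕ.≤-trans (ℕ.≤-reflexive (sym e)) (ℕ.n≤1+n _)
      ... | inj₂ (j , e) = suc j , subst (ℕ._≤ suc j ℕ.+ suc j) (sym e) (s≤s (ℕ.+-monoʳ-≤ j (ℕ.n≤1+n j))) , ℕ.≤-reflexive (trans (cong suc (ℕ.+-suc j j)) (cong suc (sym e)))

      j = proj₁ half
      open Squares j (proj₁ (proj₂ half))

      one-of : ∀ {x y} → Unit (x ⊕ y) → Unit x ⊎ Unit y
      one-of {x} {y} u = by-cases (unit? x) (unit? y)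
        where
        by-cases : Dec (Unit x) → Dec (Unit y) → Unit x ⊎ Unit y
        by-cases (yes a) _ = inj₁ a
        by-cases _ (yes b) = inj₂ b
        by-cases (no a) (no b) = ⊥-elim (p∣⇒not-unit 2 prime[2] n′ (rep x + rep y) (∣ℤ-+ (even a) (even b)) (subst Unit (trans (sym (cong₂ _⊕_ (class-rep N x) (class-rep N y))) (sym (class-+ N (rep x) (rep y)))) u))
          where
          even : ∀ {z} → ¬ Unit z → 2 ∣ℤ rep z
          even {z} ¬u = not-unit⇒ 2 prime[2] n′ (rep z) (λ u → ¬u (subst Unit (class-rep N z) u))

      mod2 : ∀ z → 2 ∣ℤ z ⊎ 2 ∣ℤ z - 1ℤ
      mod2 z with class 2 z | rep-class 2 z
      ... | x | d with toℕ x | rep-nat x | toℕ<n x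
      ... | zero | e | _ = inj₁ (subst (2 ∣ℤ_) (trans (cong (λ t → z - t) e) (alg z)) d)
        where
        opaque
          unfolding _+_ _*_ -_
          alg : ∀ x → x - 0ℤ ≡ x
          alg = solve-∀
      ... | suc zero | e | _ = inj₂ (subst (λ t → 2 ∣ℤ z - t) e d)
      ... | suc (suc _) | _ | s≤s (s≤s ())

      difference : ∀ {x y} → Unit x → Unit y → ∃ λ s → x ⊖ y ≡ pw 1 · s
      difference {x} {y} ux uy = from (∣ℤ-- (rep x) 1ℤ (rep y) (odd ux) (∣ℤ-flip (rep y) 1ℤ (odd uy)))
        where
        odd : ∀ {z} → Unit z → 2 ∣ℤ rep z - 1ℤ
        odd {z} u with mod2 (rep z)
        ... | inj₁ d = ⊥-elim (p∣⇒not-unit 2 prime[2] n′ (rep z) d (subst Unit (sym (class-rep N z)) u))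
        ... | inj₂ d = d
        from : 2 ∣ℤ rep x - rep y → ∃ λ s → x ⊖ y ≡ pw 1 · s
        from (k , e) = cls k , (begin
          x ⊖ y                       ≡⟨ cong₂ _⊖_ (sym (class-rep N x)) (sym (class-rep N y)) ⟩
          cls (rep x) ⊖ cls (rep y)   ≡⟨ sym (trans (class-+ N (rep x) (- rep y)) (cong (cls (rep x) ⊕_) (class-neg N (rep y)))) ⟩
          cls (rep x - rep y)         ≡⟨ cong cls e ⟩
          cls (k * + 2)               ≡⟨ trans (class-* N k (+ 2)) (*-comm _ _) ⟩
          pw 1 · cls k ∎)

      -- Units are odd, so y - y₀ = 2 s and y + y₀ = 2 (s + y₀). Since y₀ is a unit, so is s or s +
      -- y₀; cancelling it leaves one factor 2, whence `suc j` in place of `j`.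
      sign : ∀ {y y₀} → Unit y → Unit y₀ → cl y ≡ cl y₀ → pw (suc j) · y ≡ pw (suc j) · y₀ ⊎ pw (suc j) · y ≡ pw (suc j) · ⊝ y₀
      sign {y} {y₀} u u₀ e = by-cases (one-of (subst Unit (solve 2 (λ s z → z := s :+ z :+ (:- s)) refl s y₀) u₀))
        where
        s = proj₁ (difference u u₀)
        minus : y ⊖ y₀ ≡ pw 1 · s
        minus = proj₂ (difference u u₀)
        two : pw 1 ≡ 𝟙 ⊕ 𝟙
        two = trans (cong cls (Int.pos-+ 1 1)) (class-+ N 1ℤ 1ℤ)
        plus : y ⊕ y₀ ≡ pw 1 · (s ⊕ y₀)
        plus = begin
          y ⊕ y₀                        ≡⟨ solve 2 (λ y z → y :+ z := y :- z :+ (z :+ z)) refl y y₀ ⟩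
          y ⊖ y₀ ⊕ (y₀ ⊕ y₀)            ≡⟨ cong₂ _⊕_ minus (sym (trans (cong (_· y₀) two) (trans (distribʳ y₀ 𝟙 𝟙) (cong₂ _⊕_ (*-identityˡ y₀) (*-identityˡ y₀))))) ⟩
          pw 1 · s ⊕ pw 1 · y₀          ≡⟨ sym (distribˡ (pw 1) s y₀) ⟩
          pw 1 · (s ⊕ y₀) ∎
        by-cases : Unit (s ⊕ y₀) ⊎ Unit (⊝ s) → pw (suc j) · y ≡ pw (suc j) · y₀ ⊎ pw (suc j) · y ≡ pw (suc j) · ⊝ y₀
        by-cases (inj₁ v) = inj₁ (⊖≡𝟘⇒≡ (trans (solve 3 (λ p y z → p :* y :- p :* z := p :* (y :- z)) refl (pw (suc j)) y y₀) (unit-cancelˡ v (begin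
          (s ⊕ y₀) · (pw (suc j) · (y ⊖ y₀))       ≡⟨ cong (λ t → (s ⊕ y₀) · (t · (y ⊖ y₀))) (sym (pw-+ 1 j)) ⟩
          (s ⊕ y₀) · (pw 1 · π · (y ⊖ y₀))         ≡⟨ solve 4 (λ t a p d → t :* (a :* p :* d) := p :* (d :* (a :* t))) refl (s ⊕ y₀) (pw 1) π (y ⊖ y₀) ⟩
          π · ((y ⊖ y₀) · (pw 1 · (s ⊕ y₀)))       ≡⟨ trans (cong (λ t → π · ((y ⊖ y₀) · t)) (sym plus)) (trans (class-factors e) (sym (zeroʳ _))) ⟩
          (s ⊕ y₀) · 𝟘 ∎))))
        by-cases (inj₂ v) = inj₂ (⊖≡𝟘⇒≡ (trans (solve 3 (λ p y z → p :* y :- p :* (:- z) := p :* (y :+ z)) refl (pw (suc j)) y y₀) (unit-cancelˡ unit-s (begin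
          s · (pw (suc j) · (y ⊕ y₀))              ≡⟨ cong (λ t → s · (t · (y ⊕ y₀))) (sym (pw-+ 1 j)) ⟩
          s · (pw 1 · π · (y ⊕ y₀))                ≡⟨ solve 4 (λ s a p d → s :* (a :* p :* d) := p :* ((a :* s) :* d)) refl s (pw 1) π (y ⊕ y₀) ⟩
          π · (pw 1 · s · (y ⊕ y₀))                ≡⟨ trans (cong (λ t → π · (t · (y ⊕ y₀))) (sym minus)) (trans (class-factors e) (sym (zeroʳ _))) ⟩
          s · 𝟘 ∎))))
          where
          unit-s : Unit s
          unit-s = subst Unit (solve 1 (λ s → :- (:- s) := s) refl s) (unit-neg v)

    -- The classes have at most 2 * 2^(j + 1) elements. The square of this is 16 * 2^(2 j), and 2 j
    -- ≤ n′ + 2 makes it at most 32 N.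
    primitive-bound₂ : ∀ {f} → Primitive f → norm gset (X f) ≤ + 32 * + N * norm gset f
    primitive-bound₂ {f} pf = Int.≤-trans (bound-by-count M (Int.*-≥0 (Int.+≥0 2) (Int.+≥0 (2 ℕ.^ suc j))) (count-by-sign (suc j) sign) {f} pf) (Int.*-monoʳ (norm≥0 gset f) M²≤)
      where
      M = + 2 * + (2 ℕ.^ suc j)
      square : ∀ a → 2 ℕ.* (2 ℕ.* a) ℕ.* (2 ℕ.* (2 ℕ.* a)) ≡ 16 ℕ.* (a ℕ.* a)
      square = ℕ-Solver.solve-∀
      shift : ∀ a → 16 ℕ.* (2 ℕ.* a) ≡ 32 ℕ.* a
      shift = ℕ-Solver.solve-∀
      M≡ : M * M ≡ + (16 ℕ.* 2 ℕ.^ (j ℕ.+ j))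
      M≡ = trans (cong₂ _*_ e e) (trans (sym (Int.pos-* (2 ℕ.* 2 ℕ.^ suc j) (2 ℕ.* 2 ℕ.^ suc j))) (cong +_ (trans (square (2 ℕ.^ j)) (cong (16 ℕ.*_) (sym (ℕ.^-distribˡ-+-* 2 j j))))))
        where
        e : M ≡ + (2 ℕ.* 2 ℕ.^ suc j)
        e = sym (Int.pos-* 2 (2 ℕ.^ suc j))
      M²≤ : M * M ≤ + 32 * + N
      M²≤ = subst₂ _≤_ (sym M≡) (trans (cong +_ (shift N)) (Int.pos-* 32 N)) (Int.+≤+ (ℕ.*-monoʳ-≤ 16 (ℕ.^-monoʳ-≤ 2 (proj₂ (proj₂ half)))))

-- Functions modulo a prime power that factor through the next smaller power.

module Lift where
  open import Data.Nat.Primality using (Prime; prime⇒nonZero)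
  open ≡-Reasoning
  open Int using (ℤ; +_; 0ℤ; 1ℤ; _≤_; _<_; _+_; _*_; -_; _-_; solve-∀)
  open FiniteSums
  open FiniteRings
  open Residues
  open Operators
  open PrimePower

  private
    opaque
      unfolding _+_ _*_ -_
      expand : ∀ a b → (a + b) * (a + b) ≡ a * a + (b * b + + 2 * (a * b))
      expand = solve-∀
      plus-zero : ∀ a b → a + (b + + 2 * 0ℤ) ≡ a + b
      plus-zero = solve-∀
      restore : ∀ a b → a - b + b ≡ a
      restore = solve-∀
      square : ∀ n x → n * x * (n * x) ≡ n * n * (x * x)
      square = solve-∀
      pull : ∀ s k x → s * (k * x) ≡ k * (s * x)
      pull = solve-∀
      final : ∀ C N n m D → D * (C * N * n + m) ≡ C * N * (D * n) + D * m
      final = solve-∀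
      fourth : ∀ K p x → K * K * (K * K) * (p * p * (p * p) * x) ≡ (p * K) * (p * K) * ((p * K) * (p * K)) * x
      fourth = solve-∀
      add-nonneg : ∀ {a b c} → a + b ≡ c → 0ℤ ≤ b → a ≤ c
      add-nonneg {a} {b} refl h = Int.≤-via b h (e a b)
        where
        e : ∀ a b → a + b - a ≡ b
        e = solve-∀

  module Reduction (p : ℕ) (pr : Prime p) (n′ : ℕ) where
    private
      instance
        p≢0 : NonZero p
        p≢0 = prime⇒nonZero pr

    open PowerRing p pr (suc n′)
    private
      module R′ = PowerRing p pr n′
      K = p ℕ.^ n′
      gset = set ⊗ set
      gset′ = R′.set ⊗ R′.set
      module G = Ring (𝑹 ⊗ᴿ 𝑹)

    open Projection N p K {{pⁿ≢0}} {{R′.pⁿ≢0}} refl public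

    proj-inv : ∀ {y} → Unit y → proj (inv y) ≡ R′.inv (proj y)
    proj-inv {y} u = sym (R′.inv-unique (trans (sym (proj-· y (inv y))) (trans (cong proj u) (proj-class 1ℤ))))

    proj-unit : ∀ {y} → Unit y → R′.Unit (proj y)
    proj-unit {y} u = R′.toUnit (trans (sym (proj-· y (inv y))) (trans (cong proj u) (proj-class 1ℤ)))

    ∑-proj : ∀ F → ∑[ x ∈ set ] F (proj x) ≡ + p * ∑ R′.set F
    ∑-proj F = trans (∑-fibre set R′.set proj F) (trans (∑-cong R′.set λ u → cong (_* F u) (proj-fibre u)) (∑-*ˡ R′.set (+ p) F))

    pushforward : (R × R → ℤ) → R′.R × R′.R → ℤ
    pushforward f (u , v) = ∑[ x ∈ set ] ∑[ y ∈ set ] ([ proj x R′.≟ u ] * ([ proj y R′.≟ v ] * f (x , y)))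

    pullback : (R′.R × R′.R → ℤ) → R × R → ℤ
    pullback S (a , b) = S (proj a , proj b)

    norm-pullback : ∀ S → norm gset (pullback S) ≡ + p * + p * norm gset′ S
    norm-pullback S = begin
      norm gset (pullback S)
        ≡⟨ ∑-⊗ set set _ ⟩
      ∑[ a ∈ set ] ∑[ b ∈ set ] (S (proj a , proj b) * S (proj a , proj b))
        ≡⟨ ∑-cong set (λ a → ∑-proj (λ v → S (proj a , v) * S (proj a , v))) ⟩
      ∑[ a ∈ set ] (+ p * (∑[ v ∈ R′.set ] (S (proj a , v) * S (proj a , v))))
        ≡⟨ trans (∑-*ˡ set (+ p) _) (cong (+ p *_) (∑-proj (λ u → ∑[ v ∈ R′.set ] (S (u , v) * S (u , v))))) ⟩
      + p * (+ p * (∑[ u ∈ R′.set ] ∑[ v ∈ R′.set ] (S (u , v) * S (u , v))))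
        ≡⟨ trans (sym (Int.*-assoc (+ p) (+ p) _)) (cong (+ p * + p *_) (sym (∑-⊗ R′.set R′.set _))) ⟩
      + p * + p * norm gset′ S ∎

    module _ (c : R) (C : Unit c) where
      open Primitives p pr n′ c C
      open Primitive 𝑹 c C using (X; U; vec; op; module Moves)
      open Moves ε card>0 divides-ε using (κ; op-meanZero)

      -- The map x ↦ a + ε x has as image the coset of a modulo ε and hits each of its points K
      -- times.
      coset-sum : ∀ a (F : R → ℤ) → ∑[ x ∈ set ] F (a ⊕ ε · x) ≡ + K * (∑[ x ∈ set ] ([ proj x R′.≟ proj a ] * F x))
      coset-sum a F = trans (∑-fibre set set (λ x → a ⊕ ε · x) F) (trans (∑-cong set λ y → trans (cong (_* F y) (count y)) (Int.*-assoc (+ K) _ (F y))) (∑-*ˡ set (+ K) _))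
        where
        proj-ε : proj ε ≡ R′.𝟘
        proj-ε = trans (proj-class (+ K)) (R′.⇒cls-≡0 (1ℤ , sym (Int.*-identityˡ _)))
        count : ∀ y → ∑[ x ∈ set ] [ a ⊕ ε · x ≟ y ] ≡ + K * [ proj y R′.≟ proj a ]
        count y = by-cases (proj y R′.≟ proj a)
          where
          by-cases : (d : Dec (proj y ≡ proj a)) → ∑[ x ∈ set ] [ a ⊕ ε · x ≟ y ] ≡ + K * [ d ]
          by-cases (no ne) = trans (∑-≡0 set λ x → []-no (a ⊕ ε · x ≟ y) (λ e → ne (trans (cong proj (sym e)) (trans (proj-⊕ a (ε · x))
            (trans (cong (proj a R′.⊕_) (trans (proj-· ε x) (trans (cong (R′._· proj x) proj-ε) (R′.zeroˡ _)))) (R′.+-identityʳ _)))))) (sym (Int.*-zeroʳ (+ K)))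
          by-cases (yes e) with class-≡⇒ K {{R′.pⁿ≢0}} e
          ... | k , h = trans (trans (∑-cong set λ x → []-cong (a ⊕ ε · x ≟ y) (ε · x ≟ ε · cls k) (λ e′ → ⊕-cancelʳ a (trans (+-comm _ a) (trans e′ (trans y≡ (+-comm a _))))) (λ e′ → trans (cong (a ⊕_) e′) (sym y≡)))
              (fibre≡ {n′} (ℕ.n≤1+n n′) (cls k))) (sym (Int.*-identityʳ _))
            where
            y≡ : y ≡ a ⊕ ε · cls k
            y≡ = begin
              y                                    ≡⟨ solve 2 (λ y a → y := a :+ (y :- a)) refl y a ⟩
              a ⊕ (y ⊖ a)                          ≡⟨ cong (a ⊕_) (cong₂ _⊖_ (sym (class-rep N y)) (sym (class-rep N a))) ⟩
              a ⊕ (cls (rep y) ⊖ cls (rep a))      ≡⟨ cong (a ⊕_) (sym (trans (class-+ N (rep y) (- rep a)) (cong (cls (rep y) ⊕_) (class-neg N (rep a))))) ⟩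
              a ⊕ cls (rep y - rep a)              ≡⟨ cong (λ t → a ⊕ cls t) h ⟩
              a ⊕ cls (k * + K)                    ≡⟨ cong (a ⊕_) (trans (class-* N k (+ K)) (*-comm _ _)) ⟩
              a ⊕ ε · cls k ∎

      average : (R × R → ℤ) → R × R → ℤ
      average f g = ∑[ k ∈ gset ] f (g G.⊕ κ k)

      average≡ : ∀ f g → average f g ≡ + K * + K * pullback (pushforward f) g
      average≡ f (a , b) = begin
        ∑[ k ∈ gset ] f ((a , b) G.⊕ κ k)
          ≡⟨ ∑-⊗ set set _ ⟩
        ∑[ x ∈ set ] ∑[ y ∈ set ] f (a ⊕ ε · x , b ⊕ ε · y)
          ≡⟨ ∑-cong set (λ x → coset-sum b (λ y → f (a ⊕ ε · x , y))) ⟩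
        ∑[ x ∈ set ] (+ K * (∑[ y ∈ set ] ([ proj y R′.≟ proj b ] * f (a ⊕ ε · x , y))))
          ≡⟨ trans (∑-*ˡ set (+ K) _) (cong (+ K *_) (coset-sum a (λ x → ∑[ y ∈ set ] ([ proj y R′.≟ proj b ] * f (x , y))))) ⟩
        + K * (+ K * (∑[ x ∈ set ] ([ proj x R′.≟ proj a ] * (∑[ y ∈ set ] ([ proj y R′.≟ proj b ] * f (x , y))))))
          ≡⟨ trans (sym (Int.*-assoc (+ K) (+ K) _)) (cong (+ K * + K *_) (∑-cong set λ x → sym (∑-*ˡ set [ proj x R′.≟ proj a ] _))) ⟩
        + K * + K * pullback (pushforward f) (a , b) ∎

      private
        n² = + N * + N

        card-gset : card gset ≡ n²
        card-gset = trans (card-⊗ set set) (cong₂ _*_ card-R card-R)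

        average-invariant : ∀ f g k → average f (g G.⊕ κ k) ≡ average f g
        average-invariant f g (x₀ , y₀) = trans (∑-cong gset λ { (x , y) → cong f (cong₂ _,_ (shift (proj₁ g) x₀ x) (shift (proj₂ g) y₀ y)) }) (G.∑-shift (x₀ , y₀) (λ k → f (g G.⊕ κ k)))
          where
          shift : ∀ a t x → a ⊕ ε · t ⊕ ε · x ≡ a ⊕ ε · (x ⊕ t)
          shift a t x = solve 4 (λ a e t x → a :+ e :* t :+ e :* x := a :+ e :* (x :+ t)) refl a ε t x

        -- The part of N² f with mean zero on every coset; `average` is a sum of N² terms and is
        -- left undivided.
        defect : (R × R → ℤ) → R × R → ℤ
        defect f g = n² * f g - average f g

        defect-primitive : ∀ f → Primitive (defect f)
        defect-primitive f g = begin
          ∑[ k ∈ gset ] (n² * f (g G.⊕ κ k) - average f (g G.⊕ κ k))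
            ≡⟨ trans (∑-- gset _ _) (cong₂ _-_ (∑-*ˡ gset n² _) (trans (∑-cong gset λ k → average-invariant f g k) (trans (∑-const gset _) (cong (_* average f g) card-gset)))) ⟩
          n² * average f g - n² * average f g
            ≡⟨ Int.+-inverseʳ _ ⟩
          0ℤ ∎

        -- Averaging the inner product over the translations by κ k leaves h in place and replaces u
        -- by its vanishing mean.
        orthogonal : ∀ {u h} → Primitive u → (∀ g k → h (g G.⊕ κ k) ≡ h g) → inner gset u h ≡ 0ℤ
        orthogonal {u} {h} pu inv-h = Int.*-cancel-≡0 card>0 (begin
          card gset * inner gset u h
            ≡⟨ sym (∑-const gset _) ⟩
          ∑[ k ∈ gset ] ∑[ g ∈ gset ] (u g * h g)
            ≡⟨ ∑-cong gset (λ k → trans (sym (G.∑-shift (κ k) (λ g → u g * h g))) (∑-cong gset λ g → cong (u (g G.⊕ κ k) *_) (inv-h g k))) ⟩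
          ∑[ k ∈ gset ] ∑[ g ∈ gset ] (u (g G.⊕ κ k) * h g)
            ≡⟨ ∑-swap gset gset _ ⟩
          ∑[ g ∈ gset ] ∑[ k ∈ gset ] (u (g G.⊕ κ k) * h g)
            ≡⟨ ∑-≡0 gset (λ g → trans (∑-*ʳ gset (h g) _) (trans (cong (_* h g) (pu g)) (Int.*-zeroˡ _))) ⟩
          0ℤ ∎)

        pythagoras : ∀ {w u h : R × R → ℤ} → (∀ g → n² * w g ≡ u g + h g) → Primitive u → (∀ g k → h (g G.⊕ κ k) ≡ h g) → norm gset u + norm gset h ≡ n² * n² * norm gset w
        pythagoras {w} {u} {h} e pu inv-h = sym (begin
          n² * n² * norm gset w
            ≡⟨ sym (trans (∑-cong gset λ g → square n² (w g)) (∑-*ˡ gset (n² * n²) _)) ⟩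
          ∑[ g ∈ gset ] (n² * w g * (n² * w g))
            ≡⟨ ∑-cong gset (λ g → trans (cong₂ _*_ (e g) (e g)) (expand (u g) (h g))) ⟩
          ∑[ g ∈ gset ] (u g * u g + (h g * h g + + 2 * (u g * h g)))
            ≡⟨ trans (∑-+ gset _ _) (cong₂ _+_ refl (trans (∑-+ gset _ _) (cong₂ _+_ refl (∑-*ˡ gset (+ 2) _)))) ⟩
          norm gset u + (norm gset h + + 2 * inner gset u h)
            ≡⟨ cong (λ t → norm gset u + (norm gset h + + 2 * t)) (orthogonal {u} {h} pu inv-h) ⟩
          norm gset u + (norm gset h + + 2 * 0ℤ)
            ≡⟨ plus-zero _ _ ⟩
          norm gset u + norm gset h ∎)

        X-invariant : ∀ {h} → (∀ g k → h (g G.⊕ κ k) ≡ h g) → ∀ g k → X h (g G.⊕ κ k) ≡ X h g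
        X-invariant {h} inv-h g k = ∑-cong set λ y → cong (U y *_) (trans (cong h (G.solve 3 (λ g k v → g G.:+ k G.:+ v G.:= g G.:+ v G.:+ k) refl g (κ k) (vec y))) (inv-h (g G.⊕ vec y) k))

        X-split : ∀ f g → n² * X f g ≡ X (defect f) g + X (average f) g
        X-split f g = trans (sym (∑-*ˡ set n² _)) (trans (∑-cong set λ y → trans (pull′ n² (U y) (f (g G.⊕ vec y)) (average f (g G.⊕ vec y))) refl) (∑-+ set _ _))
          where
          opaque
            unfolding _+_ _*_ -_
            pull′ : ∀ n s f a → n * (s * f) ≡ s * (n * f - a) + s * a
            pull′ = solve-∀

      -- N² f is the orthogonal sum of a primitive function and of one that factors through the
      -- quotient modulo p ^ n′, and X respects this splitting.
      lift-bound : (C₀ : ℤ) → 0ℤ ≤ C₀ → (∀ {f} → Primitive f → norm gset (X f) ≤ C₀ * + N * norm gset f) →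
        (m′ : (R′.R × R′.R → ℤ) → ℤ) → (∀ S → norm gset (X (pullback S)) ≤ + p * + p * (+ p * + p) * m′ S) →
        ∀ f → norm gset (X f) ≤ C₀ * + N * norm gset f + m′ (pushforward f)
      lift-bound C₀ C₀≥0 prim m′ lifted f = Int.*-cancel n⁴>0 (subst₂ _≤_ (pythagoras {X f} {X (defect f)} {X (average f)} (X-split f) (op-meanZero vec U {defect f} (defect-primitive f)) (X-invariant {average f} (average-invariant f)))
          (sym (final C₀ (+ N) (norm gset f) (m′ (pushforward f)) (n² * n²))) (Int.+-mono-≤ first second))
        where
        n⁴>0 : 0ℤ < n² * n²
        n⁴>0 = subst (0ℤ <_) (trans (Int.pos-* (N ℕ.* N) (N ℕ.* N)) (cong₂ _*_ (Int.pos-* N N) (Int.pos-* N N))) (Int.+>0 (N ℕ.* N ℕ.* (N ℕ.* N)) {{ℕ.m*n≢0 (N ℕ.* N) (N ℕ.* N) {{ℕ.m*n≢0 N N}} {{ℕ.m*n≢0 N N}}}})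
        first : norm gset (X (defect f)) ≤ C₀ * + N * (n² * n² * norm gset f)
        first = Int.≤-trans (prim {defect f} (defect-primitive f)) (Int.*-monoˡ (Int.*-≥0 C₀≥0 (Int.+≥0 N))
          (add-nonneg (pythagoras {f} {defect f} {average f} (λ g → sym (restore (n² * f g) (average f g))) (defect-primitive f) (average-invariant f)) (norm≥0 gset (average f))))
        second : norm gset (X (average f)) ≤ n² * n² * m′ (pushforward f)
        second = Int.≤-trans (Int.≤-reflexive (trans (∑-cong gset λ g → trans (cong₂ _*_ (scaled g) (scaled g)) (square (+ K * + K) _)) (∑-*ˡ gset (+ K * + K * (+ K * + K)) _)))
          (Int.≤-trans (Int.*-monoˡ (Int.*-≥0 (Int.sq≥0 (+ K)) (Int.sq≥0 (+ K))) (lifted (pushforward f))) (Int.≤-reflexive (trans (fourth (+ K) (+ p) (m′ (pushforward f))) (cong (λ t → t * t * (t * t) * m′ (pushforward f)) (sym (Int.pos-* p K))))))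
          where
          scaled : ∀ g → X (average f) g ≡ + K * + K * X (pullback (pushforward f)) g
          scaled g = trans (∑-cong set λ y → trans (cong (U y *_) (average≡ f (g G.⊕ vec y))) (pull (U y) (+ K * + K) _)) (∑-*ˡ set (+ K * + K) _)

      -- Serves for n′ = 0: there the quotient is the zero ring, in which every element is a unit,
      -- so units do not lift.
      lift-trivial : ∀ S → norm gset (X (pullback S)) ≤ + p Int.* + p Int.* (∑ set U Int.* ∑ set U) Int.* norm gset′ S
      lift-trivial S = Int.≤-trans (op-trivial vec U (λ y → []-idem (unit? y)) (pullback S)) (Int.≤-reflexive (trans (cong (∑ set U * ∑ set U *_) (norm-pullback S)) (e (∑ set U) (+ p) (norm gset′ S))))
        where
        open Operator (𝑹 ⊗ᴿ 𝑹) set using (op-trivial)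
        opaque
          unfolding _+_ _*_ -_
          e : ∀ u p n → u * u * (p * p * n) ≡ p * p * (u * u) * n
          e = solve-∀

      -- Each unit of the quotient has p lifts, all of them units. The squared norm gains p² from
      -- this and another p² from the fibres in `norm-pullback`.
      lift-exact : (∀ {y} → R′.Unit (proj y) → Unit y) → ∀ S → norm gset (X (pullback S)) ≤ + p * + p * (+ p * + p) * norm gset′ (Primitive.X R′.𝑹 (proj c) (proj-unit C) S)
      lift-exact unit-lift S = Int.≤-reflexive (trans (∑-cong gset λ g → trans (cong₂ _*_ (pointwise g) (pointwise g)) (square (+ p) _)) (trans (∑-*ˡ gset (+ p * + p) _)
          (trans (cong (+ p * + p *_) (norm-pullback X′S)) (sym (Int.*-assoc (+ p * + p) (+ p * + p) _)))))
        where
        X′S = Primitive.X R′.𝑹 (proj c) (proj-unit C) S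
        U′ : R′.R → ℤ
        U′ y = [ R′.unit? y ]
        pointwise : ∀ g → X (pullback S) g ≡ + p * pullback X′S g
        pointwise (a , b) = begin
          ∑[ y ∈ set ] (U y * S (proj (a ⊕ y) , proj (b ⊕ c · inv y)))
            ≡⟨ ∑-cong set (λ y → trans ([]-subst (unit? y) (λ u → cong S (cong₂ _,_ (proj-⊕ a y) (trans (proj-⊕ b (c · inv y)) (cong (proj b R′.⊕_) (trans (proj-· c (inv y)) (cong (proj c R′.·_) (proj-inv u))))))))
                 (cong (_* S (proj a R′.⊕ proj y , proj b R′.⊕ proj c R′.· R′.inv (proj y))) ([]-cong (unit? y) (R′.unit? (proj y)) proj-unit unit-lift))) ⟩
          ∑[ y ∈ set ] (U′ (proj y) * S (proj a R′.⊕ proj y , proj b R′.⊕ proj c R′.· R′.inv (proj y)))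
            ≡⟨ ∑-proj (λ v → U′ v * S (proj a R′.⊕ v , proj b R′.⊕ proj c R′.· R′.inv v)) ⟩
          + p * X′S (proj a , proj b) ∎

-- Rings with a bounded operator and their tensor products.

module BoundedRings where
  import Data.Integer as I
  import Data.Integer.Properties as P
  open import Data.List using (List; []; _∷_; _++_; length; map)
  import Data.List.Properties as List
  import Data.Nat.Tactic.RingSolver as ℕ-Solver
  open import Data.Nat.Coprimality using (Coprime; coprime-divisor)
  import Data.Nat.Coprimality as Coprime
  open import Data.Nat.Divisibility using (_∣_; divides; ∣-trans; *-monoʳ-∣; m∣m*n; n∣m*n)
  open import Data.Product.Properties using (,-injectiveˡ; ,-injectiveʳ)
  open ≡-Reasoning
  open Int using (ℤ; +_; -[1+_]; 0ℤ; _≤_; _+_; _*_; -_; _-_; solve-∀)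
  open FiniteSums
  open FiniteRings
  open Residues
  open Operators

  private
    opaque
      unfolding _+_ _*_ -_
      *-exchange : ∀ a b x → a * (b * x) ≡ b * (a * x)
      *-exchange = solve-∀
      *-factorˡ : ∀ w a b → w * a + w * b ≡ w * (a + b)
      *-factorˡ = solve-∀
      regroup-squares : ∀ k l d e x → k * (d * d) * (l * (e * e) * x) ≡ k * l * (d * e * (d * e)) * x
      regroup-squares = solve-∀
      *-pullˡ : ∀ a b u x → a * (b * (u * x)) ≡ u * (a * (b * x))
      *-pullˡ = solve-∀
      *-reassoc : ∀ u v x → u * v * x ≡ u * (v * x)
      *-reassoc = solve-∀

  opaque
    unfolding _*_

    ∣ℤ⇒∣ : ∀ {n} z → n ∣ℤ z → n ∣ I.∣ z ∣
    ∣ℤ⇒∣ {n} z (k , e) = divides I.∣ k ∣ (trans (cong I.∣_∣ e) (P.abs-* k (+ n)))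

  ∣⇒∣ℤ : ∀ {n} z → n ∣ I.∣ z ∣ → n ∣ℤ z
  ∣⇒∣ℤ {n} (+ m) (divides k e) = + k , trans (cong +_ e) (Int.pos-* k n)
  ∣⇒∣ℤ {n} -[1+ m ] d = subst (n ∣ℤ_) (Int.neg-def (+ suc m)) (∣ℤ-neg (∣⇒∣ℤ (+ suc m) d))

  coprime-product-∣ : ∀ {a b n} → Coprime a b → a ∣ n → b ∣ n → a ℕ.* b ∣ n
  coprime-product-∣ {a} {b} c (divides k refl) d = subst (a ℕ.* b ∣_) (ℕ.*-comm a k) (*-monoʳ-∣ a (coprime-divisor (Coprime.sym c) (subst (b ∣_) (ℕ.*-comm k a) d)))

  coprime-product-∣ℤ : ∀ {a b} → Coprime a b → ∀ z → a ∣ℤ z → b ∣ℤ z → a ℕ.* b ∣ℤ z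
  coprime-product-∣ℤ c z d e = ∣⇒∣ℤ z (coprime-product-∣ c (∣ℤ⇒∣ z d) (∣ℤ⇒∣ z e))

  -- Reduction modulo a divisor e of q, described by its fibres and by its kernel on integers. This
  -- description passes to products of rings with coprime moduli.
  record Quotient (𝑹 : FinRing) (q : ℕ) : Set₁ where
    open Ring 𝑹
    field
      e e′ : ℕ
      target : FinSet
      φ : R → ∣ target ∣
      size : e ℕ.* e′ ≡ q
      card-target : card target ≡ + e
      fibre : ∀ u → ∑[ x ∈ set ] [ FinSet._≟_ target (φ x) u ] ≡ + e′
      kernel : ∀ z w → φ (fromℤ z) ≡ φ (fromℤ w) → e ∣ℤ z - w

    slice : (R × R → ℤ) → ∣ target ∣ → ∣ target ∣ → ℤ
    slice f u v = ∑[ x ∈ set ] ∑[ y ∈ set ] ([ FinSet._≟_ target (φ x) u ] * ([ FinSet._≟_ target (φ y) v ] * f (x , y)))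

    -- The squared norm of the push-forward of f along φ × φ.
    V : (R × R → ℤ) → ℤ
    V f = ∑[ u ∈ target ] ∑[ v ∈ target ] (slice f u v * slice f u v)

  form : ∀ {𝑹 q} → List (Quotient 𝑹 q) → (FinRing.R 𝑹 × FinRing.R 𝑹 → ℤ) → ℤ
  form [] f = 0ℤ
  form (Q ∷ Qs) f = + Quotient.e Q * Quotient.V Q f + form Qs f

  form-++ : ∀ {𝑹 q} (Qs Ps : List (Quotient 𝑹 q)) f → form (Qs ++ Ps) f ≡ form Qs f + form Ps f
  form-++ [] Ps f = sym (Int.+-identityˡ _)
  form-++ (Q ∷ Qs) Ps f = trans (cong₂ _+_ refl (form-++ Qs Ps f)) (sym (Int.+-assoc _ _ _))

  -- The ring is ℤ/q up to isomorphism, characterised through `fromℤ`; so a product of rings serves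
  -- for a product of coprime moduli, and nothing is transported along the Chinese remainder
  -- isomorphism. The factor D² absorbs the constants of the single primes.
  record Bounded (q κ : ℕ) : Set₁ where
    field
      ring : FinRing
    open Ring ring
    field
      card-ring : card set ≡ + q
      kernel⇒ : ∀ z → fromℤ z ≡ 𝟘 → q ∣ℤ z
      kernel⇐ : ∀ z → q ∣ℤ z → fromℤ z ≡ 𝟘
      unit⇒ : ∀ n → Unit (fromℕ n) → Coprime n q
      unit⇐ : ∀ n → Coprime n q → Unit (fromℕ n)
      quotients : List (Quotient ring q)
    D : ℕ
    D = length quotients
    field
      bound : ∀ c (C : Unit c) f → norm (set ⊗ set) (Primitive.X ring c C f) ≤ + κ * (+ D * + D) * form quotients f

  module Product (𝑹₁ 𝑹₂ : FinRing) where
    private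
      module R₁ = Ring 𝑹₁
      module R₂ = Ring 𝑹₂
      𝑹 = 𝑹₁ ⊗ᴿ 𝑹₂
      module R = Ring 𝑹
      A = R₁.set
      B = R₂.set
      Fun = R.R × R.R → ℤ

    fromℤ-⊗ : ∀ z → R.fromℤ z ≡ (R₁.fromℤ z , R₂.fromℤ z)
    fromℕ-⊗ : ∀ n → R.fromℕ n ≡ (R₁.fromℕ n , R₂.fromℕ n)
    fromℕ-⊗ zero = refl
    fromℕ-⊗ (suc n) = cong (R.𝟙 R.⊕_) (fromℕ-⊗ n)
    fromℤ-⊗ (+ n) = fromℕ-⊗ n
    fromℤ-⊗ -[1+ n ] = cong R.⊝_ (fromℕ-⊗ (suc n))

    unit-⊗⇐ : ∀ {x y} → R₁.Unit x → R₂.Unit y → R.Unit (x , y)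
    unit-⊗⇐ u v = R.toUnit (cong₂ _,_ u v)

    unit-⊗⇒ : ∀ {x y} → R.Unit (x , y) → R₁.Unit x × R₂.Unit y
    unit-⊗⇒ u = R₁.toUnit (,-injectiveˡ u) , R₂.toUnit (,-injectiveʳ u)

    inv-⊗ : ∀ {x y} → R₁.Unit x → R₂.Unit y → R.inv (x , y) ≡ (R₁.inv x , R₂.inv y)
    inv-⊗ u v = R.inv-unique (cong₂ _,_ u v)

    ∑-interchange : ∀ (F : Fun) → ∑ (R.set ⊗ R.set) F ≡ ∑[ g ∈ B ⊗ B ] ∑[ h ∈ A ⊗ A ] F ((proj₁ h , proj₁ g) , (proj₂ h , proj₂ g))
    ∑-interchange F = begin
      ∑ (R.set ⊗ R.set) F
        ≡⟨ trans (∑-⊗ R.set R.set F) (trans (∑-cong R.set λ a → ∑-⊗ A B _) (∑-⊗ A B _)) ⟩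
      ∑[ a ∈ A ] ∑[ a′ ∈ B ] ∑[ b ∈ A ] ∑[ b′ ∈ B ] F ((a , a′) , (b , b′))
        ≡⟨ trans (∑-cong A λ a → ∑-cong B λ a′ → ∑-swap A B _) (∑-swap A B _) ⟩
      ∑[ a′ ∈ B ] ∑[ a ∈ A ] ∑[ b′ ∈ B ] ∑[ b ∈ A ] F ((a , a′) , (b , b′))
        ≡⟨ ∑-cong B (λ a′ → ∑-swap A B _) ⟩
      ∑[ a′ ∈ B ] ∑[ b′ ∈ B ] ∑[ a ∈ A ] ∑[ b ∈ A ] F ((a , a′) , (b , b′))
        ≡⟨ sym (trans (∑-⊗ B B _) (∑-cong B λ a′ → ∑-cong B λ b′ → ∑-⊗ A A _)) ⟩
      ∑[ g ∈ B ⊗ B ] ∑[ h ∈ A ⊗ A ] F ((proj₁ h , proj₁ g) , (proj₂ h , proj₂ g)) ∎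

    module _ {q₁ q₂ : ℕ} (coprime : Coprime q₁ q₂) where

      coprime-divisors : ∀ {a b} → a ∣ q₁ → b ∣ q₂ → Coprime a b
      coprime-divisors a∣ b∣ (d∣a , d∣b) = coprime (∣-trans d∣a a∣ , ∣-trans d∣b b∣)

      _⊗Q_ : Quotient 𝑹₁ q₁ → Quotient 𝑹₂ q₂ → Quotient 𝑹 (q₁ ℕ.* q₂)
      Q₁ ⊗Q Q₂ = record
        { e = Q₁.e ℕ.* Q₂.e
        ; e′ = Q₁.e′ ℕ.* Q₂.e′
        ; target = Q₁.target ⊗ Q₂.target
        ; φ = λ { (x , y) → Q₁.φ x , Q₂.φ y }
        ; size = trans (alg Q₁.e Q₂.e Q₁.e′ Q₂.e′) (cong₂ ℕ._*_ Q₁.size Q₂.size)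
        ; card-target = trans (card-⊗ Q₁.target Q₂.target) (trans (cong₂ _*_ Q₁.card-target Q₂.card-target) (sym (Int.pos-* Q₁.e Q₂.e)))
        ; fibre = λ { (u , v) → trans (∑-⊗ A B _) (trans (∑-cong A λ x → ∑-cong B λ y → sym (≟-⊗ x y u v)) (trans (∑-∑-* A B _ _) (trans (cong₂ _*_ (Q₁.fibre u) (Q₂.fibre v)) (sym (Int.pos-* Q₁.e′ Q₂.e′))))) }
        ; kernel = λ z w h → let h′ = trans (sym (cong (λ t → Q₁.φ (proj₁ t) , Q₂.φ (proj₂ t)) (fromℤ-⊗ z))) (trans h (cong (λ t → Q₁.φ (proj₁ t) , Q₂.φ (proj₂ t)) (fromℤ-⊗ w))) in
            coprime-product-∣ℤ (coprime-divisors (divides Q₁.e′ (trans (sym Q₁.size) (ℕ.*-comm Q₁.e Q₁.e′))) (divides Q₂.e′ (trans (sym Q₂.size) (ℕ.*-comm Q₂.e Q₂.e′)))) (z - w) (Q₁.kernel z w (,-injectiveˡ h′)) (Q₂.kernel z w (,-injectiveʳ h′))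
        }
        where
        module Q₁ = Quotient Q₁
        module Q₂ = Quotient Q₂
        alg : ∀ a b c d → a ℕ.* b ℕ.* (c ℕ.* d) ≡ a ℕ.* c ℕ.* (b ℕ.* d)
        alg = ℕ-Solver.solve-∀
        ≟-⊗ : ∀ x y u v → [ FinSet._≟_ Q₁.target (Q₁.φ x) u ] * [ FinSet._≟_ Q₂.target (Q₂.φ y) v ] ≡ [ FinSet._≟_ (Q₁.target ⊗ Q₂.target) (Q₁.φ x , Q₂.φ y) (u , v) ]
        ≟-⊗ x y u v = []-× (FinSet._≟_ Q₁.target (Q₁.φ x) u) (FinSet._≟_ Q₂.target (Q₂.φ y) v) (FinSet._≟_ (Q₁.target ⊗ Q₂.target) (Q₁.φ x , Q₂.φ y) (u , v)) (λ { (a , b) → cong₂ _,_ a b }) (λ h → ,-injectiveˡ h , ,-injectiveʳ h)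

      module _ (Q₁ : Quotient 𝑹₁ q₁) where
        private module Q₁ = Quotient Q₁

        -- The push-forward in the first factor alone: for fixed u and v a function on the square of
        -- the second ring is left.
        partial : Fun → ∣ Q₁.target ∣ → ∣ Q₁.target ∣ → R₂.R × R₂.R → ℤ
        partial f u v (x′ , y′) = Q₁.slice (λ { (x , y) → f ((x , x′) , (y , y′)) }) u v

        slice-⊗ : ∀ Q₂ f u v u′ v′ → Quotient.slice (Q₁ ⊗Q Q₂) f (u , u′) (v , v′) ≡ Quotient.slice Q₂ (partial f u v) u′ v′
        slice-⊗ Q₂ f u v u′ v′ = begin
          ∑[ x ∈ R.set ] ∑[ y ∈ R.set ] ([ FinSet._≟_ T (φ x) (u , u′) ] * ([ FinSet._≟_ T (φ y) (v , v′) ] * f (x , y)))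
            ≡⟨ trans (∑-cong R.set λ x → ∑-⊗ A B _) (∑-⊗ A B _) ⟩
          ∑[ x ∈ A ] ∑[ x′ ∈ B ] ∑[ y ∈ A ] ∑[ y′ ∈ B ] ([ FinSet._≟_ T (φ (x , x′)) (u , u′) ] * ([ FinSet._≟_ T (φ (y , y′)) (v , v′) ] * f ((x , x′) , (y , y′))))
            ≡⟨ ∑-cong A (λ x → ∑-cong B λ x′ → ∑-cong A λ y → ∑-cong B λ y′ → trans (cong₂ (λ s t → s * (t * f ((x , x′) , (y , y′)))) (sym (≟-⊗ x x′ u u′)) (sym (≟-⊗ y y′ v v′)))
                 (shuffle [ FinSet._≟_ Q₁.target (Q₁.φ x) u ] [ FinSet._≟_ Q₂.target (Q₂.φ x′) u′ ] [ FinSet._≟_ Q₁.target (Q₁.φ y) v ] [ FinSet._≟_ Q₂.target (Q₂.φ y′) v′ ] _)) ⟩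
          ∑[ x ∈ A ] ∑[ x′ ∈ B ] ∑[ y ∈ A ] ∑[ y′ ∈ B ] (L x′ * (L′ y′ * (H x * (H′ y * f ((x , x′) , (y , y′))))))
            ≡⟨ trans (∑-swap A B _) (∑-cong B λ x′ → trans (∑-cong A λ x → ∑-swap A B _) (∑-swap A B _)) ⟩
          ∑[ x′ ∈ B ] ∑[ y′ ∈ B ] ∑[ x ∈ A ] ∑[ y ∈ A ] (L x′ * (L′ y′ * (H x * (H′ y * f ((x , x′) , (y , y′))))))
            ≡⟨ ∑-cong B (λ x′ → ∑-cong B λ y′ → trans (∑-cong A λ x → trans (∑-*ˡ A (L x′) _) (cong (L x′ *_) (∑-*ˡ A (L′ y′) _))) (trans (∑-*ˡ A (L x′) _) (cong (L x′ *_) (∑-*ˡ A (L′ y′) _)))) ⟩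
          Q₂.slice (partial f u v) u′ v′ ∎
          where
          module Q₂ = Quotient Q₂
          T = Q₁.target ⊗ Q₂.target
          φ = Quotient.φ (Q₁ ⊗Q Q₂)
          H : R₁.R → ℤ
          H x = [ FinSet._≟_ Q₁.target (Q₁.φ x) u ]
          H′ : R₁.R → ℤ
          H′ y = [ FinSet._≟_ Q₁.target (Q₁.φ y) v ]
          L : R₂.R → ℤ
          L x′ = [ FinSet._≟_ Q₂.target (Q₂.φ x′) u′ ]
          L′ : R₂.R → ℤ
          L′ y′ = [ FinSet._≟_ Q₂.target (Q₂.φ y′) v′ ]
          ≟-⊗ : ∀ x y u v → [ FinSet._≟_ Q₁.target (Q₁.φ x) u ] * [ FinSet._≟_ Q₂.target (Q₂.φ y) v ] ≡ [ FinSet._≟_ T (φ (x , y)) (u , v) ]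
          ≟-⊗ x y u v = []-× (FinSet._≟_ Q₁.target (Q₁.φ x) u) (FinSet._≟_ Q₂.target (Q₂.φ y) v) (FinSet._≟_ T (φ (x , y)) (u , v)) (λ { (a , b) → cong₂ _,_ a b }) (λ h → ,-injectiveˡ h , ,-injectiveʳ h)
          opaque
            unfolding _+_ _*_ -_
            shuffle : ∀ a b c d x → a * b * (c * d * x) ≡ b * (d * (a * (c * x)))
            shuffle = solve-∀

        V-⊗ : ∀ Q₂ f → Quotient.V (Q₁ ⊗Q Q₂) f ≡ ∑[ u ∈ Q₁.target ] ∑[ v ∈ Q₁.target ] Quotient.V Q₂ (partial f u v)
        V-⊗ Q₂ f = begin
          ∑[ u ∈ T ] ∑[ v ∈ T ] (S u v * S u v)
            ≡⟨ trans (∑-⊗ Q₁.target Q₂.target _) (∑-cong Q₁.target λ u → ∑-cong Q₂.target λ u′ → ∑-⊗ Q₁.target Q₂.target _) ⟩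
          ∑[ u ∈ Q₁.target ] ∑[ u′ ∈ Q₂.target ] ∑[ v ∈ Q₁.target ] ∑[ v′ ∈ Q₂.target ] (S (u , u′) (v , v′) * S (u , u′) (v , v′))
            ≡⟨ ∑-cong Q₁.target (λ u → ∑-swap Q₂.target Q₁.target _) ⟩
          ∑[ u ∈ Q₁.target ] ∑[ v ∈ Q₁.target ] ∑[ u′ ∈ Q₂.target ] ∑[ v′ ∈ Q₂.target ] (S (u , u′) (v , v′) * S (u , u′) (v , v′))
            ≡⟨ ∑-cong Q₁.target (λ u → ∑-cong Q₁.target λ v → ∑-cong Q₂.target λ u′ → ∑-cong Q₂.target λ v′ → cong₂ _*_ (slice-⊗ Q₂ f u v u′ v′) (slice-⊗ Q₂ f u v u′ v′)) ⟩
          ∑[ u ∈ Q₁.target ] ∑[ v ∈ Q₁.target ] Q₂.V (partial f u v) ∎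
          where
          module Q₂ = Quotient Q₂
          T = Q₁.target ⊗ Q₂.target
          S = Quotient.slice (Q₁ ⊗Q Q₂) f

        row : List (Quotient 𝑹₂ q₂) → List (Quotient 𝑹 (q₁ ℕ.* q₂))
        row = map (Q₁ ⊗Q_)

        form-row : ∀ Qs f → form (row Qs) f ≡ + Q₁.e * (∑[ u ∈ Q₁.target ] ∑[ v ∈ Q₁.target ] form Qs (partial f u v))
        form-row [] f = sym (trans (cong (+ Q₁.e *_) (∑-≡0 Q₁.target λ u → ∑-0 Q₁.target)) (Int.*-zeroʳ _))
        form-row (Q₂ ∷ Qs) f = begin
          + (Q₁.e ℕ.* Quotient.e Q₂) * Quotient.V (Q₁ ⊗Q Q₂) f + form (row Qs) f
            ≡⟨ cong₂ _+_ (trans (cong₂ _*_ (Int.pos-* Q₁.e (Quotient.e Q₂)) (V-⊗ Q₂ f)) (Int.*-assoc (+ Q₁.e) (+ Quotient.e Q₂) _)) (form-row Qs f) ⟩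
          + Q₁.e * (+ Quotient.e Q₂ * (∑[ u ∈ Q₁.target ] ∑[ v ∈ Q₁.target ] Quotient.V Q₂ (partial f u v))) + + Q₁.e * (∑[ u ∈ Q₁.target ] ∑[ v ∈ Q₁.target ] form Qs (partial f u v))
            ≡⟨ trans (*-factorˡ (+ Q₁.e) _ _) (cong (+ Q₁.e *_) (trans (cong₂ _+_ (trans (sym (∑-*ˡ Q₁.target (+ Quotient.e Q₂) _)) (∑-cong Q₁.target λ u → sym (∑-*ˡ Q₁.target (+ Quotient.e Q₂) _))) refl)
                 (sym (trans (∑-cong Q₁.target λ u → ∑-+ Q₁.target _ _) (∑-+ Q₁.target _ _))))) ⟩
          + Q₁.e * (∑[ u ∈ Q₁.target ] ∑[ v ∈ Q₁.target ] (+ Quotient.e Q₂ * Quotient.V Q₂ (partial f u v) + form Qs (partial f u v))) ∎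

      products : List (Quotient 𝑹₁ q₁) → List (Quotient 𝑹₂ q₂) → List (Quotient 𝑹 (q₁ ℕ.* q₂))
      products [] Ps = []
      products (Q ∷ Qs) Ps = row Q Ps ++ products Qs Ps

      length-products : ∀ Qs Ps → length (products Qs Ps) ≡ length Qs ℕ.* length Ps
      length-products [] Ps = refl
      length-products (Q ∷ Qs) Ps = trans (List.length-++ (row Q Ps)) (cong₂ ℕ._+_ (List.length-map (Q ⊗Q_) Ps) (length-products Qs Ps))

      module _ (c₁ : R₁.R) (c₂ : R₂.R) (C : R.Unit (c₁ , c₂)) where
        private
          C₁ = proj₁ (unit-⊗⇒ C)
          C₂ = proj₂ (unit-⊗⇒ C)
          module X = Primitive 𝑹 (c₁ , c₂) C
          module X₁ = Primitive 𝑹₁ c₁ C₁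
          module X₂ = Primitive 𝑹₂ c₂ C₂

          inner-X : Fun → R₂.R × R₂.R → R₁.R × R₁.R → ℤ
          inner-X f g (x , y) = X₂.X (λ { (x′ , y′) → f ((x , x′) , (y , y′)) }) g

          X-⊗ : ∀ f a a′ b b′ → X.X f ((a , a′) , (b , b′)) ≡ X₁.X (inner-X f (a′ , b′)) (a , b)
          X-⊗ f a a′ b b′ = begin
            ∑[ y ∈ R.set ] ([ R.unit? y ] * f ((a , a′) R.⊕ y , (b , b′) R.⊕ (c₁ , c₂) R.· R.inv y))
              ≡⟨ ∑-⊗ A B _ ⟩
            ∑[ y ∈ A ] ∑[ y′ ∈ B ] ([ R.unit? (y , y′) ] * f ((a , a′) R.⊕ (y , y′) , (b , b′) R.⊕ (c₁ , c₂) R.· R.inv (y , y′)))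
              ≡⟨ ∑-cong A (λ y → ∑-cong B λ y′ → trans ([]-subst (R.unit? (y , y′)) (λ u → cong (λ t → f ((a , a′) R.⊕ (y , y′) , (b , b′) R.⊕ (c₁ , c₂) R.· t)) (inv-⊗ (proj₁ (unit-⊗⇒ u)) (proj₂ (unit-⊗⇒ u)))))
                   (trans (cong (_* value y y′) (sym ([]-× (R₁.unit? y) (R₂.unit? y′) (R.unit? (y , y′)) (λ { (u , v) → unit-⊗⇐ u v }) unit-⊗⇒))) (*-reassoc [ R₁.unit? y ] [ R₂.unit? y′ ] (value y y′)))) ⟩
            ∑[ y ∈ A ] ∑[ y′ ∈ B ] ([ R₁.unit? y ] * ([ R₂.unit? y′ ] * value y y′))
              ≡⟨ ∑-cong A (λ y → ∑-*ˡ B [ R₁.unit? y ] _) ⟩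
            X₁.X (inner-X f (a′ , b′)) (a , b) ∎
            where
            value : R₁.R → R₂.R → ℤ
            value y y′ = f ((a R₁.⊕ y , a′ R₂.⊕ y′) , (b R₁.⊕ c₁ R₁.· R₁.inv y , b′ R₂.⊕ c₂ R₂.· R₂.inv y′))

          norm-⊗-X : ∀ f → norm (R.set ⊗ R.set) (X.X f) ≡ ∑[ g ∈ B ⊗ B ] norm (A ⊗ A) (X₁.X (inner-X f g))
          norm-⊗-X f = trans (∑-interchange _) (∑-cong (B ⊗ B) λ { (a′ , b′) → ∑-cong (A ⊗ A) λ { (a , b) → cong₂ _*_ (X-⊗ f a a′ b b′) (X-⊗ f a a′ b b′) } })

          slice-inner : ∀ Q f g u v → Quotient.slice Q (inner-X f g) u v ≡ X₂.X (partial Q f u v) g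
          slice-inner Q f g u v = begin
            ∑[ x ∈ A ] ∑[ y ∈ A ] (H x * (H′ y * (∑[ z ∈ B ] ([ R₂.unit? z ] * f′ x y z))))
              ≡⟨ ∑-cong A (λ x → ∑-cong A λ y → trans (cong (H x *_) (sym (∑-*ˡ B (H′ y) _))) (trans (sym (∑-*ˡ B (H x) _)) (∑-cong B λ z → *-pullˡ (H x) (H′ y) [ R₂.unit? z ] (f′ x y z)))) ⟩
            ∑[ x ∈ A ] ∑[ y ∈ A ] ∑[ z ∈ B ] ([ R₂.unit? z ] * (H x * (H′ y * f′ x y z)))
              ≡⟨ trans (∑-cong A λ x → ∑-swap A B _) (∑-swap A B _) ⟩
            ∑[ z ∈ B ] ∑[ x ∈ A ] ∑[ y ∈ A ] ([ R₂.unit? z ] * (H x * (H′ y * f′ x y z)))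
              ≡⟨ ∑-cong B (λ z → trans (∑-cong A λ x → ∑-*ˡ A [ R₂.unit? z ] _) (∑-*ˡ A [ R₂.unit? z ] _)) ⟩
            X₂.X (partial Q f u v) g ∎
            where
            module Q = Quotient Q
            H H′ : R₁.R → ℤ
            H x = [ FinSet._≟_ Q.target (Q.φ x) u ]
            H′ y = [ FinSet._≟_ Q.target (Q.φ y) v ]
            f′ : R₁.R → R₁.R → R₂.R → ℤ
            f′ x y z = f ((x , proj₁ g R₂.⊕ z) , (y , proj₂ g R₂.⊕ c₂ R₂.· R₂.inv z))

        -- For fixed coordinates in the second ring, the first bound applies to the function already
        -- transformed by the second operator. Its slices are the second operator applied to slices
        -- of f, by `slice-inner`, and there the second bound applies.
        tensor : ∀ {W₁ W₂ Qs Ps} → 0ℤ ≤ W₁ → 0ℤ ≤ W₂ →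
          (∀ f → norm (A ⊗ A) (X₁.X f) ≤ W₁ * form {𝑹₁} {q₁} Qs f) → (∀ f → norm (B ⊗ B) (X₂.X f) ≤ W₂ * form {𝑹₂} {q₂} Ps f) →
          ∀ f → norm (R.set ⊗ R.set) (X.X f) ≤ W₁ * (W₂ * form (products Qs Ps) f)
        tensor {W₁} {W₂} {Qs} {Ps} W₁≥0 W₂≥0 b₁ b₂ f = Int.≤-trans (Int.≤-reflexive (norm-⊗-X f)) (Int.≤-trans (∑-mono (B ⊗ B) λ g → b₁ (inner-X f g))
            (Int.≤-trans (Int.≤-reflexive (∑-*ˡ (B ⊗ B) W₁ _)) (Int.*-monoˡ W₁≥0 (collect Qs))))
          where
          one : ∀ Q → ∑[ g ∈ B ⊗ B ] Quotient.V Q (inner-X f g) ≤ W₂ * (∑[ u ∈ Quotient.target Q ] ∑[ v ∈ Quotient.target Q ] form Ps (partial Q f u v))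
          one Q = Int.≤-trans (Int.≤-reflexive (trans (∑-swap (B ⊗ B) T _) (∑-cong T λ u → trans (∑-swap (B ⊗ B) T _) (∑-cong T λ v → ∑-cong (B ⊗ B) λ g → cong₂ _*_ (slice-inner Q f g u v) (slice-inner Q f g u v)))))
            (Int.≤-trans (∑-mono T λ u → ∑-mono T λ v → b₂ (partial Q f u v)) (Int.≤-reflexive (trans (∑-cong T λ u → ∑-*ˡ T W₂ _) (∑-*ˡ T W₂ _))))
            where T = Quotient.target Q
          collect : ∀ Qs → ∑[ g ∈ B ⊗ B ] form Qs (inner-X f g) ≤ W₂ * form (products Qs Ps) f
          collect [] = Int.≤-reflexive (trans (∑-0 (B ⊗ B)) (sym (Int.*-zeroʳ W₂)))
          collect (Q ∷ Qs) = Int.≤-trans (Int.≤-reflexive (trans (∑-+ (B ⊗ B) _ _) (cong₂ _+_ (∑-*ˡ (B ⊗ B) (+ Quotient.e Q) _) refl)))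
            (Int.≤-trans (Int.+-mono-≤ (Int.*-monoˡ (Int.+≥0 (Quotient.e Q)) (one Q)) (collect Qs))
              (Int.≤-reflexive (trans (cong₂ _+_ (trans (*-exchange (+ Quotient.e Q) W₂ _) (cong (W₂ *_) (sym (form-row Q Ps f)))) refl) (trans (*-factorˡ W₂ _ _) (cong (W₂ *_) (sym (form-++ (row Q Ps) (products Qs Ps) f)))))))

  bounded-⊗ : ∀ {q₁ q₂ κ₁ κ₂} → Coprime q₁ q₂ → Bounded q₁ κ₁ → Bounded q₂ κ₂ → Bounded (q₁ ℕ.* q₂) (κ₁ ℕ.* κ₂)
  bounded-⊗ {q₁} {q₂} {κ₁} {κ₂} cop 𝓑₁ 𝓑₂ = record
    { ring = B₁.ring ⊗ᴿ B₂.ring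
    ; card-ring = trans (card-⊗ R₁.set R₂.set) (trans (cong₂ _*_ B₁.card-ring B₂.card-ring) (sym (Int.pos-* q₁ q₂)))
    ; kernel⇒ = λ z h → coprime-product-∣ℤ cop z (B₁.kernel⇒ z (,-injectiveˡ (trans (sym (fromℤ-⊗ z)) h))) (B₂.kernel⇒ z (,-injectiveʳ (trans (sym (fromℤ-⊗ z)) h)))
    ; kernel⇐ = λ z h → trans (fromℤ-⊗ z) (cong₂ _,_ (B₁.kernel⇐ z (∣ℤ-trans (m∣m*n q₂) h)) (B₂.kernel⇐ z (∣ℤ-trans (n∣m*n q₁) h)))
    ; unit⇒ = λ n u → let u′ = unit-⊗⇒ (subst R.Unit (fromℕ-⊗ n) u) in coprime-* (B₁.unit⇒ n (proj₁ u′)) (B₂.unit⇒ n (proj₂ u′))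
    ; unit⇐ = λ n c → subst R.Unit (sym (fromℕ-⊗ n)) (unit-⊗⇐ (B₁.unit⇐ n (λ { (d∣n , d∣q) → c (d∣n , ∣-trans d∣q (m∣m*n q₂)) })) (B₂.unit⇐ n (λ { (d∣n , d∣q) → c (d∣n , ∣-trans d∣q (n∣m*n q₁)) })))
    ; quotients = products cop B₁.quotients B₂.quotients
    ; bound = λ { (c₁ , c₂) C f → subst (norm (R.set ⊗ R.set) (Primitive.X (B₁.ring ⊗ᴿ B₂.ring) (c₁ , c₂) C f) ≤_) (constant f)
        (tensor cop c₁ c₂ C {Qs = B₁.quotients} {Ps = B₂.quotients} (W≥0 κ₁ B₁.D) (W≥0 κ₂ B₂.D) (B₁.bound c₁ (proj₁ (unit-⊗⇒ C))) (B₂.bound c₂ (proj₂ (unit-⊗⇒ C))) f) }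
    }
    where
    module B₁ = Bounded 𝓑₁
    module B₂ = Bounded 𝓑₂
    module R₁ = Ring B₁.ring
    module R₂ = Ring B₂.ring
    module R = Ring (B₁.ring ⊗ᴿ B₂.ring)
    open Product B₁.ring B₂.ring
    W≥0 : ∀ κ D → 0ℤ ≤ + κ * (+ D * + D)
    W≥0 κ D = Int.*-≥0 (Int.+≥0 κ) (Int.sq≥0 (+ D))
    constant : ∀ f → + κ₁ * (+ B₁.D * + B₁.D) * (+ κ₂ * (+ B₂.D * + B₂.D) * form (products cop B₁.quotients B₂.quotients) f)
      ≡ + (κ₁ ℕ.* κ₂) * (+ length (products cop B₁.quotients B₂.quotients) * + length (products cop B₁.quotients B₂.quotients)) * form (products cop B₁.quotients B₂.quotients) f
    constant f = trans (regroup-squares (+ κ₁) (+ κ₂) (+ B₁.D) (+ B₂.D) _) (cong₂ (λ a b → a * (b * b) * form (products cop B₁.quotients B₂.quotients) f) (sym (Int.pos-* κ₁ κ₂))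
      (trans (sym (Int.pos-* B₁.D B₂.D)) (cong +_ (sym (length-products cop B₁.quotients B₂.quotients)))))

-- Arbitrary functions modulo a prime power.

module PowerBounded where
  open import Data.List using (List; []; _∷_; length; map)
  import Data.List.Properties as List
  import Data.Nat.Tactic.RingSolver as ℕ-Solver
  open import Data.Nat.Primality using (Prime; prime⇒nonZero; prime[2])
  open ≡-Reasoning
  open Int using (ℤ; +_; 0ℤ; 1ℤ; _≤_; _+_; _*_; solve-∀)
  open FiniteSums
  open FiniteRings
  open Residues
  open Operators
  open PrimePower
  open PrimePowerBound
  open BoundedRings

  private
    opaque
      unfolding _+_ _*_
      *-factorˡ : ∀ C N n m → C * N * n + C * m ≡ C * (N * n + m)
      *-factorˡ = solve-∀

  V≥0 : ∀ {𝑹 q} (Q : Quotient 𝑹 q) f → 0ℤ ≤ Quotient.V Q f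
  V≥0 Q f = ∑-≥0 (Quotient.target Q) λ u → ∑-≥0 (Quotient.target Q) λ v → Int.sq≥0 (Quotient.slice Q f u v)

  form≥0 : ∀ {𝑹 q} (Qs : List (Quotient 𝑹 q)) f → 0ℤ ≤ form Qs f
  form≥0 [] f = Int.+≥0 0
  form≥0 (Q ∷ Qs) f = subst (_≤ form (Q ∷ Qs) f) (Int.+-identityˡ 0ℤ) (Int.+-mono-≤ (Int.*-≥0 (Int.+≥0 (Quotient.e Q)) (V≥0 Q f)) (form≥0 Qs f))

  module _ (p : ℕ) (pr : Prime p) where
    private
      instance
        p≢0 : NonZero p
        p≢0 = prime⇒nonZero pr

    module _ (n : ℕ) where
      open PowerRing p pr n

      whole : Quotient 𝑹 N
      whole = record
        { e = N
        ; e′ = 1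
        ; target = set
        ; φ = λ x → x
        ; size = ℕ.*-identityʳ N
        ; card-target = card-R
        ; fibre = ∑-once set
        ; kernel = λ z w h → cls-≡⇒ (trans (sym (fromℤ-class N z)) (trans h (fromℤ-class N w)))
        }

      V-whole : ∀ f → Quotient.V whole f ≡ norm (set ⊗ set) f
      V-whole f = trans (∑-cong set λ u → ∑-cong set λ v → cong₂ _*_ (slice u v) (slice u v)) (sym (∑-⊗ set set _))
        where
        slice : ∀ u v → Quotient.slice whole f u v ≡ f (u , v)
        slice u v = trans (∑-cong set λ x → trans (∑-*ˡ set [ x ≟ u ] _) (cong ([ x ≟ u ] *_) (∑-δ set v (λ y → f (x , y))))) (∑-δ set u (λ x → f (x , v)))

    module _ (n′ : ℕ) where
      open PowerRing p pr (suc n′)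
      open Lift.Reduction p pr n′
      private
        module R′ = PowerRing p pr n′

      proj-fromℤ : ∀ z → proj (fromℤ z) ≡ R′.fromℤ z
      proj-fromℤ z = trans (cong proj (fromℤ-class N z)) (trans (proj-class z) (sym (fromℤ-class (p ℕ.^ n′) {{R′.pⁿ≢0}} z)))

      inflate : Quotient R′.𝑹 (p ℕ.^ n′) → Quotient 𝑹 N
      inflate Q = record
        { e = Q.e
        ; e′ = p ℕ.* Q.e′
        ; target = Q.target
        ; φ = λ x → Q.φ (proj x)
        ; size = trans (alg Q.e p Q.e′) (cong (p ℕ.*_) Q.size)
        ; card-target = Q.card-target
        ; fibre = λ u → trans (∑-proj (λ x → [ FinSet._≟_ Q.target (Q.φ x) u ])) (trans (cong (+ p *_) (Q.fibre u)) (sym (Int.pos-* p Q.e′)))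
        ; kernel = λ z w h → Q.kernel z w (trans (sym (cong Q.φ (proj-fromℤ z))) (trans h (cong Q.φ (proj-fromℤ w))))
        }
        where
        module Q = Quotient Q
        alg : ∀ a b c → a ℕ.* (b ℕ.* c) ≡ b ℕ.* (a ℕ.* c)
        alg = ℕ-Solver.solve-∀

      V-inflate : ∀ Q f → Quotient.V (inflate Q) f ≡ Quotient.V Q (pushforward f)
      V-inflate Q f = ∑-cong Q.target λ u → ∑-cong Q.target λ v → cong₂ _*_ (slice u v) (slice u v)
        where
        module Q = Quotient Q
        slice : ∀ u v → Quotient.slice (inflate Q) f u v ≡ Q.slice (pushforward f) u v
        slice u v = begin
          ∑[ x ∈ set ] ∑[ y ∈ set ] (H (proj x) * (H′ (proj y) * f (x , y)))
            ≡⟨ ∑-cong set (λ x → ∑-cong set λ y → sym (trans (∑-δ′ R′.set (proj x) (λ x′ → H x′ * (∑[ y′ ∈ R′.set ] ([ proj y R′.≟ y′ ] * (H′ y′ * f (x , y)))))) (cong (H (proj x) *_) (∑-δ′ R′.set (proj y) (λ y′ → H′ y′ * f (x , y)))))) ⟩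
          ∑[ x ∈ set ] ∑[ y ∈ set ] ∑[ x′ ∈ R′.set ] ([ proj x R′.≟ x′ ] * (H x′ * (∑[ y′ ∈ R′.set ] ([ proj y R′.≟ y′ ] * (H′ y′ * f (x , y))))))
            ≡⟨ ∑-cong set (λ x → ∑-cong set λ y → ∑-cong R′.set λ x′ → trans (cong ([ proj x R′.≟ x′ ] *_) (sym (∑-*ˡ R′.set (H x′) _))) (trans (sym (∑-*ˡ R′.set [ proj x R′.≟ x′ ] _))
                 (∑-cong R′.set λ y′ → shuffle [ proj x R′.≟ x′ ] (H x′) [ proj y R′.≟ y′ ] (H′ y′) (f (x , y))))) ⟩
          ∑[ x ∈ set ] ∑[ y ∈ set ] ∑[ x′ ∈ R′.set ] ∑[ y′ ∈ R′.set ] (H x′ * (H′ y′ * ([ proj x R′.≟ x′ ] * ([ proj y R′.≟ y′ ] * f (x , y)))))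
            ≡⟨ trans (∑-cong set λ x → ∑-swap set R′.set _) (trans (∑-swap set R′.set _) (∑-cong R′.set λ x′ → trans (∑-cong set λ x → ∑-swap set R′.set _) (∑-swap set R′.set _))) ⟩
          ∑[ x′ ∈ R′.set ] ∑[ y′ ∈ R′.set ] ∑[ x ∈ set ] ∑[ y ∈ set ] (H x′ * (H′ y′ * ([ proj x R′.≟ x′ ] * ([ proj y R′.≟ y′ ] * f (x , y)))))
            ≡⟨ ∑-cong R′.set (λ x′ → ∑-cong R′.set λ y′ → trans (∑-cong set λ x → trans (∑-*ˡ set (H x′) _) (cong (H x′ *_) (∑-*ˡ set (H′ y′) _))) (trans (∑-*ˡ set (H x′) _) (cong (H x′ *_) (∑-*ˡ set (H′ y′) _)))) ⟩
          Q.slice (pushforward f) u v ∎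
          where
          H H′ : R′.R → ℤ
          H x = [ FinSet._≟_ Q.target (Q.φ x) u ]
          H′ y = [ FinSet._≟_ Q.target (Q.φ y) v ]
          opaque
            unfolding _+_ _*_
            shuffle : ∀ a h b h′ x → a * (h * (b * (h′ * x))) ≡ h * (h′ * (a * (b * x)))
            shuffle = solve-∀

      form-inflate : ∀ Qs f → form (map inflate Qs) f ≡ form Qs (pushforward f)
      form-inflate [] f = refl
      form-inflate (Q ∷ Qs) f = cong₂ _+_ (cong (+ Quotient.e Q *_) (V-inflate Q f)) (form-inflate Qs f)

    chain : ∀ n → List (Quotient (PowerRing.𝑹 p pr n) (p ℕ.^ n))
    chain zero = whole 0 ∷ []
    chain (suc n) = whole (suc n) ∷ map (inflate n) (chain n)

    length-chain : ∀ n → length (chain n) ≡ suc n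
    length-chain zero = refl
    length-chain (suc n) = cong suc (trans (List.length-map (inflate n) (chain n)) (length-chain n))

    trivial-bound : ∀ c C f → norm (PowerRing.set p pr 0 ⊗ PowerRing.set p pr 0) (Primitive.X (PowerRing.𝑹 p pr 0) c C f) ≤ form (chain 0) f
    trivial-bound c C f = Int.≤-trans (op-trivial (Primitive.vec 𝑹 c C) U (λ y → []-idem (unit? y)) f) (Int.≤-trans (Int.*-monoʳ (norm≥0 (set ⊗ set) f) (Int.≤-trans (Int.*-monoʳ U≥0 U≤1) (Int.*-monoˡ (Int.+≥0 1) U≤1)))
        (Int.≤-reflexive (trans (cong₂ _*_ (Int.*-identityˡ 1ℤ) (sym (V-whole 0 f))) (sym (Int.+-identityʳ _)))))
      where
      open PowerRing p pr 0
      open Operator (𝑹 ⊗ᴿ 𝑹) set using (op-trivial)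
      U = Primitive.U 𝑹 c C
      U≥0 : 0ℤ ≤ ∑ set U
      U≥0 = ∑-≥0 set λ y → []-≥0 (unit? y)
      U≤1 : ∑ set U ≤ 1ℤ
      U≤1 = Int.≤-trans (∑-mono set λ y → []-≤1 (unit? y)) (Int.≤-reflexive card-R)

    module _ (C₀ : ℕ) (C₀≥1 : 1 ℕ.≤ C₀)
      (prim-bound : ∀ n′ c C {f} → Primitives.Primitive p pr n′ c C f → norm (PowerRing.set p pr (suc n′) ⊗ PowerRing.set p pr (suc n′)) (Primitive.X (PowerRing.𝑹 p pr (suc n′)) c C f) ≤ + C₀ * + (p ℕ.^ suc n′) * norm (PowerRing.set p pr (suc n′) ⊗ PowerRing.set p pr (suc n′)) f) where

      chain-bound : ∀ n c C f → norm (PowerRing.set p pr n ⊗ PowerRing.set p pr n) (Primitive.X (PowerRing.𝑹 p pr n) c C f) ≤ + C₀ * form (chain n) f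

      -- In the step from 1 to p the trivial bound suffices, as at most p units give the factor p².
      -- In later steps units lift, and the bound for the smaller power is used.
      lifted : ∀ n c C S → norm (PowerRing.set p pr (suc n) ⊗ PowerRing.set p pr (suc n)) (Primitive.X (PowerRing.𝑹 p pr (suc n)) c C (Lift.Reduction.pullback p pr n S)) ≤ + p * + p * (+ p * + p) * (+ C₀ * form (chain n) S)
      lifted zero c C S = Int.≤-trans (Lift.Reduction.lift-trivial p pr 0 c C S) (Int.≤-trans (Int.*-monoʳ (norm≥0 (R′.set ⊗ R′.set) S) (Int.*-monoˡ (Int.sq≥0 (+ p)) U²≤)) (Int.*-monoˡ (Int.*-≥0 (Int.sq≥0 (+ p)) (Int.sq≥0 (+ p))) step))
        where
        open PowerRing p pr 1
        module R′ = PowerRing p pr 0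
        U = Primitive.U 𝑹 c C
        U≥0 : 0ℤ ≤ ∑ set U
        U≥0 = ∑-≥0 set λ y → []-≥0 (unit? y)
        U≤p : ∑ set U ≤ + p
        U≤p = Int.≤-trans (∑-mono set λ y → []-≤1 (unit? y)) (Int.≤-reflexive (trans card-R (cong +_ (ℕ.^-identityʳ p))))
        U²≤ : ∑ set U * ∑ set U ≤ + p * + p
        U²≤ = Int.≤-trans (Int.*-monoʳ U≥0 U≤p) (Int.*-monoˡ (Int.+≥0 p) U≤p)
        step : norm (R′.set ⊗ R′.set) S ≤ + C₀ * form (chain 0) S
        step = subst (_≤ + C₀ * form (chain 0) S) (trans (Int.*-identityˡ _) (trans (Int.+-identityʳ _) (trans (Int.*-identityˡ _) (V-whole 0 S)))) (Int.*-monoʳ (form≥0 (chain 0) S) (Int.+≤+ C₀≥1))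
      lifted (suc n) c C S = Int.≤-trans (Lift.Reduction.lift-exact p pr (suc n) c C unit-lift S) (Int.*-monoˡ (Int.*-≥0 (Int.sq≥0 (+ p)) (Int.sq≥0 (+ p))) (chain-bound (suc n) (proj c) (proj-unit C) S))
        where
        open PowerRing p pr (suc (suc n))
        module R′ = PowerRing p pr (suc n)
        open Lift.Reduction p pr (suc n) using (proj; proj-unit; proj-class)
        unit-lift : ∀ {y} → R′.Unit (proj y) → Unit y
        unit-lift {y} u = by-cases (unit? y)
          where
          by-cases : Dec (Unit y) → Unit y
          by-cases (yes v) = v
          by-cases (no ¬v) = ⊥-elim (p∣⇒not-unit p pr n (rep y) (not-unit⇒ p pr (suc n) (rep y) (λ v → ¬v (subst Unit (class-rep N y) v))) u)

      chain-bound zero c C f = Int.≤-trans (trivial-bound c C f) (subst (_≤ + C₀ * form (chain 0) f) (Int.*-identityˡ _) (Int.*-monoʳ (form≥0 (chain 0) f) (Int.+≤+ C₀≥1)))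
      chain-bound (suc n) c C f = Int.≤-trans (Lift.Reduction.lift-bound p pr n c C (+ C₀) (Int.+≥0 C₀) (λ {f} → prim-bound n c C {f}) (λ S → + C₀ * form (chain n) S) (lifted n c C) f)
        (Int.≤-reflexive (trans (*-factorˡ (+ C₀) (+ N) _ _) (cong (+ C₀ *_) (cong₂ _+_ (cong (+ N *_) (sym (V-whole (suc n) f))) (sym (form-inflate n (chain n) f))))))
        where open PowerRing p pr (suc n)

      power-bounded : ∀ κ n → C₀ ℕ.≤ κ ℕ.* (suc n ℕ.* suc n) → Bounded (p ℕ.^ n) κ
      power-bounded κ n h = record
        { ring = 𝑹
        ; card-ring = card-R
        ; kernel⇒ = λ z e → cls-≡0⇒ (trans (sym (fromℤ-class N z)) e)
        ; kernel⇐ = λ z d → trans (fromℤ-class N z) (⇒cls-≡0 d)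
        ; unit⇒ = λ m u → unit⇒coprime N m (subst Unit (fromℕ-class N m) u)
        ; unit⇐ = λ m c → subst Unit (sym (fromℕ-class N m)) (coprime⇒unit N m c)
        ; quotients = chain n
        ; bound = λ c C f → Int.≤-trans (chain-bound n c C f) (Int.*-monoʳ (form≥0 (chain n) f) constant)
        }
        where
        open PowerRing p pr n
        constant : + C₀ ≤ + κ * (+ length (chain n) * + length (chain n))
        constant = subst (λ d → + C₀ ≤ + κ * (+ d * + d)) (sym (length-chain n)) (subst (+ C₀ ≤_) (trans (Int.pos-* κ (suc n ℕ.* suc n)) (cong (+ κ *_) (Int.pos-* (suc n) (suc n)))) (Int.+≤+ h))

  odd-power : ∀ p′ (pr : Prime (suc p′)) h₀ → suc p′ ≡ suc (h₀ ℕ.+ h₀) → ∀ n → Bounded (suc p′ ℕ.^ suc n) 1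
  odd-power p′ pr h₀ odd n = power-bounded (suc p′) pr 4 (s≤s z≤n) (λ n′ c C {f} → OddPrime.primitive-bound p′ pr h₀ odd n′ c C {f}) 1 (suc n)
    (subst (4 ℕ.≤_) (sym (ℕ.*-identityˡ _)) (ℕ.*-mono-≤ {2} {suc (suc n)} {2} {suc (suc n)} (s≤s (s≤s z≤n)) (s≤s (s≤s z≤n))))

  two-power : ∀ n → Bounded (2 ℕ.^ suc n) 8
  two-power n = power-bounded 2 prime[2] 32 (s≤s z≤n) (λ n′ c C {f} → EvenPrime.primitive-bound₂ n′ c C {f}) 8 (suc n)
    (ℕ.*-monoʳ-≤ 8 (ℕ.*-mono-≤ {2} {suc (suc n)} {2} {suc (suc n)} (s≤s (s≤s z≤n)) (s≤s (s≤s z≤n))))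

  -- ℤ/1 is taken as ℤ/2⁰.
  one-bounded : Bounded 1 1
  one-bounded = record
    { ring = 𝑹
    ; card-ring = card-R
    ; kernel⇒ = λ z e → cls-≡0⇒ (trans (sym (fromℤ-class N z)) e)
    ; kernel⇐ = λ z d → trans (fromℤ-class N z) (⇒cls-≡0 d)
    ; unit⇒ = λ m u → unit⇒coprime N m (subst Unit (fromℕ-class N m) u)
    ; unit⇐ = λ m c → subst Unit (sym (fromℕ-class N m)) (coprime⇒unit N m c)
    ; quotients = chain 2 prime[2] 0
    ; bound = λ c C f → Int.≤-trans (trivial-bound 2 prime[2] c C f) (Int.≤-reflexive (sym (trans (cong (_* form (chain 2 prime[2] 0) f) (trans (Int.*-identityˡ _) (Int.*-identityˡ _))) (Int.*-identityˡ _))))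
    }
    where open PowerRing 2 prime[2] 0

-- Divisor counts and the passage to composite moduli.

module Moduli where
  open import Data.Fin using (Fin; toℕ)
  import Data.Fin.Properties as Fin
  open import Data.List using (List; []; _∷_; length; filter; upTo)
  import Data.List.Properties as List
  open import Data.List.Relation.Unary.All using ([]; _∷_)
  open import Data.Nat.Coprimality using (Coprime; coprime-divisor)
  import Data.Nat.Coprimality as Coprime
  open import Data.Nat.Divisibility using (_∣_; divides; _∣?_; ∣-trans; ∣-antisym; m∣m*n; n∣m*n; *-pres-∣)
  open import Data.Nat.Induction using (<-rec)
  open import Data.Nat.ListAction using (product)
  open import Data.Nat.Primality using (Prime; prime⇒nonZero; prime⇒nonTrivial; prime[2])
  open import Data.Nat.Primality.Factorisation using (factorise; PrimeFactorisation)
  open import Data.Unit using (⊤; tt)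
  open import Function using (id; _∘_)
  open import Relation.Binary.Definitions using (tri<; tri≈; tri>)
  open import Relation.Nullary.Decidable using (_×-dec_)
  open ≡-Reasoning
  open import Defs using (numDivisors; Icc1)
  open Int using (ℤ; +_; _≤_; _<_; _+_; _*_; -_; _-_)
  open FiniteSums
  open FiniteRings
  open Residues
  open BoundedRings
  open PrimePowerBound using (parity)
  open PowerBounded

  module _ (A B : FinSet) {P : ∣ A ∣ → Set} {Q : ∣ B ∣ → Set} (P? : ∀ x → Dec (P x)) (Q? : ∀ y → Dec (Q y)) (φ : ∣ A ∣ → ∣ B ∣)
    (maps : ∀ x → P x → Q (φ x)) (injective : ∀ x y → P x → P y → φ x ≡ φ y → x ≡ y) where

    count-injective : ∑[ x ∈ A ] [ P? x ] ≤ ∑[ y ∈ B ] [ Q? y ]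
    count-injective = Int.≤-trans (Int.≤-reflexive (trans (∑-cong A λ x → sym (∑-δ′ B (φ x) (λ _ → [ P? x ]))) (∑-swap A B _))) (∑-mono B fibre)
      where
      fibre : ∀ y → ∑[ x ∈ A ] ([ FinSet._≟_ B (φ x) y ] * [ P? x ]) ≤ [ Q? y ]
      fibre y = Int.≤-trans (Int.≤-reflexive (∑-cong A λ x → []-× (FinSet._≟_ B (φ x) y) (P? x) (both? x) id id)) (by-cases (search A both?))
        where
        both? : ∀ x → Dec (φ x ≡ y × P x)
        both? x = FinSet._≟_ B (φ x) y ×-dec P? x
        by-cases : Dec (∃ λ x → φ x ≡ y × P x) → ∑[ x ∈ A ] [ both? x ] ≤ [ Q? y ]
        by-cases (no none) = Int.≤-trans (Int.≤-reflexive (∑-≡0 A λ x → []-no (both? x) (λ h → none (x , h)))) ([]-≥0 (Q? y))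
        by-cases (yes (x₀ , e₀ , p₀)) = Int.≤-trans (∑-mono A λ x → []-mono (both? x) (FinSet._≟_ A x x₀) (λ { (e , p) → injective x x₀ p p₀ (trans e (sym e₀)) }))
          (Int.≤-trans (Int.≤-reflexive (∑-once A x₀)) (Int.≤-reflexive (sym ([]-yes (Q? y) (subst Q e₀ (maps x₀ p₀))))))

  length-filter : {A : Set} {P : A → Set} (P? : ∀ x → Dec (P x)) (xs : List A) → + length (filter P? xs) ≡ sumL xs (λ x → [ P? x ])
  length-filter P? [] = refl
  length-filter P? (x ∷ xs) with P? x
  ... | yes _ = trans (Int.pos-+ 1 _) (cong₂ _+_ refl (length-filter P? xs))
  ... | no _ = trans (length-filter P? xs) (sym (Int.+-identityˡ _))

  toℕ-class : ∀ N .{{_ : NonZero N}} {i} → i ℕ.< N → toℕ (class N (+ i)) ≡ i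
  toℕ-class N {i} i<N = sym (small-congruent i<N (Fin.toℕ<n _) (subst (λ w → N ∣ℤ + i - w) (rep-nat (class N (+ i))) (rep-class N (+ i))))

  private
    finSet : (N : ℕ) .{{_ : NonZero N}} → FinSet
    finSet N = FinRing.set (ℤ/ N)

    -- Divisors are numbered from 1, the elements of `Fin N` from 0.
    index : (N : ℕ) .{{_ : NonZero N}} → ℕ → Fin N
    index N k = class N (+ ℕ.pred k)

    index-suc : ∀ N .{{_ : NonZero N}} k .{{_ : NonZero k}} → k ℕ.≤ N → suc (toℕ (index N k)) ≡ k
    index-suc N (suc k) k≤N = cong suc (toℕ-class N k≤N)

  divisor-count : ∀ q .{{_ : NonZero q}} → + numDivisors q ≡ ∑[ x ∈ finSet q ] [ suc (toℕ x) ∣? q ]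
  divisor-count q = begin
    + length (filter (_∣? q) (Icc1 q))                         ≡⟨ length-filter (_∣? q) (Icc1 q) ⟩
    sumL (Icc1 q) (λ k → [ k ∣? q ])                           ≡⟨ trans (sumL-map suc (upTo q) _) (sumL-applyUpTo id q _) ⟩
    sumTo q (λ i → [ suc i ∣? q ])                             ≡⟨ sumTo-cong q (λ i i<q → cong (λ k → [ suc k ∣? q ]) (sym (toℕ-class q i<q))) ⟩
    sumTo q (λ i → [ suc (toℕ (class q (+ i))) ∣? q ])         ≡⟨ sym (∑-ℤ/ q _) ⟩
    ∑[ x ∈ finSet q ] [ suc (toℕ x) ∣? q ] ∎

  -- The powers p^i with i ≤ n are distinct divisors.
  numDivisors-power : ∀ p → 1 ℕ.< p → ∀ n → suc n ℕ.≤ numDivisors (p ℕ.^ n)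
  numDivisors-power p p>1 n = Int.drop‿+≤+ (subst₂ _≤_ (card-ℤ/ (suc n)) (sym (divisor-count N))
      (count-injective (finSet (suc n)) (finSet N) {λ _ → ⊤} (λ _ → yes tt) (λ y → suc (toℕ y) ∣? N) (λ i → index N (p ℕ.^ toℕ i)) maps injective))
    where
    instance
      p≢0 : NonZero p
      p≢0 = ℕ.>-nonZero (ℕ.<-trans (s≤s z≤n) p>1)
      N≢0 : NonZero (p ℕ.^ n)
      N≢0 = ℕ.m^n≢0 p n
    N = p ℕ.^ n
    i≤n : ∀ (i : Fin (suc n)) → toℕ i ℕ.≤ n
    i≤n i = ℕ.s≤s⁻¹ (Fin.toℕ<n i)
    index≡ : ∀ i → suc (toℕ (index N (p ℕ.^ toℕ i))) ≡ p ℕ.^ toℕ i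
    index≡ i = index-suc N (p ℕ.^ toℕ i) {{ℕ.m^n≢0 p (toℕ i)}} (ℕ.^-monoʳ-≤ p (i≤n i))
    maps : ∀ i → ⊤ → suc (toℕ (index N (p ℕ.^ toℕ i))) ∣ N
    maps i _ = subst (_∣ N) (sym (index≡ i)) (divides (p ℕ.^ (n ℕ.∸ toℕ i)) (trans (cong (p ℕ.^_) (sym (ℕ.m∸n+n≡m (i≤n i)))) (ℕ.^-distribˡ-+-* p (n ℕ.∸ toℕ i) (toℕ i))))
    injective : ∀ i j → ⊤ → ⊤ → index N (p ℕ.^ toℕ i) ≡ index N (p ℕ.^ toℕ j) → i ≡ j
    injective i j _ _ e = Fin.toℕ-injective (by-order (ℕ.<-cmp (toℕ i) (toℕ j)))
      where
      same : p ℕ.^ toℕ i ≡ p ℕ.^ toℕ j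
      same = trans (sym (index≡ i)) (trans (cong (suc ∘ toℕ) e) (index≡ j))
      by-order : _ → toℕ i ≡ toℕ j
      by-order (tri< a _ _) = ⊥-elim (ℕ.<⇒≢ (ℕ.^-monoʳ-< p p>1 a) same)
      by-order (tri≈ _ b _) = b
      by-order (tri> _ _ c) = ⊥-elim (ℕ.<⇒≢ (ℕ.^-monoʳ-< p p>1 c) (sym same))

  -- The products x y with x ∣ a and y ∣ b are distinct: if x y = x′ y′, then x is coprime to y′ and
  -- hence divides x′, and conversely.
  numDivisors-* : ∀ a b .{{_ : NonZero a}} .{{_ : NonZero b}} → Coprime a b → numDivisors a ℕ.* numDivisors b ℕ.≤ numDivisors (a ℕ.* b)
  numDivisors-* a b cop = Int.drop‿+≤+ (subst₂ _≤_ (sym count-pairs) (sym (divisor-count N))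
      (count-injective (finSet a ⊗ finSet b) (finSet N) pair? (λ z → suc (toℕ z) ∣? N) φ maps injective))
    where
    instance
      N≢0 : NonZero (a ℕ.* b)
      N≢0 = ℕ.m*n≢0 a b
    N = a ℕ.* b
    Pair : Fin a × Fin b → Set
    Pair (x , y) = (suc (toℕ x) ∣ a) × (suc (toℕ y) ∣ b)
    pair? : ∀ z → Dec (Pair z)
    pair? (x , y) = (suc (toℕ x) ∣? a) ×-dec (suc (toℕ y) ∣? b)
    count-pairs : + (numDivisors a ℕ.* numDivisors b) ≡ ∑[ z ∈ finSet a ⊗ finSet b ] [ pair? z ]
    count-pairs = trans (Int.pos-* (numDivisors a) (numDivisors b)) (trans (cong₂ _*_ (divisor-count a) (divisor-count b)) (trans (sym (∑-∑-* (finSet a) (finSet b) _ _))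
      (trans (∑-cong (finSet a) λ x → ∑-cong (finSet b) λ y → []-× (suc (toℕ x) ∣? a) (suc (toℕ y) ∣? b) (pair? (x , y)) id id) (sym (∑-⊗ (finSet a) (finSet b) _)))))
    φ : Fin a × Fin b → Fin N
    φ (x , y) = index N (suc (toℕ x) ℕ.* suc (toℕ y))
    φ≡ : ∀ x y → suc (toℕ (φ (x , y))) ≡ suc (toℕ x) ℕ.* suc (toℕ y)
    φ≡ x y = index-suc N (suc (toℕ x) ℕ.* suc (toℕ y)) (ℕ.*-mono-≤ (Fin.toℕ<n x) (Fin.toℕ<n y))
    maps : ∀ z → Pair z → suc (toℕ (φ z)) ∣ N
    maps (x , y) (d , e) = subst (_∣ N) (sym (φ≡ x y)) (*-pres-∣ d e)
    divisor : ∀ {i j k l} → i ∣ a → l ∣ b → i ℕ.* j ≡ k ℕ.* l → i ∣ k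
    divisor {i} {j} {k} {l} i∣a l∣b e = coprime-divisor (λ { (d∣i , d∣l) → cop (∣-trans d∣i i∣a , ∣-trans d∣l l∣b) }) (subst (i ∣_) (trans e (ℕ.*-comm k l)) (m∣m*n j))
    injective : ∀ z w → Pair z → Pair w → φ z ≡ φ w → z ≡ w
    injective (x , y) (x′ , y′) (d , e) (d′ , e′) h = cong₂ _,_ (Fin.toℕ-injective (ℕ.suc-injective x≡)) (Fin.toℕ-injective (ℕ.suc-injective y≡))
      where
      same : suc (toℕ x) ℕ.* suc (toℕ y) ≡ suc (toℕ x′) ℕ.* suc (toℕ y′)
      same = trans (sym (φ≡ x y)) (trans (cong (suc ∘ toℕ) h) (φ≡ x′ y′))
      x≡ : suc (toℕ x) ≡ suc (toℕ x′)
      x≡ = ∣-antisym (divisor d e′ same) (divisor d′ e (sym same))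
      y≡ : suc (toℕ y) ≡ suc (toℕ y′)
      y≡ = ℕ.*-cancelˡ-≡ _ _ (suc (toℕ x)) (trans same (cong (ℕ._* suc (toℕ y′)) (sym x≡)))

  -- `few` is carried along so that the number of quotients can be replaced by d(q) at the end.
  record Good (q κ : ℕ) : Set₁ where
    field
      bounded : Bounded q κ
      few : Bounded.D bounded ℕ.≤ numDivisors q

  split-power : ∀ p → 1 ℕ.< p → ∀ q → .{{NonZero q}} → ∃ λ k → ∃ λ r → q ≡ p ℕ.^ k ℕ.* r × ¬ p ∣ r
  split-power p p>1 = <-rec (λ q → .{{NonZero q}} → ∃ λ k → ∃ λ r → q ≡ p ℕ.^ k ℕ.* r × ¬ p ∣ r) step
    where
    step : ∀ q → (∀ {r} → r ℕ.< q → .{{NonZero r}} → ∃ λ k → ∃ λ s → r ≡ p ℕ.^ k ℕ.* s × ¬ p ∣ s) → .{{NonZero q}} → ∃ λ k → ∃ λ r → q ≡ p ℕ.^ k ℕ.* r × ¬ p ∣ r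
    step q rec with p ∣? q
    ... | no p∤q = 0 , q , sym (ℕ.*-identityˡ q) , p∤q
    ... | yes (divides zero refl) = ⊥-elim (ℕ.≢-nonZero⁻¹ 0 refl)
    ... | yes (divides (suc r) refl) with rec {suc r} (ℕ.m<m*n (suc r) p p>1)
    ... | k , s , e , p∤s = suc k , s , trans (cong (ℕ._* p) e) (trans (ℕ.*-comm _ p) (sym (ℕ.*-assoc p (p ℕ.^ k) s))) , p∤s

  prime-factor : ∀ q → 1 ℕ.< q → ∃ λ p → Prime p × p ∣ q
  prime-factor q q>1 = from (factorise q {{ℕ.>-nonZero (ℕ.<-trans (s≤s z≤n) q>1)}})
    where
    from : PrimeFactorisation q → ∃ λ p → Prime p × p ∣ q
    from record { factors = [] ; isFactorisation = e } = ⊥-elim (ℕ.<⇒≢ q>1 (sym e))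
    from record { factors = p ∷ ps ; isFactorisation = e ; factorsPrime = pr ∷ _ } = p , pr , subst (p ∣_) (sym e) (m∣m*n (product ps))

  good-⊗ : ∀ {a b κ κ′} .{{_ : NonZero a}} .{{_ : NonZero b}} → Coprime a b → Good a κ → Good b κ′ → Good (a ℕ.* b) (κ ℕ.* κ′)
  good-⊗ {a} {b} cop 𝓐 𝓑 = record
    { bounded = bounded-⊗ cop A.bounded B.bounded
    ; few = ℕ.≤-trans (ℕ.≤-reflexive (Product.length-products _ _ cop (Bounded.quotients A.bounded) (Bounded.quotients B.bounded))) (ℕ.≤-trans (ℕ.*-mono-≤ A.few B.few) (numDivisors-* a b cop))
    }
    where
    module A = Good 𝓐
    module B = Good 𝓑

  odd-prime-power-good : ∀ p′ (pr : Prime (suc p′)) h₀ → suc p′ ≡ suc (h₀ ℕ.+ h₀) → ∀ k → Good (suc p′ ℕ.^ suc k) 1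
  odd-prime-power-good p′ pr h₀ odd k = record
    { bounded = odd-power p′ pr h₀ odd k
    ; few = subst (ℕ._≤ numDivisors (suc p′ ℕ.^ suc k)) (sym (length-chain (suc p′) pr (suc k))) (numDivisors-power (suc p′) (ℕ.nonTrivial⇒n>1 (suc p′) {{prime⇒nonTrivial pr}}) (suc k))
    }

  -- Strong induction: the full power of a prime factor is split off, which leaves a smaller odd
  -- cofactor coprime to it.
  odd-good : ∀ q → .{{NonZero q}} → ¬ 2 ∣ q → Good q 1
  odd-good = <-rec (λ q → .{{NonZero q}} → ¬ 2 ∣ q → Good q 1) step
    where
    Smaller : ℕ → Set₁
    Smaller q = ∀ {r} → r ℕ.< q → .{{NonZero r}} → ¬ 2 ∣ r → Good r 1

    extend : ∀ {q} → Smaller q → ¬ 2 ∣ q → ∀ p′ (pr : Prime (suc p′)) → suc p′ ∣ q →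
      (∃ λ j → suc p′ ≡ j ℕ.+ j) ⊎ (∃ λ j → suc p′ ≡ suc (j ℕ.+ j)) → (∃ λ k → ∃ λ r → q ≡ suc p′ ℕ.^ k ℕ.* r × ¬ suc p′ ∣ r) → Good q 1
    extend rec 2∤q p′ pr p∣q (inj₁ (j , e)) _ = ⊥-elim (2∤q (∣-trans (divides j (trans e (trans (cong (j ℕ.+_) (sym (ℕ.+-identityʳ j))) (ℕ.*-comm 2 j)))) p∣q))
    extend rec 2∤q p′ pr p∣q (inj₂ _) (zero , r , e , p∤r) = ⊥-elim (p∤r (subst (suc p′ ∣_) (trans e (ℕ.*-identityˡ r)) p∣q))
    extend {q} rec 2∤q p′ pr p∣q (inj₂ (h₀ , odd)) (suc k , r , e , p∤r) = subst (λ n → Good n 1) (sym e)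
      (good-⊗ {{ℕ.m^n≢0 p (suc k)}} {{r≢0}} (Coprime.sym (coprime-^ (suc k) (prime-coprime pr p∤r))) (odd-prime-power-good p′ pr h₀ odd k)
        (rec r<q {{r≢0}} (λ 2∣r → 2∤q (subst (2 ∣_) (sym e) (∣-trans 2∣r (n∣m*n (p ℕ.^ suc k)))))))
      where
      p = suc p′
      p>1 : 1 ℕ.< p
      p>1 = ℕ.nonTrivial⇒n>1 p {{prime⇒nonTrivial pr}}
      r≢0 : NonZero r
      r≢0 = ℕ.≢-nonZero (λ { refl → p∤r (divides 0 refl) })
      r<q : r ℕ.< q
      r<q = subst (r ℕ.<_) (sym e) (subst (r ℕ.<_) (ℕ.*-comm r _) (ℕ.m<m*n r (p ℕ.^ suc k) {{r≢0}} (ℕ.<-≤-trans p>1 (ℕ.m≤m*n p (p ℕ.^ k) {{ℕ.m^n≢0 p k}}))))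

    step : ∀ q → Smaller q → .{{NonZero q}} → ¬ 2 ∣ q → Good q 1
    -- 1 is read as 2⁰, which has at least 0 + 1 divisors.
    step 1 rec _ = record { bounded = one-bounded ; few = numDivisors-power 2 (s≤s (s≤s z≤n)) 0 }
    step q@(suc (suc _)) rec 2∤q = from (prime-factor q (s≤s (s≤s z≤n)))
      where
      from : (∃ λ p → Prime p × p ∣ q) → Good q 1
      from (zero , pr , _) = ⊥-elim (ℕ.≢-nonZero⁻¹ 0 {{prime⇒nonZero pr}} refl)
      from (suc p′ , pr , p∣q) = extend rec 2∤q p′ pr p∣q (parity (suc p′)) (split-power (suc p′) (ℕ.nonTrivial⇒n>1 (suc p′) {{prime⇒nonTrivial pr}}) q)

  weaken : ∀ {q} → Good q 1 → Good q 8
  weaken 𝓖 = record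
    { bounded = record
        { ring = B.ring ; card-ring = B.card-ring ; kernel⇒ = B.kernel⇒ ; kernel⇐ = B.kernel⇐ ; unit⇒ = B.unit⇒ ; unit⇐ = B.unit⇐ ; quotients = B.quotients
        ; bound = λ c C f → Int.≤-trans (B.bound c C f) (Int.*-monoʳ (form≥0 B.quotients f) (Int.*-monoʳ (Int.sq≥0 (+ B.D)) (Int.+≤+ (s≤s z≤n)))) }
    ; few = Good.few 𝓖
    }
    where module B = Bounded (Good.bounded 𝓖)

  -- The factor 8 enters only once, with the power of 2.
  all-good : ∀ q → .{{NonZero q}} → Good q 8
  all-good q with split-power 2 (s≤s (s≤s z≤n)) q
  ... | zero , r , e , 2∤r = subst (λ n → Good n 8) (sym (trans e (ℕ.*-identityˡ r))) (weaken (odd-good r {{ℕ.≢-nonZero (λ { refl → 2∤r (divides 0 refl) })}} 2∤r))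
  ... | suc k , r , e , 2∤r = subst (λ n → Good n 8) (sym e)
    (good-⊗ {{ℕ.m^n≢0 2 (suc k)}} {{r≢0}} (Coprime.sym (coprime-^ (suc k) (prime-coprime prime[2] 2∤r)))
      (record { bounded = two-power k ; few = subst (ℕ._≤ numDivisors (2 ℕ.^ suc k)) (sym (length-chain 2 prime[2] (suc k))) (numDivisors-power 2 (s≤s (s≤s z≤n)) (suc k)) })
      (odd-good r {{r≢0}} 2∤r))
    where
    r≢0 : NonZero r
    r≢0 = ℕ.≢-nonZero (λ { refl → 2∤r (divides 0 refl) })

-- The quadratic form evaluated on a pair of intervals.

module FormBound where
  open import Data.Fin using (Fin)
  import Data.Fin as Fin
  open import Data.List using (List; []; _∷_; length)
  open import Data.Nat.DivMod using (m≡m%n+[m/n]*n; m%n<n)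
  open ≡-Reasoning
  open Int using (ℤ; +_; 0ℤ; 1ℤ; _≤_; _+_; _*_; -_; _-_; solve-∀)
  open FiniteSums
  open FiniteRings
  open Residues
  open BoundedRings

  private
    opaque
      unfolding _+_ _*_ -_
      *-interchange : ∀ a b h g → a * (b * (h * g)) ≡ a * h * (b * g)
      *-interchange = solve-∀
      square-* : ∀ h g → h * g * (h * g) ≡ h * h * (g * g)
      square-* = solve-∀
      *-distrib-minus : ∀ a q j l → a * (q * j - l) ≡ q * (a * j) - l * a
      *-distrib-minus = solve-∀
      square-minus : ∀ q h l e′ → (q * h - l * e′) * (q * h - l * e′) ≡ q * q * (h * h) + (l * e′ * (l * e′) - + 2 * (q * (l * e′)) * h)
      square-minus = solve-∀
      -- With q = e e′ the left side collapses to q² (e P - L²), a variance: the square of the mean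
      -- has been subtracted, and the hypothesis leaves L e for the rest.
      variance : ∀ q P L e e′ → e * e′ ≡ q → e * P ≤ L * (L + e) → e * (q * q * P + (e * (L * e′ * (L * e′)) - + 2 * (q * (L * e′)) * L)) ≤ e * (q * q * L)
      variance q P L e e′ refl h = Int.≤-via (e * e′ * (e * e′) * (L * (L + e) - e * P)) (Int.*-≥0 (Int.sq≥0 (e * e′)) (Int.≤⇒0≤- h)) (alg L e e′ P)
        where
        alg : ∀ L e e′ P → e * (e * e′ * (e * e′) * L) - e * (e * e′ * (e * e′) * P + (e * (L * e′ * (L * e′)) - + 2 * (e * e′ * (L * e′)) * L)) ≡ e * e′ * (e * e′) * (L * (L + e) - e * P)
        alg = solve-∀
      collect : ∀ q L₁ L₂ → q * q * L₁ * (L₂ * (q + q)) ≡ + 2 * (q * q * q * L₁ * L₂)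
      collect = solve-∀
      swap : ∀ e G H → e * (H * G) ≡ G * (e * H)
      swap = solve-∀
      one-plus : ∀ b n → b + n * b ≡ (1ℤ + n) * b
      one-plus = solve-∀

  sumTo-+ : ∀ n f g → sumTo n (λ i → f i + g i) ≡ sumTo n f + sumTo n g
  sumTo-+ n f g = trans (sym (sumL-applyUpTo (λ i → i) n _)) (trans (sumL-+ (applyUpTo (λ i → i) n) f g) (cong₂ _+_ (sumL-applyUpTo (λ i → i) n f) (sumL-applyUpTo (λ i → i) n g)))
    where open import Data.List using (applyUpTo)

  sumTo-* : ∀ n k f → sumTo n (λ i → k * f i) ≡ k * sumTo n f
  sumTo-* n k f = trans (sym (sumL-applyUpTo (λ i → i) n _)) (trans (sumL-* (applyUpTo (λ i → i) n) k f) (cong (k *_) (sumL-applyUpTo (λ i → i) n f)))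
    where open import Data.List using (applyUpTo)

  sumTo-mono : ∀ n {f g} → (∀ i → f i ≤ g i) → sumTo n f ≤ sumTo n g
  sumTo-mono zero h = Int.≤-refl
  sumTo-mono (suc n) h = Int.+-mono-≤ (h 0) (sumTo-mono n (λ i → h (suc i)))

  sumTo-∑ : ∀ (A : FinSet) n (f : ℕ → ∣ A ∣ → ℤ) → sumTo n (λ i → ∑ A (f i)) ≡ ∑[ x ∈ A ] sumTo n (λ i → f i x)
  sumTo-∑ A zero f = sym (∑-0 A)
  sumTo-∑ A (suc n) f = trans (cong₂ _+_ refl (sumTo-∑ A n (λ i → f (suc i)))) (sym (∑-+ A _ _))

  sumTo-sumTo-* : ∀ m n f g → sumTo m (λ i → sumTo n (λ j → f i * g j)) ≡ sumTo m f * sumTo n g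
  sumTo-sumTo-* m n f g = trans (sumTo-cong m (λ i _ → trans (sumTo-* n (f i) g) (Int.*-comm (f i) _))) (trans (sumTo-* m (sumTo n g) f) (Int.*-comm _ _))

  sumTo-≤-extend : ∀ a b {f} → (∀ i → 0ℤ ≤ f i) → sumTo a f ≤ sumTo (a ℕ.+ b) f
  sumTo-≤-extend a b {f} f≥0 = subst₂ _≤_ (Int.+-identityʳ _) (sym (sumTo-split a b f)) (Int.+-mono-≤ (Int.≤-refl {sumTo a f}) (subst (_≤ sumTo b (λ i → f (a ℕ.+ i))) (sumTo-0 b {λ _ → 0ℤ} (λ _ _ → refl)) (sumTo-mono b (λ i → f≥0 (a ℕ.+ i)))))

  -- The interval is extended until its length is the next multiple of e above L, where every class
  -- is met equally often.
  residue-count : ∀ e .{{_ : NonZero e}} r L → + e * sumTo L (λ i → [ class e (+ suc i) Fin.≟ r ]) ≤ + (L ℕ.+ e)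
  residue-count e r L = Int.≤-trans (Int.*-monoˡ (Int.+≥0 e) count) (subst (_≤ + (L ℕ.+ e)) (Int.pos-* e (suc m)) (Int.+≤+ size))
    where
    m = L ℕ./ e
    s = L ℕ.% e
    L≡ : L ≡ s ℕ.+ m ℕ.* e
    L≡ = m≡m%n+[m/n]*n L e
    rest = e ℕ.∸ s
    total : L ℕ.+ rest ≡ suc m ℕ.* e
    total = begin
      L ℕ.+ rest                        ≡⟨ cong (ℕ._+ rest) (trans L≡ (ℕ.+-comm s (m ℕ.* e))) ⟩
      m ℕ.* e ℕ.+ s ℕ.+ rest            ≡⟨ ℕ.+-assoc (m ℕ.* e) s rest ⟩
      m ℕ.* e ℕ.+ (s ℕ.+ rest)          ≡⟨ cong (m ℕ.* e ℕ.+_) (ℕ.m+[n∸m]≡n (ℕ.<⇒≤ (m%n<n L e))) ⟩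
      m ℕ.* e ℕ.+ e                     ≡⟨ ℕ.+-comm (m ℕ.* e) e ⟩
      suc m ℕ.* e ∎
    module E = Ring (ℤ/ e)
    count : sumTo L (λ i → [ class e (+ suc i) Fin.≟ r ]) ≤ + suc m
    count = Int.≤-trans (sumTo-≤-extend L rest (λ i → []-≥0 (class e (+ suc i) Fin.≟ r))) (Int.≤-reflexive (trans (cong (λ n → sumTo n (λ i → [ class e (+ suc i) Fin.≟ r ])) total)
      (trans (sumTo-cong (suc m ℕ.* e) (λ i _ → []-cong (class e (+ suc i) Fin.≟ r) (class e (+ i) Fin.≟ (r E.⊖ E.𝟙))
          (λ h → E.⊕-cancelʳ E.𝟙 (trans (E.+-comm _ _) (trans (sym (next i)) (trans h (sym (restore r))))))
          (λ h → trans (next i) (trans (E.+-comm _ _) (trans (cong (E._⊕ E.𝟙) h) (restore r))))))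
        (residue-blocks e (r E.⊖ E.𝟙) (suc m)))))
      where
      next : ∀ i → class e (+ suc i) ≡ E.𝟙 E.⊕ class e (+ i)
      next i = trans (cong (class e) (Int.pos-+ 1 i)) (class-+ e 1ℤ (+ i))
      restore : ∀ r → r E.⊖ E.𝟙 E.⊕ E.𝟙 ≡ r
      restore r = E.solve 2 (λ r o → r E.:- o E.:+ o E.:= r) refl r E.𝟙
    size : e ℕ.* suc m ℕ.≤ L ℕ.+ e
    size = subst (ℕ._≤ L ℕ.+ e) (ℕ.*-comm (suc m) e) (subst (ℕ._≤ L ℕ.+ e) (ℕ.+-comm (m ℕ.* e) e) (ℕ.+-monoˡ-≤ e (subst (m ℕ.* e ℕ.≤_) (sym L≡) (ℕ.m≤n+m (m ℕ.* e) s))))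

  module Intervals (𝑹 : FinRing) (q : ℕ) .{{q≢0 : NonZero q}} (L₁ L₂ : ℕ) (L₂≤q : L₂ ℕ.≤ q) where
    open Ring 𝑹

    J : ℕ → R → ℤ
    J L x = sumTo L (λ i → [ fromℕ (suc i) ≟ x ])

    -- `g` compares the first interval with its expected density, scaled by q. In `f` below the
    -- second interval comes first, since `vec y` is (y , c / y) with y in the role of q₂ and c / y
    -- in that of q₁.
    g h : R → ℤ
    g x = + q * J L₁ x - + L₁
    h y = J L₂ y

    f : R × R → ℤ
    f (y , x) = h y * g x

    module _ (Q : Quotient 𝑹 q) where
      open Quotient Q
      private
        instance
          e≢0 : NonZero e
          e≢0 = ℕ.≢-nonZero λ e≡0 → ℕ.≢-nonZero⁻¹ q (trans (sym size) (cong (ℕ._* e′) e≡0))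

        e≤q : e ℕ.≤ q
        e≤q = subst (e ℕ.≤_) size (ℕ.m≤m*n e e′ {{ℕ.≢-nonZero λ e′≡0 → ℕ.≢-nonZero⁻¹ q (trans (sym size) (trans (cong (e ℕ.*_) e′≡0) (ℕ.*-zeroʳ e)))}})

        T = target
        open FinSet T using () renaming (_≟_ to _≟ᵀ_)

        point : ℕ → ∣ T ∣
        point i = φ (fromℕ (suc i))

        push : (R → ℤ) → ∣ T ∣ → ℤ
        push k u = ∑[ x ∈ set ] ([ φ x ≟ᵀ u ] * k x)

        push-J : ∀ L u → push (J L) u ≡ sumTo L (λ i → [ point i ≟ᵀ u ])
        push-J L u = begin
          ∑[ x ∈ set ] ([ φ x ≟ᵀ u ] * sumTo L (λ i → [ fromℕ (suc i) ≟ x ]))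
            ≡⟨ ∑-cong set (λ x → sym (sumTo-* L [ φ x ≟ᵀ u ] _)) ⟩
          ∑[ x ∈ set ] sumTo L (λ i → [ φ x ≟ᵀ u ] * [ fromℕ (suc i) ≟ x ])
            ≡⟨ sym (sumTo-∑ set L _) ⟩
          sumTo L (λ i → ∑[ x ∈ set ] ([ φ x ≟ᵀ u ] * [ fromℕ (suc i) ≟ x ]))
            ≡⟨ sumTo-cong L (λ i _ → trans (∑-cong set λ x → Int.*-comm [ φ x ≟ᵀ u ] _) (∑-δ′ set (fromℕ (suc i)) (λ x → [ φ x ≟ᵀ u ]))) ⟩
          sumTo L (λ i → [ point i ≟ᵀ u ]) ∎

        ∑-push : ∀ L → ∑ T (push (J L)) ≡ + L
        ∑-push L = trans (∑-cong T (push-J L)) (trans (sym (sumTo-∑ T L _)) (trans (sumTo-cong L (λ i _ → ∑-δ″ T (point i))) (trans (sumTo-const L 1ℤ) (Int.*-identityʳ _))))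

        energy : ℕ → ℤ
        energy L = norm T (push (J L))

        -- The energy counts pairs of points of the interval with the same image, which are
        -- congruent modulo e; each point has at most L / e + 1 partners.
        energy≤ : ∀ L → + e * energy L ≤ + L * (+ L + + e)
        energy≤ L = subst (_≤ + L * (+ L + + e)) (cong (+ e *_) (sym expand)) (subst (_≤ + L * (+ L + + e)) (sumTo-* L (+ e) _) (Int.≤-trans (sumTo-mono L row) (Int.≤-reflexive (trans (sumTo-const L (+ (L ℕ.+ e))) (cong (+ L *_) (Int.pos-+ L e))))))
          where
          expand : energy L ≡ sumTo L (λ i → sumTo L (λ j → [ point j ≟ᵀ point i ]))
          expand = begin
            ∑[ u ∈ T ] (push (J L) u * push (J L) u)
              ≡⟨ ∑-cong T (λ u → trans (cong₂ _*_ (push-J L u) (push-J L u)) (sym (sumTo-sumTo-* L L _ _))) ⟩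
            ∑[ u ∈ T ] sumTo L (λ i → sumTo L (λ j → [ point i ≟ᵀ u ] * [ point j ≟ᵀ u ]))
              ≡⟨ trans (sym (sumTo-∑ T L _)) (sumTo-cong L (λ i _ → trans (sym (sumTo-∑ T L _)) (sumTo-cong L (λ j _ → ∑-δ′ T (point i) (λ u → [ point j ≟ᵀ u ]))))) ⟩
            sumTo L (λ i → sumTo L (λ j → [ point j ≟ᵀ point i ])) ∎
          row : ∀ i → + e * sumTo L (λ j → [ point j ≟ᵀ point i ]) ≤ + (L ℕ.+ e)
          row i = Int.≤-trans (Int.*-monoˡ (Int.+≥0 e) (sumTo-mono L λ j → []-mono (point j ≟ᵀ point i) (class e (+ suc j) Fin.≟ class e (+ suc i)) (λ s → class-cong e (kernel (+ suc j) (+ suc i) s))))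
            (residue-count e (class e (+ suc i)) L)

        push-g : ∀ v → push g v ≡ + q * push (J L₁) v - + L₁ * + e′
        push-g v = trans (∑-cong set λ x → *-distrib-minus [ φ x ≟ᵀ v ] (+ q) (J L₁ x) (+ L₁)) (trans (∑-- set _ _) (cong₂ _-_ (∑-*ˡ set (+ q) _) (trans (∑-*ˡ set (+ L₁) _) (cong (+ L₁ *_) (fibre v)))))

        norm-g : norm T (push g) ≤ + q * + q * + L₁
        norm-g = Int.*-cancel (Int.+>0 e) (subst (λ t → + e * t ≤ + e * (+ q * + q * + L₁)) (sym expand) (variance (+ q) (energy L₁) (+ L₁) (+ e) (+ e′) (trans (sym (Int.pos-* e e′)) (cong +_ size)) (energy≤ L₁)))
          where
          expand : norm T (push g) ≡ + q * + q * energy L₁ + (+ e * (+ L₁ * + e′ * (+ L₁ * + e′)) - + 2 * (+ q * (+ L₁ * + e′)) * + L₁)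
          expand = trans (∑-cong T λ v → trans (cong₂ _*_ (push-g v) (push-g v)) (square-minus (+ q) (push (J L₁) v) (+ L₁) (+ e′))) (trans (∑-+ T _ _) (cong₂ _+_ (∑-*ˡ T (+ q * + q) _)
            (trans (∑-- T _ _) (cong₂ _-_ (trans (∑-const T _) (cong (_* (+ L₁ * + e′ * (+ L₁ * + e′))) card-target)) (trans (∑-*ˡ T (+ 2 * (+ q * (+ L₁ * + e′))) _) (cong (+ 2 * (+ q * (+ L₁ * + e′)) *_) (∑-push L₁)))))))

        V≡ : V f ≡ energy L₂ * norm T (push g)
        V≡ = trans (∑-cong T λ u → ∑-cong T λ v → trans (cong₂ _*_ (factor u v) (factor u v)) (square-* (push h u) (push g v))) (∑-∑-* T T _ _)
          where
          factor : ∀ u v → slice f u v ≡ push h u * push g v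
          factor u v = trans (∑-cong set λ x → ∑-cong set λ y → *-interchange [ φ x ≟ᵀ u ] [ φ y ≟ᵀ v ] (h x) (g y)) (∑-∑-* set set _ _)

      -- The product of `norm-g` with e times the energy of the second interval, where L₂ + e ≤ 2 q.
      V-bound : + e * V f ≤ + 2 * (+ q * + q * + q * + L₁ * + L₂)
      V-bound = subst₂ _≤_ (trans (sym (swap (+ e) _ _)) (cong (+ e *_) (sym V≡))) (collect (+ q) (+ L₁) (+ L₂))
        (Int.≤-trans (Int.*-monoʳ (Int.*-≥0 (Int.+≥0 e) (norm≥0 T _)) norm-g) (Int.*-monoˡ (Int.*-≥0 (Int.sq≥0 (+ q)) (Int.+≥0 L₁)) (Int.≤-trans (energy≤ L₂) (Int.*-monoˡ (Int.+≥0 L₂) (Int.+-mono-≤ (Int.+≤+ L₂≤q) (Int.+≤+ e≤q))))))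

    form-bound : ∀ (Qs : List (Quotient 𝑹 q)) → form Qs f ≤ + length Qs * (+ 2 * (+ q * + q * + q * + L₁ * + L₂))
    form-bound [] = Int.≤-reflexive (sym (Int.*-zeroˡ _))
    form-bound (Q ∷ Qs) = Int.≤-trans (Int.+-mono-≤ (V-bound Q) (form-bound Qs)) (Int.≤-reflexive (trans (one-plus _ (+ length Qs)) (cong (_* (+ 2 * (+ q * + q * + q * + L₁ * + L₂))) (sym (Int.pos-+ 1 (length Qs))))))

-- From the operator bound back to the rational deviations.

module Final where
  open import Data.Fin using (Fin; toℕ)
  import Data.Fin.Properties as Fin
  import Data.Integer as I
  import Data.Integer.Properties as P
  open import Data.List using (List; []; _∷_; map; upTo)
  open import Data.Nat.Coprimality using (Coprime; coprime?)
  import Data.Nat.ListAction as ListAction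
  open import Data.Rational as ℚ using (ℚ)
  import Data.Rational.Properties as ℚ
  open import Data.Rational.Unnormalised as ℚᵘ using (mkℚᵘ; *≡*; *≤*)
  import Data.Rational.Unnormalised.Properties as ℚᵘ
  open import Function using (id)
  open import Relation.Nullary.Decidable using (_×-dec_)
  open ≡-Reasoning
  open import Defs
  open Int using (ℤ; +_; -[1+_]; _≤_; _+_; _*_; -_; _-_; solve-∀)
  open FiniteSums
  open FiniteRings
  open Residues
  open BoundedRings
  open Moduli
  open FormBound

  ⟦_⟧ : ℤ → ℚ
  ⟦ z ⟧ = z ℚ./ 1

  private
    toℚᵘ-/ : ∀ z n → ℚ.toℚᵘ (z ℚ./ suc n) ℚᵘ.≃ mkℚᵘ z n
    toℚᵘ-/ z n = ℚ.toℚᵘ-fromℚᵘ (mkℚᵘ z n)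

  opaque
    unfolding _+_ _*_ -_

    ⟦⟧-+ : ∀ a b → ⟦ a + b ⟧ ≡ ⟦ a ⟧ ℚ.+ ⟦ b ⟧
    ⟦⟧-+ a b = ℚ.toℚᵘ-injective (ℚᵘ.≃-trans (toℚᵘ-/ (a + b) 0) (ℚᵘ.≃-sym (ℚᵘ.≃-trans (ℚ.toℚᵘ-homo-+ ⟦ a ⟧ ⟦ b ⟧) (ℚᵘ.≃-trans (ℚᵘ.+-cong (toℚᵘ-/ a 0) (toℚᵘ-/ b 0)) (*≡* (alg a b))))))
      where
      alg : ∀ a b → (a * + 1 + b * + 1) * + 1 ≡ (a + b) * + 1
      alg = solve-∀

    ⟦⟧-* : ∀ a b → ⟦ a * b ⟧ ≡ ⟦ a ⟧ ℚ.* ⟦ b ⟧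
    ⟦⟧-* a b = ℚ.toℚᵘ-injective (ℚᵘ.≃-trans (toℚᵘ-/ (a * b) 0) (ℚᵘ.≃-sym (ℚᵘ.≃-trans (ℚ.toℚᵘ-homo-* ⟦ a ⟧ ⟦ b ⟧) (ℚᵘ.≃-trans (ℚᵘ.*-cong (toℚᵘ-/ a 0) (toℚᵘ-/ b 0)) (*≡* refl)))))

    ⟦⟧-mono : ∀ {a b} → a ≤ b → ⟦ a ⟧ ℚ.≤ ⟦ b ⟧
    ⟦⟧-mono {a} {b} h = ℚ.toℚᵘ-cancel-≤ (ℚᵘ.≤-respˡ-≃ (ℚᵘ.≃-sym (toℚᵘ-/ a 0)) (ℚᵘ.≤-respʳ-≃ (ℚᵘ.≃-sym (toℚᵘ-/ b 0)) (*≤* (P.*-monoʳ-≤-nonNeg (+ 1) h))))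

    ⟦⟧-cancel : ∀ q .{{_ : NonZero q}} a → ⟦ + q ⟧ ℚ.* (a ℚ./ q) ≡ ⟦ a ⟧
    ⟦⟧-cancel (suc n) a = ℚ.toℚᵘ-injective (ℚᵘ.≃-trans (ℚ.toℚᵘ-homo-* ⟦ + suc n ⟧ (a ℚ./ suc n)) (ℚᵘ.≃-trans (ℚᵘ.*-cong (toℚᵘ-/ (+ suc n) 0) (toℚᵘ-/ a n)) (ℚᵘ.≃-trans (*≡* cross) (ℚᵘ.≃-sym (toℚᵘ-/ a 0)))))
      where
      cross : + suc n I.* a I.* + 1 ≡ a I.* + (1 ℕ.* suc n)
      cross = trans (P.*-identityʳ _) (trans (P.*-comm (+ suc n) a) (cong (λ k → a I.* + k) (sym (ℕ.*-identityˡ (suc n)))))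

    ⟦⟧-neg : ∀ a → ⟦ - a ⟧ ≡ ℚ.- ⟦ a ⟧
    ⟦⟧-neg a = ℚ.toℚᵘ-injective (ℚᵘ.≃-trans (toℚᵘ-/ (- a) 0) (ℚᵘ.≃-sym (ℚᵘ.≃-trans (ℚ.toℚᵘ-homo‿- ⟦ a ⟧) (ℚᵘ.-‿cong (toℚᵘ-/ a 0)))))

  scale-sum : {A : Set} (k : ℚ) (F : A → ℚ) (G : A → ℤ) → (∀ x → k ℚ.* F x ≡ ⟦ G x ⟧) → ∀ xs → k ℚ.* sumℚ (map F xs) ≡ ⟦ sumL xs G ⟧
  scale-sum k F G h [] = ℚ.*-zeroʳ k
  scale-sum k F G h (x ∷ xs) = trans (ℚ.*-distribˡ-+ k (F x) _) (trans (cong₂ ℚ._+_ (h x) (scale-sum k F G h xs)) (sym (⟦⟧-+ (G x) _)))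

  pos-sum : {A : Set} (F : A → ℕ) (xs : List A) → + ListAction.sum (map F xs) ≡ sumL xs (λ x → + F x)
  pos-sum F [] = refl
  pos-sum F (x ∷ xs) = trans (Int.pos-+ (F x) _) (cong₂ _+_ refl (pos-sum F xs))

  sumL-Ioc : ∀ a L (f : ℕ → ℤ) → sumL (Ioc a L) f ≡ sumTo L (λ i → f (a ℕ.+ suc i))
  sumL-Ioc a L f = trans (sumL-map (λ i → a ℕ.+ suc i) (upTo L) f) (sumL-applyUpTo id L _)

  module _ (q : ℕ) .{{q≢0 : NonZero q}} (c : ℤ) (L₁ L₂ : ℕ) where

    error : ℕ → ℕ → ℤ
    error a b = + q * + countCong q c L₁ L₂ a b - + countAll q L₁ L₂ a b

    q*deviation : ∀ a b → ⟦ + q ⟧ ℚ.* deviation q c L₁ L₂ a b ≡ ⟦ error a b ⟧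
    q*deviation a b = begin
      ⟦ + q ⟧ ℚ.* (⟦ N ⟧ ℚ.- M ℚ./ q)               ≡⟨ ℚ.*-distribˡ-+ ⟦ + q ⟧ ⟦ N ⟧ (ℚ.- (M ℚ./ q)) ⟩
      ⟦ + q ⟧ ℚ.* ⟦ N ⟧ ℚ.+ ⟦ + q ⟧ ℚ.* (ℚ.- (M ℚ./ q)) ≡⟨ cong₂ ℚ._+_ (sym (⟦⟧-* (+ q) N)) (trans (sym (ℚ.neg-distribʳ-* ⟦ + q ⟧ (M ℚ./ q))) (trans (cong ℚ.-_ (⟦⟧-cancel q M)) (sym (⟦⟧-neg M)))) ⟩
      ⟦ + q * N ⟧ ℚ.+ ⟦ - M ⟧                       ≡⟨ sym (⟦⟧-+ (+ q * N) (- M)) ⟩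
      ⟦ error a b ⟧ ∎
      where
      N = + countCong q c L₁ L₂ a b
      M = + countAll q L₁ L₂ a b

    total-error : ℤ
    total-error = sumL (Icc1 q) (λ a → sumL (Icc1 q) (λ b → error a b * error a b))

    q²*lhs : ⟦ + q ⟧ ℚ.* ⟦ + q ⟧ ℚ.* lhs q c L₁ L₂ ≡ ⟦ total-error ⟧
    q²*lhs = scale-sum (⟦ + q ⟧ ℚ.* ⟦ + q ⟧) _ _ (λ a → scale-sum (⟦ + q ⟧ ℚ.* ⟦ + q ⟧) _ _ (square a) (Icc1 q)) (Icc1 q)
      where
      interchange : ∀ (k x : ℚ) → k ℚ.* k ℚ.* (x ℚ.* x) ≡ (k ℚ.* x) ℚ.* (k ℚ.* x)
      interchange k x = begin
        k ℚ.* k ℚ.* (x ℚ.* x)     ≡⟨ ℚ.*-assoc k k (x ℚ.* x) ⟩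
        k ℚ.* (k ℚ.* (x ℚ.* x))   ≡⟨ cong (k ℚ.*_) (trans (sym (ℚ.*-assoc k x x)) (trans (cong (ℚ._* x) (ℚ.*-comm k x)) (ℚ.*-assoc x k x))) ⟩
        k ℚ.* (x ℚ.* (k ℚ.* x))   ≡⟨ sym (ℚ.*-assoc k x (k ℚ.* x)) ⟩
        k ℚ.* x ℚ.* (k ℚ.* x) ∎
      square : ∀ a b → ⟦ + q ⟧ ℚ.* ⟦ + q ⟧ ℚ.* (deviation q c L₁ L₂ a b ℚ.* deviation q c L₁ L₂ a b) ≡ ⟦ error a b * error a b ⟧
      square a b = trans (interchange ⟦ + q ⟧ (deviation q c L₁ L₂ a b)) (trans (cong₂ ℚ._*_ (q*deviation a b) (q*deviation a b)) (sym (⟦⟧-* (error a b) (error a b))))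

    module _ (good : Good q 8) (cop : Coprime I.∣ c ∣ q) (L₂≤q : L₂ ℕ.≤ q) where
      private
        module 𝓖 = Good good
        module 𝓑 = Bounded 𝓖.bounded
      open Ring 𝓑.ring
      open Intervals 𝓑.ring q L₁ L₂ L₂≤q using (J; g; h; f; form-bound)

      private
        c̄ : R
        c̄ = fromℤ c

        c̄-unit : Unit c̄
        c̄-unit = signed c cop
          where
          signed : ∀ z → Coprime I.∣ z ∣ q → Unit (fromℤ z)
          signed (+ n) cop = 𝓑.unit⇐ n cop
          signed -[1+ n ] cop = unit-neg (𝓑.unit⇐ (suc n) cop)

        X : (R × R → ℤ) → R × R → ℤ
        X = Primitive.X 𝓑.ring c̄ c̄-unit

        U : R → ℤ
        U y = [ unit? y ]

        hits : ℕ → ℕ → Set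
        hits x y = Coprime y q × (_≡_[mod_] (+ (x ℕ.* y)) c q)

        hits? : ∀ x y → Dec (hits x y)
        hits? x y = coprime? y q ×-dec congr? (+ (x ℕ.* y)) c q

        coprime-unit : ∀ y → U (fromℕ y) ≡ [ coprime? y q ]
        coprime-unit y = []-cong (unit? (fromℕ y)) (coprime? y q) (𝓑.unit⇒ y) (𝓑.unit⇐ y)

        congruent⇒ : ∀ x y → _≡_[mod_] (+ (x ℕ.* y)) c q → fromℕ x · fromℕ y ≡ c̄
        congruent⇒ x y d = trans (sym (fromℕ-hom-* x y)) (⊖≡𝟘⇒≡ (trans (sym (trans (fromℤ-hom-+ (+ (x ℕ.* y)) (- c)) (cong (fromℕ (x ℕ.* y) ⊕_) (fromℤ-hom-neg c))))
          (𝓑.kernel⇐ (+ (x ℕ.* y) - c) (∣⇒∣ℤ (+ (x ℕ.* y) - c) (subst (λ z → q Data.Nat.Divisibility.∣ I.∣ z ∣) (sym sub-def) d)))))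
          where
          import Data.Nat.Divisibility
          sub-def : + (x ℕ.* y) - c ≡ + (x ℕ.* y) I.- c
          sub-def = trans (Int.+-def _ _) (cong (λ t → + (x ℕ.* y) I.+ t) (Int.neg-def c))

        ⇒congruent : ∀ x y → fromℕ x · fromℕ y ≡ c̄ → _≡_[mod_] (+ (x ℕ.* y)) c q
        ⇒congruent x y e = subst (λ z → q Data.Nat.Divisibility.∣ I.∣ z ∣) sub-def (∣ℤ⇒∣ (+ (x ℕ.* y) - c) (𝓑.kernel⇒ (+ (x ℕ.* y) - c) (trans (trans (fromℤ-hom-+ (+ (x ℕ.* y)) (- c)) (cong₂ _⊕_ (fromℕ-hom-* x y) (fromℤ-hom-neg c))) (≡⇒⊖≡𝟘 e))))
          where
          import Data.Nat.Divisibility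
          sub-def : + (x ℕ.* y) - c ≡ + (x ℕ.* y) I.- c
          sub-def = trans (Int.+-def _ _) (cong (λ t → + (x ℕ.* y) I.+ t) (Int.neg-def c))

        hit : ∀ x y → U (fromℕ y) * [ c̄ · inv (fromℕ y) ≟ fromℕ x ] ≡ [ hits? x y ]
        hit x y = []-× (unit? (fromℕ y)) (c̄ · inv (fromℕ y) ≟ fromℕ x) (hits? x y)
          (λ { (u , e) → 𝓑.unit⇒ y u , ⇒congruent x y (trans (cong (_· fromℕ y) (sym e)) (trans (*-assoc c̄ _ _) (trans (cong (c̄ ·_) (trans (*-comm _ _) u)) (*-identityʳ c̄)))) })
          (λ { (k , d) → 𝓑.unit⇐ y k , unit-cancelˡ (𝓑.unit⇐ y k) (trans (solve 3 (λ y c i → y :* (c :* i) := c :* (y :* i)) refl (fromℕ y) c̄ (inv (fromℕ y)))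
                (trans (cong (c̄ ·_) (𝓑.unit⇐ y k)) (trans (*-identityʳ c̄) (trans (sym (congruent⇒ x y d)) (*-comm _ _))))) })

        shifted : ∀ (a : ℕ) (x : R) i → [ fromℕ (suc i) ≟ ⊝ fromℕ a ⊕ x ] ≡ [ x ≟ fromℕ (a ℕ.+ suc i) ]
        shifted a x i = []-cong (fromℕ (suc i) ≟ ⊝ fromℕ a ⊕ x) (x ≟ fromℕ (a ℕ.+ suc i))
          (λ e → trans (solve 2 (λ a x → x := a :+ ((:- a) :+ x)) refl (fromℕ a) x) (trans (cong (fromℕ a ⊕_) (sym e)) (sym (fromℕ-hom-+ a (suc i)))))
          (λ e → sym (trans (cong (⊝ fromℕ a ⊕_) (trans e (fromℕ-hom-+ a (suc i)))) (solve 2 (λ a t → (:- a) :+ (a :+ t) := t) refl (fromℕ a) (fromℕ (suc i)))))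

        -- At (-b , -a) the factor h (y - b) selects the y in (b , b + L₂], and g (c / y - a)
        -- compares the number of q₁ in (a , a + L₁] congruent to c / y with its expected value.
        evaluate : ∀ a b → X f (⊝ fromℕ b , ⊝ fromℕ a) ≡ error a b
        evaluate a b = begin
          ∑[ y ∈ set ] (U y * (h (⊝ fromℕ b ⊕ y) * g (⊝ fromℕ a ⊕ c̄ · inv y)))
            ≡⟨ ∑-cong set (λ y → trans (cong (λ t → U y * (t * g (⊝ fromℕ a ⊕ c̄ · inv y))) (sumTo-cong L₂ (λ j _ → shifted b y j))) (trans (rearrange (U y) _ _) (sym (sumTo-* L₂ (U y * g (⊝ fromℕ a ⊕ c̄ · inv y)) _)))) ⟩
          ∑[ y ∈ set ] sumTo L₂ (λ j → U y * g (⊝ fromℕ a ⊕ c̄ · inv y) * [ y ≟ fromℕ (b ℕ.+ suc j) ])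
            ≡⟨ sym (sumTo-∑ set L₂ _) ⟩
          sumTo L₂ (λ j → ∑[ y ∈ set ] (U y * g (⊝ fromℕ a ⊕ c̄ · inv y) * [ y ≟ fromℕ (b ℕ.+ suc j) ]))
            ≡⟨ sumTo-cong L₂ (λ j _ → trans (∑-cong set λ y → Int.*-comm _ [ y ≟ fromℕ (b ℕ.+ suc j) ]) (∑-δ set (fromℕ (b ℕ.+ suc j)) (λ y → U y * g (⊝ fromℕ a ⊕ c̄ · inv y)))) ⟩
          sumTo L₂ (λ j → U (fromℕ (b ℕ.+ suc j)) * g (⊝ fromℕ a ⊕ c̄ · inv (fromℕ (b ℕ.+ suc j))))
            ≡⟨ sumTo-cong L₂ (λ j _ → single (b ℕ.+ suc j)) ⟩
          sumTo L₂ (λ j → + q * sumTo L₁ (λ i → [ hits? (a ℕ.+ suc i) (b ℕ.+ suc j) ]) + - (+ L₁ * [ coprime? (b ℕ.+ suc j) q ]))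
            ≡⟨ trans (sumTo-+ L₂ _ _) (cong₂ _+_ (trans (sumTo-* L₂ (+ q) _) (cong (+ q *_) (sym cong-count))) (sym all-count)) ⟩
          error a b ∎
          where
          opaque
            unfolding _+_ _*_ -_
            rearrange : ∀ u s t → u * (s * t) ≡ u * t * s
            rearrange = solve-∀
            split : ∀ u k s l → u * (k * s - l) ≡ k * (u * s) + - (l * u)
            split = solve-∀
            neg-one : ∀ l k → - (l * k) ≡ - l * k
            neg-one = solve-∀
          single : ∀ y → U (fromℕ y) * g (⊝ fromℕ a ⊕ c̄ · inv (fromℕ y)) ≡ + q * sumTo L₁ (λ i → [ hits? (a ℕ.+ suc i) y ]) + - (+ L₁ * [ coprime? y q ])
          single y = trans (cong (λ t → U (fromℕ y) * (+ q * t - + L₁)) (sumTo-cong L₁ (λ i _ → shifted a (c̄ · inv (fromℕ y)) i))) (trans (split (U (fromℕ y)) (+ q) _ (+ L₁))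
            (cong₂ (λ s t → + q * s + - (+ L₁ * t)) (trans (sym (sumTo-* L₁ (U (fromℕ y)) _)) (sumTo-cong L₁ (λ i _ → hit (a ℕ.+ suc i) y))) (coprime-unit y)))
          cong-count : + countCong q c L₁ L₂ a b ≡ sumTo L₂ (λ j → sumTo L₁ (λ i → [ hits? (a ℕ.+ suc i) (b ℕ.+ suc j) ]))
          cong-count = trans (pos-sum _ (Ioc a L₁)) (trans (sumL-cong (Ioc a L₁) λ x → length-filter (hits? x) (Ioc b L₂))
            (trans (sumL-swap (Ioc a L₁) (Ioc b L₂) _) (trans (sumL-cong (Ioc b L₂) λ y → sumL-Ioc a L₁ _) (sumL-Ioc b L₂ _))))
          all-count : - + countAll q L₁ L₂ a b ≡ sumTo L₂ (λ j → - (+ L₁ * [ coprime? (b ℕ.+ suc j) q ]))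
          all-count = trans (cong -_ (trans (pos-sum _ (Ioc a L₁)) (trans (sumL-cong (Ioc a L₁) λ x → trans (length-filter (λ y → coprime? y q) (Ioc b L₂)) (sumL-Ioc b L₂ _)) (trans (sumL-Ioc a L₁ _) (sumTo-const L₁ _)))))
            (sym (trans (sumTo-cong L₂ (λ j _ → neg-one (+ L₁) _)) (trans (sumTo-* L₂ (- + L₁) _) (sym (neg-one (+ L₁) _)))))

        -- The points (-b , -a) with 1 ≤ a, b ≤ q are distinct, so the sum is part of the norm.
        total≤ : total-error ≤ norm (set ⊗ set) (X f)
        total≤ = Int.≤-trans (Int.≤-reflexive reindexed) (∑-injective (F ⊗ F) (set ⊗ set) (λ { (i , j) → ⊝ fromℕ (suc (toℕ j)) , ⊝ fromℕ (suc (toℕ i)) }) injective (λ z → Int.sq≥0 (X f z)))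
          where
          F = FinRing.set (ℤ/ q)
          range : ∀ (k : ℕ → ℤ) → sumL (Icc1 q) k ≡ ∑[ i ∈ F ] k (suc (toℕ i))
          range k = trans (sumL-Ioc 0 q k) (trans (sumTo-cong q (λ i i<q → cong (λ t → k (suc t)) (sym (toℕ-class q i<q)))) (sym (∑-ℤ/ q _)))
          reindexed : total-error ≡ ∑[ z ∈ F ⊗ F ] (X f (⊝ fromℕ (suc (toℕ (proj₂ z))) , ⊝ fromℕ (suc (toℕ (proj₁ z)))) * X f (⊝ fromℕ (suc (toℕ (proj₂ z))) , ⊝ fromℕ (suc (toℕ (proj₁ z)))))
          reindexed = trans (range _) (trans (∑-cong F λ i → trans (range _) (∑-cong F λ j → sym (cong₂ _*_ (evaluate (suc (toℕ i)) (suc (toℕ j))) (evaluate (suc (toℕ i)) (suc (toℕ j)))))) (sym (∑-⊗ F F _)))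
          same : ∀ (i j : Fin q) → ⊝ fromℕ (suc (toℕ i)) ≡ ⊝ fromℕ (suc (toℕ j)) → i ≡ j
          same i j e = Fin.toℕ-injective (small-congruent (Fin.toℕ<n i) (Fin.toℕ<n j) (𝓑.kernel⇒ (+ toℕ i - + toℕ j) (trans (fromℤ-hom-+ (+ toℕ i) (- + toℕ j)) (trans (cong (fromℕ (toℕ i) ⊕_) (fromℤ-hom-neg (+ toℕ j)))
            (trans (solve 3 (λ o a b → a :- b := (:- (o :+ b)) :- (:- (o :+ a))) refl 𝟙 (fromℕ (toℕ i)) (fromℕ (toℕ j))) (≡⇒⊖≡𝟘 (sym e)))))))
          injective : ∀ z w → (⊝ fromℕ (suc (toℕ (proj₂ z))) , ⊝ fromℕ (suc (toℕ (proj₁ z)))) ≡ (⊝ fromℕ (suc (toℕ (proj₂ w))) , ⊝ fromℕ (suc (toℕ (proj₁ w)))) → z ≡ w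
          injective (i , j) (i′ , j′) e = cong₂ _,_ (same i i′ (cong proj₂ e)) (same j j′ (cong proj₁ e))

      total-error-bound : total-error ≤ + q * + q * + (16 ℕ.* L₁ ℕ.* L₂ ℕ.* q ℕ.* numDivisors q ℕ.^ 3)
      total-error-bound = Int.≤-trans total≤ (Int.≤-trans (𝓑.bound c̄ c̄-unit f) (Int.≤-trans (Int.*-monoˡ (Int.*-≥0 (Int.+≥0 8) (Int.sq≥0 (+ 𝓑.D))) (form-bound 𝓑.quotients))
        (Int.≤-trans (Int.≤-reflexive (gather (+ 𝓑.D) (+ q) (+ L₁) (+ L₂))) (Int.≤-trans (Int.*-monoˡ (Int.*-≥0 (Int.sq≥0 (+ q)) (Int.*-≥0 (Int.*-≥0 (Int.*-≥0 (Int.+≥0 16) (Int.+≥0 L₁)) (Int.+≥0 L₂)) (Int.+≥0 q))) D³≤) (Int.≤-reflexive final)))))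
        where
        d = numDivisors q
        opaque
          unfolding _+_ _*_ -_
          gather : ∀ D q L₁ L₂ → + 8 * (D * D) * (D * (+ 2 * (q * q * q * L₁ * L₂))) ≡ q * q * (+ 16 * L₁ * L₂ * q) * (D * D * D)
          gather = solve-∀
        D³≤ : + 𝓑.D * + 𝓑.D * + 𝓑.D ≤ + (d ℕ.* d ℕ.* d)
        D³≤ = subst (_≤ + (d ℕ.* d ℕ.* d)) (trans (Int.pos-* (𝓑.D ℕ.* 𝓑.D) 𝓑.D) (cong (_* + 𝓑.D) (Int.pos-* 𝓑.D 𝓑.D))) (Int.+≤+ (ℕ.*-mono-≤ (ℕ.*-mono-≤ 𝓖.few 𝓖.few) 𝓖.few))
        cube : d ℕ.* d ℕ.* d ≡ d ℕ.^ 3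
        cube = trans (ℕ.*-assoc d d d) (cong (λ t → d ℕ.* (d ℕ.* t)) (sym (ℕ.*-identityʳ d)))
        final : + q * + q * (+ 16 * + L₁ * + L₂ * + q) * + (d ℕ.* d ℕ.* d) ≡ + q * + q * + (16 ℕ.* L₁ ℕ.* L₂ ℕ.* q ℕ.* d ℕ.^ 3)
        final = trans (Int.*-assoc (+ q * + q) _ _) (cong (+ q * + q *_) (sym (trans (Int.pos-* (16 ℕ.* L₁ ℕ.* L₂ ℕ.* q) (d ℕ.^ 3)) (cong₂ _*_ (trans (Int.pos-* (16 ℕ.* L₁ ℕ.* L₂) q) (cong (_* + q) (trans (Int.pos-* (16 ℕ.* L₁) L₂) (cong (_* + L₂) (Int.pos-* 16 L₁))))) (cong +_ (sym cube))))))

      lhs-bound : lhs q c L₁ L₂ ℚ.≤ ⟦ + (16 ℕ.* L₁ ℕ.* L₂ ℕ.* q ℕ.* numDivisors q ℕ.^ 3) ⟧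
      lhs-bound = cancel (subst₂ ℚ._≤_ (sym q²*lhs) (trans (⟦⟧-* (+ q * + q) _) (cong (ℚ._* ⟦ B ⟧) (⟦⟧-* (+ q) (+ q)))) (⟦⟧-mono total-error-bound))
        where
        B = + (16 ℕ.* L₁ ℕ.* L₂ ℕ.* q ℕ.* numDivisors q ℕ.^ 3)
        q̂² = ⟦ + q ⟧ ℚ.* ⟦ + q ⟧
        positive : ℚ.Positive q̂²
        positive = ℚ.pos*pos⇒pos ⟦ + q ⟧ {{ℚ.normalize-pos q 1}} ⟦ + q ⟧ {{ℚ.normalize-pos q 1}}
        cancel : ∀ {x y} → q̂² ℚ.* x ℚ.≤ q̂² ℚ.* y → x ℚ.≤ y
        cancel h = ℚ.*-cancelˡ-≤-pos q̂² {{positive}} h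

open import Defs
open import Data.Nat as ℕ using (ℕ; _≤_; _<_; NonZero)
open import Data.Nat.Coprimality using (Coprime)
open import Data.Integer as ℤ using (ℤ)
open import Data.Rational as ℚ using (ℚ)
open import Data.Product using (∃-syntax; _×_)
open Moduli using (all-good)
open Final using (lhs-bound)

theorem2 : ∃[ C ] (0 < C × (∀ (q : ℕ) .{{_ : NonZero q}} (L₁ L₂ : ℕ) (c : ℤ) → 1 ≤ L₁ → L₁ ≤ q → 1 ≤ L₂ → L₂ ≤ q → Coprime ℤ.∣ c ∣ q → lhs q c L₁ L₂ ℚ.≤ ((ℤ.+ (C ℕ.* L₁ ℕ.* L₂ ℕ.* q ℕ.* (numDivisors q ℕ.^ 3))) ℚ./ 1)))
theorem2 = 16 , s≤s z≤n , λ q L₁ L₂ c _ _ _ L₂≤q cop → lhs-bound q c L₁ L₂ (all-good q) cop L₂≤q
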